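{- Let $n$ be a positive integer. Then $n=\frac{x(x-1)}2+\frac{y(y-1)}2+8\frac{z(z-1)}2$ for some $x,y,z\in\mathbb Z$ if and only if either $4n+5$ is not a perfect square or $4n+5$ has a prime divisor of the form $4k+3$. -}

module Defs where

open import Data.Nat as ℕ using (ℕ)
open import Data.Integer using (ℤ; +_; _*_; _-_; _+_)
open import Data.Integer.DivMod using (_/_)
open import Data.Product using (∃)
open import Relation.Binary.PropositionalEquality using (_≡_)

-- triangular-type number x(x-1)/2 for x ∈ ℤ (x(x-1) is always even, so the division is exact)
tri : ℤ → ℤ
tri x = (x * (x - + 1)) / + 2

IsSquare : ℕ → Set
IsSquare m = ∃ λ r → m ≡ r ℕ.* r

{-# OPTIONS --safe #-}

-- Put m = 4 n + 5. Completing squares, n is represented iff m = a² + 4 w² + 4 z² with a and z odd.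
--
-- Suppose m = 4 μ + 1 is not a square, and let R(μ) be the number of solutions of i (i + 1) + w² + z² = μ with i ≥ 0.
-- By the two-square theorem ∑ⱼ R(κ - j (j + 1)) is a convolution of divisor sums, which Liouville's method evaluates as
-- the number of odd positive triples with d (p + q) = 4 κ + 2. Each triple determines a lattice of index 4 κ + 2 in ℤ²,
-- which has exactly one reduced basis, and counting the reduced bases instead gives ∑ⱼ G(κ - j (j + 1)), where G(μ) > 0 is
-- the number of reduced binary forms of determinant 4 μ + 1. Hence R = G > 0. On the other hand, summing (-1)^z over the
-- solutions gives 0, since the indefinite forms of discriminant m cancel along their periods; so some solution has z odd.
--
-- If m = r² has a prime divisor p = 4 k + 3, a representation of p by four squares yields one of p² of the required shape,
-- which is then scaled by r / p. Conversely, if r² = u² + v² + 4 z² with z odd and r = 4 k + 1, then r + 2 z is 3 modulo 4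
-- and (r + 2 z) (r - 2 z) = u² + v², so r + 2 z and r - 2 z have a common prime divisor that is 3 modulo 4.

module Submission where

open import Defs
open import Data.Nat as ℕ using (ℕ; zero; suc)
import Data.Nat.Properties as ℕₚ
import Data.Nat.Divisibility as ℕ∣
open import Data.Nat.GCD using (gcd; gcd-GCD; gcd[m,n]∣m; gcd[m,n]∣n; module Bézout)
open import Data.Nat.Induction using (<-rec)
open import Data.Nat.ListAction using (product)
open import Data.Nat.Primality using (Prime; euclidsLemma; prime⇒nonZero; prime⇒nonTrivial)
open import Data.Nat.Primality.Factorisation using (factorise; PrimeFactorisation)
open import Data.Integer as ℤ using (ℤ; +_; -[1+_]; _+_; _*_; _-_; -_; ∣_∣; _≤_; _<_; 0ℤ; 1ℤ; -1ℤ; +≤+; +<+)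
open import Data.Integer.DivMod using (_%_; _/_; n%d<d; a≡a%n+[a/n]*n; _%ℕ_; _/ℕ_; n%ℕd<d; a≡a%ℕn+[a/ℕn]*n)
open import Data.Integer.Divisibility.Signed using (divides; ∣⇒∣ᵤ; ∣ᵤ⇒∣; ∣m∣n⇒∣m+n; ∣m∣n⇒∣m-n; ∣m⇒∣m*n; ∣n⇒∣m*n; ∣-trans) renaming (_∣_ to _dvd_; _∣?_ to _dvd?_)
open import Data.Integer.Properties
open import Data.Integer.Solver using (module +-*-Solver)
open +-*-Solver using (Polynomial; solve; con; _:+_; _:*_; _:-_; :-_; _:=_)
open import Data.Integer.Tactic.RingSolver using (solve-∀)
open import Data.List using (List; []; _∷_; _++_; map; filter; concatMap; upTo)
open import Data.List.Membership.Propositional using (_∈_; _∉_)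
open import Data.List.Membership.Propositional.Properties using (∈-++⁺ˡ; ∈-++⁺ʳ; ∈-++⁻; ∈-map⁺; ∈-map⁻; ∈-filter⁺; ∈-filter⁻; ∈-∃++; ∈-upTo⁺; ∈-upTo⁻)
open import Data.List.Relation.Unary.Any using (here; there)
open import Data.List.Relation.Unary.All as All using (All; []; _∷_)
open import Data.List.Relation.Unary.AllPairs using ([]; _∷_)
open import Data.List.Relation.Unary.Unique.Propositional using (Unique)
import Data.List.Relation.Unary.Unique.Propositional.Properties as Uniqueₚ
open import Data.Product using (∃; Σ; _×_; _,_; proj₁; proj₂)
open import Data.Sum using (_⊎_; inj₁; inj₂; [_,_]′; map₁)
open import Data.Empty using (⊥; ⊥-elim)
open import Function using (_∘_; id)
open import Function.Bundles using (_⇔_; mk⇔)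
open import Relation.Nullary using (¬_; Dec; yes; no; ¬?)
open import Relation.Nullary.Decidable using (_×-dec_; map′)
open import Relation.Unary using (Decidable)
open import Relation.Binary.PropositionalEquality

-- Lattices and forms meet in the splitting of an integral 2 by 2 matrix of determinant `4 κ + 2`
-- into its symmetric part, a binary form, and its antisymmetric part `T`. The determinant is that
-- of the form plus `T²`, so `T = ± (2 j + 1)` leaves `4 (κ - j (j + 1)) + 1` for the form: this is
-- where the shifts by `j (j + 1)` come from. The obstacle is that a change of basis mixes the two
-- parts, so the matrix has to be reduced as a whole. This is done for matrices that are an odd
-- multiple of (1 -1; 1 1) modulo 4. The congruence makes `T` odd, so that the reduction never meets
-- a tie, and it leaves so few changes of basis that two reduced bases of one lattice must coincide.
-- R and G then have equal convolutions for every κ, with coefficient 1 at `j = 0`, whence R = G by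
-- recursion. The alternating sum is used twice. A prime `4 μ + 1` is not a square, and for it the
-- vanishing sum yields Fermat's representation as a sum of two squares; the two-square theorem, and
-- with it the convolution of divisor sums, rests on that.

infix 10 #_

#_ : ∀ {n} → ℕ → Polynomial n
# k = con (+ k)

-- Finite enumerations and integer-valued sums over them.

module FiniteSums where

  private variable
    A B : Set

  sumL : (A → ℤ) → List A → ℤ
  sumL w []       = 0ℤ
  sumL w (x ∷ xs) = w x + sumL w xs

  sumL-cong : ∀ {w v : A → ℤ} xs → (∀ {x} → x ∈ xs → w x ≡ v x) → sumL w xs ≡ sumL v xs
  sumL-cong []       e = refl
  sumL-cong (x ∷ xs) e = cong₂ _+_ (e (here refl)) (sumL-cong xs (e ∘ there))

  sumL-++ : ∀ (w : A → ℤ) xs ys → sumL w (xs ++ ys) ≡ sumL w xs + sumL w ys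
  sumL-++ w []       ys = sym (+-identityˡ _)
  sumL-++ w (x ∷ xs) ys = trans (cong (_+_ (w x)) (sumL-++ w xs ys)) (sym (+-assoc (w x) _ _))

  sumL-map : ∀ (w : B → ℤ) (f : A → B) xs → sumL w (map f xs) ≡ sumL (w ∘ f) xs
  sumL-map w f []       = refl
  sumL-map w f (x ∷ xs) = cong (_+_ (w (f x))) (sumL-map w f xs)

  sumL-* : ∀ c (w : A → ℤ) xs → sumL (λ x → c * w x) xs ≡ c * sumL w xs
  sumL-* c w []       = sym (*-zeroʳ c)
  sumL-* c w (x ∷ xs) = trans (cong (_+_ (c * w x)) (sumL-* c w xs)) (sym (*-distribˡ-+ c (w x) _))

  sumL-mid : ∀ (w : A → ℤ) xs y ys → sumL w (xs ++ y ∷ ys) ≡ w y + sumL w (xs ++ ys)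
  sumL-mid w []       y ys = refl
  sumL-mid w (x ∷ xs) y ys = trans (cong (_+_ (w x)) (sumL-mid w xs y ys))
    (trans (sym (+-assoc (w x) (w y) _)) (trans (cong (_+ sumL w (xs ++ ys)) (+-comm (w x) (w y))) (+-assoc (w y) (w x) _)))

  ∈-mid⁻ : ∀ xs {y : A} {ys z} → z ∈ xs ++ y ∷ ys → z ≢ y → z ∈ xs ++ ys
  ∈-mid⁻ xs {y} {ys} z∈ z≢y with ∈-++⁻ xs z∈
  ... | inj₁ p         = ∈-++⁺ˡ p
  ... | inj₂ (here e)  = ⊥-elim (z≢y e)
  ... | inj₂ (there p) = ∈-++⁺ʳ xs p

  ∈-mid⁺ : ∀ xs {y : A} {ys z} → z ∈ xs ++ ys → z ∈ xs ++ y ∷ ys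
  ∈-mid⁺ xs z∈ with ∈-++⁻ xs z∈
  ... | inj₁ p = ∈-++⁺ˡ p
  ... | inj₂ p = ∈-++⁺ʳ xs (there p)

  unique-∉ : ∀ {x : A} {xs} → Unique (x ∷ xs) → x ∉ xs
  unique-∉ (px ∷ _) x∈ = All.lookup px x∈ refl

  unique-mid : ∀ xs {y : A} {ys} → Unique (xs ++ y ∷ ys) → Unique (xs ++ ys) × y ∉ xs ++ ys
  unique-mid [] u@(_ ∷ q) = q , unique-∉ u
  unique-mid (x ∷ xs) {y} {ys} u@(px ∷ q) with unique-mid xs q
  ... | r , y∉ = All.tabulate (λ {z} z∈ x≡z → unique-∉ u (subst (_∈ xs ++ y ∷ ys) (sym x≡z) (∈-mid⁺ xs z∈))) ∷ r
               , λ { (here e) → unique-∉ u (subst (_∈ xs ++ y ∷ ys) e (∈-++⁺ʳ xs (here refl))) ; (there p) → y∉ p }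

  -- Induction on `xs`: the image of the head occurs exactly once in `ys` and is cut out there;
  -- injectivity keeps the other images in what remains.
  sumL-bij : ∀ (v : B → ℤ) (f : A → B) xs ys → Unique xs → Unique ys →
    (∀ {x} → x ∈ xs → f x ∈ ys) →
    (∀ {x x′} → x ∈ xs → x′ ∈ xs → f x ≡ f x′ → x ≡ x′) →
    (∀ {y} → y ∈ ys → ∃ λ x → x ∈ xs × f x ≡ y) →
    sumL (v ∘ f) xs ≡ sumL v ys
  sumL-bij v f [] [] _ _ _ _ _ = refl
  sumL-bij v f [] (y ∷ ys) _ _ _ _ surj with surj (here refl)
  ... | _ , () , _
  sumL-bij v f (x ∷ xs) ys ux@(_ ∷ uxs) uy into inj surj with ∈-∃++ (into (here refl))
  ... | ys₁ , ys₂ , refl with unique-mid ys₁ uy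
  ... | u , fx∉ = trans (cong (_+_ (v (f x))) rec) (sym (sumL-mid v ys₁ (f x) ys₂))
    where
    rec : sumL (v ∘ f) xs ≡ sumL v (ys₁ ++ ys₂)
    rec = sumL-bij v f xs (ys₁ ++ ys₂) uxs u
      (λ {x′} x′∈ → ∈-mid⁻ ys₁ (into (there x′∈)) λ e → unique-∉ ux (subst (_∈ xs) (inj (there x′∈) (here refl) e) x′∈))
      (λ p q → inj (there p) (there q))
      surj′
      where
      surj′ : ∀ {y} → y ∈ ys₁ ++ ys₂ → ∃ λ x′ → x′ ∈ xs × f x′ ≡ y
      surj′ y∈ with surj (∈-mid⁺ ys₁ y∈)
      ... | _  , here refl , e = ⊥-elim (fx∉ (subst (_∈ ys₁ ++ ys₂) (sym e) y∈))
      ... | x′ , there p   , e = x′ , p , e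

  -- An explicit list without repetition. Sums and cardinalities are integers, so they can be
  -- signed, subtracted and cancelled, and by `∑-same` they depend on the predicate only.
  record Finite (P : A → Set) : Set where
    field
      elems    : List A
      unique   : Unique elems
      sound    : ∀ {x} → x ∈ elems → P x
      complete : ∀ {x} → P x → x ∈ elems
  open Finite

  ∑ : {P : A → Set} → Finite P → (A → ℤ) → ℤ
  ∑ F w = sumL w (elems F)

  count : {P : A → Set} → Finite P → ℤ
  count F = ∑ F (λ _ → 1ℤ)

  module _ {P : A → Set} (F : Finite P) where

    ∑-cong : ∀ {w v} → (∀ {x} → P x → w x ≡ v x) → ∑ F w ≡ ∑ F v
    ∑-cong e = sumL-cong (elems F) (e ∘ sound F)

    ∑-* : ∀ c w → ∑ F (λ x → c * w x) ≡ c * ∑ F w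
    ∑-* c w = sumL-* c w (elems F)

    ∑-neg : ∀ w → ∑ F (λ x → - w x) ≡ - ∑ F w
    ∑-neg w = trans (∑-cong (λ {x} _ → sym (-1*i≡-i (w x)))) (trans (∑-* -1ℤ w) (-1*i≡-i _))

    ∑-zero : ∀ {w} → (∀ {x} → P x → w x ≡ 0ℤ) → ∑ F w ≡ 0ℤ
    ∑-zero e = go (elems F) (e ∘ sound F)
      where
      go : ∀ {w} xs → (∀ {x} → x ∈ xs → w x ≡ 0ℤ) → sumL w xs ≡ 0ℤ
      go []       e = refl
      go (x ∷ xs) e = cong₂ _+_ (e (here refl)) (go xs (e ∘ there))

    -- The source of the existence statements below: a sum over the solutions is shown not to
    -- vanish.
    ∑≢0 : ∀ {w} → ∑ F w ≢ 0ℤ → ∃ P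
    ∑≢0 {w} ne with elems F | sound F
    ... | []    | _ = ⊥-elim (ne refl)
    ... | x ∷ _ | s = x , s (here refl)

    count>0 : ∃ P → 0ℤ < count F
    count>0 (x , px) = go (elems F) (complete F px)
      where
      nn : ∀ (xs : List A) → 0ℤ ≤ sumL (λ _ → 1ℤ) xs
      nn []       = ≤-refl
      nn (x ∷ xs) = +-mono-≤ {0ℤ} {1ℤ} (+≤+ ℕ.z≤n) (nn xs)
      go : ∀ {x} (xs : List A) → x ∈ xs → 0ℤ < sumL (λ _ → 1ℤ) xs
      go (x ∷ xs) _ = +-mono-<-≤ {0ℤ} {1ℤ} (+<+ (ℕ.s≤s ℕ.z≤n)) (nn xs)

  ∑-bij : ∀ {P : A → Set} {Q : B → Set} (F : Finite P) (G : Finite Q) (f : A → B) {w v} →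
    (∀ {x} → P x → Q (f x)) →
    (∀ {x x′} → P x → P x′ → f x ≡ f x′ → x ≡ x′) →
    (∀ {y} → Q y → ∃ λ x → P x × f x ≡ y) →
    (∀ {x} → P x → w x ≡ v (f x)) →
    ∑ F w ≡ ∑ G v
  ∑-bij F G f {w} {v} into inj surj e = trans (∑-cong F e)
    (sumL-bij v f (elems F) (elems G) (unique F) (unique G)
      (complete G ∘ into ∘ sound F) (λ p q → inj (sound F p) (sound F q))
      (λ y∈ → let (x , px , fx) = surj (sound G y∈) in x , complete F px , fx))

  ∑-same : ∀ {P Q : A → Set} (F : Finite P) (G : Finite Q) {w} →
    (∀ {x} → P x → Q x) → (∀ {x} → Q x → P x) → ∑ F w ≡ ∑ G w
  ∑-same F G to from = ∑-bij F G id to (λ _ _ e → e) (λ q → _ , from q , refl) (λ _ → refl)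

  image : ∀ {P : A → Set} {Q : B → Set} (F : Finite P) (f : A → B) →
    (∀ {x} → P x → Q (f x)) →
    (∀ {x x′} → P x → P x′ → f x ≡ f x′ → x ≡ x′) →
    (∀ {y} → Q y → ∃ λ x → P x × f x ≡ y) → Finite Q
  image {A} {B} {P} {Q} F f into inj surj = record
    { elems    = map f (elems F)
    ; unique   = uniq (elems F) (unique F) (sound F)
    ; sound    = λ y∈ → let (x , x∈ , e) = ∈-map⁻ f y∈ in subst Q (sym e) (into (sound F x∈))
    ; complete = λ q → let (x , px , e) = surj q in subst (_∈ map f (elems F)) e (∈-map⁺ f (complete F px))
    }
    where
    uniq : ∀ xs → Unique xs → (∀ {x} → x ∈ xs → P x) → Unique (map f xs)
    uniq [] _ _ = []
    uniq (x ∷ xs) ux@(_ ∷ u) s = All.tabulate (λ {y} y∈ e → let (x′ , x′∈ , e′) = ∈-map⁻ f y∈ in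
        unique-∉ ux (subst (_∈ xs) (inj (s (there x′∈)) (s (here refl)) (trans (sym e′) (sym e))) x′∈))
      ∷ uniq xs u (s ∘ there)

  restrict : ∀ {P R : A → Set} → Finite P → Decidable R → Finite (λ x → P x × R x)
  restrict F R? = record
    { elems    = filter R? (elems F)
    ; unique   = Uniqueₚ.filter⁺ R? (unique F)
    ; sound    = λ x∈ → let (p , r) = ∈-filter⁻ R? x∈ in sound F p , r
    ; complete = λ (p , r) → ∈-filter⁺ R? (complete F p) r
    }

  ∑-split : ∀ {P R : A → Set} (F : Finite P) (R? : Decidable R) w →
    ∑ F w ≡ ∑ (restrict F R?) w + ∑ (restrict F (¬? ∘ R?)) w
  ∑-split F R? w = go (elems F)
    where
    go : ∀ xs → sumL w xs ≡ sumL w (filter R? xs) + sumL w (filter (¬? ∘ R?) xs)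
    go [] = refl
    go (x ∷ xs) with R? x
    ... | yes _ = trans (cong (_+_ (w x)) (go xs)) (sym (+-assoc (w x) _ _))
    ... | no  _ = trans (cong (_+_ (w x)) (go xs)) (rearrange (w x) (sumL w (filter R? xs)) (sumL w (filter (¬? ∘ R?) xs)))
      where
      rearrange : ∀ a b c → a + (b + c) ≡ b + (a + c)
      rearrange = solve 3 (λ a b c → a :+ (b :+ c) := b :+ (a :+ c)) refl

  sigma : ∀ {P : A → Set} {Q : A → B → Set} → Finite P → (∀ i → Finite (Q i)) → Finite (λ ix → P (proj₁ ix) × Q (proj₁ ix) (proj₂ ix))
  sigma {A} {B} {P} {Q} F G = record
    { elems    = pairs (elems F)
    ; unique   = uniq (elems F) (unique F)
    ; sound    = λ ix∈ → let (i∈ , x∈) = pairs⁻ (elems F) ix∈ in sound F i∈ , sound (G _) x∈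
    ; complete = λ (p , q) → pairs⁺ (elems F) (complete F p) (complete (G _) q)
    }
    where
    pairs : List A → List (A × B)
    pairs = concatMap (λ i → map (i ,_) (elems (G i)))
    pairs⁻ : ∀ is {i x} → (i , x) ∈ pairs is → i ∈ is × x ∈ elems (G i)
    pairs⁻ (i ∷ is) ix∈ with ∈-++⁻ (map (i ,_) (elems (G i))) ix∈
    ... | inj₂ p = let (i∈ , x∈) = pairs⁻ is p in there i∈ , x∈
    ... | inj₁ p with ∈-map⁻ (i ,_) p
    ... | _ , x∈ , refl = here refl , x∈
    pairs⁺ : ∀ is {i x} → i ∈ is → x ∈ elems (G i) → (i , x) ∈ pairs is
    pairs⁺ (i ∷ is) (here refl) x∈ = ∈-++⁺ˡ (∈-map⁺ (i ,_) x∈)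
    pairs⁺ (i ∷ is) (there i∈)  x∈ = ∈-++⁺ʳ (map (i ,_) (elems (G i))) (pairs⁺ is i∈ x∈)
    uniq : ∀ is → Unique is → Unique (pairs is)
    uniq [] _ = []
    uniq (i ∷ is) ui@(_ ∷ u) = Uniqueₚ.++⁺ (Uniqueₚ.map⁺ (cong proj₂) (unique (G i))) (uniq is u)
      λ (p , q) → let (_ , _ , e) = ∈-map⁻ (i ,_) p in unique-∉ ui (subst (_∈ is) (cong proj₁ e) (proj₁ (pairs⁻ is q)))

  ∑-sigma : ∀ {P : A → Set} {Q : A → B → Set} (F : Finite P) (G : ∀ i → Finite (Q i)) w →
    ∑ (sigma F G) w ≡ ∑ F (λ i → ∑ (G i) (λ x → w (i , x)))
  ∑-sigma {A} F G w = go (elems F)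
    where
    go : (is : List A) → sumL w (concatMap (λ i → map (i ,_) (elems (G i))) is) ≡ sumL (λ i → ∑ (G i) (λ x → w (i , x))) is
    go [] = refl
    go (i ∷ is) = trans (sumL-++ w (map (i ,_) (elems (G i))) _) (cong₂ _+_ (sumL-map w (i ,_) (elems (G i))) (go is))

  Abs≤ : ℕ → ℤ → Set
  Abs≤ N z = ∣ z ∣ ℕ.≤ N

  interval : ∀ N → Finite (Abs≤ N)
  interval N = record
    { elems    = map +_ (upTo (suc N)) ++ map -[1+_] (upTo N)
    ; unique   = Uniqueₚ.++⁺ (Uniqueₚ.map⁺ +-injective (Uniqueₚ.upTo⁺ (suc N))) (Uniqueₚ.map⁺ -[1+-injective (Uniqueₚ.upTo⁺ N)) disj
    ; sound    = snd
    ; complete = cmp _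
    }
    where
    disj : ∀ {z} → ¬ (z ∈ map +_ (upTo (suc N)) × z ∈ map -[1+_] (upTo N))
    disj (p , q) with ∈-map⁻ +_ p | ∈-map⁻ -[1+_] q
    ... | _ , _ , refl | _ , _ , ()
    snd : ∀ {z} → z ∈ map +_ (upTo (suc N)) ++ map -[1+_] (upTo N) → ∣ z ∣ ℕ.≤ N
    snd z∈ with ∈-++⁻ (map +_ (upTo (suc N))) z∈
    ... | inj₁ p = let (_ , n∈ , e) = ∈-map⁻ +_ p in subst (λ z → ∣ z ∣ ℕ.≤ N) (sym e) (ℕₚ.≤-pred (∈-upTo⁻ n∈))
    ... | inj₂ p = let (_ , n∈ , e) = ∈-map⁻ -[1+_] p in subst (λ z → ∣ z ∣ ℕ.≤ N) (sym e) (∈-upTo⁻ n∈)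
    cmp : ∀ z → ∣ z ∣ ℕ.≤ N → z ∈ map +_ (upTo (suc N)) ++ map -[1+_] (upTo N)
    cmp (+ n)    b = ∈-++⁺ˡ (∈-map⁺ +_ (∈-upTo⁺ (ℕ.s≤s b)))
    cmp -[1+ n ] b = ∈-++⁺ʳ (map +_ (upTo (suc N))) (∈-map⁺ -[1+_] (∈-upTo⁺ b))

  ℤ² ℤ³ ℤ⁴ : Set
  ℤ² = ℤ × ℤ
  ℤ³ = ℤ × ℤ²
  ℤ⁴ = ℤ × ℤ³

  -- A box is filtered; the `image` along the identity only removes the bound from the predicate.
  finite₁ : ∀ {P : ℤ → Set} N → Decidable P → (∀ {x} → P x → Abs≤ N x) → Finite P
  finite₁ N P? bd = image (restrict (interval N) P?) id proj₂ (λ _ _ e → e) (λ p → _ , (bd p , p) , refl)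

  finite₂ : ∀ {P : ℤ² → Set} N → Decidable P → (∀ {x} → P x → Abs≤ N (proj₁ x) × Abs≤ N (proj₂ x)) → Finite P
  finite₂ N P? bd = image (restrict (sigma (interval N) (λ _ → interval N)) P?) id proj₂ (λ _ _ e → e) (λ p → _ , (bd p , p) , refl)

  finite₃ : ∀ {P : ℤ³ → Set} N → Decidable P → (∀ {x} → P x → Abs≤ N (proj₁ x) × Abs≤ N (proj₁ (proj₂ x)) × Abs≤ N (proj₂ (proj₂ x))) → Finite P
  finite₃ N P? bd = image (restrict (sigma (interval N) (λ _ → sigma (interval N) (λ _ → interval N))) P?) id proj₂ (λ _ _ e → e) (λ p → _ , (bd p , p) , refl)

  finite₄ : ∀ {P : ℤ⁴ → Set} N → Decidable P → (∀ {x} → P x → Abs≤ N (proj₁ x) × Abs≤ N (proj₁ (proj₂ x)) × Abs≤ N (proj₁ (proj₂ (proj₂ x))) × Abs≤ N (proj₂ (proj₂ (proj₂ x)))) → Finite P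
  finite₄ N P? bd = image (restrict (sigma (interval N) (λ _ → sigma (interval N) (λ _ → sigma (interval N) (λ _ → interval N)))) P?) id proj₂ (λ _ _ e → e) (λ p → _ , (bd p , p) , refl)

open FiniteSums

-- Integer inequalities

infixl 6 _⊕_
infixl 7 _⊗_

_⊕_ : ∀ {a b} → 0ℤ ≤ a → 0ℤ ≤ b → 0ℤ ≤ a + b
p ⊕ q = +-mono-≤ p q

_⊗_ : ∀ {a b} → 0ℤ ≤ a → 0ℤ ≤ b → 0ℤ ≤ a * b
_⊗_ {+ m} {+ n} _ _ = subst (0ℤ ≤_) (pos-* m n) (+≤+ ℕ.z≤n)

nat≥0 : ∀ n → 0ℤ ≤ + n
nat≥0 n = +≤+ ℕ.z≤n

sq≥0 : ∀ a → 0ℤ ≤ a * a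
sq≥0 (+ n)      = nat≥0 n ⊗ nat≥0 n
sq≥0 (-[1+ n ]) = +≤+ ℕ.z≤n

-- Inequalities are proved by certificates: a ring identity rewrites the term as an expression built
-- by `_⊕_` and `_⊗_` from terms known to be nonnegative.
by : ∀ {x y} → 0ℤ ≤ y → x ≡ y → 0ℤ ≤ x
by p e = subst (0ℤ ≤_) (sym e) p

pred≥0 : ∀ {x} → 0ℤ < x → 0ℤ ≤ x - 1ℤ
pred≥0 p = i≤j⇒0≤j-i (i<j⇒suc[i]≤j p)

pred⇒pos : ∀ {x} → 0ℤ ≤ x - 1ℤ → 0ℤ < x
pred⇒pos p = suc[i]≤j⇒i<j (0≤i-j⇒j≤i p)

pos→nn : ∀ {x} → 0ℤ < x → 0ℤ ≤ x
pos→nn = <⇒≤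

-- Over the integers `0 < x` means that `x - 1` is nonnegative, so certificates serve for strict
-- inequalities too.
pby : ∀ {x y} → 0ℤ ≤ y → x - 1ℤ ≡ y → 0ℤ < x
pby p e = pred⇒pos (by p e)

pos* : ∀ {a b} → 0ℤ < a → 0ℤ < b → 0ℤ < a * b
pos* {a} {b} p q = pby (pred≥0 p ⊗ pred≥0 q ⊕ pred≥0 p ⊕ pred≥0 q) (lem a b)
  where
  lem : ∀ a b → a * b - 1ℤ ≡ (a - 1ℤ) * (b - 1ℤ) + (a - 1ℤ) + (b - 1ℤ)
  lem = solve 2 (λ a b → a :* b :- # 1 := (a :- # 1) :* (b :- # 1) :+ (a :- # 1) :+ (b :- # 1)) refl

-- Refutation by certificate: a combination of the hypotheses is nonnegative and yet, by a ring
-- identity, a negative constant.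
absurd : ∀ {x n} → 0ℤ ≤ x → x ≡ -[1+ n ] → ⊥
absurd p refl with p
... | ()

pos≢0 : ∀ {x} → 0ℤ < x → x ≢ 0ℤ
pos≢0 p refl = <-irrefl refl p

neg-pos : ∀ {x} → 0ℤ < - x → ¬ 0ℤ < x
neg-pos {x} p q = absurd {n = 1} (pred≥0 p ⊕ pred≥0 q) (lem x)
  where
  lem : ∀ x → - x - 1ℤ + (x - 1ℤ) ≡ -[1+ 1 ]
  lem = solve 1 (λ x → :- x :- # 1 :+ (x :- # 1) := con -[1+ 1 ]) refl

data Sign (x : ℤ) : Set where
  isNeg  : 0ℤ < - x → Sign x
  isZero : x ≡ 0ℤ → Sign x
  isPos  : 0ℤ < x → Sign x

sign : ∀ x → Sign x
sign (+ zero)  = isZero refl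
sign (+ suc n) = isPos (+<+ (ℕ.s≤s ℕ.z≤n))
sign -[1+ n ]  = isNeg (+<+ (ℕ.s≤s ℕ.z≤n))

nn⊎neg : ∀ x → 0ℤ ≤ x ⊎ 0ℤ < - x
nn⊎neg (+ n)    = inj₁ (nat≥0 n)
nn⊎neg -[1+ n ] = inj₂ (+<+ (ℕ.s≤s ℕ.z≤n))

0<? : ∀ x → Dec (0ℤ < x)
0<? x = 0ℤ <? x

pos*-cancelˡ : ∀ {a b} → 0ℤ < a → 0ℤ < a * b → 0ℤ < b
pos*-cancelˡ {a} {b} p q with sign b
... | isPos r     = r
... | isZero refl = ⊥-elim (pos≢0 q (*-zeroʳ a))
... | isNeg r     = ⊥-elim (neg-pos (subst (0ℤ <_) (lem a b) (pos* p r)) q)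
  where
  lem : ∀ a b → a * - b ≡ - (a * b)
  lem = solve 2 (λ a b → a :* :- b := :- (a :* b)) refl

≤⇒Abs≤ : ∀ {N} x → 0ℤ ≤ + N - x → 0ℤ ≤ + N + x → Abs≤ N x
≤⇒Abs≤ {N} (+ n)    p _ = drop‿+≤+ (0≤i-j⇒j≤i p)
≤⇒Abs≤ {N} -[1+ n ] _ q = drop‿+≤+ (0≤i-j⇒j≤i {+ N} {+ suc n} q)

+∣_∣≥ : ∀ x → 0ℤ ≤ + ∣ x ∣ - x
+∣ + n ∣≥      = by (nat≥0 0) (+-inverseʳ (+ n))
+∣ -[1+ n ] ∣≥ = +≤+ ℕ.z≤n

1≢0 : 1ℤ ≢ 0ℤ
1≢0 ()

1≢-1 : 1ℤ ≢ -1ℤ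
1≢-1 ()

0≢-1 : 0ℤ ≢ -1ℤ
0≢-1 ()

0≮-[1+n] : ∀ {n} {P : Set} → 0ℤ < -[1+ n ] → P
0≮-[1+n] ()

-- Parity and the character modulo 4

-- `sg z` is the sign (-1)^z.
sgℕ : ℕ → ℤ
sgℕ 0             = 1ℤ
sgℕ 1             = -1ℤ
sgℕ (suc (suc n)) = sgℕ n

sg : ℤ → ℤ
sg z = sgℕ ∣ z ∣

-- `χ` is the nontrivial Dirichlet character modulo 4, continued to the negative integers as an odd
-- function, so that it stays periodic and multiplicative there.
χℕ : ℕ → ℤ
χℕ 0                         = 0ℤ
χℕ 1                         = 1ℤ
χℕ 2                         = 0ℤ
χℕ 3                         = -1ℤ
χℕ (suc (suc (suc (suc n)))) = χℕ n

χ : ℤ → ℤ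
χ (+ n)    = χℕ n
χ -[1+ n ] = - χℕ (suc n)

periodic : ∀ (f : ℤ → ℤ) c → (∀ z → f (z + c) ≡ f z) → ∀ z k → f (z + c * k) ≡ f z
periodic f c h z (+ n) = go n z
  where
  step : ∀ z c k → z + c * (1ℤ + k) ≡ z + c + c * k
  step = solve 3 (λ z c k → z :+ c :* (# 1 :+ k) := z :+ c :+ c :* k) refl
  go : ∀ n z → f (z + c * + n) ≡ f z
  go zero    z = cong f (trans (cong (_+_ z) (*-zeroʳ c)) (+-identityʳ z))
  go (suc n) z = trans (cong f (step z c (+ n))) (trans (go n (z + c)) (h z))
periodic f c h z -[1+ n ] = trans (sym (periodic f c h (z + c * -[1+ n ]) (+ suc n))) (cong f (lem z c (+ suc n)))
  where
  lem : ∀ z c k → z + c * - k + c * k ≡ z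
  lem = solve 3 (λ z c k → z :+ c :* :- k :+ c :* k := z) refl

sg+2 : ∀ z → sg (z + + 2) ≡ sg z
sg+2 (+ n) = cong sgℕ (ℕₚ.+-comm n 2)
sg+2 -[1+ 0 ] = refl
sg+2 -[1+ 1 ] = refl
sg+2 -[1+ suc (suc n) ] = refl

χ+4 : ∀ z → χ (z + + 4) ≡ χ z
χ+4 (+ n) = cong χℕ (ℕₚ.+-comm n 4)
χ+4 -[1+ 0 ] = refl
χ+4 -[1+ 1 ] = refl
χ+4 -[1+ 2 ] = refl
χ+4 -[1+ 3 ] = refl
χ+4 -[1+ suc (suc (suc (suc n))) ] = refl

sg-per : ∀ z k → sg (z + + 2 * k) ≡ sg z
sg-per = periodic sg (+ 2) sg+2

χ-per : ∀ z k → χ (z + + 4 * k) ≡ χ z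
χ-per = periodic χ (+ 4) χ+4

data Parity (z : ℤ) : Set where
  even : ∀ k → z ≡ 0ℤ + + 2 * k → Parity z
  odd  : ∀ k → z ≡ 1ℤ + + 2 * k → Parity z

parity : ∀ z → Parity z
parity z with z %ℕ 2 | n%ℕd<d z 2 | a≡a%ℕn+[a/ℕn]*n z 2
... | 0 | _ | e = even (z /ℕ 2) (trans e (cong (_+_ 0ℤ) (*-comm (z /ℕ 2) (+ 2))))
... | 1 | _ | e = odd (z /ℕ 2) (trans e (cong (_+_ 1ℤ) (*-comm (z /ℕ 2) (+ 2))))
... | suc (suc _) | ℕ.s≤s (ℕ.s≤s ()) | _

mod4 : ∀ z → ∃ λ r → ∃ λ k → r ℕ.< 4 × z ≡ + r + + 4 * k
mod4 z = z %ℕ 4 , z /ℕ 4 , n%ℕd<d z 4 , trans (a≡a%ℕn+[a/ℕn]*n z 4) (cong (_+_ (+ (z %ℕ 4))) (*-comm (z /ℕ 4) (+ 4)))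

sg-odd : ∀ k → sg (1ℤ + + 2 * k) ≡ -1ℤ
sg-odd = sg-per 1ℤ

sg-even : ∀ k → sg (0ℤ + + 2 * k) ≡ 1ℤ
sg-even = sg-per 0ℤ

-- A record rather than a bare equation, so that `z` can be inferred from a proof. In the sign form,
-- parities of sums are computed by `sg-+`.
record Odd (z : ℤ) : Set where
  constructor mkOdd
  field sg-1 : sg z ≡ -1ℤ
open Odd

odd? : ∀ z → Dec (Odd z)
odd? z with sg z ≟ -1ℤ
... | yes e = yes (mkOdd e)
... | no ¬e = no λ o → ¬e (sg-1 o)

odd⇒ : ∀ {z} → Odd z → ∃ λ k → z ≡ 1ℤ + + 2 * k
odd⇒ {z} (mkOdd o) with parity z
... | odd k e = k , e
... | even k refl with trans (sym o) (sg-even k)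
... | ()

odd-by : ∀ {z} k → z ≡ 1ℤ + + 2 * k → Odd z
odd-by k refl = mkOdd (sg-odd k)

odd-per : ∀ {z} k → Odd z → Odd (z + + 2 * k)
odd-per {z} k (mkOdd o) = mkOdd (trans (sg-per z k) o)

sg-+ : ∀ a b → sg (a + b) ≡ sg a * sg b
sg-+ a b with parity a | parity b
... | even k refl | even l refl = trans (cong sg (lem k l)) (trans (sg-even (k + l)) (sym (cong₂ _*_ (sg-even k) (sg-even l))))
  where
  lem : ∀ k l → 0ℤ + + 2 * k + (0ℤ + + 2 * l) ≡ 0ℤ + + 2 * (k + l)
  lem = solve 2 (λ k l → # 0 :+ # 2 :* k :+ (# 0 :+ # 2 :* l) := # 0 :+ # 2 :* (k :+ l)) refl
... | even k refl | odd l refl = trans (cong sg (lem k l)) (trans (sg-odd (k + l)) (sym (cong₂ _*_ (sg-even k) (sg-odd l))))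
  where
  lem : ∀ k l → 0ℤ + + 2 * k + (1ℤ + + 2 * l) ≡ 1ℤ + + 2 * (k + l)
  lem = solve 2 (λ k l → # 0 :+ # 2 :* k :+ (# 1 :+ # 2 :* l) := # 1 :+ # 2 :* (k :+ l)) refl
... | odd k refl | even l refl = trans (cong sg (lem k l)) (trans (sg-odd (k + l)) (sym (cong₂ _*_ (sg-odd k) (sg-even l))))
  where
  lem : ∀ k l → 1ℤ + + 2 * k + (0ℤ + + 2 * l) ≡ 1ℤ + + 2 * (k + l)
  lem = solve 2 (λ k l → # 1 :+ # 2 :* k :+ (# 0 :+ # 2 :* l) := # 1 :+ # 2 :* (k :+ l)) refl
... | odd k refl | odd l refl = trans (cong sg (lem k l)) (trans (sg-even (1ℤ + (k + l))) (sym (cong₂ _*_ (sg-odd k) (sg-odd l))))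
  where
  lem : ∀ k l → 1ℤ + + 2 * k + (1ℤ + + 2 * l) ≡ 0ℤ + + 2 * (1ℤ + (k + l))
  lem = solve 2 (λ k l → # 1 :+ # 2 :* k :+ (# 1 :+ # 2 :* l) := # 0 :+ # 2 :* (# 1 :+ (k :+ l))) refl

sg-neg : ∀ a → sg (- a) ≡ sg a
sg-neg a = cong sgℕ (∣-i∣≡∣i∣ a)

sg² : ∀ a → sg a * sg a ≡ 1ℤ
sg² a with parity a
... | even k refl = cong₂ _*_ (sg-even k) (sg-even k)
... | odd k refl  = cong₂ _*_ (sg-odd k) (sg-odd k)

odd* : ∀ {a b} → Odd a → Odd b → Odd (a * b)
odd* {a} {b} p q with odd⇒ {a} p | odd⇒ {b} q
... | k , refl | l , refl = odd-by (k + l + + 2 * (k * l)) (lem k l)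
  where
  lem : ∀ k l → (1ℤ + + 2 * k) * (1ℤ + + 2 * l) ≡ 1ℤ + + 2 * (k + l + + 2 * (k * l))
  lem = solve 2 (λ k l → (# 1 :+ # 2 :* k) :* (# 1 :+ # 2 :* l) := # 1 :+ # 2 :* (k :+ l :+ # 2 :* (k :* l))) refl

odd*ˡ : ∀ {a b} → Odd (a * b) → Odd a
odd*ˡ {a} {b} (mkOdd o) with parity a
... | odd k e = odd-by k e
... | even k refl with trans (sym o) (trans (cong sg (lem k b)) (sg-even (k * b)))
  where
  lem : ∀ k b → (0ℤ + + 2 * k) * b ≡ 0ℤ + + 2 * (k * b)
  lem = solve 2 (λ k b → (# 0 :+ # 2 :* k) :* b := # 0 :+ # 2 :* (k :* b)) refl
... | ()

odd*ʳ : ∀ {a b} → Odd (a * b) → Odd b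
odd*ʳ {a} {b} o = odd*ˡ {b} {a} (subst Odd (*-comm a b) o)

odd≢0 : ∀ {a} → Odd a → a ≢ 0ℤ
odd≢0 (mkOdd ()) refl

χ-neg : ∀ a → χ (- a) ≡ - χ a
χ-neg (+ 0)     = refl
χ-neg (+ suc n) = refl
χ-neg -[1+ n ]  = sym (neg-involutive _)

χ-* : ∀ a b → χ (a * b) ≡ χ a * χ b
χ-* a b with mod4 a | mod4 b
... | r , k , r< , refl | s , l , s< , refl =
  trans (cong χ (lem (+ r) k (+ s) l)) (trans (χ-per (+ r * + s) (+ r * l + k * + s + + 4 * (k * l)))
    (trans (table r s r< s<) (sym (cong₂ _*_ (χ-per (+ r) k) (χ-per (+ s) l)))))
  where
  lem : ∀ r k s l → (r + + 4 * k) * (s + + 4 * l) ≡ r * s + + 4 * (r * l + k * s + + 4 * (k * l))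
  lem = solve 4 (λ r k s l → (r :+ # 4 :* k) :* (s :+ # 4 :* l) := r :* s :+ # 4 :* (r :* l :+ k :* s :+ # 4 :* (k :* l))) refl
  pattern big = ℕ.s≤s (ℕ.s≤s (ℕ.s≤s (ℕ.s≤s ())))
  table : ∀ r s → r ℕ.< 4 → s ℕ.< 4 → χ (+ r * + s) ≡ χ (+ r) * χ (+ s)
  table 0 s _ _ = refl
  table 1 0 _ _ = refl
  table 1 1 _ _ = refl
  table 1 2 _ _ = refl
  table 1 3 _ _ = refl
  table 2 0 _ _ = refl
  table 2 1 _ _ = refl
  table 2 2 _ _ = refl
  table 2 3 _ _ = refl
  table 3 0 _ _ = refl
  table 3 1 _ _ = refl
  table 3 2 _ _ = refl
  table 3 3 _ _ = refl
  table 1 (suc (suc (suc (suc _)))) _ big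
  table 2 (suc (suc (suc (suc _)))) _ big
  table 3 (suc (suc (suc (suc _)))) _ big
  table (suc (suc (suc (suc _)))) _ big _

χ-odd : ∀ i → χ (1ℤ + + 2 * i) ≡ sg i
χ-odd i with parity i
... | even k refl = trans (cong χ (lem k)) (trans (χ-per 1ℤ k) (sym (sg-even k)))
  where
  lem : ∀ k → 1ℤ + + 2 * (0ℤ + + 2 * k) ≡ 1ℤ + + 4 * k
  lem = solve 1 (λ k → # 1 :+ # 2 :* (# 0 :+ # 2 :* k) := # 1 :+ # 4 :* k) refl
... | odd k refl = trans (cong χ (lem k)) (trans (χ-per (+ 3) k) (sym (sg-odd k)))
  where
  lem : ∀ k → 1ℤ + + 2 * (1ℤ + + 2 * k) ≡ + 3 + + 4 * k
  lem = solve 1 (λ k → # 1 :+ # 2 :* (# 1 :+ # 2 :* k) := # 3 :+ # 4 :* k) refl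

χ² : ∀ {a} → Odd a → χ a * χ a ≡ 1ℤ
χ² {a} o with odd⇒ {a} o
... | i , refl = trans (cong₂ _*_ (χ-odd i) (χ-odd i)) (sg² i)

χ±1 : ∀ {a} → Odd a → χ a ≡ 1ℤ ⊎ χ a ≡ -1ℤ
χ±1 {a} o with odd⇒ {a} o
... | i , refl with parity i
... | even k refl = inj₁ (trans (χ-odd (0ℤ + + 2 * k)) (sg-even k))
... | odd k refl  = inj₂ (trans (χ-odd (1ℤ + + 2 * k)) (sg-odd k))

odd-χ : ∀ {a} → χ a ≢ 0ℤ → Odd a
odd-χ {a} ne with parity a
... | odd k e = odd-by k e
... | even k refl with parity k
... | even l refl = ⊥-elim (ne (trans (cong χ (lem l)) (χ-per 0ℤ l)))
  where
  lem : ∀ l → 0ℤ + + 2 * (0ℤ + + 2 * l) ≡ 0ℤ + + 4 * l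
  lem = solve 1 (λ l → # 0 :+ # 2 :* (# 0 :+ # 2 :* l) := # 0 :+ # 4 :* l) refl
... | odd l refl = ⊥-elim (ne (trans (cong χ (lem l)) (χ-per (+ 2) l)))
  where
  lem : ∀ l → 0ℤ + + 2 * (1ℤ + + 2 * l) ≡ + 2 + + 4 * l
  lem = solve 1 (λ l → # 0 :+ # 2 :* (# 1 :+ # 2 :* l) := # 2 :+ # 4 :* l) refl

χ≡1⇒ : ∀ {a} → χ a ≡ 1ℤ → ∃ λ k → a ≡ 1ℤ + + 4 * k
χ≡1⇒ {a} e with mod4 a
... | 0 , k , _ , refl = ⊥-elim (1≢0 (trans (sym e) (χ-per 0ℤ k)))
... | 1 , k , _ , refl = k , refl
... | 2 , k , _ , refl = ⊥-elim (1≢0 (trans (sym e) (χ-per (+ 2) k)))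
... | 3 , k , _ , refl = ⊥-elim (1≢-1 (trans (sym e) (χ-per (+ 3) k)))
... | suc (suc (suc (suc _))) , _ , ℕ.s≤s (ℕ.s≤s (ℕ.s≤s (ℕ.s≤s ()))) , _

odd-sign : ∀ {x} → Odd x → 0ℤ < - x ⊎ 0ℤ < x
odd-sign {x} o with sign x
... | isNeg p  = inj₁ p
... | isPos p  = inj₂ p
... | isZero e = ⊥-elim (odd≢0 o e)

pos-double : ∀ {x} → 0ℤ < + 2 * x → 0ℤ < x
pos-double {x} = pos*-cancelˡ {+ 2} {x} (+<+ (ℕ.s≤s ℕ.z≤n))

factor-1 : ∀ {x y} → 0ℤ < x → 0ℤ < y → x * y ≡ 1ℤ → x ≡ 1ℤ
factor-1 {x} {y} p q e = ≤-antisym (0≤i-j⇒j≤i (by (pred≥0 p ⊗ pred≥0 q ⊕ pred≥0 q) (trans (cong (_- x) (sym e)) (lem x y)))) (0≤i-j⇒j≤i (pred≥0 p))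
  where
  lem : ∀ x y → x * y - x ≡ (x - 1ℤ) * (y - 1ℤ) + (y - 1ℤ)
  lem = solve 2 (λ x y → x :* y :- x := (x :- # 1) :* (y :- # 1) :+ (y :- # 1)) refl

odd-neg : ∀ {x} → Odd x → Odd (- x)
odd-neg {x} (mkOdd o) = mkOdd (trans (sg-neg x) o)

pos*-cancel-≡ : ∀ {c a b} → 0ℤ < c → c * a ≡ c * b → a ≡ b
pos*-cancel-≡ {c} {a} {b} p e = *-cancelˡ-≡ c a b {{ℤ.>-nonZero p}} e

abs-sign : ∀ X → ∃ λ s → X ≡ s * + ∣ X ∣ × + ∣ X ∣ ≡ s * X
abs-sign (+ n)    = 1ℤ , sym (*-identityˡ (+ n)) , sym (*-identityˡ (+ n))
abs-sign -[1+ n ] = -1ℤ , sym (-1*i≡-i (+ suc n)) , sym (-1*i≡-i -[1+ n ])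

-- The gcd is taken of the absolute values; the signs `s` and `s′` are moved into the cofactors and
-- into the coefficients. That `X` is positive excludes `D = 0`.
bezout : ∀ X Y → 0ℤ < X → ∃ λ D → ∃ λ α → ∃ λ γ → ∃ λ u → ∃ λ v → 0ℤ < D × X ≡ α * D × Y ≡ γ * D × α * u + γ * v ≡ 1ℤ
bezout X Y X>0 with abs-sign X | abs-sign Y | gcd[m,n]∣m ∣ X ∣ ∣ Y ∣ | gcd[m,n]∣n ∣ X ∣ ∣ Y ∣ | Bézout.identity (gcd-GCD ∣ X ∣ ∣ Y ∣)
... | s , X≡ , ∣X∣≡ | s′ , Y≡ , ∣Y∣≡ | ℕ∣.divides x ex | ℕ∣.divides y ey | bz = D , α , γ , U , V , D>0 , eX , eY , one
  where
  g : ℕ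
  g = gcd ∣ X ∣ ∣ Y ∣
  D α γ : ℤ
  D = + g
  α = s * + x
  γ = s′ * + y
  eX : X ≡ α * D
  eX = trans X≡ (trans (cong (λ n → s * + n) ex) (trans (cong (_*_ s) (pos-* x g)) (sym (*-assoc s (+ x) D))))
  eY : Y ≡ γ * D
  eY = trans Y≡ (trans (cong (λ n → s′ * + n) ey) (trans (cong (_*_ s′) (pos-* y g)) (sym (*-assoc s′ (+ y) D))))
  D>0 : 0ℤ < D
  D>0 with sign D
  ... | isPos p = p
  ... | isZero e = ⊥-elim (pos≢0 X>0 (trans eX (trans (cong (_*_ α) e) (*-zeroʳ α))))
  ... | isNeg h = ⊥-elim (absurd {n = 0} (pred≥0 h ⊕ nat≥0 g) (l D))
    where
    l : ∀ D → - D - 1ℤ + D ≡ -[1+ 0 ]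
    l = solve 1 (λ D → :- D :- # 1 :+ D := con -[1+ 0 ]) refl
  lin : Bézout.Identity g ∣ X ∣ ∣ Y ∣ → ∃ λ U → ∃ λ V → D ≡ X * U + Y * V
  lin (Bézout.+- u v e) = s * + u , - (s′ * + v) ,
          trans (shift (trans (cong (_+_ D) (sym (pos-* v ∣ Y ∣))) (trans (cong +_ e) (pos-* u ∣ X ∣))))
            (trans (cong₂ (λ m n → + u * m - + v * n) ∣X∣≡ ∣Y∣≡) (l (+ u) (+ v) s s′ X Y))
    where
    shift : ∀ {a b c} → a + b ≡ c → a ≡ c - b
    shift {a} {b} e = trans (l′ a b) (cong (_- b) e)
      where
      l′ : ∀ a b → a ≡ a + b - b
      l′ = solve-∀
    l : ∀ u v s s′ X Y → u * (s * X) - v * (s′ * Y) ≡ X * (s * u) + Y * - (s′ * v)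
    l = solve 6 (λ u v s s′ X Y → u :* (s :* X) :- v :* (s′ :* Y) := X :* (s :* u) :+ Y :* :- (s′ :* v)) refl
  lin (Bézout.-+ u v e) = - (s * + u) , s′ * + v ,
          trans (shift (trans (cong (_+_ D) (sym (pos-* u ∣ X ∣))) (trans (cong +_ e) (pos-* v ∣ Y ∣))))
            (trans (cong₂ (λ m n → + v * n - + u * m) ∣X∣≡ ∣Y∣≡) (l (+ u) (+ v) s s′ X Y))
    where
    shift : ∀ {a b c} → a + b ≡ c → a ≡ c - b
    shift {a} {b} e = trans (l′ a b) (cong (_- b) e)
      where
      l′ : ∀ a b → a ≡ a + b - b
      l′ = solve-∀
    l : ∀ u v s s′ X Y → v * (s′ * Y) - u * (s * X) ≡ X * - (s * u) + Y * (s′ * v)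
    l = solve 6 (λ u v s s′ X Y → v :* (s′ :* Y) :- u :* (s :* X) := X :* :- (s :* u) :+ Y :* (s′ :* v)) refl
  U V : ℤ
  U = proj₁ (lin bz)
  V = proj₁ (proj₂ (lin bz))
  one : α * U + γ * V ≡ 1ℤ
  one = pos*-cancel-≡ {D} {α * U + γ * V} {1ℤ} D>0 (trans (l α γ D U V) (trans (sym (cong₂ (λ m n → m * U + n * V) eX eY)) (trans (sym (proj₂ (proj₂ (lin bz)))) (sym (*-identityʳ D)))))
    where
    l : ∀ α γ D U V → D * (α * U + γ * V) ≡ α * D * U + γ * D * V
    l = solve 5 (λ α γ D U V → D :* (α :* U :+ γ :* V) := α :* D :* U :+ γ :* D :* V) refl

half-pos : ∀ {x u v} → 0ℤ < u → 0ℤ < v → u + v ≡ + 2 * x → 0ℤ < x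
half-pos {x} p q e = pos-double {x} (subst (0ℤ <_) e (+-mono-< p q))

pos-quarter : ∀ {μ} → 0ℤ < 1ℤ + + 4 * μ → 0ℤ ≤ μ
pos-quarter {μ} h with nn⊎neg μ
... | inj₁ p = p
... | inj₂ q = ⊥-elim (absurd {n = 3} (pred≥0 h ⊕ nat≥0 4 ⊗ pred≥0 q) (l μ))
  where
  l : ∀ μ → 1ℤ + + 4 * μ - 1ℤ + + 4 * (- μ - 1ℤ) ≡ -[1+ 3 ]
  l = solve 1 (λ μ → # 1 :+ # 4 :* μ :- # 1 :+ # 4 :* (:- μ :- # 1) := con -[1+ 3 ]) refl

even≢odd : ∀ {k l} → 1ℤ + + 2 * k ≢ + 2 * l
even≢odd {k} {l} e = 1≢-1 (trans (sym (sg-even l)) (trans (cong sg (trans (+-identityˡ (+ 2 * l)) (sym e))) (sg-odd k)))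

nonpos : ∀ {x} → Odd x → ¬ 0ℤ < x → 0ℤ < - x
nonpos {x} o n with odd-sign o
... | inj₁ p = p
... | inj₂ p = ⊥-elim (n p)

quarter : ∀ {a b} → 1ℤ + + 4 * a ≡ 1ℤ + + 4 * b → a ≡ b
quarter {a} {b} e = *-cancelˡ-≡ (+ 4) a b (trans (l a) (trans (cong (_- 1ℤ) e) (sym (l b))))
  where
  l : ∀ a → + 4 * a ≡ 1ℤ + + 4 * a - 1ℤ
  l = solve 1 (λ a → # 4 :* a := # 1 :+ # 4 :* a :- # 1) refl

-- A class number relation through the reduction of lattice bases.

module Tiles where

  -- Reduction on the tree of tiles

  -- A tile stands for the matrix with rows (T + 2 a + 2 d , - T + 2 a - 2 d) and (T + 2 a - 2 d , T + 2 b + 2 c), where a + c = b + d.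
  -- Its four neighbours are its products with four reflections congruent to 1 modulo 2;
  -- the label T + 4 x is the value of T at the neighbour across the side x.
  record Tile : Set where
    constructor tile
    field T a b c d : ℤ

    la lb lc ld : ℤ
    la = T + + 4 * a
    lb = T + + 4 * b
    lc = T + + 4 * c
    ld = T + + 4 * d
  open Tile

  rot unrot negate cross : Tile → Tile
  rot    (tile T a b c d) = tile T b c d a
  unrot  (tile T a b c d) = tile T d a b c
  negate (tile T a b c d) = tile (- T) (- a) (- b) (- c) (- d)
  cross  (tile T a b c d) = tile (T + + 4 * a) (- a) b (b - d - T - a) (- T - + 2 * a - d)

  -- An odd `T` makes all labels odd and all sums of two labels twice an odd number. None of them is
  -- ever 0, so every comparison in the reduction is strict.
  Regular : Tile → Set
  Regular t = a t + c t ≡ b t + d t × Odd (T t)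

  Central : Tile → Set
  Central t = (0ℤ < la t × 0ℤ < lb t × 0ℤ < lc t × 0ℤ < ld t)
            ⊎ (0ℤ < - la t × 0ℤ < - lb t × 0ℤ < - lc t × 0ℤ < - ld t)

  -- The reduction only moves by negation and by crossings, so it preserves any such property; it
  -- will be applied to being a basis of a fixed lattice.
  record Closed (P : Tile → Set) : Set where
    field
      neg    : ∀ {t} → P t → P (negate t)
      cross₀ : ∀ {t} → P t → P (cross t)
      cross₁ : ∀ {t} → P t → P (unrot (cross (rot t)))
      cross₂ : ∀ {t} → P t → P (rot (rot (cross (rot (rot t)))))
      cross₃ : ∀ {t} → P t → P (rot (cross (unrot t)))
  open Closed

  -- Rotation permutes the four crossings cyclically, which reduces every crossing to that of the
  -- first side.
  closed-unrot : ∀ {P} → Closed P → Closed (P ∘ unrot)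
  closed-unrot C = record { neg = neg C ; cross₀ = cross₁ C ; cross₁ = cross₂ C ; cross₂ = cross₃ C ; cross₃ = cross₀ C }

  label-odd : ∀ {T} x → Odd T → Odd (T + + 4 * x)
  label-odd {T} x o = subst Odd (lem T x) (odd-per (+ 2 * x) o)
    where
    lem : ∀ T x → T + + 2 * (+ 2 * x) ≡ T + + 4 * x
    lem = solve 2 (λ T x → T :+ # 2 :* (# 2 :* x) := T :+ # 4 :* x) refl

  label-sign : ∀ {T} x → Odd T → 0ℤ < - (T + + 4 * x) ⊎ 0ℤ < T + + 4 * x
  label-sign x o = odd-sign (label-odd x o)

  labels-sign : ∀ {T} x y → Odd T → 0ℤ < - (T + + 4 * x + (T + + 4 * y)) ⊎ 0ℤ < T + + 4 * x + (T + + 4 * y)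
  labels-sign {T} x y o with sign (T + + 4 * x + (T + + 4 * y))
  ... | isNeg p  = inj₁ p
  ... | isPos p  = inj₂ p
  ... | isZero e = ⊥-elim (odd≢0 (odd-per (x + y) o)
          (*-cancelˡ-≡ (+ 2) (T + + 2 * (x + y)) 0ℤ (trans (sym (lem T x y)) e)))
    where
    lem : ∀ T x y → T + + 4 * x + (T + + 4 * y) ≡ + 2 * (T + + 2 * (x + y))
    lem = solve 3 (λ T x y → T :+ # 4 :* x :+ (T :+ # 4 :* y) := # 2 :* (T :+ # 2 :* (x :+ y))) refl

  -- Read the labels cyclically. Where a negative label is followed by a positive one, the side
  -- whose label is smaller in absolute value is outward. `Inward` is the opposite comparison with
  -- the same neighbour; it holds for the side through which a tile was entered and so forbids
  -- turning back.
  Outward Inward : Tile → Set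
  Outward t = (0ℤ < - la t × 0ℤ < la t + lb t) ⊎ (0ℤ < la t × 0ℤ < - (la t + ld t))
  Inward  t = (0ℤ < - la t × 0ℤ < - (la t + lb t)) ⊎ (0ℤ < la t × 0ℤ < la t + ld t)

  -- If the labels do not all have one sign, somewhere in the cyclic order a negative one is
  -- followed by a positive one, and the sign of their sum tells which of the two sides to cross.
  outward : ∀ t → Odd (T t) → Central t ⊎ Outward t ⊎ Outward (rot t) ⊎ Outward (rot (rot t)) ⊎ Outward (unrot t)
  outward t@(tile T a b c d) o = go (label-sign a o) (label-sign b o) (label-sign c o) (label-sign d o)
    where
    comm : ∀ x y → 0ℤ < - (T + + 4 * x + (T + + 4 * y)) → 0ℤ < - (T + + 4 * y + (T + + 4 * x))
    comm x y = subst (λ e → 0ℤ < - e) (+-comm (T + + 4 * x) (T + + 4 * y))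
    go : 0ℤ < - la t ⊎ 0ℤ < la t → 0ℤ < - lb t ⊎ 0ℤ < lb t → 0ℤ < - lc t ⊎ 0ℤ < lc t → 0ℤ < - ld t ⊎ 0ℤ < ld t → _
    go (inj₁ p) (inj₂ q) _ _ with labels-sign a b o
    ... | inj₁ s = inj₂ (inj₂ (inj₁ (inj₂ (q , comm a b s))))
    ... | inj₂ s = inj₂ (inj₁ (inj₁ (p , s)))
    go (inj₁ p) (inj₁ q) (inj₁ r) (inj₁ s) = inj₁ (inj₂ (p , q , r , s))
    go (inj₂ p) (inj₂ q) (inj₂ r) (inj₂ s) = inj₁ (inj₁ (p , q , r , s))
    go (inj₂ p) _ _ (inj₁ q) with labels-sign d a o
    ... | inj₁ s = inj₂ (inj₁ (inj₂ (p , comm d a s)))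
    ... | inj₂ s = inj₂ (inj₂ (inj₂ (inj₂ (inj₁ (q , s)))))
    go _ (inj₁ p) (inj₂ q) _ with labels-sign b c o
    ... | inj₁ s = inj₂ (inj₂ (inj₂ (inj₁ (inj₂ (q , comm b c s)))))
    ... | inj₂ s = inj₂ (inj₂ (inj₁ (inj₁ (p , s))))
    go _ _ (inj₁ p) (inj₂ q) with labels-sign c d o
    ... | inj₁ s = inj₂ (inj₂ (inj₂ (inj₂ (inj₂ (q , comm c d s)))))
    ... | inj₂ s = inj₂ (inj₂ (inj₂ (inj₁ (inj₁ (p , s)))))

  inward-not-outward : ∀ t → Inward t → ¬ Outward t
  inward-not-outward t (inj₁ (_ , p)) (inj₁ (_ , q)) = neg-pos p q
  inward-not-outward t (inj₁ (p , _)) (inj₂ (q , _)) = neg-pos p q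
  inward-not-outward t (inj₂ (p , _)) (inj₁ (q , _)) = neg-pos q p
  inward-not-outward t (inj₂ (_ , p)) (inj₂ (_ , q)) = neg-pos q p

  -- `- x` is smaller than `y` and `w`, and `z = y + w - x` is larger than both. So `x` has the
  -- least absolute value; each difference of squares is a product of two positive factors.
  smallest : ∀ x y z w → x + z ≡ y + w → 0ℤ < - x → 0ℤ < x + y → 0ℤ < x + w →
    0ℤ < y * y - x * x × 0ℤ < z * z - x * x × 0ℤ < w * w - x * x
  smallest x y z w e p q r =
      subst (0ℤ <_) (e₁ x y) (pos* q (pby (pred≥0 q ⊕ nat≥0 2 ⊗ pos→nn p) (e₂ x y)))
    , subst (0ℤ <_) (e₁ x z)
        (pos* {x + z} {z - x} (pby (pred≥0 q ⊕ pos→nn r ⊕ nat≥0 2 ⊗ pos→nn p) (trans (cong (_- 1ℤ) e) (e₃ x y w)))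
              (pby (pred≥0 q ⊕ pos→nn r ⊕ nat≥0 4 ⊗ pos→nn p) (trans (cong (λ s → s - + 2 * x - 1ℤ) e) (e₄ x y w)) ▹ e₅ x z))
    , subst (0ℤ <_) (e₁ x w) (pos* r (pby (pred≥0 r ⊕ nat≥0 2 ⊗ pos→nn p) (e₂ x w)))
    where
    _▹_ : ∀ {u v} → 0ℤ < u → u ≡ v → 0ℤ < v
    h ▹ refl = h
    e₁ : ∀ x y → (x + y) * (y - x) ≡ y * y - x * x
    e₁ = solve 2 (λ x y → (x :+ y) :* (y :- x) := y :* y :- x :* x) refl
    e₂ : ∀ x y → y - x - 1ℤ ≡ x + y - 1ℤ + + 2 * - x
    e₂ = solve 2 (λ x y → y :- x :- # 1 := x :+ y :- # 1 :+ # 2 :* :- x) refl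
    e₃ : ∀ x y w → y + w - 1ℤ ≡ x + y - 1ℤ + (x + w) + + 2 * - x
    e₃ = solve 3 (λ x y w → y :+ w :- # 1 := x :+ y :- # 1 :+ (x :+ w) :+ # 2 :* :- x) refl
    e₄ : ∀ x y w → y + w - + 2 * x - 1ℤ ≡ x + y - 1ℤ + (x + w) + + 4 * - x
    e₄ = solve 3 (λ x y w → y :+ w :- # 2 :* x :- # 1 := x :+ y :- # 1 :+ (x :+ w) :+ # 4 :* :- x) refl
    e₅ : ∀ x z → x + z - + 2 * x ≡ z - x
    e₅ = solve 2 (λ x z → x :+ z :- # 2 :* x := z :- x) refl

  -- With `k′ - k` in place of `k`, the right side is twice the difference between `x² + k′` and
  -- `T² + k`, the potentials at the two ends of a crossing. Two sums of adjacent labels thus decide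
  -- which potential is larger.
  edge-identity : ∀ x y z w T k → x + z ≡ y + w → x * z + y * w + + 2 * (T * T) ≡ + 2 * k →
    (x + y) * (x + w) ≡ + 2 * (x * x - T * T + k)
  edge-identity x y z w T k e i = begin
    (x + y) * (x + w)                                              ≡⟨ e₁ x y w ⟩
    x * x + x * (y + w) + y * w                                    ≡⟨ cong (λ s → x * x + x * s + y * w) (sym e) ⟩
    x * x + x * (x + z) + y * w                                    ≡⟨ e₂ x y z w T ⟩
    + 2 * (x * x - T * T) + (x * z + y * w + + 2 * (T * T))        ≡⟨ cong (_+_ (+ 2 * (x * x - T * T))) i ⟩
    + 2 * (x * x - T * T) + + 2 * k                                ≡⟨ sym (*-distribˡ-+ (+ 2) (x * x - T * T) k) ⟩
    + 2 * (x * x - T * T + k)                                      ∎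
    where
    open ≡-Reasoning
    e₁ : ∀ x y w → (x + y) * (x + w) ≡ x * x + x * (y + w) + y * w
    e₁ = solve 3 (λ x y w → (x :+ y) :* (x :+ w) := x :* x :+ x :* (y :+ w) :+ y :* w) refl
    e₂ : ∀ x y z w T → x * x + x * (x + z) + y * w ≡ + 2 * (x * x - T * T) + (x * z + y * w + + 2 * (T * T))
    e₂ = solve 5 (λ x y z w T → x :* x :+ x :* (x :+ z) :+ y :* w := # 2 :* (x :* x :- T :* T) :+ (x :* z :+ y :* w :+ # 2 :* (T :* T))) refl

  -- The left side is twice the determinant of the matrix. A crossing reverses the determinant and
  -- so exchanges `k` and `k′`; starting from 0 and `N` keeps both nonnegative.
  record Invariant (k k′ : ℤ) (t : Tile) : Set where
    constructor mkInv
    field holds : la t * lc t + lb t * ld t + + 2 * (T t * T t) ≡ + 2 * (k′ - k)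

  label-sum : ∀ t → Regular t → la t + lc t ≡ lb t + ld t
  label-sum (tile T a b c d) (e , _) = trans (lem T a c) (trans (cong (λ s → + 2 * T + + 4 * s) e) (sym (lem T b d)))
    where
    lem : ∀ T a c → T + + 4 * a + (T + + 4 * c) ≡ + 2 * T + + 4 * (a + c)
    lem = solve 3 (λ T a c → T :+ # 4 :* a :+ (T :+ # 4 :* c) := # 2 :* T :+ # 4 :* (a :+ c)) refl

  -- If the sums of `la` with its two neighbours have the same sign, `la` is the least label by
  -- `smallest`. Otherwise their product is negative and `edge-identity` makes the potential drop.
  outward-small : ∀ {k k′} t → Regular t → Invariant k k′ t → Outward t →
    (0ℤ < lb t * lb t - la t * la t × 0ℤ < lc t * lc t - la t * la t × 0ℤ < ld t * ld t - la t * la t)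
    ⊎ 0ℤ < T t * T t + k - (la t * la t + k′)
  outward-small {k} {k′} t@(tile T a b c d) r@(_ , o) (mkInv i) (inj₁ (p , q)) with labels-sign a d o
  ... | inj₂ s = inj₁ (smallest (la t) (lb t) (lc t) (ld t) (label-sum t r) p q s)
  ... | inj₁ s = inj₂ (pos-double {T * T + k - (la t * la t + k′)} (subst (0ℤ <_)
          (trans (e₁ (la t) (lb t) (ld t)) (trans (cong -_ (edge-identity (la t) (lb t) (lc t) (ld t) T (k′ - k) (label-sum t r) i)) (e₂ (la t) T k k′)))
          (pos* q s)))
    where
    e₁ : ∀ x y w → (x + y) * - (x + w) ≡ - ((x + y) * (x + w))
    e₁ = solve 3 (λ x y w → (x :+ y) :* :- (x :+ w) := :- ((x :+ y) :* (x :+ w))) refl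
    e₂ : ∀ x T k k′ → - (+ 2 * (x * x - T * T + (k′ - k))) ≡ + 2 * (T * T + k - (x * x + k′))
    e₂ = solve 4 (λ x T k k′ → :- (# 2 :* (x :* x :- T :* T :+ (k′ :- k))) := # 2 :* (T :* T :+ k :- (x :* x :+ k′))) refl
  outward-small {k} {k′} t@(tile T a b c d) r@(_ , o) (mkInv i) (inj₂ (p , q)) with labels-sign a b o
  ... | inj₁ s = inj₁ (let (u , v , w) = sm in back (lb t) u , back (lc t) v , back (ld t) w)
    where
    x = la t
    sm = smallest (- x) (- lb t) (- lc t) (- ld t)
           (trans (sym (neg-distrib-+ x (lc t))) (trans (cong -_ (label-sum t r)) (neg-distrib-+ (lb t) (ld t))))
           (subst (0ℤ <_) (sym (neg-involutive x)) p)
           (subst (0ℤ <_) (neg-distrib-+ x (lb t)) s) (subst (0ℤ <_) (neg-distrib-+ x (ld t)) q)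
    e₀ : ∀ y x → - y * - y - - x * - x ≡ y * y - x * x
    e₀ = solve 2 (λ y x → :- y :* :- y :- :- x :* :- x := y :* y :- x :* x) refl
    back : ∀ y → 0ℤ < - y * - y - - x * - x → 0ℤ < y * y - x * x
    back y = subst (0ℤ <_) (e₀ y x)
  ... | inj₂ s = inj₂ (pos-double {T * T + k - (la t * la t + k′)} (subst (0ℤ <_)
          (trans (e₁ (la t) (lb t) (ld t)) (trans (cong -_ (edge-identity (la t) (lb t) (lc t) (ld t) T (k′ - k) (label-sum t r) i)) (e₂ (la t) T k k′)))
          (pos* s q)))
    where
    e₁ : ∀ x y w → (x + y) * - (x + w) ≡ - ((x + y) * (x + w))
    e₁ = solve 3 (λ x y w → (x :+ y) :* :- (x :+ w) := :- ((x :+ y) :* (x :+ w))) refl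
    e₂ : ∀ x T k k′ → - (+ 2 * (x * x - T * T + (k′ - k))) ≡ + 2 * (T * T + k - (x * x + k′))
    e₂ = solve 4 (λ x T k k′ → :- (# 2 :* (x :* x :- T :* T :+ (k′ :- k))) := # 2 :* (T :* T :+ k :- (x :* x :+ k′))) refl

  regular-rot : ∀ t → Regular t → Regular (rot t)
  regular-rot t (e , o) = trans (sym e) (+-comm (a t) (c t)) , o

  regular-negate : ∀ t → Regular t → Regular (negate t)
  regular-negate t (e , o) = trans (sym (neg-distrib-+ (a t) (c t))) (trans (cong -_ e) (neg-distrib-+ (b t) (d t)))
                           , mkOdd (trans (sg-neg (T t)) (Odd.sg-1 o))

  regular-cross : ∀ t → Regular t → Regular (cross t)
  regular-cross (tile T a b c d) (e , o) = lem T a b d , label-odd a o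
    where
    lem : ∀ T a b d → - a + (b - d - T - a) ≡ b + (- T - + 2 * a - d)
    lem = solve 4 (λ T a b d → :- a :+ (b :- d :- T :- a) := b :+ (:- T :- # 2 :* a :- d)) refl

  invariant-rot : ∀ {k k′} t → Invariant k k′ t → Invariant k k′ (rot t)
  invariant-rot t (mkInv i) = mkInv (trans (lem (la t) (lb t) (lc t) (ld t) (T t)) i)
    where
    lem : ∀ x y z w T → y * w + z * x + + 2 * (T * T) ≡ x * z + y * w + + 2 * (T * T)
    lem = solve 5 (λ x y z w T → y :* w :+ z :* x :+ # 2 :* (T :* T) := x :* z :+ y :* w :+ # 2 :* (T :* T)) refl

  invariant-negate : ∀ {k k′} t → Invariant k k′ t → Invariant k k′ (negate t)
  invariant-negate (tile T a b c d) (mkInv i) = mkInv (trans (lem T a b c d) i)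
    where
    lem : ∀ T a b c d → (- T + + 4 * - a) * (- T + + 4 * - c) + (- T + + 4 * - b) * (- T + + 4 * - d) + + 2 * (- T * - T)
        ≡ (T + + 4 * a) * (T + + 4 * c) + (T + + 4 * b) * (T + + 4 * d) + + 2 * (T * T)
    lem = solve 5 (λ T a b c d → (:- T :+ # 4 :* :- a) :* (:- T :+ # 4 :* :- c) :+ (:- T :+ # 4 :* :- b) :* (:- T :+ # 4 :* :- d) :+ # 2 :* (:- T :* :- T) := (T :+ # 4 :* a) :* (T :+ # 4 :* c) :+ (T :+ # 4 :* b) :* (T :+ # 4 :* d) :+ # 2 :* (T :* T)) refl

  invariant-cross : ∀ {k k′} t → Regular t → Invariant k k′ t → Invariant k′ k (cross t)
  invariant-cross {k} {k′} (tile T a b c d) (e , _) (mkInv i) = mkInv (trans (lem T a b d)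
    (trans (cong -_ (trans (cong (λ s → (T + + 4 * a) * (T + + 4 * s) + (T + + 4 * b) * (T + + 4 * d) + + 2 * (T * T)) c≡) i)) (lem₂ k k′)))
    where
    lem : ∀ T a b d → (T + + 4 * a + + 4 * - a) * (T + + 4 * a + + 4 * (b - d - T - a)) + (T + + 4 * a + + 4 * b) * (T + + 4 * a + + 4 * (- T - + 2 * a - d)) + + 2 * ((T + + 4 * a) * (T + + 4 * a))
        ≡ - ((T + + 4 * a) * (T + + 4 * (b + d - a)) + (T + + 4 * b) * (T + + 4 * d) + + 2 * (T * T))
    lem = solve 4 (λ T a b d → (T :+ # 4 :* a :+ # 4 :* :- a) :* (T :+ # 4 :* a :+ # 4 :* (b :- d :- T :- a)) :+ (T :+ # 4 :* a :+ # 4 :* b) :* (T :+ # 4 :* a :+ # 4 :* (:- T :- # 2 :* a :- d)) :+ # 2 :* ((T :+ # 4 :* a) :* (T :+ # 4 :* a)) := :- ((T :+ # 4 :* a) :* (T :+ # 4 :* (b :+ d :- a)) :+ (T :+ # 4 :* b) :* (T :+ # 4 :* d) :+ # 2 :* (T :* T))) refl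
    lem₂ : ∀ k k′ → - (+ 2 * (k′ - k)) ≡ + 2 * (k - k′)
    lem₂ = solve 2 (λ k k′ → :- (# 2 :* (k′ :- k)) := # 2 :* (k :- k′)) refl
    lem₃ : ∀ a c → a + c - a ≡ c
    lem₃ = solve-∀
    c≡ : b + d - a ≡ c
    c≡ = trans (cong (_- a) (sym e)) (lem₃ a c)

  central-unrot : ∀ t → Central t → Central (unrot t)
  central-unrot t (inj₁ (p , q , r , s)) = inj₁ (s , p , q , r)
  central-unrot t (inj₂ (p , q , r , s)) = inj₂ (s , p , q , r)

  Result : (Tile → Set) → Set
  Result P = ∃ λ t → P t × Regular t × Central t

  result-unrot : ∀ {P : Tile → Set} → Result (P ∘ unrot) → Result P
  result-unrot (t , p , r , c) = unrot t , p , regular-rot (rot (rot t)) (regular-rot (rot t) (regular-rot t r)) , central-unrot t c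

  -- The potential max (2 (l² + k′)) (2 (T² + k) + 1), where l is the label of the side just crossed, drops at every crossing.
  flow : ∀ (F : ℕ) {k k′ P} → Closed P → ∀ t → Regular t → 0ℤ < T t → Inward t → Invariant k k′ t → 0ℤ ≤ k → 0ℤ ≤ k′ →
    0ℤ ≤ + F - + 2 * (la t * la t + k′) → 0ℤ ≤ + F - (+ 2 * (T t * T t + k) + 1ℤ) → P t → Result P

  -- The old `T` becomes, up to sign, the label of the entered side. If the new `T` is negative, the
  -- tile is negated: `T` stays positive, and the entered side is inward.
  step : ∀ (F : ℕ) {k k′ P} → Closed P → ∀ t → Regular t → 0ℤ < T t → Outward t → Invariant k k′ t → 0ℤ ≤ k → 0ℤ ≤ k′ →
    0ℤ ≤ + F - + 2 * (T t * T t + k) → 0ℤ ≤ + F - (+ 2 * (la t * la t + k′) + 1ℤ) → P t → Result P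
  step F {k} {k′} C t@(tile T a b c d) r T>0 (inj₁ (p , q)) i k≥0 k′≥0 bd₁ bd₂ h =
    flow F C (negate (cross t)) (regular-negate (cross t) (regular-cross t r)) p
      (inj₁ (subst (0ℤ <_) (sym (e₁ T a)) T>0 , subst (0ℤ <_) (sym (e₂ T a b)) q))
      (invariant-negate (cross t) (invariant-cross t r i)) k′≥0 k≥0
      (subst (λ s → 0ℤ ≤ + F - + 2 * (s + k)) (sym (e₃ T a)) bd₁)
      (subst (λ s → 0ℤ ≤ + F - (+ 2 * (s + k′) + 1ℤ)) (sym (e₄ T a)) bd₂) (neg C (cross₀ C h))
    where
    e₁ : ∀ T a → - (- (T + + 4 * a) + + 4 * - - a) ≡ T
    e₁ = solve 2 (λ T a → :- (:- (T :+ # 4 :* a) :+ # 4 :* :- :- a) := T) refl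
    e₂ : ∀ T a b → - (- (T + + 4 * a) + + 4 * - - a + (- (T + + 4 * a) + + 4 * - b)) ≡ T + + 4 * a + (T + + 4 * b)
    e₂ = solve 3 (λ T a b → :- (:- (T :+ # 4 :* a) :+ # 4 :* :- :- a :+ (:- (T :+ # 4 :* a) :+ # 4 :* :- b)) := T :+ # 4 :* a :+ (T :+ # 4 :* b)) refl
    e₃ : ∀ T a → (- (T + + 4 * a) + + 4 * - - a) * (- (T + + 4 * a) + + 4 * - - a) ≡ T * T
    e₃ = solve 2 (λ T a → (:- (T :+ # 4 :* a) :+ # 4 :* :- :- a) :* (:- (T :+ # 4 :* a) :+ # 4 :* :- :- a) := T :* T) refl
    e₄ : ∀ T a → - (T + + 4 * a) * - (T + + 4 * a) ≡ (T + + 4 * a) * (T + + 4 * a)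
    e₄ = solve 2 (λ T a → :- (T :+ # 4 :* a) :* :- (T :+ # 4 :* a) := (T :+ # 4 :* a) :* (T :+ # 4 :* a)) refl
  step F {k} {k′} C t@(tile T a b c d) r T>0 (inj₂ (p , q)) i k≥0 k′≥0 bd₁ bd₂ h =
    flow F C (cross t) (regular-cross t r) p
      (inj₂ (subst (0ℤ <_) (sym (e₁ T a)) T>0 , subst (0ℤ <_) (sym (e₂ T a d)) q))
      (invariant-cross t r i) k′≥0 k≥0
      (subst (λ s → 0ℤ ≤ + F - + 2 * (s + k)) (sym (cong₂ _*_ (e₁ T a) (e₁ T a))) bd₁) bd₂ (cross₀ C h)
    where
    e₁ : ∀ T a → T + + 4 * a + + 4 * - a ≡ T
    e₁ = solve 2 (λ T a → T :+ # 4 :* a :+ # 4 :* :- a := T) refl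
    e₂ : ∀ T a d → T + + 4 * a + + 4 * - a + (T + + 4 * a + + 4 * (- T - + 2 * a - d)) ≡ - (T + + 4 * a + (T + + 4 * d))
    e₂ = solve 3 (λ T a d → T :+ # 4 :* a :+ # 4 :* :- a :+ (T :+ # 4 :* a :+ # 4 :* (:- T :- # 2 :* a :- d)) := :- (T :+ # 4 :* a :+ (T :+ # 4 :* d))) refl

  flow zero {k} C t r T>0 _ i k≥0 k′≥0 _ bd _ = ⊥-elim (absurd {n = 0} (bd ⊕ nat≥0 2 ⊗ (sq≥0 (T t) ⊕ k≥0)) (lem (T t * T t + k)))
    where
    lem : ∀ x → 0ℤ - (+ 2 * x + 1ℤ) + + 2 * x ≡ -[1+ 0 ]
    lem = solve 1 (λ x → # 0 :- (# 2 :* x :+ # 1) :+ # 2 :* x := con -[1+ 0 ]) refl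
  flow (suc F) {k} {k′} {P} C t@(tile T a b c d) r@(_ , o) T>0 inw i k≥0 k′≥0 bd₁ bd₂ h = go (outward t o)
    where
    r₁ = regular-rot t r
    r₂ = regular-rot (rot t) r₁
    r₃ = regular-rot (rot (rot t)) r₂
    i₁ = invariant-rot t i
    i₂ = invariant-rot (rot t) i₁
    i₃ = invariant-rot (rot (rot t)) i₂
    bd₃ : 0ℤ ≤ + F - + 2 * (T * T + k)
    bd₃ = by bd₂ (lem (+ F) (T * T + k))
      where
      lem : ∀ F x → F - + 2 * x ≡ 1ℤ + F - (+ 2 * x + 1ℤ)
      lem = solve 2 (λ F x → F :- # 2 :* x := # 1 :+ F :- (# 2 :* x :+ # 1)) refl
    -- The next label is smaller than the label just crossed, or its potential lies below `T² + k`;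
    -- either way one unit of fuel can be spent.
    bd₄ : ∀ l → 0ℤ < la t * la t - l * l ⊎ 0ℤ < T * T + k - (l * l + k′) → 0ℤ ≤ + F - (+ 2 * (l * l + k′) + 1ℤ)
    bd₄ l (inj₁ p) = by (bd₁ ⊕ nat≥0 2 ⊗ pred≥0 p) (lem (+ F) (l * l) (la t * la t) k′)
      where
      lem : ∀ F x y k′ → F - (+ 2 * (x + k′) + 1ℤ) ≡ 1ℤ + F - + 2 * (y + k′) + + 2 * (y - x - 1ℤ)
      lem = solve 4 (λ F x y k′ → F :- (# 2 :* (x :+ k′) :+ # 1) := # 1 :+ F :- # 2 :* (y :+ k′) :+ # 2 :* (y :- x :- # 1)) refl
    bd₄ l (inj₂ p) = by (bd₂ ⊕ nat≥0 2 ⊗ pred≥0 p ⊕ nat≥0 1) (lem (+ F) (l * l) (T * T) k k′)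
      where
      lem : ∀ F x y k k′ → F - (+ 2 * (x + k′) + 1ℤ) ≡ 1ℤ + F - (+ 2 * (y + k) + 1ℤ) + + 2 * (y + k - (x + k′) - 1ℤ) + 1ℤ
      lem = solve 5 (λ F x y k k′ → F :- (# 2 :* (x :+ k′) :+ # 1) := # 1 :+ F :- (# 2 :* (y :+ k) :+ # 1) :+ # 2 :* (y :+ k :- (x :+ k′) :- # 1) :+ # 1) refl
    go : Central t ⊎ Outward t ⊎ Outward (rot t) ⊎ Outward (rot (rot t)) ⊎ Outward (unrot t) → Result P
    go (inj₁ z) = t , h , r , z
    -- The first side is the one just crossed, so it cannot be the way on.
    go (inj₂ (inj₁ z)) = ⊥-elim (inward-not-outward t inw z)
    go (inj₂ (inj₂ (inj₁ z))) = result-unrot (step F (closed-unrot C) (rot t) r₁ T>0 z i₁ k≥0 k′≥0 bd₃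
      (bd₄ (lb t) (map₁ (proj₂ ∘ proj₂) (outward-small (rot t) r₁ i₁ z))) h)
    go (inj₂ (inj₂ (inj₂ (inj₁ z)))) = result-unrot (result-unrot (step F (closed-unrot (closed-unrot C)) (rot (rot t)) r₂ T>0 z i₂ k≥0 k′≥0 bd₃
      (bd₄ (lc t) (map₁ (proj₁ ∘ proj₂) (outward-small (rot (rot t)) r₂ i₂ z))) h))
    go (inj₂ (inj₂ (inj₂ (inj₂ z)))) = result-unrot (result-unrot (result-unrot (step F (closed-unrot (closed-unrot (closed-unrot C))) (unrot t) r₃ T>0 z i₃ k≥0 k′≥0 bd₃
      (bd₄ (ld t) (map₁ proj₁ (outward-small (unrot t) r₃ i₃ z))) h)))

  -- At the start no side has been entered, so the fuel is chosen to dominate the potentials on both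
  -- sides of the first crossing.
  reduce⁺ : ∀ {k k′ P} → Closed P → ∀ t → Regular t → 0ℤ < T t → Invariant k k′ t → 0ℤ ≤ k → 0ℤ ≤ k′ → P t → Result P
  reduce⁺ {k} {k′} {P} C t r T>0 i k≥0 k′≥0 h = go (outward t (proj₂ r))
    where
    first : ∀ {P} → Closed P → ∀ t → Regular t → 0ℤ < T t → Outward t → Invariant k k′ t → P t → Result P
    first C t r T>0 z i h = step ∣ x ∣ C t r T>0 z i k≥0 k′≥0
      (by (+∣ x ∣≥ ⊕ (nat≥0 2 ⊗ (sq≥0 (la t) ⊕ k′≥0) ⊕ nat≥0 1)) (e₁ (+ ∣ x ∣) u v))
      (by (+∣ x ∣≥ ⊕ nat≥0 2 ⊗ (sq≥0 (T t) ⊕ k≥0)) (e₂ (+ ∣ x ∣) u v)) h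
      where
      u v x : ℤ
      u = T t * T t + k
      v = la t * la t + k′
      x = + 2 * u + (+ 2 * v + 1ℤ)
      e₁ : ∀ F u v → F - + 2 * u ≡ F - (+ 2 * u + (+ 2 * v + 1ℤ)) + (+ 2 * v + 1ℤ)
      e₁ = solve 3 (λ F u v → F :- # 2 :* u := F :- (# 2 :* u :+ (# 2 :* v :+ # 1)) :+ (# 2 :* v :+ # 1)) refl
      e₂ : ∀ F u v → F - (+ 2 * v + 1ℤ) ≡ F - (+ 2 * u + (+ 2 * v + 1ℤ)) + + 2 * u
      e₂ = solve 3 (λ F u v → F :- (# 2 :* v :+ # 1) := F :- (# 2 :* u :+ (# 2 :* v :+ # 1)) :+ # 2 :* u) refl
    r₁ = regular-rot t r
    r₂ = regular-rot (rot t) r₁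
    r₃ = regular-rot (rot (rot t)) r₂
    i₁ = invariant-rot t i
    i₂ = invariant-rot (rot t) i₁
    i₃ = invariant-rot (rot (rot t)) i₂
    go : Central t ⊎ Outward t ⊎ Outward (rot t) ⊎ Outward (rot (rot t)) ⊎ Outward (unrot t) → Result P
    go (inj₁ z) = t , h , r , z
    go (inj₂ (inj₁ z)) = first C t r T>0 z i h
    go (inj₂ (inj₂ (inj₁ z))) = result-unrot (first (closed-unrot C) (rot t) r₁ T>0 z i₁ h)
    go (inj₂ (inj₂ (inj₂ (inj₁ z)))) = result-unrot (result-unrot (first (closed-unrot (closed-unrot C)) (rot (rot t)) r₂ T>0 z i₂ h))
    go (inj₂ (inj₂ (inj₂ (inj₂ z)))) = result-unrot (result-unrot (result-unrot (first (closed-unrot (closed-unrot (closed-unrot C))) (unrot t) r₃ T>0 z i₃ h)))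

  reduce : ∀ {k k′ P} → Closed P → ∀ t → Regular t → Invariant k k′ t → 0ℤ ≤ k → 0ℤ ≤ k′ → P t → Result P
  reduce C t r i k≥0 k′≥0 h with odd-sign (proj₂ r)
  ... | inj₂ T>0 = reduce⁺ C t r T>0 i k≥0 k′≥0 h
  ... | inj₁ T<0 = reduce⁺ C (negate t) (regular-negate t r) T<0 (invariant-negate t i) k≥0 k′≥0 (neg C h)

  -- Tiles as bases of sublattices of ℤ²

  X₁ Y₁ X₂ Y₂ : Tile → ℤ
  X₁ (tile T a b c d) = T + + 2 * a + + 2 * d
  Y₁ (tile T a b c d) = - T + + 2 * a - + 2 * d
  X₂ (tile T a b c d) = T + + 2 * a - + 2 * d
  Y₂ (tile T a b c d) = T + + 2 * b + + 2 * c

  -- The rows of t form a basis of the lattice spanned by (D , J) and (0 , E).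
  record Basis (D J E : ℤ) (t : Tile) : Set where
    field
      c≡          : c t ≡ b t + d t - a t
      α β γ δ     : ℤ
      unit        : α * δ - β * γ ≡ 1ℤ ⊎ α * δ - β * γ ≡ -1ℤ
      x₁          : X₁ t ≡ α * D
      y₁          : Y₁ t ≡ α * J + β * E
      x₂          : X₂ t ≡ γ * D
      y₂          : Y₂ t ≡ γ * J + δ * E

  act : ∀ {D J E t t′} m n m′ n′ → m * n′ - n * m′ ≡ 1ℤ ⊎ m * n′ - n * m′ ≡ -1ℤ → c t′ ≡ b t′ + d t′ - a t′ →
    X₁ t′ ≡ m * X₁ t + n * X₂ t → Y₁ t′ ≡ m * Y₁ t + n * Y₂ t →
    X₂ t′ ≡ m′ * X₁ t + n′ * X₂ t → Y₂ t′ ≡ m′ * Y₁ t + n′ * Y₂ t →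
    Basis D J E t → Basis D J E t′
  act {D} {J} {E} m n m′ n′ u c≡′ e₁ e₂ e₃ e₄ B = record
    { c≡ = c≡′
    ; α = m * α + n * γ ; β = m * β + n * δ ; γ = m′ * α + n′ * γ ; δ = m′ * β + n′ * δ
    ; unit = units u unit
    ; x₁ = trans e₁ (trans (cong₂ (λ x y → m * x + n * y) x₁ x₂) (l₁ m n α γ D))
    ; y₁ = trans e₂ (trans (cong₂ (λ x y → m * x + n * y) y₁ y₂) (l₂ m n α β γ δ J E))
    ; x₂ = trans e₃ (trans (cong₂ (λ x y → m′ * x + n′ * y) x₁ x₂) (l₁ m′ n′ α γ D))
    ; y₂ = trans e₄ (trans (cong₂ (λ x y → m′ * x + n′ * y) y₁ y₂) (l₂ m′ n′ α β γ δ J E))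
    }
    where
    open Basis B
    l₁ : ∀ m n α γ D → m * (α * D) + n * (γ * D) ≡ (m * α + n * γ) * D
    l₁ = solve 5 (λ m n α γ D → m :* (α :* D) :+ n :* (γ :* D) := (m :* α :+ n :* γ) :* D) refl
    l₂ : ∀ m n α β γ δ J E → m * (α * J + β * E) + n * (γ * J + δ * E) ≡ (m * α + n * γ) * J + (m * β + n * δ) * E
    l₂ = solve 8 (λ m n α β γ δ J E → m :* (α :* J :+ β :* E) :+ n :* (γ :* J :+ δ :* E) := (m :* α :+ n :* γ) :* J :+ (m :* β :+ n :* δ) :* E) refl
    det : ∀ m n m′ n′ α β γ δ → (m * α + n * γ) * (m′ * β + n′ * δ) - (m * β + n * δ) * (m′ * α + n′ * γ) ≡ (m * n′ - n * m′) * (α * δ - β * γ)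
    det = solve 8 (λ m n m′ n′ α β γ δ → (m :* α :+ n :* γ) :* (m′ :* β :+ n′ :* δ) :- (m :* β :+ n :* δ) :* (m′ :* α :+ n′ :* γ) := (m :* n′ :- n :* m′) :* (α :* δ :- β :* γ)) refl
    d′ = det m n m′ n′ α β γ δ
    units : _ → _ → _
    units (inj₁ p) (inj₁ q) = inj₁ (trans d′ (cong₂ _*_ p q))
    units (inj₁ p) (inj₂ q) = inj₂ (trans d′ (cong₂ _*_ p q))
    units (inj₂ p) (inj₁ q) = inj₂ (trans d′ (cong₂ _*_ p q))
    units (inj₂ p) (inj₂ q) = inj₁ (trans d′ (cong₂ _*_ p q))

  -- The four crossings multiply the rows by the reflections (-1 0; 2 1), (-1 -2; 0 1), (1 -2; 0 -1)
  -- and (1 0; 2 -1), which do not change the lattice.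
  basis-closed : ∀ {D J E} → Closed (Basis D J E)
  basis-closed = record
    { neg    = λ {t} B → negate-basis t B
    ; cross₀ = λ {t} B → cross₀-basis t B
    ; cross₁ = λ {t} B → cross₁-basis t B
    ; cross₂ = λ {t} B → cross₂-basis t B
    ; cross₃ = λ {t} B → cross₃-basis t B
    }
    where
    negate-basis : ∀ {D J E} t → Basis D J E t → Basis D J E (negate t)
    negate-basis (tile T a b c d) B with Basis.c≡ B
    ... | refl = act -1ℤ 0ℤ 0ℤ -1ℤ (inj₁ refl) (e₀ a b d) (e₁ T a d) (e₂ T a b d) (e₃ T a d) (e₄ T a b d) B
      where
      e₀ : ∀ a b d → - (b + d - a) ≡ - b + - d - - a
      e₀ = solve 3 (λ a b d → :- (b :+ d :- a) := :- b :+ :- d :- :- a) refl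
      e₁ : ∀ T a d → - T + + 2 * - a + + 2 * - d ≡ -1ℤ * (T + + 2 * a + + 2 * d) + 0ℤ * (T + + 2 * a - + 2 * d)
      e₁ = solve 3 (λ T a d → :- T :+ # 2 :* :- a :+ # 2 :* :- d := con -1ℤ :* (T :+ # 2 :* a :+ # 2 :* d) :+ # 0 :* (T :+ # 2 :* a :- # 2 :* d)) refl
      e₂ : ∀ T a b d → - - T + + 2 * - a - + 2 * - d ≡ -1ℤ * (- T + + 2 * a - + 2 * d) + 0ℤ * (T + + 2 * b + + 2 * (b + d - a))
      e₂ = solve 4 (λ T a b d → :- :- T :+ # 2 :* :- a :- # 2 :* :- d := con -1ℤ :* (:- T :+ # 2 :* a :- # 2 :* d) :+ # 0 :* (T :+ # 2 :* b :+ # 2 :* (b :+ d :- a))) refl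
      e₃ : ∀ T a d → - T + + 2 * - a - + 2 * - d ≡ 0ℤ * (T + + 2 * a + + 2 * d) + -1ℤ * (T + + 2 * a - + 2 * d)
      e₃ = solve 3 (λ T a d → :- T :+ # 2 :* :- a :- # 2 :* :- d := # 0 :* (T :+ # 2 :* a :+ # 2 :* d) :+ con -1ℤ :* (T :+ # 2 :* a :- # 2 :* d)) refl
      e₄ : ∀ T a b d → - T + + 2 * - b + + 2 * - (b + d - a) ≡ 0ℤ * (- T + + 2 * a - + 2 * d) + -1ℤ * (T + + 2 * b + + 2 * (b + d - a))
      e₄ = solve 4 (λ T a b d → :- T :+ # 2 :* :- b :+ # 2 :* :- (b :+ d :- a) := # 0 :* (:- T :+ # 2 :* a :- # 2 :* d) :+ con -1ℤ :* (T :+ # 2 :* b :+ # 2 :* (b :+ d :- a))) refl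
    cross₀-basis : ∀ {D J E} t → Basis D J E t → Basis D J E (cross t)
    cross₀-basis (tile T a b c d) B with Basis.c≡ B
    ... | refl = act -1ℤ 0ℤ (+ 2) 1ℤ (inj₂ refl) (e₀ T a b d) (e₁ T a d) (e₂ T a b d) (e₃ T a d) (e₄ T a b d) B
      where
      e₀ : ∀ T a b d → b - d - T - a ≡ b + (- T - + 2 * a - d) - - a
      e₀ = solve 4 (λ T a b d → b :- d :- T :- a := b :+ (:- T :- # 2 :* a :- d) :- :- a) refl
      e₁ : ∀ T a d → T + + 4 * a + + 2 * - a + + 2 * (- T - + 2 * a - d) ≡ -1ℤ * (T + + 2 * a + + 2 * d) + 0ℤ * (T + + 2 * a - + 2 * d)
      e₁ = solve 3 (λ T a d → T :+ # 4 :* a :+ # 2 :* :- a :+ # 2 :* (:- T :- # 2 :* a :- d) := con -1ℤ :* (T :+ # 2 :* a :+ # 2 :* d) :+ # 0 :* (T :+ # 2 :* a :- # 2 :* d)) refl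
      e₂ : ∀ T a b d → - (T + + 4 * a) + + 2 * - a - + 2 * (- T - + 2 * a - d) ≡ -1ℤ * (- T + + 2 * a - + 2 * d) + 0ℤ * (T + + 2 * b + + 2 * (b + d - a))
      e₂ = solve 4 (λ T a b d → :- (T :+ # 4 :* a) :+ # 2 :* :- a :- # 2 :* (:- T :- # 2 :* a :- d) := con -1ℤ :* (:- T :+ # 2 :* a :- # 2 :* d) :+ # 0 :* (T :+ # 2 :* b :+ # 2 :* (b :+ d :- a))) refl
      e₃ : ∀ T a d → T + + 4 * a + + 2 * - a - + 2 * (- T - + 2 * a - d) ≡ + 2 * (T + + 2 * a + + 2 * d) + 1ℤ * (T + + 2 * a - + 2 * d)
      e₃ = solve 3 (λ T a d → T :+ # 4 :* a :+ # 2 :* :- a :- # 2 :* (:- T :- # 2 :* a :- d) := # 2 :* (T :+ # 2 :* a :+ # 2 :* d) :+ # 1 :* (T :+ # 2 :* a :- # 2 :* d)) refl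
      e₄ : ∀ T a b d → T + + 4 * a + + 2 * b + + 2 * (b - d - T - a) ≡ + 2 * (- T + + 2 * a - + 2 * d) + 1ℤ * (T + + 2 * b + + 2 * (b + d - a))
      e₄ = solve 4 (λ T a b d → T :+ # 4 :* a :+ # 2 :* b :+ # 2 :* (b :- d :- T :- a) := # 2 :* (:- T :+ # 2 :* a :- # 2 :* d) :+ # 1 :* (T :+ # 2 :* b :+ # 2 :* (b :+ d :- a))) refl
    cross₁-basis : ∀ {D J E} t → Basis D J E t → Basis D J E (unrot (cross (rot t)))
    cross₁-basis (tile T a b c d) B with Basis.c≡ B
    ... | refl = act -1ℤ (- + 2) 0ℤ 1ℤ (inj₂ refl) (e₀ T a b d) (e₁ T a b d) (e₂ T a b d) (e₃ T a b d) (e₄ T a b d) B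
      where
      e₀ : ∀ T a b d → b + d - a ≡ - b + (b + d - a - a - T - b) - (- T - + 2 * b - a)
      e₀ = solve 4 (λ T a b d → b :+ d :- a := :- b :+ (b :+ d :- a :- a :- T :- b) :- (:- T :- # 2 :* b :- a)) refl
      e₁ : ∀ T a b d → T + + 4 * b + + 2 * (- T - + 2 * b - a) + + 2 * (b + d - a - a - T - b) ≡ -1ℤ * (T + + 2 * a + + 2 * d) + - + 2 * (T + + 2 * a - + 2 * d)
      e₁ = solve 4 (λ T a b d → T :+ # 4 :* b :+ # 2 :* (:- T :- # 2 :* b :- a) :+ # 2 :* (b :+ d :- a :- a :- T :- b) := con -1ℤ :* (T :+ # 2 :* a :+ # 2 :* d) :+ :- # 2 :* (T :+ # 2 :* a :- # 2 :* d)) refl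
      e₂ : ∀ T a b d → - (T + + 4 * b) + + 2 * (- T - + 2 * b - a) - + 2 * (b + d - a - a - T - b) ≡ -1ℤ * (- T + + 2 * a - + 2 * d) + - + 2 * (T + + 2 * b + + 2 * (b + d - a))
      e₂ = solve 4 (λ T a b d → :- (T :+ # 4 :* b) :+ # 2 :* (:- T :- # 2 :* b :- a) :- # 2 :* (b :+ d :- a :- a :- T :- b) := con -1ℤ :* (:- T :+ # 2 :* a :- # 2 :* d) :+ :- # 2 :* (T :+ # 2 :* b :+ # 2 :* (b :+ d :- a))) refl
      e₃ : ∀ T a b d → T + + 4 * b + + 2 * (- T - + 2 * b - a) - + 2 * (b + d - a - a - T - b) ≡ 0ℤ * (T + + 2 * a + + 2 * d) + 1ℤ * (T + + 2 * a - + 2 * d)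
      e₃ = solve 4 (λ T a b d → T :+ # 4 :* b :+ # 2 :* (:- T :- # 2 :* b :- a) :- # 2 :* (b :+ d :- a :- a :- T :- b) := # 0 :* (T :+ # 2 :* a :+ # 2 :* d) :+ # 1 :* (T :+ # 2 :* a :- # 2 :* d)) refl
      e₄ : ∀ T a b d → T + + 4 * b + + 2 * - b + + 2 * (b + d - a) ≡ 0ℤ * (- T + + 2 * a - + 2 * d) + 1ℤ * (T + + 2 * b + + 2 * (b + d - a))
      e₄ = solve 4 (λ T a b d → T :+ # 4 :* b :+ # 2 :* :- b :+ # 2 :* (b :+ d :- a) := # 0 :* (:- T :+ # 2 :* a :- # 2 :* d) :+ # 1 :* (T :+ # 2 :* b :+ # 2 :* (b :+ d :- a))) refl
    cross₂-basis : ∀ {D J E} t → Basis D J E t → Basis D J E (rot (rot (cross (rot (rot t)))))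
    cross₂-basis (tile T a b c d) B with Basis.c≡ B
    ... | refl = act 1ℤ (- + 2) 0ℤ -1ℤ (inj₂ refl) (e₀ T a b d) (e₁ T a b d) (e₂ T a b d) (e₃ T a b d) (e₄ T a b d) B
      where
      e₀ : ∀ T a b d → - (b + d - a) ≡ - T - + 2 * (b + d - a) - b + d - (d - b - T - (b + d - a))
      e₀ = solve 4 (λ T a b d → :- (b :+ d :- a) := :- T :- # 2 :* (b :+ d :- a) :- b :+ d :- (d :- b :- T :- (b :+ d :- a))) refl
      e₁ : ∀ T a b d → T + + 4 * (b + d - a) + + 2 * (d - b - T - (b + d - a)) + + 2 * d ≡ 1ℤ * (T + + 2 * a + + 2 * d) + - + 2 * (T + + 2 * a - + 2 * d)
      e₁ = solve 4 (λ T a b d → T :+ # 4 :* (b :+ d :- a) :+ # 2 :* (d :- b :- T :- (b :+ d :- a)) :+ # 2 :* d := # 1 :* (T :+ # 2 :* a :+ # 2 :* d) :+ :- # 2 :* (T :+ # 2 :* a :- # 2 :* d)) refl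
      e₂ : ∀ T a b d → - (T + + 4 * (b + d - a)) + + 2 * (d - b - T - (b + d - a)) - + 2 * d ≡ 1ℤ * (- T + + 2 * a - + 2 * d) + - + 2 * (T + + 2 * b + + 2 * (b + d - a))
      e₂ = solve 4 (λ T a b d → :- (T :+ # 4 :* (b :+ d :- a)) :+ # 2 :* (d :- b :- T :- (b :+ d :- a)) :- # 2 :* d := # 1 :* (:- T :+ # 2 :* a :- # 2 :* d) :+ :- # 2 :* (T :+ # 2 :* b :+ # 2 :* (b :+ d :- a))) refl
      e₃ : ∀ T a b d → T + + 4 * (b + d - a) + + 2 * (d - b - T - (b + d - a)) - + 2 * d ≡ 0ℤ * (T + + 2 * a + + 2 * d) + -1ℤ * (T + + 2 * a - + 2 * d)
      e₃ = solve 4 (λ T a b d → T :+ # 4 :* (b :+ d :- a) :+ # 2 :* (d :- b :- T :- (b :+ d :- a)) :- # 2 :* d := # 0 :* (T :+ # 2 :* a :+ # 2 :* d) :+ con -1ℤ :* (T :+ # 2 :* a :- # 2 :* d)) refl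
      e₄ : ∀ T a b d → T + + 4 * (b + d - a) + + 2 * (- T - + 2 * (b + d - a) - b) + + 2 * - (b + d - a) ≡ 0ℤ * (- T + + 2 * a - + 2 * d) + -1ℤ * (T + + 2 * b + + 2 * (b + d - a))
      e₄ = solve 4 (λ T a b d → T :+ # 4 :* (b :+ d :- a) :+ # 2 :* (:- T :- # 2 :* (b :+ d :- a) :- b) :+ # 2 :* :- (b :+ d :- a) := # 0 :* (:- T :+ # 2 :* a :- # 2 :* d) :+ con -1ℤ :* (T :+ # 2 :* b :+ # 2 :* (b :+ d :- a))) refl
    cross₃-basis : ∀ {D J E} t → Basis D J E t → Basis D J E (rot (cross (unrot t)))
    cross₃-basis (tile T a b c d) B with Basis.c≡ B
    ... | refl = act 1ℤ 0ℤ (+ 2) -1ℤ (inj₂ refl) (e₀ T a b d) (e₁ T a b d) (e₂ T a b d) (e₃ T a b d) (e₄ T a b d) B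
      where
      e₀ : ∀ T a b d → - T - + 2 * d - (b + d - a) ≡ a - (b + d - a) - T - d + - d - a
      e₀ = solve 4 (λ T a b d → :- T :- # 2 :* d :- (b :+ d :- a) := a :- (b :+ d :- a) :- T :- d :+ :- d :- a) refl
      e₁ : ∀ T a b d → T + + 4 * d + + 2 * a + + 2 * - d ≡ 1ℤ * (T + + 2 * a + + 2 * d) + 0ℤ * (T + + 2 * a - + 2 * d)
      e₁ = solve 4 (λ T a b d → T :+ # 4 :* d :+ # 2 :* a :+ # 2 :* :- d := # 1 :* (T :+ # 2 :* a :+ # 2 :* d) :+ # 0 :* (T :+ # 2 :* a :- # 2 :* d)) refl
      e₂ : ∀ T a b d → - (T + + 4 * d) + + 2 * a - + 2 * - d ≡ 1ℤ * (- T + + 2 * a - + 2 * d) + 0ℤ * (T + + 2 * b + + 2 * (b + d - a))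
      e₂ = solve 4 (λ T a b d → :- (T :+ # 4 :* d) :+ # 2 :* a :- # 2 :* :- d := # 1 :* (:- T :+ # 2 :* a :- # 2 :* d) :+ # 0 :* (T :+ # 2 :* b :+ # 2 :* (b :+ d :- a))) refl
      e₃ : ∀ T a b d → T + + 4 * d + + 2 * a - + 2 * - d ≡ + 2 * (T + + 2 * a + + 2 * d) + -1ℤ * (T + + 2 * a - + 2 * d)
      e₃ = solve 4 (λ T a b d → T :+ # 4 :* d :+ # 2 :* a :- # 2 :* :- d := # 2 :* (T :+ # 2 :* a :+ # 2 :* d) :+ con -1ℤ :* (T :+ # 2 :* a :- # 2 :* d)) refl
      e₄ : ∀ T a b d → T + + 4 * d + + 2 * (a - (b + d - a) - T - d) + + 2 * (- T - + 2 * d - (b + d - a)) ≡ + 2 * (- T + + 2 * a - + 2 * d) + -1ℤ * (T + + 2 * b + + 2 * (b + d - a))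
      e₄ = solve 4 (λ T a b d → T :+ # 4 :* d :+ # 2 :* (a :- (b :+ d :- a) :- T :- d) :+ # 2 :* (:- T :- # 2 :* d :- (b :+ d :- a)) := # 2 :* (:- T :+ # 2 :* a :- # 2 :* d) :+ con -1ℤ :* (T :+ # 2 :* b :+ # 2 :* (b :+ d :- a))) refl

  sq-1≥0 : ∀ {x} → x ≢ 0ℤ → 0ℤ ≤ x * x - 1ℤ
  sq-1≥0 {x} ne with sign x
  ... | isPos p  = pred≥0 (pos* p p)
  ... | isZero e = ⊥-elim (ne e)
  ... | isNeg p  = subst (λ s → 0ℤ ≤ s - 1ℤ) (lem x) (pred≥0 (pos* p p))
    where
    lem : ∀ x → - x * - x ≡ x * x
    lem = solve 1 (λ x → :- x :* :- x := x :* x) refl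

  squares≡0 : ∀ {p q r x y} → 0ℤ < p → 0ℤ < q → 0ℤ ≤ r → p * (x * x) + q * (y * y) + r ≡ 0ℤ → x ≡ 0ℤ × y ≡ 0ℤ
  squares≡0 {p} {q} {r} {x} {y} p>0 q>0 r≥0 e = go p>0 (by (pos→nn q>0 ⊗ sq≥0 y ⊕ r≥0) (trans (sym (+-identityˡ _)) (trans (cong (_+ - (p * (x * x))) (sym e)) (e₁ (p * (x * x)) (q * (y * y)) r))))
                                              , go q>0 (by (pos→nn p>0 ⊗ sq≥0 x ⊕ r≥0) (trans (sym (+-identityˡ _)) (trans (cong (_+ - (q * (y * y))) (sym e)) (e₂ (p * (x * x)) (q * (y * y)) r))))
    where
    e₁ : ∀ u v r → u + v + r + - u ≡ v + r
    e₁ = solve 3 (λ u v r → u :+ v :+ r :+ :- u := v :+ r) refl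
    e₂ : ∀ u v r → u + v + r + - v ≡ u + r
    e₂ = solve 3 (λ u v r → u :+ v :+ r :+ :- v := u :+ r) refl
    lem : ∀ p x → - (p * (x * x)) + ((p - 1ℤ) * (x * x) + (x * x - 1ℤ)) ≡ -[1+ 0 ]
    lem = solve 2 (λ p x → :- (p :* (x :* x)) :+ ((p :- # 1) :* (x :* x) :+ (x :* x :- # 1)) := con -[1+ 0 ]) refl
    go : ∀ {p x} → 0ℤ < p → 0ℤ ≤ - (p * (x * x)) → x ≡ 0ℤ
    go {p} {x} p>0 h with x ≟ 0ℤ
    ... | yes e = e
    ... | no ne = ⊥-elim (absurd {n = 0} (h ⊕ (pred≥0 p>0 ⊗ sq≥0 x ⊕ sq-1≥0 ne)) (lem p x))

  -- The pairing of the form (A, B, C) with the form (A′, B′, C′) transported by the inverse of g = (α β; γ δ)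
  pairing : (A B C A′ B′ C′ α β γ δ : ℤ) → ℤ
  pairing A B C A′ B′ C′ α β γ δ =
    A * (γ * γ * A′ - + 2 * (α * γ * B′) + α * α * C′) + C * (δ * δ * A′ - + 2 * (δ * β * B′) + β * β * C′)
    - + 2 * (B * ((α * δ + β * γ) * B′ - δ * γ * A′ - α * β * C′))

  -- All that the rigidity argument uses of a transition matrix: certain odd combinations of its
  -- entries have square at least 1, and two even ones, being nonzero, have square at least 4.
  record Unimodular (α β γ δ : ℤ) : Set where
    field
      α-1 : 0ℤ ≤ α * α - 1ℤ
      δ-1 : 0ℤ ≤ δ * δ - 1ℤ
      α+γ : 0ℤ ≤ (α + γ) * (α + γ) - 1ℤ
      α-γ : 0ℤ ≤ (α - γ) * (α - γ) - 1ℤ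
      δ+β : 0ℤ ≤ (δ + β) * (δ + β) - 1ℤ
      δ-β : 0ℤ ≤ (δ - β) * (δ - β) - 1ℤ
      δ+γ : 0ℤ ≤ (δ + γ) * (δ + γ) - 1ℤ
      δ-γ : 0ℤ ≤ (δ - γ) * (δ - γ) - 1ℤ
      α+β : 0ℤ ≤ (α + β) * (α + β) - 1ℤ
      α-β : 0ℤ ≤ (α - β) * (α - β) - 1ℤ
      s-4 : 0ℤ ≤ (α + β + γ + δ) * (α + β + γ + δ) - + 4
      r-4 : 0ℤ ≤ (α - β - γ + δ) * (α - β - γ + δ) - + 4

  -- Writing both forms as nonnegative combinations of the squares of x, y and x ± y, the pairing becomes a combination
  -- of squares of determinants, none of which drops when g is replaced by 1.
  rigid⁺ : ∀ A B C A′ B′ C′ α β γ δ → Unimodular α β γ δ → 0ℤ ≤ B → 0ℤ < A - B → 0ℤ < C - B →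
    0ℤ < A′ - B′ → 0ℤ < C′ - B′ → 0ℤ < A′ + B′ → 0ℤ < C′ + B′ →
    pairing A B C A′ B′ C′ α β γ δ ≡ pairing A B C A′ B′ C′ 1ℤ 0ℤ 0ℤ 1ℤ → γ ≡ 0ℤ × β ≡ 0ℤ
  rigid⁺ A B C A′ B′ C′ α β γ δ U B≥0 X>0 Y>0 X′>0 Y′>0 X″>0 Y″>0 e with ≤-total 0ℤ B′
  ... | inj₁ B′≥0 = squares≡0 (pos* X>0 X′>0) (pos* Y>0 Y′>0)
      (pos→nn X>0 ⊗ pos→nn Y′>0 ⊗ α-1 ⊕ pos→nn X>0 ⊗ B′≥0 ⊗ α-γ ⊕ pos→nn Y>0 ⊗ pos→nn X′>0 ⊗ δ-1 ⊕ pos→nn Y>0 ⊗ B′≥0 ⊗ δ-β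
       ⊕ B≥0 ⊗ pos→nn X′>0 ⊗ δ+γ ⊕ B≥0 ⊗ pos→nn Y′>0 ⊗ α+β ⊕ B≥0 ⊗ B′≥0 ⊗ sq≥0 (α + β - γ - δ))
      (trans (sym (expand A B C A′ B′ C′ α β γ δ)) (i≡j⇒i-j≡0 e))
    where
    open Unimodular U
    expand : ∀ A B C A′ B′ C′ α β γ δ →
      (A * (γ * γ * A′ - + 2 * (α * γ * B′) + α * α * C′) + C * (δ * δ * A′ - + 2 * (δ * β * B′) + β * β * C′)
        - + 2 * (B * ((α * δ + β * γ) * B′ - δ * γ * A′ - α * β * C′)))
      - (A * (0ℤ * 0ℤ * A′ - + 2 * (1ℤ * 0ℤ * B′) + 1ℤ * 1ℤ * C′) + C * (1ℤ * 1ℤ * A′ - + 2 * (1ℤ * 0ℤ * B′) + 0ℤ * 0ℤ * C′)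
        - + 2 * (B * ((1ℤ * 1ℤ + 0ℤ * 0ℤ) * B′ - 1ℤ * 0ℤ * A′ - 1ℤ * 0ℤ * C′)))
      ≡ (A - B) * (A′ - B′) * (γ * γ) + (C - B) * (C′ - B′) * (β * β)
      + ((A - B) * (C′ - B′) * (α * α - 1ℤ) + (A - B) * B′ * ((α - γ) * (α - γ) - 1ℤ) + (C - B) * (A′ - B′) * (δ * δ - 1ℤ) + (C - B) * B′ * ((δ - β) * (δ - β) - 1ℤ)
        + B * (A′ - B′) * ((δ + γ) * (δ + γ) - 1ℤ) + B * (C′ - B′) * ((α + β) * (α + β) - 1ℤ) + B * B′ * ((α + β - γ - δ) * (α + β - γ - δ)))
    expand = solve 10 (λ A B C A′ B′ C′ α β γ δ → (A :* (γ :* γ :* A′ :- # 2 :* (α :* γ :* B′) :+ α :* α :* C′) :+ C :* (δ :* δ :* A′ :- # 2 :* (δ :* β :* B′) :+ β :* β :* C′) :- # 2 :* (B :* ((α :* δ :+ β :* γ) :* B′ :- δ :* γ :* A′ :- α :* β :* C′))) :- (A :* (# 0 :* # 0 :* A′ :- # 2 :* (# 1 :* # 0 :* B′) :+ # 1 :* # 1 :* C′) :+ C :* (# 1 :* # 1 :* A′ :- # 2 :* (# 1 :* # 0 :* B′) :+ # 0 :* # 0 :* C′) :- # 2 :* (B :* ((# 1 :* # 1 :+ # 0 :* # 0) :* B′ :- # 1 :* # 0 :* A′ :- # 1 :* # 0 :* C′))) := (A :- B) :* (A′ :- B′) :* (γ :* γ) :+ (C :- B) :* (C′ :- B′) :*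 (β :* β) :+ ((A :- B) :* (C′ :- B′) :* (α :* α :- # 1) :+ (A :- B) :* B′ :* ((α :- γ) :* (α :- γ) :- # 1) :+ (C :- B) :* (A′ :- B′) :* (δ :* δ :- # 1) :+ (C :- B) :* B′ :* ((δ :- β) :* (δ :- β) :- # 1) :+ B :* (A′ :- B′) :* ((δ :+ γ) :* (δ :+ γ) :- # 1) :+ B :* (C′ :- B′) :* ((α :+ β) :* (α :+ β) :- # 1) :+ B :* B′ :* ((α :+ β :- γ :- δ) :* (α :+ β :- γ :- δ)))) refl
  ... | inj₂ B′≤0 = squares≡0 (pos* X>0 X″>0) (pos* Y>0 Y″>0)
      (pos→nn X>0 ⊗ pos→nn Y″>0 ⊗ α-1 ⊕ pos→nn X>0 ⊗ -B′≥0 ⊗ α+γ ⊕ pos→nn Y>0 ⊗ pos→nn X″>0 ⊗ δ-1 ⊕ pos→nn Y>0 ⊗ -B′≥0 ⊗ δ+β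
       ⊕ B≥0 ⊗ pos→nn X″>0 ⊗ δ+γ ⊕ B≥0 ⊗ pos→nn Y″>0 ⊗ α+β ⊕ B≥0 ⊗ -B′≥0 ⊗ s-4)
      (trans (sym (expand A B C A′ B′ C′ α β γ δ)) (i≡j⇒i-j≡0 e))
    where
    open Unimodular U
    -B′≥0 : 0ℤ ≤ - B′
    -B′≥0 = neg-mono-≤ B′≤0
    expand : ∀ A B C A′ B′ C′ α β γ δ →
      (A * (γ * γ * A′ - + 2 * (α * γ * B′) + α * α * C′) + C * (δ * δ * A′ - + 2 * (δ * β * B′) + β * β * C′)
        - + 2 * (B * ((α * δ + β * γ) * B′ - δ * γ * A′ - α * β * C′)))
      - (A * (0ℤ * 0ℤ * A′ - + 2 * (1ℤ * 0ℤ * B′) + 1ℤ * 1ℤ * C′) + C * (1ℤ * 1ℤ * A′ - + 2 * (1ℤ * 0ℤ * B′) + 0ℤ * 0ℤ * C′)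
        - + 2 * (B * ((1ℤ * 1ℤ + 0ℤ * 0ℤ) * B′ - 1ℤ * 0ℤ * A′ - 1ℤ * 0ℤ * C′)))
      ≡ (A - B) * (A′ + B′) * (γ * γ) + (C - B) * (C′ + B′) * (β * β)
      + ((A - B) * (C′ + B′) * (α * α - 1ℤ) + (A - B) * - B′ * ((α + γ) * (α + γ) - 1ℤ) + (C - B) * (A′ + B′) * (δ * δ - 1ℤ) + (C - B) * - B′ * ((δ + β) * (δ + β) - 1ℤ)
        + B * (A′ + B′) * ((δ + γ) * (δ + γ) - 1ℤ) + B * (C′ + B′) * ((α + β) * (α + β) - 1ℤ) + B * - B′ * ((α + β + γ + δ) * (α + β + γ + δ) - + 4))
    expand = solve 10 (λ A B C A′ B′ C′ α β γ δ → (A :* (γ :* γ :* A′ :- # 2 :* (α :* γ :* B′) :+ α :* α :* C′) :+ C :* (δ :* δ :* A′ :- # 2 :* (δ :* β :* B′) :+ β :* β :* C′) :- # 2 :* (B :* ((α :* δ :+ β :* γ) :* B′ :- δ :* γ :* A′ :- α :* β :* C′))) :- (A :* (# 0 :* # 0 :* A′ :- # 2 :* (# 1 :* # 0 :* B′) :+ # 1 :* # 1 :* C′) :+ C :* (# 1 :* # 1 :* A′ :- # 2 :* (# 1 :* # 0 :* B′) :+ # 0 :* # 0 :* C′) :- # 2 :* (B :* ((# 1 :* # 1 :+ # 0 :* # 0) :* B′ :- # 1 :* # 0 :* A′ :- # 1 :* # 0 :* C′))) := (A :- B) :* (A′ :+ B′) :* (γ :* γ) :+ (C :- B) :* (C′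 :+ B′) :* (β :* β) :+ ((A :- B) :* (C′ :+ B′) :* (α :* α :- # 1) :+ (A :- B) :* :- B′ :* ((α :+ γ) :* (α :+ γ) :- # 1) :+ (C :- B) :* (A′ :+ B′) :* (δ :* δ :- # 1) :+ (C :- B) :* :- B′ :* ((δ :+ β) :* (δ :+ β) :- # 1) :+ B :* (A′ :+ B′) :* ((δ :+ γ) :* (δ :+ γ) :- # 1) :+ B :* (C′ :+ B′) :* ((α :+ β) :* (α :+ β) :- # 1) :+ B :* :- B′ :* ((α :+ β :+ γ :+ δ) :* (α :+ β :+ γ :+ δ) :- # 4))) refl

  -- The case of negative `B` follows by conjugation with the diagonal matrix (1, -1): it reverses
  -- the signs of `B`, `B′`, `β` and `γ` and leaves the pairing alone.
  rigid : ∀ A B C A′ B′ C′ α β γ δ → Unimodular α β γ δ → 0ℤ < A - B → 0ℤ < C - B → 0ℤ < A + B → 0ℤ < C + B →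
    0ℤ < A′ - B′ → 0ℤ < C′ - B′ → 0ℤ < A′ + B′ → 0ℤ < C′ + B′ →
    pairing A B C A′ B′ C′ α β γ δ ≡ pairing A B C A′ B′ C′ 1ℤ 0ℤ 0ℤ 1ℤ → γ ≡ 0ℤ × β ≡ 0ℤ
  rigid A B C A′ B′ C′ α β γ δ U X>0 Y>0 V>0 W>0 X′>0 Y′>0 V′>0 W′>0 e with ≤-total 0ℤ B
  ... | inj₁ B≥0 = rigid⁺ A B C A′ B′ C′ α β γ δ U B≥0 X>0 Y>0 X′>0 Y′>0 V′>0 W′>0 e
  ... | inj₂ B≤0 = neg0 (proj₁ res) , neg0 (proj₂ res)
    where
    open Unimodular U
    neg0 : ∀ {x} → - x ≡ 0ℤ → x ≡ 0ℤ
    neg0 {x} p = trans (sym (neg-involutive x)) (cong -_ p)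
    flip : ∀ x y → 0ℤ < x + y → 0ℤ < x - - y
    flip x y = subst (λ z → 0ℤ < x + z) (sym (neg-involutive y))
    sq : ∀ x y {k} → 0ℤ ≤ (x + y) * (x + y) - k → 0ℤ ≤ (x - - y) * (x - - y) - k
    sq x y {k} = subst (λ z → 0ℤ ≤ (x + z) * (x + z) - k) (sym (neg-involutive y))
    U′ : Unimodular α (- β) (- γ) δ
    U′ = record { α-1 = α-1 ; δ-1 = δ-1 ; α+γ = α-γ ; α-γ = sq α γ α+γ ; δ+β = δ-β ; δ-β = sq δ β δ+β
                ; δ+γ = δ-γ ; δ-γ = sq δ γ δ+γ ; α+β = α-β ; α-β = sq α β α+β ; s-4 = r-4
                ; r-4 = subst₂ (λ y z → 0ℤ ≤ (α + y + z + δ) * (α + y + z + δ) - + 4) (sym (neg-involutive β)) (sym (neg-involutive γ)) s-4 }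
    sym-pairing : ∀ A B C A′ B′ C′ α β γ δ →
      A * (- γ * - γ * A′ - + 2 * (α * - γ * - B′) + α * α * C′) + C * (δ * δ * A′ - + 2 * (δ * - β * - B′) + - β * - β * C′)
        - + 2 * (- B * ((α * δ + - β * - γ) * - B′ - δ * - γ * A′ - α * - β * C′))
      ≡ A * (γ * γ * A′ - + 2 * (α * γ * B′) + α * α * C′) + C * (δ * δ * A′ - + 2 * (δ * β * B′) + β * β * C′)
        - + 2 * (B * ((α * δ + β * γ) * B′ - δ * γ * A′ - α * β * C′))
    sym-pairing = solve 10 (λ A B C A′ B′ C′ α β γ δ → A :* (:- γ :* :- γ :* A′ :- # 2 :* (α :* :- γ :* :- B′) :+ α :* α :* C′) :+ C :* (δ :* δ :* A′ :- # 2 :* (δ :* :- β :* :- B′) :+ :- β :* :- β :* C′) :- # 2 :* (:- B :* ((α :* δ :+ :- β :* :- γ) :* :- B′ :- δ :* :- γ :* A′ :- α :* :- β :* C′)) := A :* (γ :* γ :* A′ :- # 2 :* (α :* γ :* B′) :+ α :* α :* C′) :+ C :* (δ :* δ :* A′ :- # 2 :* (δ :* β :* B′) :+ β :* β :* C′) :- # 2 :* (B :* ((α :* δ :+ β :* γ) :* B′ :- δ :* γ :* A′ :- α :* β :* C′))) refl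
    res = rigid⁺ A (- B) C A′ (- B′) C′ α (- β) (- γ) δ U′ (neg-mono-≤ B≤0) (flip A B V>0) (flip C B W>0) (flip A′ B′ V′>0) (flip C′ B′ W′>0) X′>0 Y′>0
      (trans (sym-pairing A B C A′ B′ C′ α β γ δ) (trans e (sym (sym-pairing A B C A′ B′ C′ 1ℤ 0ℤ 0ℤ 1ℤ))))

  -- Both forms are the symmetric parts of matrices K and K′ = g K with antisymmetric parts ± T, and g J gᵀ = (det g) J.
  pairing-invariant : ∀ A B C T A′ B′ C′ T′ α β γ δ → α * δ - β * γ ≡ 1ℤ →
    A′ ≡ α * A + β * (B + T) → B′ - T′ ≡ α * (B - T) + β * C → B′ + T′ ≡ γ * A + δ * (B + T) → C′ ≡ γ * (B - T) + δ * C →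
    pairing A B C A′ B′ C′ α β γ δ ≡ pairing A B C A′ B′ C′ 1ℤ 0ℤ 0ℤ 1ℤ
  pairing-invariant A B C T A′ B′ C′ T′ α β γ δ det a′ y′ x′ c′ = *-cancelˡ-≡ (+ 2) _ _ (begin
    + 2 * pairing A B C A′ B′ C′ α β γ δ                  ≡⟨ double A B C A′ B′ C′ α β γ δ T′ ⟩
    doubled A′ ((B′ - T′) + (B′ + T′)) C′ α β γ δ         ≡⟨ cong₂ (λ u v → doubled u v C′ α β γ δ) a′ (cong₂ _+_ y′ x′) ⟩
    doubled A″ U C′ α β γ δ                               ≡⟨ cong (λ u → doubled A″ U u α β γ δ) c′ ⟩
    doubled A″ U C″ α β γ δ                               ≡⟨ transport A B C T α β γ δ ⟩
    (α * δ - β * γ) * doubled A″ U C″ 1ℤ 0ℤ 0ℤ 1ℤ         ≡⟨ cong (_* doubled A″ U C″ 1ℤ 0ℤ 0ℤ 1ℤ) det ⟩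
    1ℤ * doubled A″ U C″ 1ℤ 0ℤ 0ℤ 1ℤ                      ≡⟨ *-identityˡ _ ⟩
    doubled A″ U C″ 1ℤ 0ℤ 0ℤ 1ℤ                           ≡⟨ cong (λ u → doubled A″ U u 1ℤ 0ℤ 0ℤ 1ℤ) (sym c′) ⟩
    doubled A″ U C′ 1ℤ 0ℤ 0ℤ 1ℤ                           ≡⟨ cong₂ (λ u v → doubled u v C′ 1ℤ 0ℤ 0ℤ 1ℤ) (sym a′) (sym (cong₂ _+_ y′ x′)) ⟩
    doubled A′ ((B′ - T′) + (B′ + T′)) C′ 1ℤ 0ℤ 0ℤ 1ℤ     ≡⟨ sym (double A B C A′ B′ C′ 1ℤ 0ℤ 0ℤ 1ℤ T′) ⟩
    + 2 * pairing A B C A′ B′ C′ 1ℤ 0ℤ 0ℤ 1ℤ              ∎)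
    where
    open ≡-Reasoning
    A″ = α * A + β * (B + T)
    C″ = γ * (B - T) + δ * C
    U = α * (B - T) + β * C + (γ * A + δ * (B + T))
    doubled : ℤ → ℤ → ℤ → ℤ → ℤ → ℤ → ℤ → ℤ
    doubled A′ U C′ α β γ δ = A * (+ 2 * (γ * γ * A′) - + 2 * (α * γ * U) + + 2 * (α * α * C′)) + C * (+ 2 * (δ * δ * A′) - + 2 * (δ * β * U) + + 2 * (β * β * C′))
      - + 2 * (B * ((α * δ + β * γ) * U - + 2 * (δ * γ * A′) - + 2 * (α * β * C′)))
    double : ∀ A B C A′ B′ C′ α β γ δ T′ →
      + 2 * (A * (γ * γ * A′ - + 2 * (α * γ * B′) + α * α * C′) + C * (δ * δ * A′ - + 2 * (δ * β * B′) + β * β * C′)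
        - + 2 * (B * ((α * δ + β * γ) * B′ - δ * γ * A′ - α * β * C′)))
      ≡ A * (+ 2 * (γ * γ * A′) - + 2 * (α * γ * (B′ - T′ + (B′ + T′))) + + 2 * (α * α * C′)) + C * (+ 2 * (δ * δ * A′) - + 2 * (δ * β * (B′ - T′ + (B′ + T′))) + + 2 * (β * β * C′))
      - + 2 * (B * ((α * δ + β * γ) * (B′ - T′ + (B′ + T′)) - + 2 * (δ * γ * A′) - + 2 * (α * β * C′)))
    double = solve 11 (λ A B C A′ B′ C′ α β γ δ T′ → # 2 :* (A :* (γ :* γ :* A′ :- # 2 :* (α :* γ :* B′) :+ α :* α :* C′) :+ C :* (δ :* δ :* A′ :- # 2 :* (δ :* β :* B′) :+ β :* β :* C′) :- # 2 :* (B :* ((α :* δ :+ β :* γ) :* B′ :- δ :* γ :* A′ :- α :* β :* C′))) := A :* (# 2 :* (γ :* γ :* A′) :- # 2 :* (α :* γ :* (B′ :- T′ :+ (B′ :+ T′))) :+ # 2 :* (α :* α :* C′)) :+ C :* (# 2 :* (δ :* δ :* A′) :- # 2 :* (δ :* β :* (B′ :- T′ :+ (B′ :+ T′))) :+ # 2 :* (β :* β :* C′)) :- # 2 :* (B :* ((α :* δ :+ β :* γ) :* (B′ :- T′ :+ (B′ :+ T′)) :- # 2 :* (δ :* γ :* A′) :- # 2 :* (α :* β :* C′)))) refl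
    transport : ∀ A B C T α β γ δ →
      A * (+ 2 * (γ * γ * (α * A + β * (B + T))) - + 2 * (α * γ * (α * (B - T) + β * C + (γ * A + δ * (B + T)))) + + 2 * (α * α * (γ * (B - T) + δ * C)))
      + C * (+ 2 * (δ * δ * (α * A + β * (B + T))) - + 2 * (δ * β * (α * (B - T) + β * C + (γ * A + δ * (B + T)))) + + 2 * (β * β * (γ * (B - T) + δ * C)))
      - + 2 * (B * ((α * δ + β * γ) * (α * (B - T) + β * C + (γ * A + δ * (B + T))) - + 2 * (δ * γ * (α * A + β * (B + T))) - + 2 * (α * β * (γ * (B - T) + δ * C))))
      ≡ (α * δ - β * γ) * (A * (+ 2 * (0ℤ * 0ℤ * (α * A + β * (B + T))) - + 2 * (1ℤ * 0ℤ * (α * (B - T) + β * C + (γ * A + δ * (B + T)))) + + 2 * (1ℤ * 1ℤ * (γ * (B - T) + δ * C)))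
      + C * (+ 2 * (1ℤ * 1ℤ * (α * A + β * (B + T))) - + 2 * (1ℤ * 0ℤ * (α * (B - T) + β * C + (γ * A + δ * (B + T)))) + + 2 * (0ℤ * 0ℤ * (γ * (B - T) + δ * C)))
      - + 2 * (B * ((1ℤ * 1ℤ + 0ℤ * 0ℤ) * (α * (B - T) + β * C + (γ * A + δ * (B + T))) - + 2 * (1ℤ * 0ℤ * (α * A + β * (B + T))) - + 2 * (1ℤ * 0ℤ * (γ * (B - T) + δ * C)))))
    transport = solve 8 (λ A B C T α β γ δ → A :* (# 2 :* (γ :* γ :* (α :* A :+ β :* (B :+ T))) :- # 2 :* (α :* γ :* (α :* (B :- T) :+ β :* C :+ (γ :* A :+ δ :* (B :+ T)))) :+ # 2 :* (α :* α :* (γ :* (B :- T) :+ δ :* C))) :+ C :* (# 2 :* (δ :* δ :* (α :* A :+ β :* (B :+ T))) :- # 2 :* (δ :* β :* (α :* (B :- T) :+ β :* C :+ (γ :* A :+ δ :* (B :+ T)))) :+ # 2 :* (β :* β :* (γ :* (B :- T) :+ δ :* C))) :- # 2 :* (B :* ((α :* δ :+ β :* γ) :* (α :* (B :- T) :+ β :* C :+ (γ :* A :+ δ :* (B :+ T))) :- # 2 :* (δ :* γ :* (α :* A :+ β :* (B :+ T))) :- # 2 :* (α :* β :* (γ :* (B :- T) :+ δ :* C)))) := (α :* δ :- β :* γ) :* (A :* (# 2 :* (# 0 :* # 0 :* (α :* A :+ β :* (B :+ T))) :- # 2 :* (# 1 :* # 0 :* (α :* (B :- T) :+ β :* C :+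 (γ :* A :+ δ :* (B :+ T)))) :+ # 2 :* (# 1 :* # 1 :* (γ :* (B :- T) :+ δ :* C))) :+ C :* (# 2 :* (# 1 :* # 1 :* (α :* A :+ β :* (B :+ T))) :- # 2 :* (# 1 :* # 0 :* (α :* (B :- T) :+ β :* C :+ (γ :* A :+ δ :* (B :+ T)))) :+ # 2 :* (# 0 :* # 0 :* (γ :* (B :- T) :+ δ :* C))) :- # 2 :* (B :* ((# 1 :* # 1 :+ # 0 :* # 0) :* (α :* (B :- T) :+ β :* C :+ (γ :* A :+ δ :* (B :+ T))) :- # 2 :* (# 1 :* # 0 :* (α :* A :+ β :* (B :+ T))) :- # 2 :* (# 1 :* # 0 :* (γ :* (B :- T) :+ δ :* C)))))) refl

  odd+even : ∀ {x y} → Odd x → ∃ (λ k → y ≡ + 2 * k) → Odd (x + y)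
  odd+even o (k , refl) = odd-per k o

  odd-even : ∀ {x y} → Odd x → ∃ (λ k → y ≡ + 2 * k) → Odd (x - y)
  odd-even {x} o (k , refl) = subst Odd (lem x k) (odd-per (- k) o)
    where
    lem : ∀ x k → x + + 2 * - k ≡ x - + 2 * k
    lem = solve 2 (λ x k → x :+ # 2 :* :- k := x :- # 2 :* k) refl

  even-factor : ∀ {x p} k → Odd p → x * p ≡ + 2 * k → ∃ λ l → x ≡ + 2 * l
  even-factor {x} {p} k o e with parity x
  ... | even l refl = l , +-identityˡ _
  ... | odd l q = ⊥-elim (1≢-1 (trans (sym (sg-even k)) (trans (cong sg (trans (+-identityˡ (+ 2 * k)) (sym e))) (Odd.sg-1 (odd* (odd-by l q) o)))))

  twice-odd-sq : ∀ {s p} k q → Odd p → Odd q → (∃ λ l → s ≡ + 2 * l) → s * p ≡ + 2 * (q + + 2 * k) → 0ℤ ≤ s * s - + 4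
  twice-odd-sq {s} {p} k q op oq (l , refl) e = by (nat≥0 4 ⊗ sq-1≥0 (odd≢0 (odd*ˡ {l} {p} (subst Odd (sym lp) (odd-per k oq))))) (lem l)
    where
    lem : ∀ l → + 2 * l * (+ 2 * l) - + 4 ≡ + 4 * (l * l - 1ℤ)
    lem = solve 1 (λ l → # 2 :* l :* (# 2 :* l) :- # 4 := # 4 :* (l :* l :- # 1)) refl
    lp : l * p ≡ q + + 2 * k
    lp = *-cancelˡ-≡ (+ 2) (l * p) (q + + 2 * k) (trans (sym (*-assoc (+ 2) l p)) e)

  even-neg : ∀ {x} → ∃ (λ k → x ≡ + 2 * k) → ∃ (λ k → - x ≡ + 2 * k)
  even-neg (k , refl) = - k , lem k
    where
    lem : ∀ k → - (+ 2 * k) ≡ + 2 * - k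
    lem = solve 1 (λ k → :- (# 2 :* k) := # 2 :* :- k) refl

  even-sum : ∀ {x y u v} → Odd x → Odd y → ∃ (λ k → u ≡ + 2 * k) → ∃ (λ k → v ≡ + 2 * k) → ∃ (λ k → x + u + v + y ≡ + 2 * k)
  even-sum ox oy (m , refl) (n , refl) with odd⇒ ox | odd⇒ oy
  ... | k , refl | l , refl = 1ℤ + k + l + m + n , lem k l m n
    where
    lem : ∀ k l m n → 1ℤ + + 2 * k + + 2 * m + + 2 * n + (1ℤ + + 2 * l) ≡ + 2 * (1ℤ + k + l + m + n)
    lem = solve 4 (λ k l m n → # 1 :+ # 2 :* k :+ # 2 :* m :+ # 2 :* n :+ (# 1 :+ # 2 :* l) := # 2 :* (# 1 :+ k :+ l :+ m :+ n)) refl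

  -- Modulo 4 a tile matrix is `p` times (1 -1; 1 1) with `p` odd. A transition matrix therefore
  -- carries (1 -1; 1 1) to plus or minus itself modulo 4: `β` and `γ` are even, `α` and `δ` odd,
  -- and `α + β + γ + δ` and `α - β - γ + δ` are 2 modulo 4.
  unimodular : ∀ p a b d p′ a′ b′ d′ α β γ δ → Odd p → Odd p′ → α * δ - β * γ ≡ 1ℤ →
    p′ + + 4 * a′ ≡ α * (p + + 4 * a) + β * (p + + 4 * (a - d)) → - p′ ≡ α * - p + β * (p + + 4 * b) →
    p′ + + 4 * (a′ - d′) ≡ γ * (p + + 4 * a) + δ * (p + + 4 * (a - d)) → p′ + + 4 * b′ ≡ γ * - p + δ * (p + + 4 * b) →
    Unimodular α β γ δ
  unimodular p a b d p′ a′ b′ d′ α β γ δ op op′ det e₁ e₂ e₃ e₄ = record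
    { α-1 = odd-1 oα ; δ-1 = odd-1 oδ
    ; α+γ = odd-1 (odd+even oα γ-even) ; α-γ = odd-1 (odd-even oα γ-even)
    ; δ+β = odd-1 (odd+even oδ β-even) ; δ-β = odd-1 (odd-even oδ β-even)
    ; δ+γ = odd-1 (odd+even oδ γ-even) ; δ-γ = odd-1 (odd-even oδ γ-even)
    ; α+β = odd-1 (odd+even oα β-even) ; α-β = odd-1 (odd-even oα β-even)
    ; s-4 = twice-odd-sq {α + β + γ + δ} {p} (a′ + (a′ - d′) - α * a - β * (a - d) - γ * a - δ * (a - d)) p′ op op′ s-even
              (trans (s₁ p a d α β γ δ) (trans (cong (_- + 4 * (α * a + β * (a - d) + γ * a + δ * (a - d))) (sym (cong₂ _+_ e₁ e₃))) (s₂ p′ a′ d′ a d α β γ δ)))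
    ; r-4 = twice-odd-sq {α - β - γ + δ} {p} (b′ + β * b - δ * b) p′ op op′ r-even
              (trans (r₁ p b α β γ δ) (trans (cong (λ u → u + + 4 * (β * b - δ * b)) (cong₂ (λ u v → - u + v) (sym e₂) (sym e₄))) (r₂ p′ b′ b β δ)))
    }
    where
    odd-1 : ∀ {x} → Odd x → 0ℤ ≤ x * x - 1ℤ
    odd-1 o = sq-1≥0 (odd≢0 o)
    β-even : ∃ λ l → β ≡ + 2 * l
    β-even = even-factor {β} {p} (a′ - α * a - β * (a - d) - β * b) op (*-cancelˡ-≡ (+ 2) (β * p) (+ 2 * (a′ - α * a - β * (a - d) - β * b))
      (trans (b₁ p a b d α β) (trans (cong (_- + 4 * (α * a + β * (a - d) + β * b)) (sym (cong₂ _+_ e₁ e₂))) (b₂ p′ a′ a b d α β))))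
      where
      b₁ : ∀ p a b d α β → + 2 * (β * p) ≡ α * (p + + 4 * a) + β * (p + + 4 * (a - d)) + (α * - p + β * (p + + 4 * b)) - + 4 * (α * a + β * (a - d) + β * b)
      b₁ = solve 6 (λ p a b d α β → # 2 :* (β :* p) := α :* (p :+ # 4 :* a) :+ β :* (p :+ # 4 :* (a :- d)) :+ (α :* :- p :+ β :* (p :+ # 4 :* b)) :- # 4 :* (α :* a :+ β :* (a :- d) :+ β :* b)) refl
      b₂ : ∀ p′ a′ a b d α β → p′ + + 4 * a′ + - p′ - + 4 * (α * a + β * (a - d) + β * b) ≡ + 2 * (+ 2 * (a′ - α * a - β * (a - d) - β * b))
      b₂ = solve 7 (λ p′ a′ a b d α β → p′ :+ # 4 :* a′ :+ :- p′ :- # 4 :* (α :* a :+ β :* (a :- d) :+ β :* b) := # 2 :* (# 2 :* (a′ :- α :* a :- β :* (a :- d) :- β :* b))) refl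
    γ-even : ∃ λ l → γ ≡ + 2 * l
    γ-even = even-factor {γ} {p} (a′ - d′ - b′ - γ * a - δ * (a - d - b)) op (*-cancelˡ-≡ (+ 2) (γ * p) (+ 2 * (a′ - d′ - b′ - γ * a - δ * (a - d - b)))
      (trans (g₁ p a b d γ δ) (trans (cong (_- + 4 * (γ * a + δ * (a - d - b))) (sym (cong₂ _-_ e₃ e₄))) (g₂ p′ a′ b′ d′ a b d γ δ))))
      where
      g₁ : ∀ p a b d γ δ → + 2 * (γ * p) ≡ γ * (p + + 4 * a) + δ * (p + + 4 * (a - d)) - (γ * - p + δ * (p + + 4 * b)) - + 4 * (γ * a + δ * (a - d - b))
      g₁ = solve 6 (λ p a b d γ δ → # 2 :* (γ :* p) := γ :* (p :+ # 4 :* a) :+ δ :* (p :+ # 4 :* (a :- d)) :- (γ :* :- p :+ δ :* (p :+ # 4 :* b)) :- # 4 :* (γ :* a :+ δ :* (a :- d :- b))) refl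
      g₂ : ∀ p′ a′ b′ d′ a b d γ δ → p′ + + 4 * (a′ - d′) - (p′ + + 4 * b′) - + 4 * (γ * a + δ * (a - d - b)) ≡ + 2 * (+ 2 * (a′ - d′ - b′ - γ * a - δ * (a - d - b)))
      g₂ = solve 9 (λ p′ a′ b′ d′ a b d γ δ → p′ :+ # 4 :* (a′ :- d′) :- (p′ :+ # 4 :* b′) :- # 4 :* (γ :* a :+ δ :* (a :- d :- b)) := # 2 :* (# 2 :* (a′ :- d′ :- b′ :- γ :* a :- δ :* (a :- d :- b)))) refl
    αδ-odd : Odd (α * δ)
    αδ-odd = odd-by (proj₁ β-even * γ) (trans (l₁ (α * δ) (β * γ)) (trans (cong (_+ β * γ) det) (trans (cong (λ u → 1ℤ + u * γ) (proj₂ β-even)) (cong (_+_ 1ℤ) (*-assoc (+ 2) (proj₁ β-even) γ)))))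
      where
      l₁ : ∀ u v → u ≡ u - v + v
      l₁ = solve-∀
    oα : Odd α
    oα = odd*ˡ {α} {δ} αδ-odd
    oδ : Odd δ
    oδ = odd*ʳ {α} {δ} αδ-odd
    s-even : ∃ λ l → α + β + γ + δ ≡ + 2 * l
    s-even = even-sum oα oδ β-even γ-even
    r-even : ∃ λ l → α - β - γ + δ ≡ + 2 * l
    r-even = even-sum {α} {δ} { - β} { - γ} oα oδ (even-neg β-even) (even-neg γ-even)
    s₁ : ∀ p a d α β γ δ → (α + β + γ + δ) * p ≡ α * (p + + 4 * a) + β * (p + + 4 * (a - d)) + (γ * (p + + 4 * a) + δ * (p + + 4 * (a - d))) - + 4 * (α * a + β * (a - d) + γ * a + δ * (a - d))
    s₁ = solve 7 (λ p a d α β γ δ → (α :+ β :+ γ :+ δ) :* p := α :* (p :+ # 4 :* a) :+ β :* (p :+ # 4 :* (a :- d)) :+ (γ :* (p :+ # 4 :* a) :+ δ :* (p :+ # 4 :* (a :- d))) :- # 4 :* (α :* a :+ β :* (a :- d) :+ γ :* a :+ δ :* (a :- d))) refl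
    s₂ : ∀ p′ a′ d′ a d α β γ δ → p′ + + 4 * a′ + (p′ + + 4 * (a′ - d′)) - + 4 * (α * a + β * (a - d) + γ * a + δ * (a - d)) ≡ + 2 * (p′ + + 2 * (a′ + (a′ - d′) - α * a - β * (a - d) - γ * a - δ * (a - d)))
    s₂ = solve 9 (λ p′ a′ d′ a d α β γ δ → p′ :+ # 4 :* a′ :+ (p′ :+ # 4 :* (a′ :- d′)) :- # 4 :* (α :* a :+ β :* (a :- d) :+ γ :* a :+ δ :* (a :- d)) := # 2 :* (p′ :+ # 2 :* (a′ :+ (a′ :- d′) :- α :* a :- β :* (a :- d) :- γ :* a :- δ :* (a :- d)))) refl
    r₁ : ∀ p b α β γ δ → (α - β - γ + δ) * p ≡ - (α * - p + β * (p + + 4 * b)) + (γ * - p + δ * (p + + 4 * b)) + + 4 * (β * b - δ * b)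
    r₁ = solve 6 (λ p b α β γ δ → (α :- β :- γ :+ δ) :* p := :- (α :* :- p :+ β :* (p :+ # 4 :* b)) :+ (γ :* :- p :+ δ :* (p :+ # 4 :* b)) :+ # 4 :* (β :* b :- δ :* b)) refl
    r₂ : ∀ p′ b′ b β δ → - - p′ + (p′ + + 4 * b′) + + 4 * (β * b - δ * b) ≡ + 2 * (p′ + + 2 * (b′ + β * b - δ * b))
    r₂ = solve 5 (λ p′ b′ b β δ → :- :- p′ :+ (p′ :+ # 4 :* b′) :+ # 4 :* (β :* b :- δ :* b) := # 2 :* (p′ :+ # 2 :* (b′ :+ β :* b :- δ :* b))) refl

  -- Reduced bases and Hermite normal forms.

  tileOf : ℤ⁴ → Tile
  tileOf (T , a , b , d) = tile T a b (b + d - a) d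

  -- If the symmetric part of the matrix is (A B; B C), the labels `la`, `lb`, `lc`, `ld` are A + B,
  -- C + B, C - B, A - B. Their positivity bounds the absolute value of B by A and C, and `inv` says
  -- that the determinant is `N`.
  record Reduced (N : ℤ) (y : ℤ⁴) : Set where
    t : Tile
    t = tileOf y
    field
      odd-T : Odd (T t)
      la>0  : 0ℤ < la t
      lb>0  : 0ℤ < lb t
      lc>0  : 0ℤ < lc t
      ld>0  : 0ℤ < ld t
      inv   : la t * lc t + lb t * ld t + + 2 * (T t * T t) ≡ + 2 * N

  -- Orientation is fixed because the pairing is invariant under transition matrices of determinant
  -- 1.
  Basis⁺ : ℤ → ℤ → ℤ → Tile → Set
  Basis⁺ D J E t = Σ (Basis D J E t) λ B → let open Basis B in α * δ - β * γ ≡ 1ℤ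

  module _ {N T a b d T′ a′ b′ d′ : ℤ} (R : Reduced N (T , a , b , d)) (R′ : Reduced N (T′ , a′ , b′ , d′)) (α β γ δ : ℤ) (det : α * δ - β * γ ≡ 1ℤ) where
    private
      module R = Reduced R
      module R′ = Reduced R′
      t = tileOf (T , a , b , d)
      t′ = tileOf (T′ , a′ , b′ , d′)

    -- Invariance of the pairing together with `rigid` makes the transition matrix diagonal. Its
    -- entries have product 1 and are positive, since `X₁` and `Y₂` are positive in both bases.
    reduced-rigid : X₁ t′ ≡ α * X₁ t + β * X₂ t → Y₁ t′ ≡ α * Y₁ t + β * Y₂ t → X₂ t′ ≡ γ * X₁ t + δ * X₂ t → Y₂ t′ ≡ γ * Y₁ t + δ * Y₂ t →
      _≡_ {A = ℤ⁴} (T , a , b , d) (T′ , a′ , b′ , d′)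
    reduced-rigid eX₁ eY₁ eX₂ eY₂ = same
      where
      p p′ : ℤ
      p = T - + 2 * a + + 2 * d
      p′ = T′ - + 2 * a′ + + 2 * d′
      odd-p : ∀ T a d → Odd T → Odd (T - + 2 * a + + 2 * d)
      odd-p T a d o = subst Odd (l T a d) (odd-per (d - a) o)
        where
        l : ∀ T a d → T + + 2 * (d - a) ≡ T - + 2 * a + + 2 * d
        l = solve 3 (λ T a d → T :+ # 2 :* (d :- a) := T :- # 2 :* a :+ # 2 :* d) refl
      X₁≡ : ∀ T a d → T + + 2 * a + + 2 * d ≡ T - + 2 * a + + 2 * d + + 4 * a
      X₁≡ = solve 3 (λ T a d → T :+ # 2 :* a :+ # 2 :* d := T :- # 2 :* a :+ # 2 :* d :+ # 4 :* a) refl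
      Y₁≡ : ∀ T a d → - T + + 2 * a - + 2 * d ≡ - (T - + 2 * a + + 2 * d)
      Y₁≡ = solve 3 (λ T a d → :- T :+ # 2 :* a :- # 2 :* d := :- (T :- # 2 :* a :+ # 2 :* d)) refl
      X₂≡ : ∀ T a d → T + + 2 * a - + 2 * d ≡ T - + 2 * a + + 2 * d + + 4 * (a - d)
      X₂≡ = solve 3 (λ T a d → T :+ # 2 :* a :- # 2 :* d := T :- # 2 :* a :+ # 2 :* d :+ # 4 :* (a :- d)) refl
      Y₂≡ : ∀ T a b d → T + + 2 * b + + 2 * (b + d - a) ≡ T - + 2 * a + + 2 * d + + 4 * b
      Y₂≡ = solve 4 (λ T a b d → T :+ # 2 :* b :+ # 2 :* (b :+ d :- a) := T :- # 2 :* a :+ # 2 :* d :+ # 4 :* b) refl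
      U : Unimodular α β γ δ
      U = unimodular p a b d p′ a′ b′ d′ α β γ δ (odd-p T a d R.odd-T) (odd-p T′ a′ d′ R′.odd-T) det
        (trans (sym (X₁≡ T′ a′ d′)) (trans eX₁ (cong₂ (λ u v → α * u + β * v) (X₁≡ T a d) (X₂≡ T a d))))
        (trans (sym (Y₁≡ T′ a′ d′)) (trans eY₁ (cong₂ (λ u v → α * u + β * v) (Y₁≡ T a d) (Y₂≡ T a b d))))
        (trans (sym (X₂≡ T′ a′ d′)) (trans eX₂ (cong₂ (λ u v → γ * u + δ * v) (X₁≡ T a d) (X₂≡ T a d))))
        (trans (sym (Y₂≡ T′ a′ b′ d′)) (trans eY₂ (cong₂ (λ u v → γ * u + δ * v) (Y₁≡ T a d) (Y₂≡ T a b d))))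
      B B′ : ℤ
      B = + 2 * (a - d)
      B′ = + 2 * (a′ - d′)
      X₂B : ∀ T a d → T + + 2 * a - + 2 * d ≡ + 2 * (a - d) + T
      X₂B = solve 3 (λ T a d → T :+ # 2 :* a :- # 2 :* d := # 2 :* (a :- d) :+ T) refl
      Y₁B : ∀ T a d → - T + + 2 * a - + 2 * d ≡ + 2 * (a - d) - T
      Y₁B = solve 3 (λ T a d → :- T :+ # 2 :* a :- # 2 :* d := # 2 :* (a :- d) :- T) refl
      inv′ : pairing (X₁ t) B (Y₂ t) (X₁ t′) B′ (Y₂ t′) α β γ δ ≡ pairing (X₁ t) B (Y₂ t) (X₁ t′) B′ (Y₂ t′) 1ℤ 0ℤ 0ℤ 1ℤ
      inv′ = pairing-invariant (X₁ t) B (Y₂ t) T (X₁ t′) B′ (Y₂ t′) T′ α β γ δ det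
        (trans eX₁ (cong (λ u → α * X₁ t + β * u) (X₂B T a d)))
        (trans (sym (Y₁B T′ a′ d′)) (trans eY₁ (cong (λ u → α * u + β * Y₂ t) (Y₁B T a d))))
        (trans (sym (X₂B T′ a′ d′)) (trans eX₂ (cong (λ u → γ * X₁ t + δ * u) (X₂B T a d))))
        (trans eY₂ (cong (λ u → γ * u + δ * Y₂ t) (Y₁B T a d)))
      A-B : ∀ T a d → T + + 4 * d ≡ T + + 2 * a + + 2 * d - + 2 * (a - d)
      A-B = solve 3 (λ T a d → T :+ # 4 :* d := T :+ # 2 :* a :+ # 2 :* d :- # 2 :* (a :- d)) refl
      A+B : ∀ T a d → T + + 4 * a ≡ T + + 2 * a + + 2 * d + + 2 * (a - d)
      A+B = solve 3 (λ T a d → T :+ # 4 :* a := T :+ # 2 :* a :+ # 2 :* d :+ # 2 :* (a :- d)) refl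
      C-B : ∀ T a b d → T + + 4 * (b + d - a) ≡ T + + 2 * b + + 2 * (b + d - a) - + 2 * (a - d)
      C-B = solve 4 (λ T a b d → T :+ # 4 :* (b :+ d :- a) := T :+ # 2 :* b :+ # 2 :* (b :+ d :- a) :- # 2 :* (a :- d)) refl
      C+B : ∀ T a b d → T + + 4 * b ≡ T + + 2 * b + + 2 * (b + d - a) + + 2 * (a - d)
      C+B = solve 4 (λ T a b d → T :+ # 4 :* b := T :+ # 2 :* b :+ # 2 :* (b :+ d :- a) :+ # 2 :* (a :- d)) refl
      γβ : γ ≡ 0ℤ × β ≡ 0ℤ
      γβ = rigid (X₁ t) B (Y₂ t) (X₁ t′) B′ (Y₂ t′) α β γ δ U
        (subst (0ℤ <_) (A-B T a d) R.ld>0) (subst (0ℤ <_) (C-B T a b d) R.lc>0) (subst (0ℤ <_) (A+B T a d) R.la>0) (subst (0ℤ <_) (C+B T a b d) R.lb>0)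
        (subst (0ℤ <_) (A-B T′ a′ d′) R′.ld>0) (subst (0ℤ <_) (C-B T′ a′ b′ d′) R′.lc>0) (subst (0ℤ <_) (A+B T′ a′ d′) R′.la>0) (subst (0ℤ <_) (C+B T′ a′ b′ d′) R′.lb>0) inv′
      half-sum : ∀ {x u v} → 0ℤ < u → 0ℤ < v → + 2 * x ≡ u + v → 0ℤ < x
      half-sum {x} {u} {v} p q e = pos-double {x} (subst (0ℤ <_) (sym e) (+-mono-< p q))
      X₁>0 : ∀ T a d → 0ℤ < T + + 4 * a → 0ℤ < T + + 4 * d → 0ℤ < T + + 2 * a + + 2 * d
      X₁>0 T a d p q = half-sum p q (l T a d)
        where
        l : ∀ T a d → + 2 * (T + + 2 * a + + 2 * d) ≡ T + + 4 * a + (T + + 4 * d)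
        l = solve 3 (λ T a d → # 2 :* (T :+ # 2 :* a :+ # 2 :* d) := T :+ # 4 :* a :+ (T :+ # 4 :* d)) refl
      Y₂>0 : ∀ T b c → 0ℤ < T + + 4 * b → 0ℤ < T + + 4 * c → 0ℤ < T + + 2 * b + + 2 * c
      Y₂>0 T b c p q = half-sum p q (l T b c)
        where
        l : ∀ T b c → + 2 * (T + + 2 * b + + 2 * c) ≡ T + + 4 * b + (T + + 4 * c)
        l = solve 3 (λ T b c → # 2 :* (T :+ # 2 :* b :+ # 2 :* c) := T :+ # 4 :* b :+ (T :+ # 4 :* c)) refl
      αX : X₁ t′ ≡ X₁ t * α
      αX = trans eX₁ (trans (cong (λ u → α * X₁ t + u * X₂ t) (proj₂ γβ)) (trans (+-identityʳ (α * X₁ t)) (*-comm α (X₁ t))))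
      δY : Y₂ t′ ≡ Y₂ t * δ
      δY = trans eY₂ (trans (cong (λ u → u * Y₁ t + δ * Y₂ t) (proj₁ γβ)) (trans (+-identityˡ (δ * Y₂ t)) (*-comm δ (Y₂ t))))
      α>0 : 0ℤ < α
      α>0 = pos*-cancelˡ {X₁ t} {α} (X₁>0 T a d R.la>0 R.ld>0) (subst (0ℤ <_) αX (X₁>0 T′ a′ d′ R′.la>0 R′.ld>0))
      δ>0 : 0ℤ < δ
      δ>0 = pos*-cancelˡ {Y₂ t} {δ} (Y₂>0 T b (b + d - a) R.lb>0 R.lc>0) (subst (0ℤ <_) δY (Y₂>0 T′ b′ (b′ + d′ - a′) R′.lb>0 R′.lc>0))
      αδ : α * δ ≡ 1ℤ
      αδ = trans (sym (+-identityʳ (α * δ))) (trans (cong (λ u → α * δ - u * γ) (sym (proj₂ γβ))) det)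
      α1 : α ≡ 1ℤ
      α1 = factor-1 α>0 δ>0 αδ
      δ1 : δ ≡ 1ℤ
      δ1 = factor-1 δ>0 α>0 (trans (*-comm δ α) αδ)
      one : ∀ u v x w {z} → u ≡ 1ℤ → v ≡ 0ℤ → z ≡ u * x + v * w → z ≡ x
      one _ _ x w refl refl e = trans e (trans (+-identityʳ (1ℤ * x)) (*-identityˡ x))
      one′ : ∀ u v x w {z} → u ≡ 0ℤ → v ≡ 1ℤ → z ≡ u * x + v * w → z ≡ w
      one′ _ _ x w refl refl e = trans e (trans (+-identityˡ (1ℤ * w)) (*-identityˡ w))
      X₁s : X₁ t′ ≡ X₁ t
      X₁s = one α β (X₁ t) (X₂ t) α1 (proj₂ γβ) eX₁
      Y₁s : Y₁ t′ ≡ Y₁ t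
      Y₁s = one α β (Y₁ t) (Y₂ t) α1 (proj₂ γβ) eY₁
      X₂s : X₂ t′ ≡ X₂ t
      X₂s = one′ γ δ (X₁ t) (X₂ t) (proj₁ γβ) δ1 eX₂
      Y₂s : Y₂ t′ ≡ Y₂ t
      Y₂s = one′ γ δ (Y₁ t) (Y₂ t) (proj₁ γβ) δ1 eY₂
      T-of : ∀ T a d → + 2 * T ≡ T + + 2 * a - + 2 * d - (- T + + 2 * a - + 2 * d)
      T-of = solve 3 (λ T a d → # 2 :* T := T :+ # 2 :* a :- # 2 :* d :- (:- T :+ # 2 :* a :- # 2 :* d)) refl
      a-of : ∀ T a d → + 4 * a ≡ T + + 2 * a + + 2 * d + (- T + + 2 * a - + 2 * d)
      a-of = solve 3 (λ T a d → # 4 :* a := T :+ # 2 :* a :+ # 2 :* d :+ (:- T :+ # 2 :* a :- # 2 :* d)) refl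
      d-of : ∀ T a d → + 4 * d ≡ T + + 2 * a + + 2 * d - (T + + 2 * a - + 2 * d)
      d-of = solve 3 (λ T a d → # 4 :* d := T :+ # 2 :* a :+ # 2 :* d :- (T :+ # 2 :* a :- # 2 :* d)) refl
      b-of : ∀ T a b d → + 4 * b ≡ T + + 2 * b + + 2 * (b + d - a) + (- T + + 2 * a - + 2 * d)
      b-of = solve 4 (λ T a b d → # 4 :* b := T :+ # 2 :* b :+ # 2 :* (b :+ d :- a) :+ (:- T :+ # 2 :* a :- # 2 :* d)) refl
      same : _≡_ {A = ℤ⁴} (T , a , b , d) (T′ , a′ , b′ , d′)
      same = cong₂ _,_ (*-cancelˡ-≡ (+ 2) T T′ (trans (T-of T a d) (trans (sym (cong₂ _-_ X₂s Y₁s)) (sym (T-of T′ a′ d′)))))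
        (cong₂ _,_ (*-cancelˡ-≡ (+ 4) a a′ (trans (a-of T a d) (trans (sym (cong₂ _+_ X₁s Y₁s)) (sym (a-of T′ a′ d′)))))
        (cong₂ _,_ (*-cancelˡ-≡ (+ 4) b b′ (trans (b-of T a b d) (trans (sym (cong₂ _+_ Y₂s Y₁s)) (sym (b-of T′ a′ b′ d′)))))
          (*-cancelˡ-≡ (+ 4) d d′ (trans (d-of T a d) (trans (sym (cong₂ _-_ X₁s X₂s)) (sym (d-of T′ a′ d′)))))))

  reduced-unique : ∀ {N D J E y y′} → Reduced N y → Reduced N y′ → Basis⁺ D J E (tileOf y) → Basis⁺ D J E (tileOf y′) → y ≡ y′
  reduced-unique {N} {D} {J} {E} {y} {y′} R R′ (B₁ , det₁) (B₂ , det₂) = reduced-rigid R R′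
      -- The transition matrix is the second coordinate matrix times the adjugate of the first.
      (α₂ * δ₁ - β₂ * γ₁) (β₂ * α₁ - α₂ * β₁) (γ₂ * δ₁ - δ₂ * γ₁) (δ₂ * α₁ - γ₂ * β₁)
      (trans (dets α₁ β₁ γ₁ δ₁ α₂ β₂ γ₂ δ₂) (cong₂ _*_ det₁ det₂))
      (trans x₁′ (rowX α₂ β₂)) (trans y₁′ (rowY α₂ β₂)) (trans x₂′ (rowX γ₂ δ₂)) (trans y₂′ (rowY γ₂ δ₂))
    where
    open Basis B₁ renaming (α to α₁; β to β₁; γ to γ₁; δ to δ₁)
    open Basis B₂ renaming (α to α₂; β to β₂; γ to γ₂; δ to δ₂; x₁ to x₁′; x₂ to x₂′; y₁ to y₁′; y₂ to y₂′) hiding (c≡; unit)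
    t = tileOf y
    dets : ∀ α₁ β₁ γ₁ δ₁ α₂ β₂ γ₂ δ₂ → (α₂ * δ₁ - β₂ * γ₁) * (δ₂ * α₁ - γ₂ * β₁) - (β₂ * α₁ - α₂ * β₁) * (γ₂ * δ₁ - δ₂ * γ₁) ≡ (α₁ * δ₁ - β₁ * γ₁) * (α₂ * δ₂ - β₂ * γ₂)
    dets = solve 8 (λ α₁ β₁ γ₁ δ₁ α₂ β₂ γ₂ δ₂ → (α₂ :* δ₁ :- β₂ :* γ₁) :* (δ₂ :* α₁ :- γ₂ :* β₁) :- (β₂ :* α₁ :- α₂ :* β₁) :* (γ₂ :* δ₁ :- δ₂ :* γ₁) := (α₁ :* δ₁ :- β₁ :* γ₁) :* (α₂ :* δ₂ :- β₂ :* γ₂)) refl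
    rowX : ∀ u v → u * D ≡ (u * δ₁ - v * γ₁) * X₁ t + (v * α₁ - u * β₁) * X₂ t
    rowX u v = sym (trans (cong₂ (λ x x′ → (u * δ₁ - v * γ₁) * x + (v * α₁ - u * β₁) * x′) x₁ x₂) (trans (l u v α₁ β₁ γ₁ δ₁ D) (trans (cong (_* (u * D)) det₁) (*-identityˡ _))))
      where
      l : ∀ u v α β γ δ D → (u * δ - v * γ) * (α * D) + (v * α - u * β) * (γ * D) ≡ (α * δ - β * γ) * (u * D)
      l = solve 7 (λ u v α β γ δ D → (u :* δ :- v :* γ) :* (α :* D) :+ (v :* α :- u :* β) :* (γ :* D) := (α :* δ :- β :* γ) :* (u :* D)) refl
    rowY : ∀ u v → u * J + v * E ≡ (u * δ₁ - v * γ₁) * Y₁ t + (v * α₁ - u * β₁) * Y₂ t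
    rowY u v = sym (trans (cong₂ (λ x x′ → (u * δ₁ - v * γ₁) * x + (v * α₁ - u * β₁) * x′) y₁ y₂) (trans (l u v α₁ β₁ γ₁ δ₁ J E) (trans (cong (_* (u * J + v * E)) det₁) (*-identityˡ _))))
      where
      l : ∀ u v α β γ δ J E → (u * δ - v * γ) * (α * J + β * E) + (v * α - u * β) * (γ * J + δ * E) ≡ (α * δ - β * γ) * (u * J + v * E)
      l = solve 8 (λ u v α β γ δ J E → (u :* δ :- v :* γ) :* (α :* J :+ β :* E) :+ (v :* α :- u :* β) :* (γ :* J :+ δ :* E) := (α :* δ :- β :* γ) :* (u :* J :+ v :* E)) refl

  record Triple (N : ℤ) (x : ℤ³) : Set where
    D : ℤ
    D = proj₁ x
    p : ℤ
    p = proj₁ (proj₂ x)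
    q : ℤ
    q = proj₂ (proj₂ x)
    field
      D>0   : 0ℤ < D
      p>0   : 0ℤ < p
      q>0   : 0ℤ < q
      odd-D : Odd D
      odd-p : Odd p
      odd-q : Odd q
      prod  : D * (p + q) ≡ N

  -- A triple is read as the Hermite basis `(D , - p)`, `(0 , p + q)` of a lattice of index
  -- `D (p + q) = N`; that `p` lies strictly between 0 and `p + q` makes it unique.
  Spans : ℤ³ → ℤ⁴ → Set
  Spans (D , p , q) y = Basis⁺ D (- p) (p + q) (tileOf y)

  basis-inv : ∀ {D J E} t → (B : Basis D J E t) → let open Basis B in
    la t * lc t + lb t * ld t + + 2 * (T t * T t) ≡ + 2 * ((α * δ - β * γ) * (D * E))
  basis-inv {D} {J} {E} (tile T a b c d) B with Basis.c≡ B
  ... | refl = trans (l₁ T a b d) (trans (cong₂ (λ u v → + 2 * (u * (T + + 2 * b + + 2 * (b + d - a)) - v * (T + + 2 * a - + 2 * d))) x₁ y₁)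
         (trans (cong₂ (λ u v → + 2 * (α * D * u - (α * J + β * E) * v)) y₂ x₂) (l₂ α β γ δ D J E)))
    where
    open Basis B
    l₁ : ∀ T a b d → (T + + 4 * a) * (T + + 4 * (b + d - a)) + (T + + 4 * b) * (T + + 4 * d) + + 2 * (T * T)
       ≡ + 2 * ((T + + 2 * a + + 2 * d) * (T + + 2 * b + + 2 * (b + d - a)) - (- T + + 2 * a - + 2 * d) * (T + + 2 * a - + 2 * d))
    l₁ = solve 4 (λ T a b d → (T :+ # 4 :* a) :* (T :+ # 4 :* (b :+ d :- a)) :+ (T :+ # 4 :* b) :* (T :+ # 4 :* d) :+ # 2 :* (T :* T) := # 2 :* ((T :+ # 2 :* a :+ # 2 :* d) :* (T :+ # 2 :* b :+ # 2 :* (b :+ d :- a)) :- (:- T :+ # 2 :* a :- # 2 :* d) :* (T :+ # 2 :* a :- # 2 :* d))) refl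
    l₂ : ∀ α β γ δ D J E → + 2 * (α * D * (γ * J + δ * E) - (α * J + β * E) * (γ * D)) ≡ + 2 * ((α * δ - β * γ) * (D * E))
    l₂ = solve 7 (λ α β γ δ D J E → # 2 :* (α :* D :* (γ :* J :+ δ :* E) :- (α :* J :+ β :* E) :* (γ :* D)) := # 2 :* ((α :* δ :- β :* γ) :* (D :* E))) refl

  -- Positive labels make the determinant positive, so the coordinate matrix has determinant 1 and
  -- not -1.
  reduced-of : ∀ {N D J E} t → Basis D J E t → Odd (T t) → D * E ≡ N → 0ℤ < N →
    0ℤ < la t → 0ℤ < lb t → 0ℤ < lc t → 0ℤ < ld t → ∃ λ y → Reduced N y × Basis⁺ D J E (tileOf y)
  reduced-of {N} t@(tile T a b c d) B o DE N>0 p q r s with basis-inv t B | Basis.unit B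
  ... | i | inj₂ u = ⊥-elim (neg-pos {+ 2 * N} (subst (0ℤ <_) (trans i (trans (cong₂ (λ v w → + 2 * (v * w)) u DE) (l N))) big) (pos* {+ 2} {N} (+<+ (ℕ.s≤s ℕ.z≤n)) N>0))
    where
    big : 0ℤ < la t * lc t + lb t * ld t + + 2 * (T * T)
    big = +-mono-<-≤ (+-mono-< (pos* p r) (pos* q s)) (nat≥0 2 ⊗ sq≥0 T)
    l : ∀ N → + 2 * (-1ℤ * N) ≡ - (+ 2 * N)
    l = solve 1 (λ N → # 2 :* (con -1ℤ :* N) := :- (# 2 :* N)) refl
  ... | i | inj₁ u with Basis.c≡ B
  ... | refl = (T , a , b , d)
             , record { odd-T = o ; la>0 = p ; lb>0 = q ; lc>0 = r ; ld>0 = s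
                      ; inv = trans i (trans (cong₂ (λ v w → + 2 * (v * w)) u DE) (cong (_*_ (+ 2)) (*-identityˡ N))) }
             , (B , u)

  reduced-exists : ∀ {N D J E} → D * E ≡ N → 0ℤ < N → ∀ t → (B : Basis D J E t) → (let open Basis B in α * δ - β * γ ≡ 1ℤ) → Odd (T t) →
    ∃ λ y → Reduced N y × Basis⁺ D J E (tileOf y)
  reduced-exists {N} {D} {J} {E} DE N>0 t B u o with reduce {0ℤ} {N} basis-closed t (reg , o) (mkInv inv) ≤-refl (pos→nn N>0) B
    where
    reg : a t + c t ≡ b t + d t
    reg = trans (cong (_+_ (a t)) (Basis.c≡ B)) (l (a t) (b t) (d t))
      where
      l : ∀ a b d → a + (b + d - a) ≡ b + d
      l = solve 3 (λ a b d → a :+ (b :+ d :- a) := b :+ d) refl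
    inv : la t * lc t + lb t * ld t + + 2 * (T t * T t) ≡ + 2 * (N - 0ℤ)
    inv = trans (basis-inv t B) (cong (_*_ (+ 2)) (trans (cong₂ _*_ u DE) (trans (*-identityˡ N) (sym (+-identityʳ N)))))
  ... | t′ , B′ , (_ , o′) , inj₁ (p , q , r , s) = reduced-of t′ B′ o′ DE N>0 p q r s
  ... | t′ , B′ , R , inj₂ (p , q , r , s) = reduced-of (negate t′) (Closed.neg basis-closed B′) (proj₂ (regular-negate t′ R)) DE N>0
        (flip (T t′) (a t′) p) (flip (T t′) (b t′) q) (flip (T t′) (c t′) r) (flip (T t′) (d t′) s)
    where
    flip : ∀ T x → 0ℤ < - (T + + 4 * x) → 0ℤ < - T + + 4 * - x
    flip T x = subst (0ℤ <_) (l T x)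
      where
      l : ∀ T x → - (T + + 4 * x) ≡ - T + + 4 * - x
      l = solve 2 (λ T x → :- (T :+ # 4 :* x) := :- T :+ # 4 :* :- x) refl

  -- `(p + q) / 2` divides the odd number `2 κ + 1`, so `p + q` is 2 modulo 4; for odd `p` and `q`
  -- this means `q = p` modulo 4.
  triple-mod4 : ∀ {κ} D p q → Triple (+ 2 + + 4 * κ) (D , p , q) →
    ∃ λ m → ∃ λ m′ → (D ≡ p + + 4 * m ⊎ D ≡ - (p + + 4 * m)) × q ≡ p + + 4 * m′
  triple-mod4 {κ} D p q R with odd⇒ (Triple.odd-D R) | odd⇒ (Triple.odd-p R) | odd⇒ (Triple.odd-q R)
  ... | k , refl | i , refl | j , refl with odd⇒ (odd*ʳ {1ℤ + + 2 * k} {1ℤ + i + j} (odd-by κ (*-cancelˡ-≡ (+ 2) _ _ (trans (l₁ k i j) (trans (Triple.prod R) (l₂ κ))))))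
    where
    l₁ : ∀ k i j → + 2 * ((1ℤ + + 2 * k) * (1ℤ + i + j)) ≡ (1ℤ + + 2 * k) * (1ℤ + + 2 * i + (1ℤ + + 2 * j))
    l₁ = solve 3 (λ k i j → # 2 :* ((# 1 :+ # 2 :* k) :* (# 1 :+ i :+ j)) := (# 1 :+ # 2 :* k) :* (# 1 :+ # 2 :* i :+ (# 1 :+ # 2 :* j))) refl
    l₂ : ∀ κ → + 2 + + 4 * κ ≡ + 2 * (1ℤ + + 2 * κ)
    l₂ = solve 1 (λ κ → # 2 :+ # 4 :* κ := # 2 :* (# 1 :+ # 2 :* κ)) refl
  ... | l , e with parity (k - i)
  ... | even m e′ = m , l - i , inj₁ (trans (cong (λ u → 1ℤ + + 2 * u) (trans (l₃ k i) (cong (_+ i) e′))) (l₄ m i)) , q≡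
    where
    l₃ : ∀ k i → k ≡ k - i + i
    l₃ = solve-∀
    l₄ : ∀ m i → 1ℤ + + 2 * (0ℤ + + 2 * m + i) ≡ 1ℤ + + 2 * i + + 4 * m
    l₄ = solve 2 (λ m i → # 1 :+ # 2 :* (# 0 :+ # 2 :* m :+ i) := # 1 :+ # 2 :* i :+ # 4 :* m) refl
    l₅ : ∀ i j → 1ℤ + + 2 * j ≡ 1ℤ + + 2 * (1ℤ + i + j) - + 2 * i - + 2
    l₅ = solve 2 (λ i j → # 1 :+ # 2 :* j := # 1 :+ # 2 :* (# 1 :+ i :+ j) :- # 2 :* i :- # 2) refl
    l₆ : ∀ i l → 1ℤ + + 2 * (1ℤ + + 2 * l) - + 2 * i - + 2 ≡ 1ℤ + + 2 * i + + 4 * (l - i)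
    l₆ = solve 2 (λ i l → # 1 :+ # 2 :* (# 1 :+ # 2 :* l) :- # 2 :* i :- # 2 := # 1 :+ # 2 :* i :+ # 4 :* (l :- i)) refl
    q≡ : 1ℤ + + 2 * j ≡ 1ℤ + + 2 * i + + 4 * (l - i)
    q≡ = trans (l₅ i j) (trans (cong (λ u → 1ℤ + + 2 * u - + 2 * i - + 2) e) (l₆ i l))
  ... | odd m e′ = - 1ℤ - m - i , l - i , inj₂ (trans (cong (λ u → 1ℤ + + 2 * u) (trans (l₃ k i) (cong (_+ i) e′))) (l₄ m i)) , q≡
    where
    l₃ : ∀ k i → k ≡ k - i + i
    l₃ = solve-∀
    l₄ : ∀ m i → 1ℤ + + 2 * (1ℤ + + 2 * m + i) ≡ - (1ℤ + + 2 * i + + 4 * (- 1ℤ - m - i))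
    l₄ = solve 2 (λ m i → # 1 :+ # 2 :* (# 1 :+ # 2 :* m :+ i) := :- (# 1 :+ # 2 :* i :+ # 4 :* (:- # 1 :- m :- i))) refl
    l₅ : ∀ i j → 1ℤ + + 2 * j ≡ 1ℤ + + 2 * (1ℤ + i + j) - + 2 * i - + 2
    l₅ = solve 2 (λ i j → # 1 :+ # 2 :* j := # 1 :+ # 2 :* (# 1 :+ i :+ j) :- # 2 :* i :- # 2) refl
    l₆ : ∀ i l → 1ℤ + + 2 * (1ℤ + + 2 * l) - + 2 * i - + 2 ≡ 1ℤ + + 2 * i + + 4 * (l - i)
    l₆ = solve 2 (λ i l → # 1 :+ # 2 :* (# 1 :+ # 2 :* l) :- # 2 :* i :- # 2 := # 1 :+ # 2 :* i :+ # 4 :* (l :- i)) refl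
    q≡ : 1ℤ + + 2 * j ≡ 1ℤ + + 2 * i + + 4 * (l - i)
    q≡ = trans (l₅ i j) (trans (cong (λ u → 1ℤ + + 2 * u - + 2 * i - + 2) e) (l₆ i l))

  -- The reduction needs a first basis with the right residues modulo 4. For `D = p` modulo 4 it has
  -- the rows `(D , - p)` and `(D , q)`; for `D = - p` modulo 4 it has `(- D , 2 p + q)` and
  -- `(- D , p)`.
  spans-total : ∀ {κ x} → Triple (+ 2 + + 4 * κ) x → ∃ λ y → Reduced (+ 2 + + 4 * κ) y × Spans x y
  spans-total {κ} {D , p , q} R with triple-mod4 {κ} D p q R
  ... | m , m′ , inj₁ refl , refl = reduced-exists (Triple.prod R) N>0 (tile (p + + 2 * m) m m′ (m′ - m) 0ℤ)
        (record { c≡ = l₀ m m′ ; α = 1ℤ ; β = 0ℤ ; γ = 1ℤ ; δ = 1ℤ ; unit = inj₁ refl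
                ; x₁ = l₁ p m ; y₁ = l₂ p m m′ ; x₂ = l₃ p m ; y₂ = l₄ p m m′ }) refl (odd-per m (Triple.odd-p R))
    where
    N>0 : 0ℤ < + 2 + + 4 * κ
    N>0 = subst (0ℤ <_) (Triple.prod R) (pos* (Triple.D>0 R) (+-mono-< (Triple.p>0 R) (Triple.q>0 R)))
    l₀ : ∀ m m′ → m′ - m ≡ m′ + 0ℤ - m
    l₀ = solve 2 (λ m m′ → m′ :- m := m′ :+ # 0 :- m) refl
    l₁ : ∀ p m → p + + 2 * m + + 2 * m + + 2 * 0ℤ ≡ 1ℤ * (p + + 4 * m)
    l₁ = solve 2 (λ p m → p :+ # 2 :* m :+ # 2 :* m :+ # 2 :* # 0 := # 1 :* (p :+ # 4 :* m)) refl
    l₂ : ∀ p m m′ → - (p + + 2 * m) + + 2 * m - + 2 * 0ℤ ≡ 1ℤ * - p + 0ℤ * (p + (p + + 4 * m′))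
    l₂ = solve 3 (λ p m m′ → :- (p :+ # 2 :* m) :+ # 2 :* m :- # 2 :* # 0 := # 1 :* :- p :+ # 0 :* (p :+ (p :+ # 4 :* m′))) refl
    l₃ : ∀ p m → p + + 2 * m + + 2 * m - + 2 * 0ℤ ≡ 1ℤ * (p + + 4 * m)
    l₃ = solve 2 (λ p m → p :+ # 2 :* m :+ # 2 :* m :- # 2 :* # 0 := # 1 :* (p :+ # 4 :* m)) refl
    l₄ : ∀ p m m′ → p + + 2 * m + + 2 * m′ + + 2 * (m′ - m) ≡ 1ℤ * - p + 1ℤ * (p + (p + + 4 * m′))
    l₄ = solve 3 (λ p m m′ → p :+ # 2 :* m :+ # 2 :* m′ :+ # 2 :* (m′ :- m) := # 1 :* :- p :+ # 1 :* (p :+ (p :+ # 4 :* m′))) refl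
  ... | m , m′ , inj₂ refl , refl = reduced-exists (Triple.prod R) N>0 (tile (p + + 2 * (m - m′ - p)) (p + m + m′) (p + m′) (- m) 0ℤ)
        (record { c≡ = l₀ p m m′ ; α = -1ℤ ; β = 1ℤ ; γ = -1ℤ ; δ = 0ℤ ; unit = inj₁ refl
                ; x₁ = l₁ p m m′ ; y₁ = l₂ p m m′ ; x₂ = l₃ p m m′ ; y₂ = l₄ p m m′ }) refl (odd-per (m - m′ - p) (Triple.odd-p R))
    where
    N>0 : 0ℤ < + 2 + + 4 * κ
    N>0 = subst (0ℤ <_) (Triple.prod R) (pos* (Triple.D>0 R) (+-mono-< (Triple.p>0 R) (Triple.q>0 R)))
    l₀ : ∀ p m m′ → - m ≡ p + m′ + 0ℤ - (p + m + m′)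
    l₀ = solve 3 (λ p m m′ → :- m := p :+ m′ :+ # 0 :- (p :+ m :+ m′)) refl
    l₁ : ∀ p m m′ → p + + 2 * (m - m′ - p) + + 2 * (p + m + m′) + + 2 * 0ℤ ≡ -1ℤ * - (p + + 4 * m)
    l₁ = solve 3 (λ p m m′ → p :+ # 2 :* (m :- m′ :- p) :+ # 2 :* (p :+ m :+ m′) :+ # 2 :* # 0 := con -1ℤ :* :- (p :+ # 4 :* m)) refl
    l₂ : ∀ p m m′ → - (p + + 2 * (m - m′ - p)) + + 2 * (p + m + m′) - + 2 * 0ℤ ≡ -1ℤ * - p + 1ℤ * (p + (p + + 4 * m′))
    l₂ = solve 3 (λ p m m′ → :- (p :+ # 2 :* (m :- m′ :- p)) :+ # 2 :* (p :+ m :+ m′) :- # 2 :* # 0 := con -1ℤ :* :- p :+ # 1 :* (p :+ (p :+ # 4 :* m′))) refl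
    l₃ : ∀ p m m′ → p + + 2 * (m - m′ - p) + + 2 * (p + m + m′) - + 2 * 0ℤ ≡ -1ℤ * - (p + + 4 * m)
    l₃ = solve 3 (λ p m m′ → p :+ # 2 :* (m :- m′ :- p) :+ # 2 :* (p :+ m :+ m′) :- # 2 :* # 0 := con -1ℤ :* :- (p :+ # 4 :* m)) refl
    l₄ : ∀ p m m′ → p + + 2 * (m - m′ - p) + + 2 * (p + m′) + + 2 * - m ≡ -1ℤ * - p + 0ℤ * (p + (p + + 4 * m′))
    l₄ = solve 3 (λ p m m′ → p :+ # 2 :* (m :- m′ :- p) :+ # 2 :* (p :+ m′) :+ # 2 :* :- m := con -1ℤ :* :- p :+ # 0 :* (p :+ (p :+ # 4 :* m′))) refl

  -- Transfers an enumeration along a relation that is one-to-one on `P` and `Q`. The target is not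
  -- assumed finite; its enumeration is produced here.
  relation-image : ∀ {A B : Set} {P : A → Set} {Q : B → Set} (F : Finite P) → Decidable P → B → (R : A → B → Set) →
    (∀ {x} → P x → ∃ λ y → Q y × R x y) → (∀ {y} → Q y → ∃ λ x → P x × R x y) →
    (∀ {x y y′} → Q y → Q y′ → R x y → R x y′ → y ≡ y′) → (∀ {x x′ y} → P x → P x′ → R x y → R x′ y → x ≡ x′) →
    Σ (Finite Q) λ G → count F ≡ count G
  relation-image {A} {B} {P} {Q} F P? y₀ R total surj func inj = image F f f∈ f-inj f-surj , ∑-bij F (image F f f∈ f-inj f-surj) f f∈ f-inj f-surj (λ _ → refl)
    where
    f : A → B
    f x with P? x
    ... | yes p = proj₁ (total p)
    -- A default value outside `P`.
    ... | no _  = y₀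
    spec : ∀ {x} → P x → Q (f x) × R x (f x)
    spec {x} p with P? x
    ... | yes p′ = proj₂ (total p′)
    ... | no ¬p  = ⊥-elim (¬p p)
    f∈ : ∀ {x} → P x → Q (f x)
    f∈ p = proj₁ (spec p)
    f-inj : ∀ {x x′} → P x → P x′ → f x ≡ f x′ → x ≡ x′
    f-inj {x} {x′} p p′ e = inj p p′ (proj₂ (spec p)) (subst (R x′) (sym e) (proj₂ (spec p′)))
    f-surj : ∀ {y} → Q y → ∃ λ x → P x × f x ≡ y
    f-surj q = let (x , p , r) = surj q in x , p , func (proj₁ (spec p)) q (proj₂ (spec p)) r

  -- Uniqueness of the Hermite normal form: `D` and `D′` divide each other, hence the second
  -- diagonal entries agree, and `p` and `p′` are congruent modulo that entry and lie strictly
  -- between 0 and it.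
  spans-injective : ∀ {N x x′ y} → Triple N x → Triple N x′ → Spans x y → Spans x′ y → x ≡ x′
  spans-injective {N} {D , p , q} {D′ , p′ , q′} {y} R R′ (B , det) (B′ , det′) = cong₂ _,_ D≡ (cong₂ _,_ p≡ q≡)
    where
    module R = Triple R
    module R′ = Triple R′
    open Basis B
    open Basis B′ renaming (α to α′; β to β′; γ to γ′; δ to δ′; x₁ to x₁′; x₂ to x₂′; y₁ to y₁′; y₂ to y₂′) hiding (c≡; unit)
    t = tileOf y
    col : ∀ α β γ δ D → (α * δ - β * γ) * D ≡ δ * (α * D) - β * (γ * D)
    col = solve 5 (λ α β γ δ D → (α :* δ :- β :* γ) :* D := δ :* (α :* D) :- β :* (γ :* D)) refl
    base : ∀ {α β γ δ D X X′} → α * δ - β * γ ≡ 1ℤ → X ≡ α * D → X′ ≡ γ * D → D ≡ δ * X - β * X′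
    base {α} {β} {γ} {δ} {D} det e e′ = trans (sym (*-identityˡ D)) (trans (cong (_* D) (sym det)) (trans (col α β γ δ D) (sym (cong₂ (λ u v → δ * u - β * v) e e′))))
    pull : ∀ α′ γ′ δ β D′ → δ * (α′ * D′) - β * (γ′ * D′) ≡ D′ * (δ * α′ - β * γ′)
    pull = solve 5 (λ α′ γ′ δ β D′ → δ :* (α′ :* D′) :- β :* (γ′ :* D′) := D′ :* (δ :* α′ :- β :* γ′)) refl
    k k′ w : ℤ
    k = δ * α′ - β * γ′
    k′ = δ′ * α - β′ * γ
    w = δ * β′ - β * δ′
    Dk : D ≡ D′ * k
    Dk = trans (base {α} {β} {γ} {δ} det x₁ x₂) (trans (cong₂ (λ u v → δ * u - β * v) x₁′ x₂′) (pull α′ γ′ δ β D′))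
    Dk′ : D′ ≡ D * k′
    Dk′ = trans (base {α′} {β′} {γ′} {δ′} det′ x₁′ x₂′) (trans (cong₂ (λ u v → δ′ * u - β′ * v) x₁ x₂) (pull α γ δ′ β′ D))
    k>0 : 0ℤ < k
    k>0 = pos*-cancelˡ {D′} {k} R′.D>0 (subst (0ℤ <_) Dk R.D>0)
    k′>0 : 0ℤ < k′
    k′>0 = pos*-cancelˡ {D} {k′} R.D>0 (subst (0ℤ <_) Dk′ R′.D>0)
    k1 : k ≡ 1ℤ
    k1 = factor-1 {k} {k′} k>0 k′>0 (sym (pos*-cancel-≡ {D} {1ℤ} {k * k′} R.D>0 (trans (*-identityʳ D) (trans Dk (trans (cong (_* k) Dk′) (trans (*-assoc D k′ k) (cong (_*_ D) (*-comm k′ k))))))))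
    D≡ : D ≡ D′
    D≡ = trans Dk (trans (cong (_*_ D′) k1) (*-identityʳ D′))
    E E′ : ℤ
    E = p + q
    E′ = p′ + q′
    E≡ : E ≡ E′
    E≡ = pos*-cancel-≡ {D} {E} {E′} R.D>0 (trans R.prod (trans (sym R′.prod) (cong (_* E′) (sym D≡))))
    J≡ : - p ≡ - p′ + w * E′
    J≡ = trans (sym (*-identityˡ (- p))) (trans (cong (_* - p) (sym det)) (trans (l₁ α β γ δ (- p) E) (trans (sym (cong₂ (λ u v → δ * u - β * v) y₁ y₂))
         (trans (cong₂ (λ u v → δ * u - β * v) y₁′ y₂′) (trans (l₂ α′ β′ γ′ δ′ β δ (- p′) E′) (trans (cong (λ u → u * - p′ + w * E′) k1) (cong (_+ w * E′) (*-identityˡ (- p′)))))))))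
      where
      l₁ : ∀ α β γ δ J E → (α * δ - β * γ) * J ≡ δ * (α * J + β * E) - β * (γ * J + δ * E)
      l₁ = solve 6 (λ α β γ δ J E → (α :* δ :- β :* γ) :* J := δ :* (α :* J :+ β :* E) :- β :* (γ :* J :+ δ :* E)) refl
      l₂ : ∀ α′ β′ γ′ δ′ β δ J E → δ * (α′ * J + β′ * E) - β * (γ′ * J + δ′ * E) ≡ (δ * α′ - β * γ′) * J + (δ * β′ - β * δ′) * E
      l₂ = solve 8 (λ α′ β′ γ′ δ′ β δ J E → δ :* (α′ :* J :+ β′ :* E) :- β :* (γ′ :* J :+ δ′ :* E) := (δ :* α′ :- β :* γ′) :* J :+ (δ :* β′ :- β :* δ′) :* E) refl
    p′≡ : p′ ≡ p + w * E′
    p′≡ = trans (l₁ p′ (w * E′)) (trans (cong (λ u → - u + w * E′) (sym J≡)) (cong (_+ w * E′) (neg-involutive p)))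
      where
      l₁ : ∀ p′ v → p′ ≡ - (- p′ + v) + v
      l₁ = solve 2 (λ p′ v → p′ := :- (:- p′ :+ v) :+ v) refl
    E′>0 : 0ℤ < E′
    E′>0 = +-mono-< R′.p>0 R′.q>0
    w0 : w ≡ 0ℤ
    w0 with sign w
    ... | isZero e = e
    ... | isPos h = ⊥-elim (absurd {n = 1} (pred≥0 h ⊗ pos→nn E′>0 ⊕ pred≥0 R.p>0 ⊕ pred≥0 R′.q>0) (trans (l₁ p p′ q′ w) (trans (cong (λ u → u - p′ - + 2) (sym p′≡)) (l₂ p′))))
      where
      l₁ : ∀ p p′ q′ w → (w - 1ℤ) * (p′ + q′) + (p - 1ℤ) + (q′ - 1ℤ) ≡ p + w * (p′ + q′) - p′ - + 2
      l₁ = solve 4 (λ p p′ q′ w → (w :- # 1) :* (p′ :+ q′) :+ (p :- # 1) :+ (q′ :- # 1) := p :+ w :* (p′ :+ q′) :- p′ :- # 2) refl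
      l₂ : ∀ p′ → p′ - p′ - + 2 ≡ -[1+ 1 ]
      l₂ = solve-∀
    ... | isNeg h = ⊥-elim (absurd {n = 1} (pred≥0 h ⊗ pos→nn E′>0 ⊕ pred≥0 R′.p>0 ⊕ pred≥0 R.q>0)
        (trans (l₁ p q p′ E′ w) (trans (cong₂ (λ u v → p - u - v + (p′ + q) - + 2) (sym p′≡) (sym E≡)) (l₂ p q p′))))
      where
      l₁ : ∀ p q p′ E′ w → (- w - 1ℤ) * E′ + (p′ - 1ℤ) + (q - 1ℤ) ≡ p - (p + w * E′) - E′ + (p′ + q) - + 2
      l₁ = solve 5 (λ p q p′ E′ w → (:- w :- # 1) :* E′ :+ (p′ :- # 1) :+ (q :- # 1) := p :- (p :+ w :* E′) :- E′ :+ (p′ :+ q) :- # 2) refl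
      l₂ : ∀ p q p′ → p - p′ - (p + q) + (p′ + q) - + 2 ≡ -[1+ 1 ]
      l₂ = solve 3 (λ p q p′ → p :- p′ :- (p :+ q) :+ (p′ :+ q) :- # 2 := con -[1+ 1 ]) refl
    p≡ : p ≡ p′
    p≡ = sym (trans p′≡ (trans (cong (λ u → p + u * E′) w0) (+-identityʳ p)))
    q≡ : q ≡ q′
    q≡ = trans (l p q) (trans (cong₂ _-_ E≡ p≡) (sym (l p′ q′)))
      where
      l : ∀ p q → q ≡ p + q - p
      l = solve-∀

  -- Correcting `(D , J′)` by `s` times `(0 , E)` changes only the coordinates along `(0 , E)`.
  hermite : ∀ {D α γ β₀ δ₀ J′ E r s} y → α * δ₀ - β₀ * γ ≡ 1ℤ → X₁ (tileOf y) ≡ α * D → X₂ (tileOf y) ≡ γ * D →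
    Y₁ (tileOf y) ≡ α * J′ + β₀ * E → Y₂ (tileOf y) ≡ γ * J′ + δ₀ * E → J′ ≡ - r - s * E → Spans (D , r , E - r) y
  hermite {D} {α} {γ} {β₀} {δ₀} {J′} {E} {r} {s} y det x₁ x₂ y₁ y₂ J≡ =
    record { c≡ = refl ; α = α ; β = β₀ - α * s ; γ = γ ; δ = δ₀ - γ * s ; unit = inj₁ det′ ; x₁ = x₁ ; x₂ = x₂
           ; y₁ = trans y₁ (trans (cong (λ u → α * u + β₀ * E) J≡) (l α β₀ r s E))
           ; y₂ = trans y₂ (trans (cong (λ u → γ * u + δ₀ * E) J≡) (l γ δ₀ r s E)) } , det′
    where
    l : ∀ α β r s E → α * (- r - s * E) + β * E ≡ α * - r + (β - α * s) * (r + (E - r))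
    l = solve 5 (λ α β r s E → α :* (:- r :- s :* E) :+ β :* E := α :* :- r :+ (β :- α :* s) :* (r :+ (E :- r))) refl
    l′ : ∀ α β γ δ s → α * (δ - γ * s) - (β - α * s) * γ ≡ α * δ - β * γ
    l′ = solve 5 (λ α β γ δ s → α :* (δ :- γ :* s) :- (β :- α :* s) :* γ := α :* δ :- β :* γ) refl
    det′ : α * (δ₀ - γ * s) - (β₀ - α * s) * γ ≡ 1ℤ
    det′ = trans (l′ α β₀ γ δ₀ s) det

  reduced-det : ∀ {N} y → Reduced N y → X₁ (tileOf y) * Y₂ (tileOf y) - Y₁ (tileOf y) * X₂ (tileOf y) ≡ N
  reduced-det {N} (T , a , b , d) R = *-cancelˡ-≡ (+ 2) _ N (trans (l T a b d) (Reduced.inv R))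
    where
    l : ∀ T a b d → + 2 * ((T + + 2 * a + + 2 * d) * (T + + 2 * b + + 2 * (b + d - a)) - (- T + + 2 * a - + 2 * d) * (T + + 2 * a - + 2 * d))
      ≡ (T + + 4 * a) * (T + + 4 * (b + d - a)) + (T + + 4 * b) * (T + + 4 * d) + + 2 * (T * T)
    l = solve 4 (λ T a b d → # 2 :* ((T :+ # 2 :* a :+ # 2 :* d) :* (T :+ # 2 :* b :+ # 2 :* (b :+ d :- a)) :- (:- T :+ # 2 :* a :- # 2 :* d) :* (T :+ # 2 :* a :- # 2 :* d)) := (T :+ # 4 :* a) :* (T :+ # 4 :* (b :+ d :- a)) :+ (T :+ # 4 :* b) :* (T :+ # 4 :* d) :+ # 2 :* (T :* T)) refl

  reduced-X₁ : ∀ {N} y → Reduced N y → 0ℤ < X₁ (tileOf y)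
  reduced-X₁ (T , a , b , d) R = pos-double {T + + 2 * a + + 2 * d} (subst (0ℤ <_) (l T a d) (+-mono-< (Reduced.la>0 R) (Reduced.ld>0 R)))
    where
    l : ∀ T a d → T + + 4 * a + (T + + 4 * d) ≡ + 2 * (T + + 2 * a + + 2 * d)
    l = solve 3 (λ T a d → T :+ # 4 :* a :+ (T :+ # 4 :* d) := # 2 :* (T :+ # 2 :* a :+ # 2 :* d)) refl

  residue : ∀ J E → 0ℤ < E → ∃ λ r → ∃ λ s → J ≡ - r - s * E × 0ℤ ≤ r × 0ℤ < E - r
  residue J (+ zero) (+<+ ())
  residue J E@(+ suc e) _ = + (- J %ℕ suc e) , - J /ℕ suc e ,
      trans (sym (neg-involutive J)) (trans (cong -_ (a≡a%ℕn+[a/ℕn]*n (- J) (suc e))) (l (+ (- J %ℕ suc e)) (- J /ℕ suc e) E))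
      , nat≥0 (- J %ℕ suc e)
      , subst (_< E - + (- J %ℕ suc e)) (+-inverseʳ (+ (- J %ℕ suc e))) (+-monoˡ-< (- + (- J %ℕ suc e)) (+<+ (n%ℕd<d (- J) (suc e))))
    where
    l : ∀ r s E → - (r + s * E) ≡ - r - s * E
    l = solve 3 (λ r s E → :- (r :+ s :* E) := :- r :- s :* E) refl

  odd-residue : ∀ {α β E ε J′ r s Y} → Odd Y → Y ≡ α * J′ + β * E → E ≡ + 2 * ε → J′ ≡ - r - s * E → Odd r
  odd-residue {α} {β} {E} {ε} {J′} {r} {s} {Y} oY Y≡ E≡ J′≡ = subst Odd (trans (cong (_+ + 2 * - (s * ε)) (trans (cong -_ J′≡) (cong (λ z → - (- r - s * z)) E≡))) (l₂ r s ε)) (odd-per (- (s * ε)) (odd-neg oJ))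
    where
    l₁ : ∀ a β l → a + β * (+ 2 * l) + + 2 * - (β * l) ≡ a
    l₁ = solve 3 (λ a β l → a :+ β :* (# 2 :* l) :+ # 2 :* :- (β :* l) := a) refl
    l₂ : ∀ r s l → - (- r - s * (+ 2 * l)) + + 2 * - (s * l) ≡ r
    l₂ = solve 3 (λ r s l → :- (:- r :- s :* (# 2 :* l)) :+ # 2 :* :- (s :* l) := r) refl
    oJ : Odd J′
    oJ = odd*ʳ {α} {J′} (subst Odd (trans (cong (_+ + 2 * - (β * ε)) (trans Y≡ (cong (λ z → α * J′ + β * z) E≡))) (l₁ (α * J′) β ε)) (odd-per (- (β * ε)) oY))

  odd-pos : ∀ {r} → Odd r → 0ℤ ≤ r → 0ℤ < r
  odd-pos {r} o r≥0 with odd-sign o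
  ... | inj₂ h = h
  ... | inj₁ h = ⊥-elim (absurd {n = 0} (pred≥0 h ⊕ r≥0) (l r))
    where
    l : ∀ r → - r - 1ℤ + r ≡ -[1+ 0 ]
    l = solve 1 (λ r → :- r :- # 1 :+ r := con -[1+ 0 ]) refl

  even-minus-odd : ∀ {E ε r} → E ≡ + 2 * ε → Odd r → Odd (E - r)
  even-minus-odd {E} {ε} {r} E≡ o = subst Odd (trans (l ε r) (cong (_- r) (sym E≡))) (odd-per ε (odd-neg o))
    where
    l : ∀ l r → - r + + 2 * l ≡ + 2 * l - r
    l = solve 2 (λ l r → :- r :+ # 2 :* l := # 2 :* l :- r) refl

  -- All parities come from the first row. `D` divides the odd `X`; since `D E` is even, `E` is
  -- even; and an even `E` passes the oddness of `Y` on to `r` and to `E - r`.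
  hermite-triple : ∀ {κ D α β E J′ r s X Y} → 0ℤ < D → D * E ≡ + 2 + + 4 * κ → Odd X → Odd Y →
    X ≡ α * D → Y ≡ α * J′ + β * E → J′ ≡ - r - s * E → 0ℤ ≤ r → 0ℤ < E - r → Triple (+ 2 + + 4 * κ) (D , r , E - r)
  hermite-triple {κ} {D} {α} {β} {E} {J′} {r} {s} {X} {Y} D>0 DE oX oY X≡ Y≡ J′≡ r≥0 q>0 =
    let oD = odd*ʳ {α} {D} (subst Odd X≡ oX)
        ε , E≡ = even-factor {E} {D} (1ℤ + + 2 * κ) oD (trans (*-comm E D) (trans DE (l₁ κ)))
        o-r = odd-residue {α} {β} {E} {ε} {J′} {r} {s} {Y} oY Y≡ E≡ J′≡
    in record { D>0 = D>0 ; p>0 = odd-pos o-r r≥0 ; q>0 = q>0 ; odd-D = oD ; odd-p = o-r ; odd-q = even-minus-odd {E} {ε} {r} E≡ o-r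
              ; prod = trans (cong (_*_ D) (l₂ r E)) DE }
    where
    l₁ : ∀ κ → + 2 + + 4 * κ ≡ + 2 * (1ℤ + + 2 * κ)
    l₁ = solve 1 (λ κ → # 2 :+ # 4 :* κ := # 2 :* (# 1 :+ # 2 :* κ)) refl
    l₂ : ∀ r E → r + (E - r) ≡ E
    l₂ = solve-∀

  -- Column reduction: `D` is the gcd of the first column, the Bézout coefficients complete its
  -- cofactors to a unimodular matrix, and the other diagonal entry is the determinant divided by
  -- `D`.
  spans-surjective′ : ∀ {κ} y (X Y X′ Y′ : ℤ) → X₁ (tileOf y) ≡ X → Y₁ (tileOf y) ≡ Y → X₂ (tileOf y) ≡ X′ → Y₂ (tileOf y) ≡ Y′ →
    Odd X → Odd Y → 0ℤ < X → 0ℤ < + 2 + + 4 * κ → X * Y′ - Y * X′ ≡ + 2 + + 4 * κ → ∃ λ x → Triple (+ 2 + + 4 * κ) x × Spans x y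
  spans-surjective′ {κ} y X Y X′ Y′ eX eY eX′ eY′ oX oY X>0 N>0 det =
    let D , α , γ , u , v , D>0 , X≡ , X′≡ , uv = bezout X X′ X>0
        DE = trans (l₁ D α γ Y Y′) (trans (sym (cong₂ (λ p q → p * Y′ - Y * q) X≡ X′≡)) det)
        E>0 = pos*-cancelˡ {D} {α * Y′ - γ * Y} D>0 (subst (0ℤ <_) (sym DE) N>0)
        r , s , J′≡ , r≥0 , q>0 = residue (u * Y - (- v) * Y′) (α * Y′ - γ * Y) E>0
        det₁ = trans (l₂ α γ u v) uv
        Y≡ = trans (sym (*-identityˡ Y)) (trans (cong (_* Y) (sym det₁)) (l₃ α γ u v Y Y′))
        Y′≡ = trans (sym (*-identityˡ Y′)) (trans (cong (_* Y′) (sym det₁)) (l₄ α γ u v Y Y′))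
    in (D , r , α * Y′ - γ * Y - r)
       , hermite-triple {κ} {D} {α} { - v} {α * Y′ - γ * Y} {u * Y - (- v) * Y′} {r} {s} {X} {Y} D>0 DE oX oY X≡ Y≡ J′≡ r≥0 q>0
       , hermite {D} {α} {γ} { - v} {u} {u * Y - (- v) * Y′} {α * Y′ - γ * Y} {r} {s} y det₁ (trans eX X≡) (trans eX′ X′≡) (trans eY Y≡) (trans eY′ Y′≡) J′≡
    where
    l₁ : ∀ D α γ Y Y′ → D * (α * Y′ - γ * Y) ≡ α * D * Y′ - Y * (γ * D)
    l₁ = solve 5 (λ D α γ Y Y′ → D :* (α :* Y′ :- γ :* Y) := α :* D :* Y′ :- Y :* (γ :* D)) refl
    l₂ : ∀ α γ u v → α * u - (- v) * γ ≡ α * u + γ * v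
    l₂ = solve 4 (λ α γ u v → α :* u :- (:- v) :* γ := α :* u :+ γ :* v) refl
    l₃ : ∀ α γ u v Y Y′ → (α * u - (- v) * γ) * Y ≡ α * (u * Y - (- v) * Y′) + - v * (α * Y′ - γ * Y)
    l₃ = solve 6 (λ α γ u v Y Y′ → (α :* u :- (:- v) :* γ) :* Y := α :* (u :* Y :- (:- v) :* Y′) :+ :- v :* (α :* Y′ :- γ :* Y)) refl
    l₄ : ∀ α γ u v Y Y′ → (α * u - (- v) * γ) * Y′ ≡ γ * (u * Y - (- v) * Y′) + u * (α * Y′ - γ * Y)
    l₄ = solve 6 (λ α γ u v Y Y′ → (α :* u :- (:- v) :* γ) :* Y′ := γ :* (u :* Y :- (:- v) :* Y′) :+ u :* (α :* Y′ :- γ :* Y)) refl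

  spans-surjective : ∀ {κ y} → 0ℤ < + 2 + + 4 * κ → Reduced (+ 2 + + 4 * κ) y → ∃ λ x → Triple (+ 2 + + 4 * κ) x × Spans x y
  spans-surjective {κ} {y@(T , a , b , d)} N>0 R = spans-surjective′ {κ} y (X₁ t) (Y₁ t) (X₂ t) (Y₂ t) refl refl refl refl
      (subst Odd (l₁ T a d) (odd-per (a + d) (Reduced.odd-T R)))
      (subst Odd (l₂ T a d) (odd-per (a - d) (odd-neg (Reduced.odd-T R))))
      (reduced-X₁ y R) N>0 (reduced-det y R)
    where
    t = tileOf y
    l₁ : ∀ T a d → T + + 2 * (a + d) ≡ T + + 2 * a + + 2 * d
    l₁ = solve 3 (λ T a d → T :+ # 2 :* (a :+ d) := T :+ # 2 :* a :+ # 2 :* d) refl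
    l₂ : ∀ T a d → - T + + 2 * (a - d) ≡ - T + + 2 * a - + 2 * d
    l₂ = solve 3 (λ T a d → :- T :+ # 2 :* (a :- d) := :- T :+ # 2 :* a :- # 2 :* d) refl

  triple? : ∀ N → Decidable (Triple N)
  triple? N (D , p , q) = map′
    (λ (a , b , c , d , e , f , g) → record { D>0 = a ; p>0 = b ; q>0 = c ; odd-D = d ; odd-p = e ; odd-q = f ; prod = g })
    (λ R → let open Triple R in D>0 , p>0 , q>0 , odd-D , odd-p , odd-q , prod)
    (0<? D ×-dec 0<? p ×-dec 0<? q ×-dec odd? D ×-dec odd? p ×-dec odd? q ×-dec (D * (p + q) ≟ N))

  triples : ∀ N → Finite (Triple N)
  triples N = finite₃ M (triple? N) bound
    where
    M = ∣ N ∣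
    bound : ∀ {x} → Triple N x → Abs≤ M (proj₁ x) × Abs≤ M (proj₁ (proj₂ x)) × Abs≤ M (proj₂ (proj₂ x))
    bound {D , p , q} R = ≤⇒Abs≤ D (by (+∣ N ∣≥ ⊕ (pred≥0 D>0 ⊗ (pred≥0 p>0 ⊕ pos→nn q>0) ⊕ pred≥0 p>0 ⊕ pos→nn q>0)) (trans (pad D) (l₁ (+ ∣ N ∣) N D p q))) (nat≥0 ∣ N ∣ ⊕ pos→nn D>0)
                        , ≤⇒Abs≤ p (by (+∣ N ∣≥ ⊕ (pred≥0 D>0 ⊗ (pos→nn p>0 ⊕ pos→nn q>0) ⊕ pos→nn q>0)) (trans (pad p) (l₂ (+ ∣ N ∣) N D p q))) (nat≥0 ∣ N ∣ ⊕ pos→nn p>0)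
                        , ≤⇒Abs≤ q (by (+∣ N ∣≥ ⊕ (pred≥0 D>0 ⊗ (pos→nn p>0 ⊕ pos→nn q>0) ⊕ pos→nn p>0)) (trans (pad q) (l₃ (+ ∣ N ∣) N D p q))) (nat≥0 ∣ N ∣ ⊕ pos→nn q>0)
      where
      open Triple R hiding (D; p; q)
      pad : ∀ x → + ∣ N ∣ - x ≡ + ∣ N ∣ - x + (D * (p + q) - N)
      pad x = sym (trans (cong (λ z → + ∣ N ∣ - x + (z - N)) prod) (l₀ (+ ∣ N ∣ - x) N))
        where
        l₀ : ∀ u N → u + (N - N) ≡ u
        l₀ = solve-∀
      l₁ : ∀ M N D p q → M - D + (D * (p + q) - N) ≡ M - N + ((D - 1ℤ) * (p - 1ℤ + q) + (p - 1ℤ) + q)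
      l₁ = solve 5 (λ M N D p q → M :- D :+ (D :* (p :+ q) :- N) := M :- N :+ ((D :- # 1) :* (p :- # 1 :+ q) :+ (p :- # 1) :+ q)) refl
      l₂ : ∀ M N D p q → M - p + (D * (p + q) - N) ≡ M - N + ((D - 1ℤ) * (p + q) + q)
      l₂ = solve 5 (λ M N D p q → M :- p :+ (D :* (p :+ q) :- N) := M :- N :+ ((D :- # 1) :* (p :+ q) :+ q)) refl
      l₃ : ∀ M N D p q → M - q + (D * (p + q) - N) ≡ M - N + ((D - 1ℤ) * (p + q) + p)
      l₃ = solve 5 (λ M N D p q → M :- q :+ (D :* (p :+ q) :- N) := M :- N :+ ((D :- # 1) :* (p :+ q) :+ p)) refl

  reduced-count : ∀ κ → 0ℤ < + 2 + + 4 * κ → Σ (Finite (Reduced (+ 2 + + 4 * κ))) λ F → count (triples (+ 2 + + 4 * κ)) ≡ count F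
  reduced-count κ N>0 = relation-image (triples N) (triple? N) (0ℤ , 0ℤ , 0ℤ , 0ℤ) Spans
    (spans-total {κ}) (spans-surjective {κ} N>0) (λ {x} → reduced-unique) (λ {x} {x′} → spans-injective {N} {x} {x′})
    where N = + 2 + + 4 * κ

  -- Positive binary forms A x² + 4 b x y + C y² of determinant 1 + 4 μ, reduced for the action of Γ(2)
  record Form (μ : ℤ) (f : ℤ³) : Set where
    A : ℤ
    A = proj₁ f
    b′ : ℤ
    b′ = proj₁ (proj₂ f)
    C : ℤ
    C = proj₂ (proj₂ f)
    field
      A-b : 0ℤ < A - + 2 * b′
      A+b : 0ℤ < A + + 2 * b′
      C-b : 0ℤ < C - + 2 * b′
      C+b : 0ℤ < C + + 2 * b′
      det : A * C - + 4 * (b′ * b′) ≡ 1ℤ + + 4 * μ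

  form? : ∀ μ → Decidable (Form μ)
  form? μ (A , b , C) = map′
    (λ (p , q , r , s , e) → record { A-b = p ; A+b = q ; C-b = r ; C+b = s ; det = e })
    (λ F → let open Form F in A-b , A+b , C-b , C+b , det)
    (0<? (A - + 2 * b) ×-dec 0<? (A + + 2 * b) ×-dec 0<? (C - + 2 * b) ×-dec 0<? (C + + 2 * b) ×-dec (A * C - + 4 * (b * b) ≟ 1ℤ + + 4 * μ))

  -- Bounds `A`, and by symmetry `C`, by the determinant, which leaves finitely many reduced forms.
  form-bound : ∀ A b C → 0ℤ < A - + 2 * b → 0ℤ < A + + 2 * b → 0ℤ < C - + 2 * b → 0ℤ < C + + 2 * b → 0ℤ ≤ A * C - + 4 * (b * b) - A
  form-bound A b C p q r s with ≤-total 0ℤ b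
  ... | inj₁ b≥0 = by (pos→nn A>0 ⊗ pred≥0 r ⊕ nat≥0 2 ⊗ (b≥0 ⊗ pos→nn p)) (l A b C)
    where
    A>0 : 0ℤ < A
    A>0 = half-pos {A} p q (l′ A b)
      where
      l′ : ∀ A b → A - + 2 * b + (A + + 2 * b) ≡ + 2 * A
      l′ = solve 2 (λ A b → A :- # 2 :* b :+ (A :+ # 2 :* b) := # 2 :* A) refl
    l : ∀ A b C → A * C - + 4 * (b * b) - A ≡ A * (C - + 2 * b - 1ℤ) + + 2 * (b * (A - + 2 * b))
    l = solve 3 (λ A b C → A :* C :- # 4 :* (b :* b) :- A := A :* (C :- # 2 :* b :- # 1) :+ # 2 :* (b :* (A :- # 2 :* b))) refl
  ... | inj₂ b≤0 = by (pos→nn A>0 ⊗ pred≥0 s ⊕ nat≥0 2 ⊗ (neg-mono-≤ b≤0 ⊗ pos→nn q)) (l A b C)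
    where
    A>0 : 0ℤ < A
    A>0 = half-pos {A} p q (l′ A b)
      where
      l′ : ∀ A b → A - + 2 * b + (A + + 2 * b) ≡ + 2 * A
      l′ = solve 2 (λ A b → A :- # 2 :* b :+ (A :+ # 2 :* b) := # 2 :* A) refl
    l : ∀ A b C → A * C - + 4 * (b * b) - A ≡ A * (C + + 2 * b - 1ℤ) + + 2 * (- b * (A + + 2 * b))
    l = solve 3 (λ A b C → A :* C :- # 4 :* (b :* b) :- A := A :* (C :+ # 2 :* b :- # 1) :+ # 2 :* (:- b :* (A :+ # 2 :* b))) refl

  forms : ∀ μ → Finite (Form μ)
  forms μ = finite₃ M (form? μ) bound
    where
    m = 1ℤ + + 4 * μ
    M = ∣ m ∣
    half : ∀ {x y} → 0ℤ < x - + 2 * y → 0ℤ < x + + 2 * y → 0ℤ ≤ x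
    half {x} {y} p q = pos→nn (half-pos {x} p q (l x y))
      where
      l : ∀ x y → x - + 2 * y + (x + + 2 * y) ≡ + 2 * x
      l = solve 2 (λ x y → x :- # 2 :* y :+ (x :+ # 2 :* y) := # 2 :* x) refl
    le : ∀ {x z} → z ≡ m → 0ℤ ≤ z - x → 0ℤ ≤ + M - x
    le {x} refl h = by (+∣ m ∣≥ ⊕ h) (l (+ M) m x)
      where
      l : ∀ M m x → M - x ≡ M - m + (m - x)
      l = solve 3 (λ M m x → M :- x := M :- m :+ (m :- x)) refl
    bound : ∀ {f} → Form μ f → Abs≤ M (proj₁ f) × Abs≤ M (proj₁ (proj₂ f)) × Abs≤ M (proj₂ (proj₂ f))
    bound {A , b , C} F = ≤⇒Abs≤ A A≤ (nat≥0 M ⊕ half {A} {b} A-b A+b)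
                        , ≤⇒Abs≤ b (by (A≤ ⊕ abs₁) (l₁ (+ M) A b)) (by (A≤ ⊕ abs₂) (l₂ (+ M) A b))
                        , ≤⇒Abs≤ C C≤ (nat≥0 M ⊕ half {C} {b} C-b C+b)
      where
      open Form F hiding (A; b′; C)
      A≤ : 0ℤ ≤ + M - A
      A≤ = le {A} {A * C - + 4 * (b * b)} det (form-bound A b C A-b A+b C-b C+b)
      C≤ : 0ℤ ≤ + M - C
      C≤ = le {C} {C * A - + 4 * (b * b)} (trans (cong (_- + 4 * (b * b)) (*-comm C A)) det) (form-bound C b A C-b C+b A-b A+b)
      abs₁ : 0ℤ ≤ A - b
      abs₁ with ≤-total 0ℤ b
      ... | inj₁ b≥0 = by (pos→nn A-b ⊕ b≥0) (l A b)
        where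
        l : ∀ A b → A - b ≡ A - + 2 * b + b
        l = solve 2 (λ A b → A :- b := A :- # 2 :* b :+ b) refl
      ... | inj₂ b≤0 = half {A} {b} A-b A+b ⊕ neg-mono-≤ b≤0
      abs₂ : 0ℤ ≤ A + b
      abs₂ with ≤-total 0ℤ b
      ... | inj₁ b≥0 = half {A} {b} A-b A+b ⊕ b≥0
      ... | inj₂ b≤0 = by (pos→nn A+b ⊕ neg-mono-≤ b≤0) (l A b)
        where
        l : ∀ A b → A + b ≡ A + + 2 * b + - b
        l = solve 2 (λ A b → A :+ b := A :+ # 2 :* b :+ :- b) refl
      l₁ : ∀ M A b → M - b ≡ M - A + (A - b)
      l₁ = solve 3 (λ M A b → M :- b := M :- A :+ (A :- b)) refl
      l₂ : ∀ M A b → M + b ≡ M - A + (A + b)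
      l₂ = solve 3 (λ M A b → M :+ b := M :- A :+ (A :+ b)) refl

  -- Reduced bases as forms together with an index `j`.

  Index : ℤ → ℤ → Set
  Index κ j = 0ℤ ≤ j × 0ℤ ≤ κ - j * (j + 1ℤ)

  index? : ∀ κ → Decidable (Index κ)
  index? κ j = (0ℤ ≤? j) ×-dec (0ℤ ≤? (κ - j * (j + 1ℤ)))

  indices : ∀ κ → Finite (Index κ)
  indices κ = finite₁ ∣ κ ∣ (index? κ) λ {j} (p , q) → ≤⇒Abs≤ j (by (+∣ κ ∣≥ ⊕ q ⊕ sq≥0 j) (l (+ ∣ κ ∣) κ j)) (nat≥0 ∣ κ ∣ ⊕ p)
    where
    l : ∀ M κ j → M - j ≡ M - κ + (κ - j * (j + 1ℤ)) + j * j
    l = solve 3 (λ M κ j → M :- j := M :- κ :+ (κ :- j :* (j :+ # 1)) :+ j :* j) refl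

  -- The matrix has diagonal `A`, `C` and off-diagonal entries `2 b - (2 j + 1)`, `2 b + (2 j + 1)`,
  -- or for `minus` their negatives. Integrality of the tile requires `A = T + 2 b` modulo 4, which
  -- holds for exactly one of the two signs of `T`.
  data Match : ℤ × ℤ³ → ℤ⁴ → Set where
    plus  : ∀ {j A b C T a β d} → T ≡ 1ℤ + + 2 * j → A ≡ T + + 2 * a + + 2 * d → b ≡ a - d → C ≡ T + + 2 * β + + 2 * (β + d - a) →
            Match (j , A , b , C) (T , a , β , d)
    minus : ∀ {j A b C T a β d} → T ≡ - (1ℤ + + 2 * j) → A ≡ T + + 2 * a + + 2 * d → b ≡ d - a → C ≡ T + + 2 * β + + 2 * (β + d - a) →
            Match (j , A , b , C) (T , a , β , d)

  FormAt : ℤ → ℤ × ℤ³ → Set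
  FormAt κ (j , f) = Index κ j × Form (κ - j * (j + 1ℤ)) f

  formsAt : ∀ κ → Finite (FormAt κ)
  formsAt κ = sigma (indices κ) (λ j → forms (κ - j * (j + 1ℤ)))

  reduced-from : ∀ {κ j A b C} T b′ m w → Form (κ - j * (j + 1ℤ)) (A , b , C) → Odd T → T * T ≡ (1ℤ + + 2 * j) * (1ℤ + + 2 * j) → b′ * b′ ≡ b * b →
    0ℤ < A - + 2 * b′ → 0ℤ < A + + 2 * b′ → 0ℤ < C - + 2 * b′ → 0ℤ < C + + 2 * b′ →
    A ≡ T - + 2 * b′ + + 4 * m → C ≡ A + + 4 * w → Reduced (+ 2 + + 4 * κ) (T , m , m + w , m - b′)
  reduced-from {κ} {j} {A} {b} {C} T b′ m w F o T² b² p q r s refl refl = record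
    { odd-T = o
    ; la>0 = subst (0ℤ <_) (e₁ T b′ m) q
    ; lb>0 = subst (0ℤ <_) (e₂ T b′ m w) s
    ; lc>0 = subst (0ℤ <_) (e₃ T b′ m w) r
    ; ld>0 = subst (0ℤ <_) (e₄ T b′ m) p
    ; inv = trans (e₅ T b′ m w) (trans (cong₂ (λ u v → + 2 * (A * C - + 4 * u + v)) b² T²) (trans (cong (λ u → + 2 * (u + (1ℤ + + 2 * j) * (1ℤ + + 2 * j))) (Form.det F)) (e₆ κ j)))
    }
    where
    e₁ : ∀ T b m → T - + 2 * b + + 4 * m + + 2 * b ≡ T + + 4 * m
    e₁ = solve 3 (λ T b m → T :- # 2 :* b :+ # 4 :* m :+ # 2 :* b := T :+ # 4 :* m) refl
    e₂ : ∀ T b m w → T - + 2 * b + + 4 * m + + 4 * w + + 2 * b ≡ T + + 4 * (m + w)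
    e₂ = solve 4 (λ T b m w → T :- # 2 :* b :+ # 4 :* m :+ # 4 :* w :+ # 2 :* b := T :+ # 4 :* (m :+ w)) refl
    e₃ : ∀ T b m w → T - + 2 * b + + 4 * m + + 4 * w - + 2 * b ≡ T + + 4 * (m + w + (m - b) - m)
    e₃ = solve 4 (λ T b m w → T :- # 2 :* b :+ # 4 :* m :+ # 4 :* w :- # 2 :* b := T :+ # 4 :* (m :+ w :+ (m :- b) :- m)) refl
    e₄ : ∀ T b m → T - + 2 * b + + 4 * m - + 2 * b ≡ T + + 4 * (m - b)
    e₄ = solve 3 (λ T b m → T :- # 2 :* b :+ # 4 :* m :- # 2 :* b := T :+ # 4 :* (m :- b)) refl
    e₅ : ∀ T b m w → (T + + 4 * m) * (T + + 4 * (m + w + (m - b) - m)) + (T + + 4 * (m + w)) * (T + + 4 * (m - b)) + + 2 * (T * T)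
       ≡ + 2 * ((T - + 2 * b + + 4 * m) * (T - + 2 * b + + 4 * m + + 4 * w) - + 4 * (b * b) + T * T)
    e₅ = solve 4 (λ T b m w → (T :+ # 4 :* m) :* (T :+ # 4 :* (m :+ w :+ (m :- b) :- m)) :+ (T :+ # 4 :* (m :+ w)) :* (T :+ # 4 :* (m :- b)) :+ # 2 :* (T :* T) := # 2 :* ((T :- # 2 :* b :+ # 4 :* m) :* (T :- # 2 :* b :+ # 4 :* m :+ # 4 :* w) :- # 4 :* (b :* b) :+ T :* T)) refl
    e₆ : ∀ κ j → + 2 * (1ℤ + + 4 * (κ - j * (j + 1ℤ)) + (1ℤ + + 2 * j) * (1ℤ + + 2 * j)) ≡ + 2 * (+ 2 + + 4 * κ)
    e₆ = solve 2 (λ κ j → # 2 :* (# 1 :+ # 4 :* (κ :- j :* (j :+ # 1)) :+ (# 1 :+ # 2 :* j) :* (# 1 :+ # 2 :* j)) := # 2 :* (# 2 :+ # 4 :* κ)) refl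

  -- `A C` is 1 modulo 4, so `A` and `C` are odd and congruent to each other modulo 4.
  form-mod4 : ∀ {μ A b C} → Form μ (A , b , C) → ∃ λ k → ∃ λ w → A ≡ 1ℤ + + 2 * k × C ≡ A + + 4 * w
  form-mod4 {μ} {A} {b} {C} F with odd⇒ (odd*ˡ {A} {C} AC-odd) | odd⇒ (odd*ʳ {A} {C} AC-odd)
    where
    AC-odd : Odd (A * C)
    AC-odd = odd-by (+ 2 * (μ + b * b)) (trans (l₁ (A * C) (b * b)) (trans (cong (_+ + 4 * (b * b)) (Form.det F)) (l₂ μ (b * b))))
      where
      l₁ : ∀ u v → u ≡ u - + 4 * v + + 4 * v
      l₁ = solve 2 (λ u v → u := u :- # 4 :* v :+ # 4 :* v) refl
      l₂ : ∀ μ v → 1ℤ + + 4 * μ + + 4 * v ≡ 1ℤ + + 2 * (+ 2 * (μ + v))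
      l₂ = solve 2 (λ μ v → # 1 :+ # 4 :* μ :+ # 4 :* v := # 1 :+ # 2 :* (# 2 :* (μ :+ v))) refl
  ... | k , refl | l , refl = k , w , refl , trans (e₁ k l) (trans (cong (λ u → 1ℤ + + 2 * k + + 2 * (u - + 2 * k)) kl) (e₀ k v))
    where
    v = μ + b * b - k * l
    e₀ : ∀ k v → 1ℤ + + 2 * k + + 2 * (+ 2 * v - + 2 * k) ≡ 1ℤ + + 2 * k + + 4 * (v - k)
    e₀ = solve 2 (λ k v → # 1 :+ # 2 :* k :+ # 2 :* (# 2 :* v :- # 2 :* k) := # 1 :+ # 2 :* k :+ # 4 :* (v :- k)) refl
    e₁ : ∀ k l → 1ℤ + + 2 * l ≡ 1ℤ + + 2 * k + + 2 * (k + l - + 2 * k)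
    e₁ = solve 2 (λ k l → # 1 :+ # 2 :* l := # 1 :+ # 2 :* k :+ # 2 :* (k :+ l :- # 2 :* k)) refl
    w = v - k
    kl : k + l ≡ + 2 * v
    kl = *-cancelˡ-≡ (+ 2) (k + l) (+ 2 * v) (trans (e₂ k l (b * b)) (trans (cong (λ u → u + + 4 * (b * b) - + 4 * (k * l) - 1ℤ) (Form.det F)) (e₃ μ (b * b) (k * l))))
      where
      e₂ : ∀ k l v → + 2 * (k + l) ≡ (1ℤ + + 2 * k) * (1ℤ + + 2 * l) - + 4 * v + + 4 * v - + 4 * (k * l) - 1ℤ
      e₂ = solve 3 (λ k l v → # 2 :* (k :+ l) := (# 1 :+ # 2 :* k) :* (# 1 :+ # 2 :* l) :- # 4 :* v :+ # 4 :* v :- # 4 :* (k :* l) :- # 1) refl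
      e₃ : ∀ μ v u → 1ℤ + + 4 * μ + + 4 * v - + 4 * u - 1ℤ ≡ + 2 * (+ 2 * (μ + v - u))
      e₃ = solve 3 (λ μ v u → # 1 :+ # 4 :* μ :+ # 4 :* v :- # 4 :* u :- # 1 := # 2 :* (# 2 :* (μ :+ v :- u))) refl

  match-total : ∀ {κ x} → FormAt κ x → ∃ λ y → Reduced (+ 2 + + 4 * κ) y × Match x y
  match-total {κ} {j , A , b , C} (_ , F) with form-mod4 {κ - j * (j + 1ℤ)} {A} {b} {C} F
  -- This is half of `A - (2 j + 1) + 2 b`; its parity decides the sign of `T`.
  ... | k , w , A≡ , C≡ with parity (k - j + b)
  ... | even m e = (1ℤ + + 2 * j , m , m + w , m - b)
        , reduced-from {κ} {j} {A} {b} {C} (1ℤ + + 2 * j) b m w F (odd-by j refl) refl refl (Form.A-b F) (Form.A+b F) (Form.C-b F) (Form.C+b F) A≡′ C≡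
        , plus refl (trans A≡′ (l₁ j b m)) (l₂ b m) (trans C≡ (trans (cong (_+ + 4 * w) A≡′) (l₃ j b m w)))
    where
    l₀ : ∀ k j b → 1ℤ + + 2 * k ≡ 1ℤ + + 2 * j - + 2 * b + + 2 * (k - j + b)
    l₀ = solve 3 (λ k j b → # 1 :+ # 2 :* k := # 1 :+ # 2 :* j :- # 2 :* b :+ # 2 :* (k :- j :+ b)) refl
    l₀′ : ∀ j b m → 1ℤ + + 2 * j - + 2 * b + + 2 * (0ℤ + + 2 * m) ≡ 1ℤ + + 2 * j - + 2 * b + + 4 * m
    l₀′ = solve 3 (λ j b m → # 1 :+ # 2 :* j :- # 2 :* b :+ # 2 :* (# 0 :+ # 2 :* m) := # 1 :+ # 2 :* j :- # 2 :* b :+ # 4 :* m) refl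
    A≡′ : A ≡ 1ℤ + + 2 * j - + 2 * b + + 4 * m
    A≡′ = trans A≡ (trans (l₀ k j b) (trans (cong (λ u → 1ℤ + + 2 * j - + 2 * b + + 2 * u) e) (l₀′ j b m)))
    l₁ : ∀ j b m → 1ℤ + + 2 * j - + 2 * b + + 4 * m ≡ 1ℤ + + 2 * j + + 2 * m + + 2 * (m - b)
    l₁ = solve 3 (λ j b m → # 1 :+ # 2 :* j :- # 2 :* b :+ # 4 :* m := # 1 :+ # 2 :* j :+ # 2 :* m :+ # 2 :* (m :- b)) refl
    l₂ : ∀ b m → b ≡ m - (m - b)
    l₂ = solve-∀
    l₃ : ∀ j b m w → 1ℤ + + 2 * j - + 2 * b + + 4 * m + + 4 * w ≡ 1ℤ + + 2 * j + + 2 * (m + w) + + 2 * (m + w + (m - b) - m)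
    l₃ = solve 4 (λ j b m w → # 1 :+ # 2 :* j :- # 2 :* b :+ # 4 :* m :+ # 4 :* w := # 1 :+ # 2 :* j :+ # 2 :* (m :+ w) :+ # 2 :* (m :+ w :+ (m :- b) :- m)) refl
  ... | odd m e = (- (1ℤ + + 2 * j) , n , n + w , n - (- b))
        , reduced-from {κ} {j} {A} {b} {C} (- (1ℤ + + 2 * j)) (- b) n w F (odd-neg (odd-by j refl)) (l₄ (1ℤ + + 2 * j)) (l₄ b)
            (subst (0ℤ <_) (l₅ A b) (Form.A+b F)) (subst (0ℤ <_) (l₆ A b) (Form.A-b F)) (subst (0ℤ <_) (l₅ C b) (Form.C+b F)) (subst (0ℤ <_) (l₆ C b) (Form.C-b F)) A≡′ C≡
        , minus refl (trans A≡′ (l₁ j b n)) (l₂ b n) (trans C≡ (trans (cong (_+ + 4 * w) A≡′) (l₃ j b n w)))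
    where
    n = 1ℤ + m + j - b
    l₀ : ∀ k j b → 1ℤ + + 2 * k ≡ 1ℤ + + 2 * j - + 2 * b + + 2 * (k - j + b)
    l₀ = solve 3 (λ k j b → # 1 :+ # 2 :* k := # 1 :+ # 2 :* j :- # 2 :* b :+ # 2 :* (k :- j :+ b)) refl
    l₀′ : ∀ j b m → 1ℤ + + 2 * j - + 2 * b + + 2 * (1ℤ + + 2 * m) ≡ - (1ℤ + + 2 * j) - + 2 * - b + + 4 * (1ℤ + m + j - b)
    l₀′ = solve 3 (λ j b m → # 1 :+ # 2 :* j :- # 2 :* b :+ # 2 :* (# 1 :+ # 2 :* m) := :- (# 1 :+ # 2 :* j) :- # 2 :* :- b :+ # 4 :* (# 1 :+ m :+ j :- b)) refl
    A≡′ : A ≡ - (1ℤ + + 2 * j) - + 2 * - b + + 4 * n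
    A≡′ = trans A≡ (trans (l₀ k j b) (trans (cong (λ u → 1ℤ + + 2 * j - + 2 * b + + 2 * u) e) (l₀′ j b m)))
    l₁ : ∀ j b m → - (1ℤ + + 2 * j) - + 2 * - b + + 4 * m ≡ - (1ℤ + + 2 * j) + + 2 * m + + 2 * (m - - b)
    l₁ = solve 3 (λ j b m → :- (# 1 :+ # 2 :* j) :- # 2 :* :- b :+ # 4 :* m := :- (# 1 :+ # 2 :* j) :+ # 2 :* m :+ # 2 :* (m :- :- b)) refl
    l₂ : ∀ b m → b ≡ m - - b - m
    l₂ = solve 2 (λ b m → b := m :- :- b :- m) refl
    l₃ : ∀ j b m w → - (1ℤ + + 2 * j) - + 2 * - b + + 4 * m + + 4 * w ≡ - (1ℤ + + 2 * j) + + 2 * (m + w) + + 2 * (m + w + (m - - b) - m)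
    l₃ = solve 4 (λ j b m w → :- (# 1 :+ # 2 :* j) :- # 2 :* :- b :+ # 4 :* m :+ # 4 :* w := :- (# 1 :+ # 2 :* j) :+ # 2 :* (m :+ w) :+ # 2 :* (m :+ w :+ (m :- :- b) :- m)) refl
    l₄ : ∀ x → - x * - x ≡ x * x
    l₄ = solve 1 (λ x → :- x :* :- x := x :* x) refl
    l₅ : ∀ A b → A + + 2 * b ≡ A - + 2 * - b
    l₅ = solve 2 (λ A b → A :+ # 2 :* b := A :- # 2 :* :- b) refl
    l₆ : ∀ A b → A - + 2 * b ≡ A + + 2 * - b
    l₆ = solve 2 (λ A b → A :- # 2 :* b := A :+ # 2 :* :- b) refl

  -- The index bound comes for free: `2 (A C - 4 b²) = (A - 2 b) (C + 2 b) + (A + 2 b) (C - 2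
  -- b)` is positive, and a positive number `1 + 4 μ` has `μ` nonnegative.
  form-from : ∀ {κ} j b′ T a b d → Reduced (+ 2 + + 4 * κ) (T , a , b , d) → 0ℤ ≤ j → T * T ≡ (1ℤ + + 2 * j) * (1ℤ + + 2 * j) →
    0ℤ < T + + 2 * a + + 2 * d - + 2 * b′ → 0ℤ < T + + 2 * a + + 2 * d + + 2 * b′ →
    0ℤ < T + + 2 * b + + 2 * (b + d - a) - + 2 * b′ → 0ℤ < T + + 2 * b + + 2 * (b + d - a) + + 2 * b′ → b′ * b′ ≡ (a - d) * (a - d) →
    FormAt κ (j , T + + 2 * a + + 2 * d , b′ , T + + 2 * b + + 2 * (b + d - a))
  form-from {κ} j b′ T a b d R j≥0 T² p q r s b² = (j≥0 , pos-quarter {κ - j * (j + 1ℤ)} (subst (0ℤ <_) det det>0))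
      , record { A-b = p ; A+b = q ; C-b = r ; C+b = s ; det = det }
    where
    A = T + + 2 * a + + 2 * d
    C = T + + 2 * b + + 2 * (b + d - a)
    det : A * C - + 4 * (b′ * b′) ≡ 1ℤ + + 4 * (κ - j * (j + 1ℤ))
    det = trans (cong (λ u → A * C - + 4 * u) b²) (*-cancelˡ-≡ (+ 2) _ _ (trans (l₁ T a b d) (trans (cong₂ (λ u v → u - + 2 * v) (Reduced.inv R) T²) (l₂ κ j))))
      where
      l₁ : ∀ T a b d → + 2 * ((T + + 2 * a + + 2 * d) * (T + + 2 * b + + 2 * (b + d - a)) - + 4 * ((a - d) * (a - d)))
         ≡ (T + + 4 * a) * (T + + 4 * (b + d - a)) + (T + + 4 * b) * (T + + 4 * d) + + 2 * (T * T) - + 2 * (T * T)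
      l₁ = solve 4 (λ T a b d → # 2 :* ((T :+ # 2 :* a :+ # 2 :* d) :* (T :+ # 2 :* b :+ # 2 :* (b :+ d :- a)) :- # 4 :* ((a :- d) :* (a :- d))) := (T :+ # 4 :* a) :* (T :+ # 4 :* (b :+ d :- a)) :+ (T :+ # 4 :* b) :* (T :+ # 4 :* d) :+ # 2 :* (T :* T) :- # 2 :* (T :* T)) refl
      l₂ : ∀ κ j → + 2 * (+ 2 + + 4 * κ) - + 2 * ((1ℤ + + 2 * j) * (1ℤ + + 2 * j)) ≡ + 2 * (1ℤ + + 4 * (κ - j * (j + 1ℤ)))
      l₂ = solve 2 (λ κ j → # 2 :* (# 2 :+ # 4 :* κ) :- # 2 :* ((# 1 :+ # 2 :* j) :* (# 1 :+ # 2 :* j)) := # 2 :* (# 1 :+ # 4 :* (κ :- j :* (j :+ # 1)))) refl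
    det>0 : 0ℤ < A * C - + 4 * (b′ * b′)
    det>0 = half-pos {A * C - + 4 * (b′ * b′)} (pos* p s) (pos* q r) (l A b′ C)
      where
      l : ∀ A b C → (A - + 2 * b) * (C + + 2 * b) + (A + + 2 * b) * (C - + 2 * b) ≡ + 2 * (A * C - + 4 * (b * b))
      l = solve 3 (λ A b C → (A :- # 2 :* b) :* (C :+ # 2 :* b) :+ (A :+ # 2 :* b) :* (C :- # 2 :* b) := # 2 :* (A :* C :- # 4 :* (b :* b))) refl

  match-surjective : ∀ {κ y} → Reduced (+ 2 + + 4 * κ) y → ∃ λ x → FormAt κ x × Match x y
  match-surjective {κ} {T , a , b , d} R with odd⇒ (Reduced.odd-T R)
  ... | k , refl with nn⊎neg k
  ... | inj₁ k≥0 = _ , form-from {κ} k (a - d) (1ℤ + + 2 * k) a b d R k≥0 refl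
          (subst (0ℤ <_) (e₁ (1ℤ + + 2 * k) a d) (Reduced.ld>0 R)) (subst (0ℤ <_) (e₂ (1ℤ + + 2 * k) a d) (Reduced.la>0 R))
          (subst (0ℤ <_) (e₃ (1ℤ + + 2 * k) a b d) (Reduced.lc>0 R)) (subst (0ℤ <_) (e₄ (1ℤ + + 2 * k) a b d) (Reduced.lb>0 R)) refl
        , plus refl refl refl refl
    where
    e₁ : ∀ T a d → T + + 4 * d ≡ T + + 2 * a + + 2 * d - + 2 * (a - d)
    e₁ = solve 3 (λ T a d → T :+ # 4 :* d := T :+ # 2 :* a :+ # 2 :* d :- # 2 :* (a :- d)) refl
    e₂ : ∀ T a d → T + + 4 * a ≡ T + + 2 * a + + 2 * d + + 2 * (a - d)
    e₂ = solve 3 (λ T a d → T :+ # 4 :* a := T :+ # 2 :* a :+ # 2 :* d :+ # 2 :* (a :- d)) refl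
    e₃ : ∀ T a b d → T + + 4 * (b + d - a) ≡ T + + 2 * b + + 2 * (b + d - a) - + 2 * (a - d)
    e₃ = solve 4 (λ T a b d → T :+ # 4 :* (b :+ d :- a) := T :+ # 2 :* b :+ # 2 :* (b :+ d :- a) :- # 2 :* (a :- d)) refl
    e₄ : ∀ T a b d → T + + 4 * b ≡ T + + 2 * b + + 2 * (b + d - a) + + 2 * (a - d)
    e₄ = solve 4 (λ T a b d → T :+ # 4 :* b := T :+ # 2 :* b :+ # 2 :* (b :+ d :- a) :+ # 2 :* (a :- d)) refl
  ... | inj₂ p = _ , form-from {κ} (- k - 1ℤ) (d - a) (1ℤ + + 2 * k) a b d R (pred≥0 p) (e₀ k)
          (subst (0ℤ <_) (e₁ (1ℤ + + 2 * k) a d) (Reduced.la>0 R)) (subst (0ℤ <_) (e₂ (1ℤ + + 2 * k) a d) (Reduced.ld>0 R))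
          (subst (0ℤ <_) (e₃ (1ℤ + + 2 * k) a b d) (Reduced.lb>0 R)) (subst (0ℤ <_) (e₄ (1ℤ + + 2 * k) a b d) (Reduced.lc>0 R)) (e₅ a d)
        , minus (e₆ k) refl refl refl
    where
    e₀ : ∀ k → (1ℤ + + 2 * k) * (1ℤ + + 2 * k) ≡ (1ℤ + + 2 * (- k - 1ℤ)) * (1ℤ + + 2 * (- k - 1ℤ))
    e₀ = solve 1 (λ k → (# 1 :+ # 2 :* k) :* (# 1 :+ # 2 :* k) := (# 1 :+ # 2 :* (:- k :- # 1)) :* (# 1 :+ # 2 :* (:- k :- # 1))) refl
    e₁ : ∀ T a d → T + + 4 * a ≡ T + + 2 * a + + 2 * d - + 2 * (d - a)
    e₁ = solve 3 (λ T a d → T :+ # 4 :* a := T :+ # 2 :* a :+ # 2 :* d :- # 2 :* (d :- a)) refl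
    e₂ : ∀ T a d → T + + 4 * d ≡ T + + 2 * a + + 2 * d + + 2 * (d - a)
    e₂ = solve 3 (λ T a d → T :+ # 4 :* d := T :+ # 2 :* a :+ # 2 :* d :+ # 2 :* (d :- a)) refl
    e₃ : ∀ T a b d → T + + 4 * b ≡ T + + 2 * b + + 2 * (b + d - a) - + 2 * (d - a)
    e₃ = solve 4 (λ T a b d → T :+ # 4 :* b := T :+ # 2 :* b :+ # 2 :* (b :+ d :- a) :- # 2 :* (d :- a)) refl
    e₄ : ∀ T a b d → T + + 4 * (b + d - a) ≡ T + + 2 * b + + 2 * (b + d - a) + + 2 * (d - a)
    e₄ = solve 4 (λ T a b d → T :+ # 4 :* (b :+ d :- a) := T :+ # 2 :* b :+ # 2 :* (b :+ d :- a) :+ # 2 :* (d :- a)) refl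
    e₅ : ∀ a d → (d - a) * (d - a) ≡ (a - d) * (a - d)
    e₅ = solve 2 (λ a d → (d :- a) :* (d :- a) := (a :- d) :* (a :- d)) refl
    e₆ : ∀ k → 1ℤ + + 2 * k ≡ - (1ℤ + + 2 * (- k - 1ℤ))
    e₆ = solve 1 (λ k → # 1 :+ # 2 :* k := :- (# 1 :+ # 2 :* (:- k :- # 1))) refl

  tile-determined : ∀ {T a b d a′ b′ d′} → T + + 2 * a + + 2 * d ≡ T + + 2 * a′ + + 2 * d′ → a - d ≡ a′ - d′ →
    T + + 2 * b + + 2 * (b + d - a) ≡ T + + 2 * b′ + + 2 * (b′ + d′ - a′) → _≡_ {A = ℤ⁴} (T , a , b , d) (T , a′ , b′ , d′)
  tile-determined {T} {a} {b} {d} {a′} {b′} {d′} e₁ e₂ e₃ = cong (T ,_) (cong₂ _,_ a≡ (cong₂ _,_ b≡ d≡))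
    where
    a≡ : a ≡ a′
    a≡ = *-cancelˡ-≡ (+ 4) a a′ (trans (l T a d) (trans (cong₂ (λ u v → u - T + + 2 * v) e₁ e₂) (sym (l T a′ d′))))
      where
      l : ∀ T a d → + 4 * a ≡ T + + 2 * a + + 2 * d - T + + 2 * (a - d)
      l = solve 3 (λ T a d → # 4 :* a := T :+ # 2 :* a :+ # 2 :* d :- T :+ # 2 :* (a :- d)) refl
    d≡ : d ≡ d′
    d≡ = trans (l a d) (trans (cong₂ _-_ a≡ e₂) (sym (l a′ d′)))
      where
      l : ∀ a d → d ≡ a - (a - d)
      l = solve-∀
    b≡ : b ≡ b′
    b≡ = *-cancelˡ-≡ (+ 4) b b′ (trans (l T a b d) (trans (cong₂ (λ u v → u - T + + 2 * v) e₃ e₂) (sym (l T a′ b′ d′))))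
      where
      l : ∀ T a b d → + 4 * b ≡ T + + 2 * b + + 2 * (b + d - a) - T + + 2 * (a - d)
      l = solve 4 (λ T a b d → # 4 :* b := T :+ # 2 :* b :+ # 2 :* (b :+ d :- a) :- T :+ # 2 :* (a :- d)) refl

  -- A form matched with both signs of `T` would make `2 (2 j + 1)` a multiple of 4.
  match-parity : ∀ {j a d a′ d′} → 1ℤ + + 2 * j + + 2 * a + + 2 * d ≡ - (1ℤ + + 2 * j) + + 2 * a′ + + 2 * d′ → a - d ≡ d′ - a′ → ⊥
  match-parity {j} {a} {d} {a′} {d′} e₁ e₂ = even≢odd {j} {a′ - d} (*-cancelˡ-≡ (+ 2) _ _
    (trans (l₁ j a d) (trans (cong₂ (λ u v → u + (1ℤ + + 2 * j) - + 2 * v - + 4 * d) e₁ e₂) (l₂ j a′ d d′))))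
    where
    l₁ : ∀ j a d → + 2 * (1ℤ + + 2 * j) ≡ 1ℤ + + 2 * j + + 2 * a + + 2 * d + (1ℤ + + 2 * j) - + 2 * (a - d) - + 4 * d
    l₁ = solve 3 (λ j a d → # 2 :* (# 1 :+ # 2 :* j) := # 1 :+ # 2 :* j :+ # 2 :* a :+ # 2 :* d :+ (# 1 :+ # 2 :* j) :- # 2 :* (a :- d) :- # 4 :* d) refl
    l₂ : ∀ j a′ d d′ → - (1ℤ + + 2 * j) + + 2 * a′ + + 2 * d′ + (1ℤ + + 2 * j) - + 2 * (d′ - a′) - + 4 * d ≡ + 2 * (+ 2 * (a′ - d))
    l₂ = solve 4 (λ j a′ d d′ → :- (# 1 :+ # 2 :* j) :+ # 2 :* a′ :+ # 2 :* d′ :+ (# 1 :+ # 2 :* j) :- # 2 :* (d′ :- a′) :- # 4 :* d := # 2 :* (# 2 :* (a′ :- d))) refl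

  match-functional : ∀ {x y y′} → Match x y → Match x y′ → y ≡ y′
  match-functional (plus refl A b C) (plus refl A′ b′ C′) = tile-determined (trans (sym A) A′) (trans (sym b) b′) (trans (sym C) C′)
  match-functional (minus {a = a} {d = d} refl A b C) (minus {a = a′} {d = d′} refl A′ b′ C′) =
    tile-determined (trans (sym A) A′) (trans (l a d) (trans (cong -_ (trans (sym b) b′)) (sym (l a′ d′)))) (trans (sym C) C′)
    where
    l : ∀ a d → a - d ≡ - (d - a)
    l = solve 2 (λ a d → a :- d := :- (d :- a)) refl
  match-functional (plus {j = j} {a = a} {d = d} refl A b C) (minus {a = a′} {d = d′} refl A′ b′ C′) = ⊥-elim (match-parity {j} {a} {d} {a′} {d′} (trans (sym A) A′) (trans (sym b) b′))
  match-functional (minus {a = a′} {d = d′} refl A′ b′ C′) (plus {j = j} {a = a} {d = d} refl A b C) = ⊥-elim (match-parity {j} {a} {d} {a′} {d′} (trans (sym A) A′) (trans (sym b) b′))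

  match-injective : ∀ {κ x x′ y} → FormAt κ x → FormAt κ x′ → Match x y → Match x′ y → x ≡ x′
  match-injective _ _ (plus {j = j} refl refl refl refl) (plus {j = j′} T refl refl refl) =
    cong (_, _) (*-cancelˡ-≡ (+ 2) j j′ (trans (l j) (trans (cong (_- 1ℤ) T) (sym (l j′)))))
    where
    l : ∀ j → + 2 * j ≡ 1ℤ + + 2 * j - 1ℤ
    l = solve 1 (λ j → # 2 :* j := # 1 :+ # 2 :* j :- # 1) refl
  match-injective _ _ (minus {j = j} refl refl refl refl) (minus {j = j′} T refl refl refl) =
    cong (_, _) (*-cancelˡ-≡ (+ 2) j j′ (trans (l j) (trans (cong (λ u → - u - 1ℤ) T) (sym (l j′)))))
    where
    l : ∀ j → + 2 * j ≡ - - (1ℤ + + 2 * j) - 1ℤ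
    l = solve 1 (λ j → # 2 :* j := :- :- (# 1 :+ # 2 :* j) :- # 1) refl
  match-injective ((p , _) , _) ((p′ , _) , _) (plus {j = j} refl _ _ _) (minus {j = j′} T _ _ _) = ⊥-elim (absurd {n = 1} (nat≥0 2 ⊗ p ⊕ nat≥0 2 ⊗ p′) (trans (l j j′) (trans (cong (λ u → u - 1ℤ + + 2 * j′) T) (l′ j′))))
    where
    l : ∀ j j′ → + 2 * j + + 2 * j′ ≡ 1ℤ + + 2 * j - 1ℤ + + 2 * j′
    l = solve 2 (λ j j′ → # 2 :* j :+ # 2 :* j′ := # 1 :+ # 2 :* j :- # 1 :+ # 2 :* j′) refl
    l′ : ∀ j′ → - (1ℤ + + 2 * j′) - 1ℤ + + 2 * j′ ≡ -[1+ 1 ]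
    l′ = solve 1 (λ j′ → :- (# 1 :+ # 2 :* j′) :- # 1 :+ # 2 :* j′ := con -[1+ 1 ]) refl
  match-injective ((p , _) , _) ((p′ , _) , _) (minus {j = j} refl _ _ _) (plus {j = j′} T _ _ _) = ⊥-elim (absurd {n = 1} (nat≥0 2 ⊗ p ⊕ nat≥0 2 ⊗ p′) (trans (l j j′) (trans (cong (λ u → + 2 * j + u - 1ℤ) (sym T)) (l′ j))))
    where
    l : ∀ j j′ → + 2 * j + + 2 * j′ ≡ + 2 * j + (1ℤ + + 2 * j′) - 1ℤ
    l = solve 2 (λ j j′ → # 2 :* j :+ # 2 :* j′ := # 2 :* j :+ (# 1 :+ # 2 :* j′) :- # 1) refl
    l′ : ∀ j → + 2 * j + - (1ℤ + + 2 * j) - 1ℤ ≡ -[1+ 1 ]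
    l′ = solve 1 (λ j → # 2 :* j :+ :- (# 1 :+ # 2 :* j) :- # 1 := con -[1+ 1 ]) refl

  formAt? : ∀ κ → Decidable (FormAt κ)
  formAt? κ (j , f) = index? κ j ×-dec form? (κ - j * (j + 1ℤ)) f

  -- A class number relation of Kronecker and Hurwitz type
  forms-triples : ∀ κ → 0ℤ < + 2 + + 4 * κ → count (formsAt κ) ≡ count (triples (+ 2 + + 4 * κ))
  forms-triples κ N>0 =
    let F , e  = reduced-count κ N>0
        F′ , e′ = relation-image (formsAt κ) (formAt? κ) (0ℤ , 0ℤ , 0ℤ , 0ℤ) Match (match-total {κ}) (match-surjective {κ})
                    (λ _ _ → match-functional) (match-injective {κ})
    in trans e′ (trans (∑-same F′ F id id) (sym e))

open Tiles using (Triple; triples; forms; Index; indices; forms-triples)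

-- Indefinite forms and an alternating sum

record Factors (m : ℤ) (x : ℤ²) : Set where
  constructor mkFactors
  field
    d>0  : 0ℤ < proj₁ x
    δ>0  : 0ℤ < proj₂ x
    prod : proj₁ x * proj₂ x ≡ m

factors? : ∀ m → Decidable (Factors m)
factors? m (d , δ) = map′ (λ (p , q , r) → mkFactors p q r) (λ (mkFactors p q r) → p , q , r) (0<? d ×-dec 0<? δ ×-dec (d * δ ≟ m))

factors : ∀ m → Finite (Factors m)
factors m = finite₂ M (factors? m) bound
  where
  M = ∣ m ∣
  le : ∀ {x y} → 0ℤ < x → 0ℤ < y → x * y ≡ m → Abs≤ M x
  le {x} {y} p q refl = ≤⇒Abs≤ x (by (+∣ m ∣≥ ⊕ pos→nn p ⊗ pred≥0 q) (l (+ M) x y)) (nat≥0 M ⊕ pos→nn p)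
    where
    l : ∀ M x y → M - x ≡ M - x * y + x * (y - 1ℤ)
    l = solve 3 (λ M x y → M :- x := M :- x :* y :+ x :* (y :- # 1)) refl
  bound : ∀ {x} → Factors m x → Abs≤ M (proj₁ x) × Abs≤ M (proj₂ x)
  bound {x , y} (mkFactors p q r) = le {x} {y} p q r , le {y} {x} q p (trans (*-comm y x) r)

-- The divisor sum of the two-square theorem; for odd positive `m` it is a quarter of the number of
-- representations of `m` as a sum of two squares.
D : ℤ → ℤ
D m = ∑ (factors m) (χ ∘ proj₁)

sq+x : ∀ z → 0ℤ ≤ z * z + z
sq+x (+ n) = sq≥0 (+ n) ⊕ nat≥0 n
sq+x -[1+ n ] = by (nat≥0 (suc n) ⊗ nat≥0 n) (l (+ n))
  where
  l : ∀ n → - (1ℤ + n) * - (1ℤ + n) + - (1ℤ + n) ≡ (1ℤ + n) * n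
  l = solve 1 (λ n → :- (# 1 :+ n) :* :- (# 1 :+ n) :+ :- (# 1 :+ n) := (# 1 :+ n) :* n) refl
sq-x : ∀ z → 0ℤ ≤ z * z - z
sq-x z = by (sq+x (- z)) (l z)
  where
  l : ∀ z → z * z - z ≡ - z * - z + - z
  l = solve 1 (λ z → z :* z :- z := :- z :* :- z :+ :- z) refl

nn-half : ∀ {x} → 0ℤ ≤ + 2 * x → 0ℤ ≤ x
nn-half {x} h with nn⊎neg x
... | inj₁ p = p
... | inj₂ p = ⊥-elim (absurd {n = 1} (h ⊕ nat≥0 2 ⊗ pred≥0 p) (l x))
  where
  l : ∀ x → + 2 * x + + 2 * (- x - 1ℤ) ≡ -[1+ 1 ]
  l = solve 1 (λ x → # 2 :* x :+ # 2 :* (:- x :- # 1) := con -[1+ 1 ]) refl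

+-cancelʳ′ : ∀ {a b} c → a + c ≡ b + c → a ≡ b
+-cancelʳ′ {a} {b} c e = trans (l a c) (trans (cong (_- c) e) (sym (l b c)))
  where
  l : ∀ a c → a ≡ a + c - c
  l = solve-∀

x≡-x⇒0 : ∀ {x} → x ≡ - x → x ≡ 0ℤ
x≡-x⇒0 {+ zero}  _ = refl
x≡-x⇒0 {+ suc _} ()
x≡-x⇒0 { -[1+ _ ]} ()

record Root (μ z : ℤ) : Set where
  constructor mkRoot
  field root : 0ℤ ≤ μ - z * z

roots : ∀ μ → Finite (Root μ)
roots μ = finite₁ ∣ μ ∣ (λ z → map′ mkRoot Root.root (0ℤ ≤? (μ - z * z)))
  λ {z} (mkRoot h) → ≤⇒Abs≤ z (by (+∣ μ ∣≥ ⊕ h ⊕ sq-x z) (l₁ (+ ∣ μ ∣) μ z)) (by (+∣ μ ∣≥ ⊕ h ⊕ sq+x z) (l₂ (+ ∣ μ ∣) μ z))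
  where
  l₁ : ∀ M μ z → M - z ≡ M - μ + (μ - z * z) + (z * z - z)
  l₁ = solve 3 (λ M μ z → M :- z := M :- μ :+ (μ :- z :* z) :+ (z :* z :- z)) refl
  l₂ : ∀ M μ z → M + z ≡ M - μ + (μ - z * z) + (z * z + z)
  l₂ = solve 3 (λ M μ z → M :+ z := M :- μ :+ (μ :- z :* z) :+ (z :* z :+ z)) refl

-- Indefinite forms with coefficients (g , 2 z , h), where γ is their value at (1 , -1)
module Edges (m : ℤ) (χm : χ m ≡ 1ℤ) where

  γ : ℤ³ → ℤ
  γ (g , z , h) = g + h - + 4 * z

  record Edge (e : ℤ³) : Set where
    constructor mkEdge
    field
      disc : + 4 * (proj₁ (proj₂ e) * proj₁ (proj₂ e)) - proj₁ e * proj₂ (proj₂ e) ≡ m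
      γ>0  : 0ℤ < γ e
  open Edge

  NegEnd NegStart : ℤ³ → Set
  NegEnd   e = Edge e × 0ℤ < - proj₂ (proj₂ e)
  NegStart e = Edge e × 0ℤ < - proj₁ e

  W : ℤ³ → ℤ
  W (g , z , h) = sg z * χ g

  -- The values `g`, `h`, `g + 4 h - 8 z` are taken at the consecutive points (1, 0), (0, 1), (-1,
  -- 2) of a line, and `shift` moves one step along it. Their second difference is `2 γ > 0`, so the
  -- negative values on a line form one finite run. `swap` reverses the line.
  swap shift : ℤ³ → ℤ³
  swap (g , z , h) = h , z , g
  shift (g , z , h) = h , h - z , g + + 4 * h - + 8 * z

  -- `g h = 4 z² - m` is 3 modulo 4.
  χ-ends : ∀ {g z h} → Edge (g , z , h) → χ g * χ h ≡ -1ℤ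
  χ-ends {g} {z} {h} E = trans (sym (χ-* g h)) (trans (cong χ (trans (l (z * z) (g * h)) (cong (λ u → + 4 * (z * z) - u) (disc E))))
    (trans (cong χ (+-comm (+ 4 * (z * z)) (- m))) (trans (χ-per (- m) (z * z)) (trans (χ-neg m) (cong -_ χm)))))
    where
    l : ∀ u v → v ≡ + 4 * u - (+ 4 * u - v)
    l = solve 2 (λ u v → v := # 4 :* u :- (# 4 :* u :- v)) refl

  odd-start : ∀ {g z h} → Edge (g , z , h) → Odd g
  odd-start {g} {z} {h} E = odd-χ {g} λ e → 0≢-1 (trans (cong (_* χ h) (sym e)) (χ-ends E))

  odd-end : ∀ {g z h} → Edge (g , z , h) → Odd h
  odd-end {g} {z} {h} E = odd-χ {h} λ e → 0≢-1 (trans (sym (*-zeroʳ (χ g))) (trans (cong (_*_ (χ g)) (sym e)) (χ-ends E)))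

  χ-end : ∀ {g z h} → Edge (g , z , h) → χ h ≡ - χ g
  χ-end {g} {z} {h} E = trans (sym (*-identityˡ (χ h))) (trans (cong (_* χ h) (sym (χ² (odd-start E)))) (trans (*-assoc (χ g) (χ g) (χ h)) (trans (cong (_*_ (χ g)) (χ-ends E)) (l (χ g)))))
    where
    l : ∀ x → x * -1ℤ ≡ - x
    l = solve-∀

  swap-edge : ∀ {e} → Edge e → Edge (swap e)
  swap-edge {g , z , h} (mkEdge p q) = mkEdge (trans (cong (λ u → + 4 * (z * z) - u) (*-comm h g)) p) (subst (λ u → 0ℤ < u - + 4 * z) (+-comm g h) q)

  shift-edge : ∀ {e} → Edge e → Edge (shift e)
  shift-edge {g , z , h} (mkEdge p q) = mkEdge (trans (l₁ g z h) p) (subst (0ℤ <_) (sym (l₂ g z h)) q)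
    where
    l₁ : ∀ g z h → + 4 * ((h - z) * (h - z)) - h * (g + + 4 * h - + 8 * z) ≡ + 4 * (z * z) - g * h
    l₁ = solve 3 (λ g z h → # 4 :* ((h :- z) :* (h :- z)) :- h :* (g :+ # 4 :* h :- # 8 :* z) := # 4 :* (z :* z) :- g :* h) refl
    l₂ : ∀ g z h → h + (g + + 4 * h - + 8 * z) - + 4 * (h - z) ≡ g + h - + 4 * z
    l₂ = solve 3 (λ g z h → h :+ (g :+ # 4 :* h :- # 8 :* z) :- # 4 :* (h :- z) := g :+ h :- # 4 :* z) refl

  W-shift : ∀ {e} → Edge e → W e ≡ W (shift e)
  W-shift {g , z , h} E = sym (trans (cong₂ _*_ (trans (sg-+ h (- z)) (cong₂ _*_ (Odd.sg-1 (odd-end E)) (sg-neg z))) (χ-end E)) (l (sg z) (χ g)))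
    where
    l : ∀ s x → -1ℤ * s * - x ≡ s * x
    l = solve 2 (λ s x → con -1ℤ :* s :* :- x := s :* x) refl

  W-swap : ∀ {e} → Edge e → W (swap e) ≡ - W e
  W-swap {g , z , h} E = trans (cong (_*_ (sg z)) (χ-end E)) (sym (neg-distribʳ-* (sg z) (χ g)))

  -- In `m = (2 z - h)² + γ (- h)` both terms are nonnegative. This bounds `h`, `γ` and `2 z - h`,
  -- hence `z` and `g`; `8 m` is a crude common bound.
  negEnds : Finite NegEnd
  negEnds = finite₃ M dec bound
    where
    N = + 8 * m
    M = ∣ N ∣
    dec : Decidable NegEnd
    dec (g , z , h) = map′ (λ (p , q) → mkEdge p q) (λ E → disc E , γ>0 E) ((+ 4 * (z * z) - g * h ≟ m) ×-dec 0<? (g + h - + 4 * z)) ×-dec 0<? (- h)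
    bound : ∀ {e} → NegEnd e → Abs≤ M (proj₁ e) × Abs≤ M (proj₁ (proj₂ e)) × Abs≤ M (proj₂ (proj₂ e))
    bound {g , z , h} (mkEdge refl q , r) =
        ≤⇒Abs≤ g (le (m-c ⊕ nat≥0 2 ⊗ m-y ⊕ pos→nn r ⊕ nat≥0 5 ⊗ m≥0) (l₁ g z h)) (ge (m-δ ⊕ nat≥0 2 ⊗ m+y ⊕ pos→nn q ⊕ nat≥0 5 ⊗ m≥0) (l₂ g z h))
      , ≤⇒Abs≤ z (le (nn-half {N - z} (by (m-y ⊕ pos→nn r ⊕ nat≥0 15 ⊗ m≥0) (l₃ g z h))) refl) (ge (nn-half {N + z} (by (m+y ⊕ m-δ ⊕ nat≥0 14 ⊗ m≥0) (l₄ g z h))) refl)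
      , ≤⇒Abs≤ h (le (nat≥0 8 ⊗ m≥0 ⊕ pos→nn r) refl) (ge (m-δ ⊕ nat≥0 7 ⊗ m≥0) (l₅ g z h))
      where
      y c δ : ℤ
      y = + 2 * z - h
      c = g + h - + 4 * z
      δ = - h
      m≥0 : 0ℤ ≤ + 4 * (z * z) - g * h
      m≥0 = by (sq≥0 y ⊕ pos→nn q ⊗ pos→nn r) (l g z h)
        where
        l : ∀ g z h → + 4 * (z * z) - g * h ≡ (+ 2 * z - h) * (+ 2 * z - h) + (g + h - + 4 * z) * - h
        l = solve 3 (λ g z h → # 4 :* (z :* z) :- g :* h := (# 2 :* z :- h) :* (# 2 :* z :- h) :+ (g :+ h :- # 4 :* z) :* :- h) refl
      m-y : 0ℤ ≤ + 4 * (z * z) - g * h - y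
      m-y = by (sq-x y ⊕ pos→nn q ⊗ pos→nn r) (l g z h)
        where
        l : ∀ g z h → + 4 * (z * z) - g * h - (+ 2 * z - h) ≡ (+ 2 * z - h) * (+ 2 * z - h) - (+ 2 * z - h) + (g + h - + 4 * z) * - h
        l = solve 3 (λ g z h → # 4 :* (z :* z) :- g :* h :- (# 2 :* z :- h) := (# 2 :* z :- h) :* (# 2 :* z :- h) :- (# 2 :* z :- h) :+ (g :+ h :- # 4 :* z) :* :- h) refl
      m+y : 0ℤ ≤ + 4 * (z * z) - g * h + y
      m+y = by (sq+x y ⊕ pos→nn q ⊗ pos→nn r) (l g z h)
        where
        l : ∀ g z h → + 4 * (z * z) - g * h + (+ 2 * z - h) ≡ (+ 2 * z - h) * (+ 2 * z - h) + (+ 2 * z - h) + (g + h - + 4 * z) * - h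
        l = solve 3 (λ g z h → # 4 :* (z :* z) :- g :* h :+ (# 2 :* z :- h) := (# 2 :* z :- h) :* (# 2 :* z :- h) :+ (# 2 :* z :- h) :+ (g :+ h :- # 4 :* z) :* :- h) refl
      m-c : 0ℤ ≤ + 4 * (z * z) - g * h - c
      m-c = by (sq≥0 y ⊕ pos→nn q ⊗ pred≥0 r) (l g z h)
        where
        l : ∀ g z h → + 4 * (z * z) - g * h - (g + h - + 4 * z) ≡ (+ 2 * z - h) * (+ 2 * z - h) + (g + h - + 4 * z) * (- h - 1ℤ)
        l = solve 3 (λ g z h → # 4 :* (z :* z) :- g :* h :- (g :+ h :- # 4 :* z) := (# 2 :* z :- h) :* (# 2 :* z :- h) :+ (g :+ h :- # 4 :* z) :* (:- h :- # 1)) refl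
      m-δ : 0ℤ ≤ + 4 * (z * z) - g * h - δ
      m-δ = by (sq≥0 y ⊕ pred≥0 q ⊗ pos→nn r) (l g z h)
        where
        l : ∀ g z h → + 4 * (z * z) - g * h - - h ≡ (+ 2 * z - h) * (+ 2 * z - h) + (g + h - + 4 * z - 1ℤ) * - h
        l = solve 3 (λ g z h → # 4 :* (z :* z) :- g :* h :- :- h := (# 2 :* z :- h) :* (# 2 :* z :- h) :+ (g :+ h :- # 4 :* z :- # 1) :* :- h) refl
      le : ∀ {x u} → 0ℤ ≤ u → N - x ≡ u → 0ℤ ≤ + M - x
      le {x} p e = by (+∣ N ∣≥ ⊕ by p e) (l (+ M) N x)
        where
        l : ∀ M N x → M - x ≡ M - N + (N - x)
        l = solve 3 (λ M N x → M :- x := M :- N :+ (N :- x)) refl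
      ge : ∀ {x u} → 0ℤ ≤ u → N + x ≡ u → 0ℤ ≤ + M + x
      ge {x} p e = by (+∣ N ∣≥ ⊕ by p e) (l (+ M) N x)
        where
        l : ∀ M N x → M + x ≡ M - N + (N + x)
        l = solve 3 (λ M N x → M :+ x := M :- N :+ (N :+ x)) refl
      l₁ : ∀ g z h → + 8 * (+ 4 * (z * z) - g * h) - g ≡ + 4 * (z * z) - g * h - (g + h - + 4 * z) + + 2 * (+ 4 * (z * z) - g * h - (+ 2 * z - h)) + - h + + 5 * (+ 4 * (z * z) - g * h)
      l₁ = solve 3 (λ g z h → # 8 :* (# 4 :* (z :* z) :- g :* h) :- g := # 4 :* (z :* z) :- g :* h :- (g :+ h :- # 4 :* z) :+ # 2 :* (# 4 :* (z :* z) :- g :* h :- (# 2 :* z :- h)) :+ :- h :+ # 5 :* (# 4 :* (z :* z) :- g :* h)) refl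
      l₂ : ∀ g z h → + 8 * (+ 4 * (z * z) - g * h) + g ≡ + 4 * (z * z) - g * h - - h + + 2 * (+ 4 * (z * z) - g * h + (+ 2 * z - h)) + (g + h - + 4 * z) + + 5 * (+ 4 * (z * z) - g * h)
      l₂ = solve 3 (λ g z h → # 8 :* (# 4 :* (z :* z) :- g :* h) :+ g := # 4 :* (z :* z) :- g :* h :- :- h :+ # 2 :* (# 4 :* (z :* z) :- g :* h :+ (# 2 :* z :- h)) :+ (g :+ h :- # 4 :* z) :+ # 5 :* (# 4 :* (z :* z) :- g :* h)) refl
      l₃ : ∀ g z h → + 2 * (+ 8 * (+ 4 * (z * z) - g * h) - z) ≡ + 4 * (z * z) - g * h - (+ 2 * z - h) + - h + + 15 * (+ 4 * (z * z) - g * h)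
      l₃ = solve 3 (λ g z h → # 2 :* (# 8 :* (# 4 :* (z :* z) :- g :* h) :- z) := # 4 :* (z :* z) :- g :* h :- (# 2 :* z :- h) :+ :- h :+ # 15 :* (# 4 :* (z :* z) :- g :* h)) refl
      l₄ : ∀ g z h → + 2 * (+ 8 * (+ 4 * (z * z) - g * h) + z) ≡ + 4 * (z * z) - g * h + (+ 2 * z - h) + (+ 4 * (z * z) - g * h - - h) + + 14 * (+ 4 * (z * z) - g * h)
      l₄ = solve 3 (λ g z h → # 2 :* (# 8 :* (# 4 :* (z :* z) :- g :* h) :+ z) := # 4 :* (z :* z) :- g :* h :+ (# 2 :* z :- h) :+ (# 4 :* (z :* z) :- g :* h :- :- h) :+ # 14 :* (# 4 :* (z :* z) :- g :* h)) refl
      l₅ : ∀ g z h → + 8 * (+ 4 * (z * z) - g * h) + h ≡ + 4 * (z * z) - g * h - - h + + 7 * (+ 4 * (z * z) - g * h)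
      l₅ = solve 3 (λ g z h → # 8 :* (# 4 :* (z :* z) :- g :* h) :+ h := # 4 :* (z :* z) :- g :* h :- :- h :+ # 7 :* (# 4 :* (z :* z) :- g :* h)) refl

  swap-injective : ∀ {e e′ : ℤ³} → swap e ≡ swap e′ → e ≡ e′
  swap-injective refl = refl

  negStarts : Finite NegStart
  negStarts = image negEnds swap (λ (E , p) → swap-edge E , p) (λ _ _ → swap-injective) (λ {e} (E , p) → swap e , (swap-edge E , p) , refl)

  shift-sum : ∑ negEnds W ≡ ∑ negStarts W
  shift-sum = ∑-bij negEnds negStarts shift (λ (E , p) → shift-edge E , p) (λ _ _ → inj) surj (λ (E , _) → W-shift E)
    where
    inj : ∀ {e e′} → shift e ≡ shift e′ → e ≡ e′
    inj {g , z , h} {g′ , z′ , h′} e with cong proj₁ e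
    ... | refl = cong₂ _,_ g≡ (cong (_, h) z≡)
      where
      l₁ : ∀ z h → z ≡ h - (h - z)
      l₁ = solve-∀
      l₂ : ∀ g z h → g ≡ g + + 4 * h - + 8 * z - + 4 * h + + 8 * z
      l₂ = solve 3 (λ g z h → g := g :+ # 4 :* h :- # 8 :* z :- # 4 :* h :+ # 8 :* z) refl
      z≡ : z ≡ z′
      z≡ = trans (l₁ z h) (trans (cong (λ x → h - proj₁ (proj₂ x)) e) (sym (l₁ z′ h)))
      g≡ : g ≡ g′
      g≡ = trans (l₂ g z h) (trans (cong₂ (λ x y → x - + 4 * h + + 8 * y) (cong (proj₂ ∘ proj₂) e) z≡) (sym (l₂ g′ z′ h)))
    surj : ∀ {e} → NegStart e → ∃ λ e′ → NegEnd e′ × shift e′ ≡ e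
    surj {g , z , h} (mkEdge p q , r) = (h + + 4 * g - + 8 * z , g - z , g) , (mkEdge (trans (l₁ g z h) p) (subst (0ℤ <_) (sym (l₂ g z h)) q) , r)
                                      , cong (g ,_) (cong₂ _,_ (l₃ g z) (l₄ g z h))
      where
      l₁ : ∀ g z h → + 4 * ((g - z) * (g - z)) - (h + + 4 * g - + 8 * z) * g ≡ + 4 * (z * z) - g * h
      l₁ = solve 3 (λ g z h → # 4 :* ((g :- z) :* (g :- z)) :- (h :+ # 4 :* g :- # 8 :* z) :* g := # 4 :* (z :* z) :- g :* h) refl
      l₂ : ∀ g z h → h + + 4 * g - + 8 * z + g - + 4 * (g - z) ≡ g + h - + 4 * z
      l₂ = solve 3 (λ g z h → h :+ # 4 :* g :- # 8 :* z :+ g :- # 4 :* (g :- z) := g :+ h :- # 4 :* z) refl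
      l₃ : ∀ g z → g - (g - z) ≡ z
      l₃ = solve-∀
      l₄ : ∀ g z h → h + + 4 * g - + 8 * z + + 4 * g - + 8 * (g - z) ≡ h
      l₄ = solve 3 (λ g z h → h :+ # 4 :* g :- # 8 :* z :+ # 4 :* g :- # 8 :* (g :- z) := h) refl

  start>0? : Decidable (λ (e : ℤ³) → 0ℤ < proj₁ e)
  start>0? e = 0<? (proj₁ e)

  end>0? : Decidable (λ (e : ℤ³) → 0ℤ < proj₂ (proj₂ e))
  end>0? e = 0<? (proj₂ (proj₂ e))

  descents : Finite (λ e → NegEnd e × 0ℤ < proj₁ e)
  descents = restrict negEnds start>0?

  ascents : Finite (λ e → NegStart e × 0ℤ < proj₂ (proj₂ e))
  ascents = restrict negStarts end>0?

  -- `shift` carries the edges with negative end to those with negative start and keeps `W`. Without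
  -- the edges that are negative at both ends, this equates the sum over the entries into negative
  -- runs with the sum over the exits; `swap` exchanges entries and exits and reverses `W`, so the
  -- sum is its own negative.
  ∑-descents : ∑ descents W ≡ 0ℤ
  ∑-descents = x≡-x⇒0 (trans down≡up up≡-down)
    where
    rest : ∑ (restrict negEnds (¬? ∘ start>0?)) W ≡ ∑ (restrict negStarts (¬? ∘ end>0?)) W
    rest = ∑-same (restrict negEnds (¬? ∘ start>0?)) (restrict negStarts (¬? ∘ end>0?))
      (λ ((E , p) , q) → (E , nonpos (odd-start E) q) , neg-pos p) (λ ((E , p) , q) → (E , nonpos (odd-end E) q) , neg-pos p)
    down≡up : ∑ descents W ≡ ∑ ascents W
    down≡up = +-cancelʳ′ (∑ (restrict negEnds (¬? ∘ start>0?)) W)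
      (trans (sym (∑-split negEnds start>0? W)) (trans shift-sum (trans (∑-split negStarts end>0? W) (cong (_+_ (∑ ascents W)) (sym rest)))))
    up≡-down : ∑ ascents W ≡ - ∑ descents W
    up≡-down = trans (∑-bij ascents descents swap {v = λ e → - W e} (λ ((E , p) , q) → (swap-edge E , p) , q) (λ _ _ → swap-injective)
        (λ {e} ((E , p) , q) → swap e , ((swap-edge E , p) , q) , refl) (λ {e} ((E , _) , _) → trans (sym (neg-involutive (W e))) (cong -_ (sym (W-swap E)))))
      (∑-neg descents W)

splittings : ∀ μ → Finite (λ (x : ℤ × ℤ²) → Root μ (proj₁ x) × Factors (1ℤ + + 4 * (μ - proj₁ x * proj₁ x)) (proj₂ x))
splittings μ = sigma (roots μ) (λ z → factors (1ℤ + + 4 * (μ - z * z)))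

factors-root : ∀ {μ z x} → Factors (1ℤ + + 4 * (μ - z * z)) x → Root μ z
factors-root {μ} {z} (mkFactors p q r) = mkRoot (pos-quarter {μ - z * z} (subst (0ℤ <_) r (pos* p q)))

χ-factors : ∀ {m d δ} → χ m ≡ 1ℤ → d * δ ≡ m → χ δ ≡ χ d
χ-factors {m} {d} {δ} χm e = trans (sym (*-identityˡ (χ δ))) (trans (cong (_* χ δ) (sym (χ² {d} od)))
    (trans (*-assoc (χ d) (χ d) (χ δ)) (trans (cong (_*_ (χ d)) χχ) (*-identityʳ (χ d)))))
  where
  χχ : χ d * χ δ ≡ 1ℤ
  χχ = trans (sym (χ-* d δ)) (trans (cong χ e) χm)
  od : Odd d
  od = odd-χ {d} λ z → 1≢0 (sym (trans (cong (_* χ δ) (sym z)) χχ))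

module _ (μ : ℤ) (nonsquare : ∀ r → r * r ≢ 1ℤ + + 4 * μ) where
  private
    m = 1ℤ + + 4 * μ
    open Edges m (χ-per 1ℤ μ)
    w : ℤ × ℤ² → ℤ
    w (z , d , δ) = sg z * χ d
    slope : ℤ × ℤ² → ℤ
    slope (z , d , δ) = d - δ - + 4 * z
    up? : Decidable (λ x → 0ℤ < slope x)
    up? x = 0<? (slope x)
    down? : Decidable (λ x → 0ℤ < - slope x)
    down? x = 0<? (- slope x)
    Ω = splittings μ

    disc₁ : ∀ {z d δ} → d * δ ≡ 1ℤ + + 4 * (μ - z * z) → + 4 * (z * z) - d * - δ ≡ m
    disc₁ {z} {d} {δ} e = trans (l₁ z d δ) (trans (cong (_+_ (+ 4 * (z * z))) e) (l₂ z μ))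
      where
      l₁ : ∀ z d δ → + 4 * (z * z) - d * - δ ≡ + 4 * (z * z) + d * δ
      l₁ = solve 3 (λ z d δ → # 4 :* (z :* z) :- d :* :- δ := # 4 :* (z :* z) :+ d :* δ) refl
      l₂ : ∀ z μ → + 4 * (z * z) + (1ℤ + + 4 * (μ - z * z)) ≡ 1ℤ + + 4 * μ
      l₂ = solve 2 (λ z μ → # 4 :* (z :* z) :+ (# 1 :+ # 4 :* (μ :- z :* z)) := # 1 :+ # 4 :* μ) refl

    disc₁⁻¹ : ∀ {z g h} → + 4 * (z * z) - g * h ≡ m → g * - h ≡ 1ℤ + + 4 * (μ - z * z)
    disc₁⁻¹ {z} {g} {h} e = trans (l₁ z g h) (trans (cong (_- + 4 * (z * z)) e) (l₂ z μ))
      where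
      l₁ : ∀ z g h → g * - h ≡ + 4 * (z * z) - g * h - + 4 * (z * z)
      l₁ = solve 3 (λ z g h → g :* :- h := # 4 :* (z :* z) :- g :* h :- # 4 :* (z :* z)) refl
      l₂ : ∀ z μ → 1ℤ + + 4 * μ - + 4 * (z * z) ≡ 1ℤ + + 4 * (μ - z * z)
      l₂ = solve 2 (λ z μ → # 1 :+ # 4 :* μ :- # 4 :* (z :* z) := # 1 :+ # 4 :* (μ :- z :* z)) refl

    χ-split : ∀ z → χ (1ℤ + + 4 * (μ - z * z)) ≡ 1ℤ
    χ-split z = χ-per 1ℤ (μ - z * z)

    -- A splitting `m = d δ + 4 z²` is a form with end values `d > 0` and `- δ < 0`, a descent; its
    -- value at (1, -1) is the slope.
    ups : ∑ (restrict Ω up?) w ≡ ∑ descents W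
    ups = ∑-bij (restrict Ω up?) descents (λ (z , d , δ) → d , z , - δ)
      (λ { {z , d , δ} ((_ , mkFactors p q r) , s) → (mkEdge (disc₁ {z} {d} {δ} r) s , subst (0ℤ <_) (sym (neg-involutive δ)) q) , p })
      (λ { {z , d , δ} {z′ , d′ , δ′} _ _ e → cong₂ _,_ (cong (proj₁ ∘ proj₂) e) (cong₂ _,_ (cong proj₁ e) (neg-injective (cong (proj₂ ∘ proj₂) e))) })
      (λ { {g , z , h} ((mkEdge p q , r) , s) → let F = mkFactors s r (disc₁⁻¹ {z} {g} {h} p) in
           (z , g , - h) , ((factors-root {μ} {z} F , F) , subst (λ u → 0ℤ < g + u - + 4 * z) (sym (neg-involutive h)) q) , cong (λ u → g , z , u) (neg-involutive h) })
      (λ _ → refl)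

    -- For negative slope the form is negated and reversed, which changes the sign of the slope. The
    -- weight survives because `χ d = χ δ`.
    downs : ∑ (restrict (restrict Ω (¬? ∘ up?)) down?) w ≡ ∑ descents W
    downs = ∑-bij (restrict (restrict Ω (¬? ∘ up?)) down?) descents (λ (z , d , δ) → δ , - z , - d)
      (λ { {z , d , δ} (((_ , mkFactors p q r) , _) , s) →
           (mkEdge (trans (l₁ z d δ) (disc₁ {z} {d} {δ} r)) (subst (0ℤ <_) (l₂ z d δ) s) , subst (0ℤ <_) (sym (neg-involutive d)) p) , q })
      (λ { {z , d , δ} {z′ , d′ , δ′} _ _ e → cong₂ _,_ (neg-injective (cong (proj₁ ∘ proj₂) e)) (cong₂ _,_ (neg-injective (cong (proj₂ ∘ proj₂) e)) (cong proj₁ e)) })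
      (λ { {g , z , h} ((mkEdge p q , r) , s) → let F = mkFactors r s (trans (l₃ z g h) (disc₁⁻¹ { - z} {g} {h} (trans (l₄ z g h) p))) in
           (- z , - h , g) , (((factors-root {μ} { - z} F , F) , neg-pos (subst (0ℤ <_) (l₅ z g h) q)) , subst (0ℤ <_) (l₅ z g h) q)
           , cong (g ,_) (cong₂ _,_ (neg-involutive z) (neg-involutive h)) })
      (λ { {z , d , δ} (((_ , mkFactors p q r) , _) , _) → sym (cong₂ _*_ (sg-neg z) (χ-factors {1ℤ + + 4 * (μ - z * z)} {d} {δ} (χ-split z) r)) })
      where
      l₁ : ∀ z d δ → + 4 * (- z * - z) - δ * - d ≡ + 4 * (z * z) - d * - δ
      l₁ = solve 3 (λ z d δ → # 4 :* (:- z :* :- z) :- δ :* :- d := # 4 :* (z :* z) :- d :* :- δ) refl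
      l₂ : ∀ z d δ → - (d - δ - + 4 * z) ≡ δ + - d - + 4 * - z
      l₂ = solve 3 (λ z d δ → :- (d :- δ :- # 4 :* z) := δ :+ :- d :- # 4 :* :- z) refl
      l₃ : ∀ z g h → - h * g ≡ g * - h
      l₃ = solve 3 (λ z g h → :- h :* g := g :* :- h) refl
      l₄ : ∀ z g h → + 4 * (- z * - z) - g * h ≡ + 4 * (z * z) - g * h
      l₄ = solve 3 (λ z g h → # 4 :* (:- z :* :- z) :- g :* h := # 4 :* (z :* z) :- g :* h) refl
      l₅ : ∀ z g h → g + h - + 4 * z ≡ - (- h - g - + 4 * - z)
      l₅ = solve 3 (λ z g h → g :+ h :- # 4 :* z := :- (:- h :- g :- # 4 :* :- z)) refl

    flats : ∑ (restrict (restrict Ω (¬? ∘ up?)) (¬? ∘ down?)) w ≡ 0ℤ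
    flats = ∑-zero (restrict (restrict Ω (¬? ∘ up?)) (¬? ∘ down?)) λ { {z , d , δ} (((_ , mkFactors p q r) , n₁) , n₂) → ⊥-elim (flat z d δ r n₁ n₂) }
      where
      flat : ∀ z d δ → d * δ ≡ 1ℤ + + 4 * (μ - z * z) → ¬ 0ℤ < d - δ - + 4 * z → ¬ 0ℤ < - (d - δ - + 4 * z) → ⊥
      flat z d δ r n₁ n₂ with sign (d - δ - + 4 * z)
      ... | isPos p  = n₁ p
      ... | isNeg p  = n₂ p
      -- Slope 0 means `d = δ + 4 z`, and then `m = d δ + 4 z² = (δ + 2 z)²`.
      ... | isZero e = nonsquare (δ + + 2 * z) (trans (l₁ z δ d) (trans (cong₂ (λ u v → u - v * δ + + 4 * (z * z)) r e) (l₂ z δ μ)))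
        where
        l₁ : ∀ z δ d → (δ + + 2 * z) * (δ + + 2 * z) ≡ d * δ - (d - δ - + 4 * z) * δ + + 4 * (z * z)
        l₁ = solve 3 (λ z δ d → (δ :+ # 2 :* z) :* (δ :+ # 2 :* z) := d :* δ :- (d :- δ :- # 4 :* z) :* δ :+ # 4 :* (z :* z)) refl
        l₂ : ∀ z δ μ → 1ℤ + + 4 * (μ - z * z) - 0ℤ * δ + + 4 * (z * z) ≡ 1ℤ + + 4 * μ
        l₂ = solve 3 (λ z δ μ → # 1 :+ # 4 :* (μ :- z :* z) :- # 0 :* δ :+ # 4 :* (z :* z) := # 1 :+ # 4 :* μ) refl

  -- Writing out `D` gives a signed sum over the splittings `m = d δ + 4 z²`; those of positive
  -- slope and those of negative slope each reproduce the vanishing sum over descents.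
  alternating-sum : ∑ (roots μ) (λ z → sg z * D (1ℤ + + 4 * (μ - z * z))) ≡ 0ℤ
  alternating-sum = trans (∑-cong (roots μ) (λ {z} _ → sym (∑-* (factors (1ℤ + + 4 * (μ - z * z))) (sg z) (χ ∘ proj₁))))
    (trans (sym (∑-sigma (roots μ) (λ z → factors (1ℤ + + 4 * (μ - z * z))) w))
    (trans (∑-split Ω up? w) (cong₂ _+_ (trans ups ∑-descents)
      (trans (∑-split (restrict Ω (¬? ∘ up?)) down? w) (cong₂ _+_ (trans downs ∑-descents) flats)))))

-- Liouville's identity for sums of two products

record Even (z : ℤ) : Set where
  constructor mkEven
  field sg1 : sg z ≡ 1ℤ

even? : ∀ z → Dec (Even z)
even? z = map′ mkEven Even.sg1 (sg z ≟ 1ℤ)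

odd+odd : ∀ {x y} → Odd x → Odd y → Even (x + y)
odd+odd {x} {y} (mkOdd p) (mkOdd q) = mkEven (trans (sg-+ x y) (cong₂ _*_ p q))

Odd+Even : ∀ {x y} → Odd x → Even y → Odd (x + y)
Odd+Even {x} {y} (mkOdd p) (mkEven q) = mkOdd (trans (sg-+ x y) (cong₂ _*_ p q))

Even-neg : ∀ {x} → Even x → Even (- x)
Even-neg {x} (mkEven p) = mkEven (trans (sg-neg x) p)

record Quad (N : ℤ) (u : ℤ⁴) : Set where
  constructor mkQuad
  field
    a>0 : 0ℤ < proj₁ u
    x>0 : 0ℤ < proj₁ (proj₂ u)
    b>0 : 0ℤ < proj₁ (proj₂ (proj₂ u))
    y>0 : 0ℤ < proj₂ (proj₂ (proj₂ u))
    oa  : Odd (proj₁ u)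
    ox  : Odd (proj₁ (proj₂ u))
    ob  : Odd (proj₁ (proj₂ (proj₂ u)))
    oy  : Odd (proj₂ (proj₂ (proj₂ u)))
    sum : proj₁ u * proj₁ (proj₂ u) + proj₁ (proj₂ (proj₂ u)) * proj₂ (proj₂ (proj₂ u)) ≡ N

-- The common target of two substitutions in a sum of two products: `e` is `a - b` or `a + b`, and
-- `s` is correspondingly `x + y` or `x - y`.
record Mixed (N : ℤ) (u : ℤ⁴) : Set where
  constructor mkMixed
  field
    e>0 : 0ℤ < proj₁ u
    x>0 : 0ℤ < proj₁ (proj₂ u)
    b>0 : 0ℤ < proj₁ (proj₂ (proj₂ u))
    s>0 : 0ℤ < proj₂ (proj₂ (proj₂ u))
    ee  : Even (proj₁ u)
    ox  : Odd (proj₁ (proj₂ u))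
    ob  : Odd (proj₁ (proj₂ (proj₂ u)))
    es  : Even (proj₂ (proj₂ (proj₂ u)))
    sum : proj₁ u * proj₁ (proj₂ u) + proj₁ (proj₂ (proj₂ u)) * proj₂ (proj₂ (proj₂ u)) ≡ N

sum-bound : ∀ {N a x b y} → 0ℤ < a → 0ℤ < x → 0ℤ < b → 0ℤ < y → a * x + b * y ≡ N → Abs≤ (∣ N ∣) a × Abs≤ (∣ N ∣) x × Abs≤ (∣ N ∣) b × Abs≤ (∣ N ∣) y
sum-bound {N} {a} {x} {b} {y} p q r s refl =
    le a p (by (pos→nn p ⊗ pred≥0 q ⊕ pos→nn r ⊗ pos→nn s) (l₁ a x b y))
  , le x q (by (pos→nn q ⊗ pred≥0 p ⊕ pos→nn r ⊗ pos→nn s) (l₂ a x b y))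
  , le b r (by (pos→nn r ⊗ pred≥0 s ⊕ pos→nn p ⊗ pos→nn q) (l₃ a x b y))
  , le y s (by (pos→nn s ⊗ pred≥0 r ⊕ pos→nn p ⊗ pos→nn q) (l₄ a x b y))
  where
  M = ∣ N ∣
  le : ∀ z → 0ℤ < z → 0ℤ ≤ N - z → Abs≤ M z
  le z z>0 h = ≤⇒Abs≤ z (by (+∣ N ∣≥ ⊕ h) (l (+ M) N z)) (nat≥0 M ⊕ pos→nn z>0)
    where
    l : ∀ M N z → M - z ≡ M - N + (N - z)
    l = solve 3 (λ M N z → M :- z := M :- N :+ (N :- z)) refl
  l₁ : ∀ a x b y → a * x + b * y - a ≡ a * (x - 1ℤ) + b * y
  l₁ = solve 4 (λ a x b y → a :* x :+ b :* y :- a := a :* (x :- # 1) :+ b :* y) refl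
  l₂ : ∀ a x b y → a * x + b * y - x ≡ x * (a - 1ℤ) + b * y
  l₂ = solve 4 (λ a x b y → a :* x :+ b :* y :- x := x :* (a :- # 1) :+ b :* y) refl
  l₃ : ∀ a x b y → a * x + b * y - b ≡ b * (y - 1ℤ) + a * x
  l₃ = solve 4 (λ a x b y → a :* x :+ b :* y :- b := b :* (y :- # 1) :+ a :* x) refl
  l₄ : ∀ a x b y → a * x + b * y - y ≡ y * (b - 1ℤ) + a * x
  l₄ = solve 4 (λ a x b y → a :* x :+ b :* y :- y := y :* (b :- # 1) :+ a :* x) refl

quads : ∀ N → Finite (Quad N)
quads N = finite₄ (∣ N ∣) (λ (a , x , b , y) → map′
    (λ (p , q , r , s , p′ , q′ , r′ , s′ , e) → mkQuad p q r s p′ q′ r′ s′ e) (λ (mkQuad p q r s p′ q′ r′ s′ e) → p , q , r , s , p′ , q′ , r′ , s′ , e)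
    (0<? a ×-dec 0<? x ×-dec 0<? b ×-dec 0<? y ×-dec odd? a ×-dec odd? x ×-dec odd? b ×-dec odd? y ×-dec (a * x + b * y ≟ N)))
  λ { {a , x , b , y} (mkQuad p q r s _ _ _ _ e) → sum-bound {N} {a} {x} {b} {y} p q r s e }

mixeds : ∀ N → Finite (Mixed N)
mixeds N = finite₄ (∣ N ∣) (λ (a , x , b , y) → map′
    (λ (p , q , r , s , p′ , q′ , r′ , s′ , e) → mkMixed p q r s p′ q′ r′ s′ e) (λ (mkMixed p q r s p′ q′ r′ s′ e) → p , q , r , s , p′ , q′ , r′ , s′ , e)
    (0<? a ×-dec 0<? x ×-dec 0<? b ×-dec 0<? y ×-dec even? a ×-dec odd? x ×-dec odd? b ×-dec even? y ×-dec (a * x + b * y ≟ N)))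
  λ { {a , x , b , y} (mkMixed p q r s _ _ _ _ e) → sum-bound {N} {a} {x} {b} {y} p q r s e }

χχ-minus : ∀ {a b} → Odd a → Odd b → χ a * χ b ≡ χ (1ℤ + (a - b))
χχ-minus oa ob with odd⇒ oa | odd⇒ ob
... | i , refl | j , refl = trans (cong₂ _*_ (χ-odd i) (χ-odd j)) (sym (trans (cong χ (l i j)) (trans (χ-odd (i - j)) (trans (sg-+ i (- j)) (cong (_*_ (sg i)) (sg-neg j))))))
  where
  l : ∀ i j → 1ℤ + (1ℤ + + 2 * i - (1ℤ + + 2 * j)) ≡ 1ℤ + + 2 * (i - j)
  l = solve 2 (λ i j → # 1 :+ (# 1 :+ # 2 :* i :- (# 1 :+ # 2 :* j)) := # 1 :+ # 2 :* (i :- j)) refl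

χχ-plus : ∀ {a b} → Odd a → Odd b → χ a * χ b ≡ - χ (1ℤ + (a + b))
χχ-plus oa ob with odd⇒ oa | odd⇒ ob
... | i , refl | j , refl = trans (cong₂ _*_ (χ-odd i) (χ-odd j)) (sym (trans (cong (-_ ∘ χ) (l i j)) (trans (cong -_ (trans (χ-odd (1ℤ + (i + j))) (trans (sg-+ 1ℤ (i + j)) (cong (_*_ -1ℤ) (sg-+ i j))))) (l′ (sg i * sg j)))))
  where
  l : ∀ i j → 1ℤ + (1ℤ + + 2 * i + (1ℤ + + 2 * j)) ≡ 1ℤ + + 2 * (1ℤ + (i + j))
  l = solve 2 (λ i j → # 1 :+ (# 1 :+ # 2 :* i :+ (# 1 :+ # 2 :* j)) := # 1 :+ # 2 :* (# 1 :+ (i :+ j))) refl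
  l′ : ∀ u → - (-1ℤ * u) ≡ u
  l′ = solve-∀

x+y-y : ∀ x y → x + y - y ≡ x
x+y-y = solve-∀

x-y+y : ∀ x y → x - y + y ≡ x
x-y+y = solve-∀

module Liouville (κ : ℤ) where

  N = + 2 + + 4 * κ

  U = quads N
  V = mixeds N

  w g : ℤ⁴ → ℤ
  w (a , x , b , y) = χ a * χ b
  g (e , x , b , s) = χ (1ℤ + e)

  a>b a<b x>y x<y s>x e>b : ℤ⁴ → Set
  a>b (a , x , b , y) = 0ℤ < a - b
  a<b (a , x , b , y) = 0ℤ < b - a
  x>y (a , x , b , y) = 0ℤ < x - y
  x<y (a , x , b , y) = 0ℤ < y - x
  s>x (e , x , b , s) = 0ℤ < s - x
  e>b (e , x , b , s) = 0ℤ < e - b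

  a>b? : Decidable a>b
  a>b? (a , x , b , y) = 0<? (a - b)
  a<b? : Decidable a<b
  a<b? (a , x , b , y) = 0<? (b - a)
  x>y? : Decidable x>y
  x>y? (a , x , b , y) = 0<? (x - y)
  x<y? : Decidable x<y
  x<y? (a , x , b , y) = 0<? (y - x)
  s>x? : Decidable s>x
  s>x? (e , x , b , s) = 0<? (s - x)
  e>b? : Decidable e>b
  e>b? (e , x , b , s) = 0<? (e - b)

  flip : ℤ⁴ → ℤ⁴
  flip (a , x , b , y) = b , y , a , x

  flip-quad : ∀ {u} → Quad N u → Quad N (flip u)
  flip-quad {a , x , b , y} (mkQuad p q r s p′ q′ r′ s′ e) = mkQuad r s p q r′ s′ p′ q′ (trans (+-comm (b * y) (a * x)) e)

  flip-injective : ∀ {u u′ : ℤ⁴} → flip u ≡ flip u′ → u ≡ u′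
  flip-injective refl = refl

  not-both : ∀ {a b} → 0ℤ < a - b → ¬ 0ℤ < b - a
  not-both {a} {b} p = neg-pos {b - a} (subst (0ℤ <_) (l a b) p)
    where
    l : ∀ a b → a - b ≡ - (b - a)
    l = solve 2 (λ a b → a :- b := :- (b :- a)) refl

  neither : ∀ {a b} → ¬ 0ℤ < a - b → ¬ 0ℤ < b - a → a ≡ b
  neither {a} {b} p q with sign (a - b)
  ... | isPos r  = ⊥-elim (p r)
  ... | isZero e = i-j≡0⇒i≡j a b e
  ... | isNeg r  = ⊥-elim (q (subst (0ℤ <_) (l a b) r))
    where
    l : ∀ a b → - (a - b) ≡ b - a
    l = solve 2 (λ a b → :- (a :- b) := b :- a) refl

  refl-not : ∀ a → ¬ 0ℤ < a - a
  refl-not a p = pos≢0 p (+-inverseʳ a)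

  U₁ = restrict U a>b?
  T₁ = restrict U x>y?
  V₁ = restrict V s>x?
  V₂ = restrict V e>b?

  -- The part `a < b` mirrors the part `a > b`, and each quadruple with `a = b` is a triple of
  -- weight `χ a χ a = 1`.
  U-split : ∑ U w ≡ ∑ U₁ w + (∑ U₁ w + count (triples N))
  U-split = trans (∑-split U a>b? w) (cong (_+_ (∑ U₁ w)) (trans (∑-split (restrict U (¬? ∘ a>b?)) a<b? w) (cong₂ _+_
      (∑-bij (restrict (restrict U (¬? ∘ a>b?)) a<b?) U₁ flip (λ ((q , _) , r) → flip-quad q , r) (λ _ _ → flip-injective)
        (λ { {a , x , b , y} (q , r) → flip (a , x , b , y) , ((flip-quad q , not-both {a} {b} r) , r) , refl }) (λ { {a , x , b , y} _ → *-comm (χ a) (χ b) }))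
      (sym (∑-bij (triples N) (restrict (restrict U (¬? ∘ a>b?)) (¬? ∘ a<b?)) (λ (D , p , q) → D , p , D , q)
        (λ { {D , p , q} R → let open Triple R hiding (D; p; q) in (mkQuad D>0 p>0 D>0 q>0 odd-D odd-p odd-D odd-q (trans (sym (*-distribˡ-+ D p q)) prod) , refl-not D) , refl-not D })
        (λ { _ _ refl → refl })
        (λ { {a , x , b , y} ((mkQuad p q r s p′ q′ r′ s′ e , n₁) , n₂) → diag (neither {a} {b} n₁ n₂) p q s p′ q′ s′ e })
        (λ { {D , p , q} R → sym (χ² (Triple.odd-D R)) }))))))
    where
    diag : ∀ {a x b y} → a ≡ b → 0ℤ < a → 0ℤ < x → 0ℤ < y → Odd a → Odd x → Odd y → a * x + b * y ≡ N →
      ∃ λ t → Triple N t × _≡_ {A = ℤ⁴} (proj₁ t , proj₁ (proj₂ t) , proj₁ t , proj₂ (proj₂ t)) (a , x , b , y)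
    diag {a} {x} {b} {y} refl p q s p′ q′ s′ e = (a , x , y)
      , record { D>0 = p ; p>0 = q ; q>0 = s ; odd-D = p′ ; odd-p = q′ ; odd-q = s′ ; prod = trans (*-distribˡ-+ a x y) e } , refl

  -- For x = y, the number a + b is twice an odd number, whence χ a χ b = 1.
  diag-weight : ∀ {D p q} → Triple N (D , p , q) → 1ℤ ≡ χ p * χ q
  diag-weight {D} {p} {q} R = sym (trans (χχ-plus (Triple.odd-p R) (Triple.odd-q R)) (go (odd⇒ (Triple.odd-D R)) (odd⇒ (Triple.odd-p R)) (odd⇒ (Triple.odd-q R))))
    where
    go : ∃ (λ k → D ≡ 1ℤ + + 2 * k) → ∃ (λ i → p ≡ 1ℤ + + 2 * i) → ∃ (λ j → q ≡ 1ℤ + + 2 * j) → - χ (1ℤ + (p + q)) ≡ 1ℤ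
    go (k , refl) (i , refl) (j , refl) with odd⇒ (odd*ʳ {1ℤ + + 2 * k} {1ℤ + i + j} (odd-by κ (*-cancelˡ-≡ (+ 2) ((1ℤ + + 2 * k) * (1ℤ + i + j)) (1ℤ + + 2 * κ) (trans (l₁ k i j) (trans (Triple.prod R) (l₂ κ))))))
      where
      l₁ : ∀ k i j → + 2 * ((1ℤ + + 2 * k) * (1ℤ + i + j)) ≡ (1ℤ + + 2 * k) * (1ℤ + + 2 * i + (1ℤ + + 2 * j))
      l₁ = solve 3 (λ k i j → # 2 :* ((# 1 :+ # 2 :* k) :* (# 1 :+ i :+ j)) := (# 1 :+ # 2 :* k) :* (# 1 :+ # 2 :* i :+ (# 1 :+ # 2 :* j))) refl
      l₂ : ∀ κ → + 2 + + 4 * κ ≡ + 2 * (1ℤ + + 2 * κ)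
      l₂ = solve 1 (λ κ → # 2 :+ # 4 :* κ := # 2 :* (# 1 :+ # 2 :* κ)) refl
    ... | l , e = cong -_ (trans (cong χ (trans (l₃ i j) (trans (cong (λ u → 1ℤ + + 2 * u) e) (l₄ l)))) (χ-per (+ 3) l))
      where
      l₃ : ∀ i j → 1ℤ + (1ℤ + + 2 * i + (1ℤ + + 2 * j)) ≡ 1ℤ + + 2 * (1ℤ + i + j)
      l₃ = solve 2 (λ i j → # 1 :+ (# 1 :+ # 2 :* i :+ (# 1 :+ # 2 :* j)) := # 1 :+ # 2 :* (# 1 :+ i :+ j)) refl
      l₄ : ∀ l → 1ℤ + + 2 * (1ℤ + + 2 * l) ≡ + 3 + + 4 * l
      l₄ = solve 1 (λ l → # 1 :+ # 2 :* (# 1 :+ # 2 :* l) := # 3 :+ # 4 :* l) refl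

  T-split : ∑ U w ≡ ∑ T₁ w + (∑ T₁ w + count (triples N))
  T-split = trans (∑-split U x>y? w) (cong (_+_ (∑ T₁ w)) (trans (∑-split (restrict U (¬? ∘ x>y?)) x<y? w) (cong₂ _+_
      (∑-bij (restrict (restrict U (¬? ∘ x>y?)) x<y?) T₁ flip (λ ((q , _) , r) → flip-quad q , r) (λ _ _ → flip-injective)
        (λ { {a , x , b , y} (q , r) → flip (a , x , b , y) , ((flip-quad q , not-both {x} {y} r) , r) , refl }) (λ { {a , x , b , y} _ → *-comm (χ a) (χ b) }))
      (sym (∑-bij (triples N) (restrict (restrict U (¬? ∘ x>y?)) (¬? ∘ x<y?)) (λ (D , p , q) → p , D , q , D)
        (λ { {D , p , q} R → let open Triple R hiding (D; p; q) in (mkQuad p>0 D>0 q>0 D>0 odd-p odd-D odd-q odd-D (trans (l D p q) prod) , refl-not D) , refl-not D })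
        (λ { _ _ refl → refl })
        (λ { {a , x , b , y} ((mkQuad p q r s p′ q′ r′ s′ e , n₁) , n₂) → diag (neither {x} {y} n₁ n₂) p q r p′ q′ r′ e })
        (λ { {D , p , q} R → diag-weight R }))))))
    where
    l : ∀ D p q → p * D + q * D ≡ D * (p + q)
    l = solve 3 (λ D p q → p :* D :+ q :* D := D :* (p :+ q)) refl
    diag : ∀ {a x b y} → x ≡ y → 0ℤ < a → 0ℤ < x → 0ℤ < b → Odd a → Odd x → Odd b → a * x + b * y ≡ N →
      ∃ λ t → Triple N t × _≡_ {A = ℤ⁴} (proj₁ (proj₂ t) , proj₁ t , proj₂ (proj₂ t) , proj₁ t) (a , x , b , y)
    diag {a} {x} {b} {y} refl p q r p′ q′ r′ e = (x , a , b)
      , record { D>0 = q ; p>0 = p ; q>0 = r ; odd-D = q′ ; odd-p = p′ ; odd-q = r′ ; prod = trans (sym (l x a b)) e } , refl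

  -- `a x + b y = (a - b) x + b (x + y)`, and `χ a χ b` depends on `a - b` only; the image is the
  -- part `s > x`.
  U₁≡V₁ : ∑ U₁ w ≡ ∑ V₁ g
  U₁≡V₁ = ∑-bij U₁ V₁ (λ (a , x , b , y) → a - b , x , b , x + y)
    (λ { {a , x , b , y} (mkQuad p q r s p′ q′ r′ s′ e , h) → mkMixed h q r (+-mono-< q s) (odd+odd p′ (odd-neg r′)) q′ r′ (odd+odd q′ s′) (trans (l₁ a x b y) e) , subst (0ℤ <_) (l₂ x y) s })
    (λ { {a , x , b , y} {a′ , x′ , b′ , y′} _ _ → inj })
    (λ { {e , x , b , s} (mkMixed p q r t p′ q′ r′ t′ h , k) → (e + b , x , b , s - x)
         , (mkQuad (+-mono-< p r) q r k (subst Odd (+-comm b e) (Odd+Even r′ p′)) q′ r′ (subst Odd (+-comm (- x) s) (Odd+Even (odd-neg q′) t′)) (trans (l₃ e x b s) h)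
           , subst (0ℤ <_) (sym (x+y-y e b)) p)
         , cong₂ _,_ (x+y-y e b) (cong (λ u → x , b , u) (l₄ x s)) })
    (λ { {a , x , b , y} (mkQuad _ _ _ _ p′ _ r′ _ _ , _) → χχ-minus p′ r′ })
    where
    l₁ : ∀ a x b y → (a - b) * x + b * (x + y) ≡ a * x + b * y
    l₁ = solve 4 (λ a x b y → (a :- b) :* x :+ b :* (x :+ y) := a :* x :+ b :* y) refl
    l₂ : ∀ x y → y ≡ x + y - x
    l₂ = solve-∀
    l₃ : ∀ e x b s → (e + b) * x + b * (s - x) ≡ e * x + b * s
    l₃ = solve 4 (λ e x b s → (e :+ b) :* x :+ b :* (s :- x) := e :* x :+ b :* s) refl
    l₄ : ∀ x s → x + (s - x) ≡ s
    l₄ = solve-∀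
    inj : ∀ {a x b y a′ x′ b′ y′} → _≡_ {A = ℤ⁴} (a - b , x , b , x + y) (a′ - b′ , x′ , b′ , x′ + y′) → _≡_ {A = ℤ⁴} (a , x , b , y) (a′ , x′ , b′ , y′)
    inj {a} {x} {b} {y} {a′} {x′} {b′} {y′} e with cong (proj₁ ∘ proj₂) e | cong (proj₁ ∘ proj₂ ∘ proj₂) e
    ... | refl | refl = cong₂ _,_ (trans (sym (x-y+y a b)) (trans (cong (_+ b) (cong proj₁ e)) (x-y+y a′ b)))
        (cong (λ u → x , b , u) (trans (l₂ x y) (trans (cong (_- x) (cong (proj₂ ∘ proj₂ ∘ proj₂) e)) (sym (l₂ x y′)))))

  -- `a x + b y = (a + b) y + a (x - y)`, and `χ a χ b` depends on `a + b` only, now with the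
  -- opposite sign; the image is the part `e > b`.
  T₁≡-V₂ : ∑ T₁ w ≡ - ∑ V₂ g
  T₁≡-V₂ = trans (∑-bij T₁ V₂ (λ (a , x , b , y) → a + b , y , a , x - y) {v = λ u → - g u}
    (λ { {a , x , b , y} (mkQuad p q r s p′ q′ r′ s′ e , h) → mkMixed (+-mono-< p r) s p h (odd+odd p′ r′) s′ p′ (odd+odd q′ (odd-neg s′)) (trans (l₁ a x b y) e) , subst (0ℤ <_) (l₂ a b) r })
    (λ { {a , x , b , y} {a′ , x′ , b′ , y′} _ _ → inj })
    (λ { {e , x , b , s} (mkMixed p q r t p′ q′ r′ t′ h , k) → (b , s + x , e - b , x)
         , (mkQuad r (+-mono-< t q) k q r′ (subst Odd (+-comm x s) (Odd+Even q′ t′)) (subst Odd (+-comm (- b) e) (Odd+Even (odd-neg r′) p′)) q′ (trans (l₃ e x b s) h)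
           , subst (0ℤ <_) (sym (x+y-y s x)) t)
         , cong₂ _,_ (l₄ b e) (cong (λ u → x , b , u) (x+y-y s x)) })
    (λ { {a , x , b , y} (mkQuad _ _ _ _ p′ _ r′ _ _ , _) → χχ-plus p′ r′ })) (∑-neg V₂ g)
    where
    l₁ : ∀ a x b y → (a + b) * y + a * (x - y) ≡ a * x + b * y
    l₁ = solve 4 (λ a x b y → (a :+ b) :* y :+ a :* (x :- y) := a :* x :+ b :* y) refl
    l₂ : ∀ a b → b ≡ a + b - a
    l₂ = solve-∀
    l₃ : ∀ e x b s → b * (s + x) + (e - b) * x ≡ e * x + b * s
    l₃ = solve 4 (λ e x b s → b :* (s :+ x) :+ (e :- b) :* x := e :* x :+ b :* s) refl
    l₄ : ∀ b e → b + (e - b) ≡ e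
    l₄ = solve-∀
    inj : ∀ {a x b y a′ x′ b′ y′} → _≡_ {A = ℤ⁴} (a + b , y , a , x - y) (a′ + b′ , y′ , a′ , x′ - y′) → _≡_ {A = ℤ⁴} (a , x , b , y) (a′ , x′ , b′ , y′)
    inj {a} {x} {b} {y} {a′} {x′} {b′} {y′} e with cong (proj₁ ∘ proj₂) e | cong (proj₁ ∘ proj₂ ∘ proj₂) e
    ... | refl | refl = cong (a ,_) (cong₂ _,_ (trans (sym (x-y+y x y)) (trans (cong (_+ y) (cong (proj₂ ∘ proj₂ ∘ proj₂) e)) (x-y+y x′ y)))
        (cong (_, y) (trans (l₂ a b) (trans (cong (_- a) (cong proj₁ e)) (sym (l₂ a b′))))))

  -- The shear `e x + b s = e (x - s) + (b + e) s` keeps `e` and with it the weight. It takes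
  -- `s < x` to `e < b`; equality is excluded by parity in both places.
  V-rest : ∑ (restrict V (¬? ∘ s>x?)) g ≡ ∑ (restrict V (¬? ∘ e>b?)) g
  V-rest = ∑-bij (restrict V (¬? ∘ s>x?)) (restrict V (¬? ∘ e>b?)) (λ (e , x , b , s) → e , x - s , b + e , s)
    (λ { {e , x , b , s} (mkMixed p q r t p′ q′ r′ t′ h , k) →
         mkMixed p (subst (0ℤ <_) (l₁ s x) (nonpos (subst Odd (+-comm (- x) s) (Odd+Even (odd-neg q′) t′)) k)) (+-mono-< r p) t p′ (Odd+Even q′ (Even-neg t′)) (Odd+Even r′ p′) t′ (trans (l₂ e x b s) h)
         , λ z → neg-pos {b} (subst (0ℤ <_) (l₃ e b) z) r })
    (λ { {e , x , b , s} {e′ , x′ , b′ , s′} _ _ → inj })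
    (λ { {e , x , b , s} (mkMixed p q r t p′ q′ r′ t′ h , k) → (e , x + s , b - e , s)
         , (mkMixed p (+-mono-< q t) (subst (0ℤ <_) (l₁ e b) (nonpos (subst Odd (+-comm (- b) e) (Odd+Even (odd-neg r′) p′)) k)) t p′ (Odd+Even q′ t′) (Odd+Even r′ (Even-neg p′)) t′ (trans (l₄ e x b s) h)
           , λ z → neg-pos {x} (subst (0ℤ <_) (l₅ x s) z) q)
         , cong (e ,_) (cong₂ _,_ (x+y-y x s) (cong (_, s) (x-y+y b e))) })
    (λ _ → refl)
    where
    l₁ : ∀ s x → - (s - x) ≡ x - s
    l₁ = solve 2 (λ s x → :- (s :- x) := x :- s) refl
    l₂ : ∀ e x b s → e * (x - s) + (b + e) * s ≡ e * x + b * s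
    l₂ = solve 4 (λ e x b s → e :* (x :- s) :+ (b :+ e) :* s := e :* x :+ b :* s) refl
    l₃ : ∀ e b → e - (b + e) ≡ - b
    l₃ = solve 2 (λ e b → e :- (b :+ e) := :- b) refl
    l₄ : ∀ e x b s → e * (x + s) + (b - e) * s ≡ e * x + b * s
    l₄ = solve 4 (λ e x b s → e :* (x :+ s) :+ (b :- e) :* s := e :* x :+ b :* s) refl
    l₅ : ∀ x s → s - (x + s) ≡ - x
    l₅ = solve 2 (λ x s → s :- (x :+ s) := :- x) refl
    inj : ∀ {e x b s e′ x′ b′ s′} → _≡_ {A = ℤ⁴} (e , x - s , b + e , s) (e′ , x′ - s′ , b′ + e′ , s′) → _≡_ {A = ℤ⁴} (e , x , b , s) (e′ , x′ , b′ , s′)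
    inj {e} {x} {b} {s} {e′} {x′} {b′} {s′} h with cong proj₁ h | cong (proj₂ ∘ proj₂ ∘ proj₂) h
    ... | refl | refl = cong (e ,_) (cong₂ _,_ (trans (sym (x-y+y x s)) (trans (cong (_+ s) (cong (proj₁ ∘ proj₂) h)) (x-y+y x′ s)))
        (cong (_, s) (trans (sym (x+y-y b e)) (trans (cong (_- e) (cong (proj₁ ∘ proj₂ ∘ proj₂) h)) (x+y-y b′ e)))))

  V₁≡V₂ : ∑ V₁ g ≡ ∑ V₂ g
  V₁≡V₂ = +-cancelʳ′ (∑ (restrict V (¬? ∘ s>x?)) g) (trans (sym (∑-split V s>x? g)) (trans (∑-split V e>b? g) (cong (_+_ (∑ V₂ g)) (sym V-rest))))

  -- Let `S` be the sum over `a > b`, `T` that over `x > y`, and `c` the number of triples. The two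
  -- divisions give `2 S + c = 2 T + c`, the substitutions give `S = - T`; so `S = 0` and only the
  -- diagonal is left.
  liouville : ∑ U w ≡ count (triples N)
  liouville = trans U-split (trans (cong (λ u → u + (u + count (triples N))) S≡0) (l (count (triples N))))
    where
    l : ∀ c → 0ℤ + (0ℤ + c) ≡ c
    l = solve-∀
    l₁ : ∀ s c → s + (s + c) ≡ + 2 * s + c
    l₁ = solve 2 (λ s c → s :+ (s :+ c) := # 2 :* s :+ c) refl
    S≡T : ∑ U₁ w ≡ ∑ T₁ w
    S≡T = *-cancelˡ-≡ (+ 2) _ _ (+-cancelʳ′ (count (triples N)) (trans (sym (l₁ (∑ U₁ w) _)) (trans (sym U-split) (trans T-split (l₁ (∑ T₁ w) _)))))
    S≡0 : ∑ U₁ w ≡ 0ℤ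
    S≡0 = x≡-x⇒0 (trans S≡T (trans T₁≡-V₂ (cong -_ (sym (trans U₁≡V₁ V₁≡V₂)))))

-- Prime divisors congruent to 3 modulo 4

prime>1 : ∀ {p} → Prime p → 0ℤ < + p - 1ℤ
prime>1 {suc zero}    pr with prime⇒nonTrivial pr
... | ()
prime>1 {suc (suc n)} _ = +<+ (ℕ.s≤s ℕ.z≤n)
prime>1 {zero} pr with prime⇒nonZero pr
... | ()

prime>0 : ∀ {p} → Prime p → 0ℤ < + p
prime>0 {p} pr = pby (pos→nn (prime>1 pr)) refl

euclid : ∀ {p} → Prime p → ∀ x y → + p dvd x * y → + p dvd x ⊎ + p dvd y
euclid {p} pr x y h with euclidsLemma ∣ x ∣ ∣ y ∣ pr (subst (p ℕ∣.∣_) (abs-* x y) (∣⇒∣ᵤ h))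
... | inj₁ q = inj₁ (∣ᵤ⇒∣ q)
... | inj₂ q = inj₂ (∣ᵤ⇒∣ q)

euclid² : ∀ {p} → Prime p → ∀ x → + p dvd x * x → + p dvd x
euclid² pr x h with euclid pr x x h
... | inj₁ q = q
... | inj₂ q = q

∣-subst : ∀ {k x y} → x ≡ y → k dvd x → k dvd y
∣-subst {k} = subst (k dvd_)

p∤1 : ∀ {p} → Prime p → ¬ + p dvd 1ℤ
p∤1 {p} pr (divides q e) with sign q
... | isZero refl = 1≢0 e
... | isPos h = absurd {n = 0} (pred≥0 h ⊗ pos→nn (prime>0 pr) ⊕ pred≥0 (prime>1 pr)) (trans (l q (+ p)) (cong (_- + 2) (sym e)))
  where
  l : ∀ q p → (q - 1ℤ) * p + (p - 1ℤ - 1ℤ) ≡ q * p - + 2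
  l = solve 2 (λ q p → (q :- # 1) :* p :+ (p :- # 1 :- # 1) := q :* p :- # 2) refl
... | isNeg h = absurd {n = 0} (pos→nn h ⊗ pos→nn (prime>0 pr)) (trans (l q (+ p)) (cong -_ (sym e)))
  where
  l : ∀ q p → - q * p ≡ - (q * p)
  l = solve 2 (λ q p → :- q :* p := :- (q :* p)) refl

-- A product with χ = -1 has a factor with χ = -1.
prime-factor-3 : ∀ {n} .{{_ : ℕ.NonZero n}} → χ (+ n) ≡ -1ℤ → ∃ λ q → Prime q × q ℕ∣.∣ n × χ (+ q) ≡ -1ℤ
prime-factor-3 {n} e = let open PrimeFactorisation (factorise n) renaming (factors to primes)
                           q , pr , d , h = go primes factorsPrime (trans (cong (χ ∘ +_) (sym isFactorisation)) e)
                       in q , pr , subst (q ℕ∣.∣_) (sym isFactorisation) d , h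
  where
  go : ∀ (ps : List ℕ) → All Prime ps → χ (+ product ps) ≡ -1ℤ → ∃ λ q → Prime q × q ℕ∣.∣ product ps × χ (+ q) ≡ -1ℤ
  go [] [] h = ⊥-elim (1≢-1 h)
  go (p ∷ ps) (pr ∷ prs) h with χ±1 {+ p} (odd-χ {+ p} λ z → 0≢-1 (trans (cong (_* χ (+ product ps)) (sym z)) h′))
    where
    h′ : χ (+ p) * χ (+ product ps) ≡ -1ℤ
    h′ = trans (sym (χ-* (+ p) (+ product ps))) (trans (cong χ (sym (pos-* p (product ps)))) h)
  ... | inj₂ z = p , pr , ℕ∣.m∣m*n (product ps) , z
  ... | inj₁ z = let q , pr′ , d , h″ = go ps prs (trans (sym (*-identityˡ _)) (trans (cong (_* χ (+ product ps)) (sym z)) (trans (sym (χ-* (+ p) (+ product ps))) (trans (cong χ (sym (pos-* p (product ps)))) h))))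
                 in q , pr′ , ℕ∣.∣-trans d (ℕ∣.n∣m*n p) , h″

pos⇒nonZero : ∀ {n} → 0ℤ < + n → ℕ.NonZero n
pos⇒nonZero {suc n} _ = _
pos⇒nonZero {zero} (+<+ ())

χ-prime-odd : ∀ {p} → χ (+ p) ≡ -1ℤ → Odd (+ p)
χ-prime-odd {p} e = odd-χ {+ p} λ z → 0≢-1 (trans (sym z) e)

residue-mod : ∀ {p} → Prime p → ∀ i → + p dvd i * i + 1ℤ → ∃ λ r → 0ℤ ≤ r × 0ℤ < + p - r × + p dvd r * r + 1ℤ
residue-mod {p} pr i h = let instance _ = prime⇒nonZero pr in go (i %ℕ p) (i /ℕ p) (a≡a%ℕn+[a/ℕn]*n i p) (n%ℕd<d i p)
  where
  go : ∀ r q → i ≡ + r + q * + p → r ℕ.< p → ∃ λ r → 0ℤ ≤ r × 0ℤ < + p - r × + p dvd r * r + 1ℤ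
  go r q e r<p = + r , nat≥0 r , subst (_< + p - + r) (+-inverseʳ (+ r)) (+-monoˡ-< (- + r) (+<+ r<p))
    , ∣-subst (trans (cong (λ u → u * u + 1ℤ - (+ r + + r + q * + p) * q * + p) e) (l (+ r) q (+ p))) (∣m∣n⇒∣m-n h (divides ((+ r + + r + q * + p) * q) refl))
    where
    l : ∀ r q p → (r + q * p) * (r + q * p) + 1ℤ - (r + r + q * p) * q * p ≡ r * r + 1ℤ
    l = solve 3 (λ r q p → (r :+ q :* p) :* (r :+ q :* p) :+ # 1 :- (r :+ r :+ q :* p) :* q :* p := r :* r :+ # 1) refl

-- One of `r` and `p - r` is even. Evenness makes the square plus one equal to 1 modulo 4, so that
-- for `χ p = -1` the cofactor of `p` has `χ` equal to -1 again.
even-representative : ∀ {p} → Odd (+ p) → ∀ r → 0ℤ ≤ r → 0ℤ < + p - r → + p dvd r * r + 1ℤ → ∃ λ l → 0ℤ ≤ + 2 * l × 0ℤ < + p - + 2 * l × + p dvd + 2 * l * (+ 2 * l) + 1ℤ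
even-representative {p} o r r≥0 r<p h′ with parity r | odd⇒ o
... | even l e | _ = l , subst (0ℤ ≤_) e′ r≥0 , subst (λ u → 0ℤ < + p - u) e′ r<p , ∣-subst (cong (λ u → u * u + 1ℤ) e′) h′
  where
  e′ : r ≡ + 2 * l
  e′ = trans e (+-identityˡ (+ 2 * l))
... | odd l refl | k , e = k - l , by (pos→nn r<p) (sym p-r)
    , subst (λ u → 0ℤ < + p - u) p-r (by′ (l₂ (+ p) l) r≥0)
    , ∣-subst (trans (l₃ (+ p) l) (cong (λ u → u * u + 1ℤ) p-r)) (∣m∣n⇒∣m+n h′ (divides (+ p - + 2 * (1ℤ + + 2 * l)) refl))
  where
  l₁ : ∀ k l → 1ℤ + + 2 * k - (1ℤ + + 2 * l) ≡ + 2 * (k - l)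
  l₁ = solve 2 (λ k l → # 1 :+ # 2 :* k :- (# 1 :+ # 2 :* l) := # 2 :* (k :- l)) refl
  p-r : + p - (1ℤ + + 2 * l) ≡ + 2 * (k - l)
  p-r = trans (cong (_- (1ℤ + + 2 * l)) e) (l₁ k l)
  l₂ : ∀ p l → p - (p - (1ℤ + + 2 * l)) ≡ 1ℤ + + 2 * l
  l₂ = solve 2 (λ p l → p :- (p :- (# 1 :+ # 2 :* l)) := # 1 :+ # 2 :* l) refl
  by′ : ∀ {x} → x ≡ 1ℤ + + 2 * l → 0ℤ ≤ 1ℤ + + 2 * l → 0ℤ < x
  by′ refl q with odd-sign (odd-by {1ℤ + + 2 * l} l refl)
  ... | inj₂ z = z
  ... | inj₁ z = ⊥-elim (absurd {n = 0} (pred≥0 z ⊕ q) (l₄ l))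
    where
    l₄ : ∀ l → - (1ℤ + + 2 * l) - 1ℤ + (1ℤ + + 2 * l) ≡ -[1+ 0 ]
    l₄ = solve 1 (λ l → :- (# 1 :+ # 2 :* l) :- # 1 :+ (# 1 :+ # 2 :* l) := con -[1+ 0 ]) refl
  l₃ : ∀ p l → (1ℤ + + 2 * l) * (1ℤ + + 2 * l) + 1ℤ + (p - + 2 * (1ℤ + + 2 * l)) * p ≡ (p - (1ℤ + + 2 * l)) * (p - (1ℤ + + 2 * l)) + 1ℤ
  l₃ = solve 2 (λ p l → (# 1 :+ # 2 :* l) :* (# 1 :+ # 2 :* l) :+ # 1 :+ (p :- # 2 :* (# 1 :+ # 2 :* l)) :* p := (p :- (# 1 :+ # 2 :* l)) :* (p :- (# 1 :+ # 2 :* l)) :+ # 1) refl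

even-residue : ∀ {p} → Prime p → Odd (+ p) → ∀ i → + p dvd i * i + 1ℤ → ∃ λ l → 0ℤ ≤ + 2 * l × 0ℤ < + p - + 2 * l × + p dvd + 2 * l * (+ 2 * l) + 1ℤ
even-residue pr o i h = let r , r≥0 , r<p , h′ = residue-mod pr i h in even-representative o r r≥0 r<p h′

-- If p = 3 mod 4 divides i² + 1, with i even and less than p, then so does a smaller such prime, dividing the cofactor.
no-root : ∀ p → Prime p → χ (+ p) ≡ -1ℤ → ∀ i → ¬ + p dvd i * i + 1ℤ
no-root = <-rec _ step
  where
  cofactor-pos : ∀ P j c → 0ℤ < P → j * j + 1ℤ ≡ c * P → 0ℤ < c
  cofactor-pos P j c P>0 e = pos*-cancelˡ {P} {c} P>0 (subst (0ℤ <_) (trans e (*-comm c P)) (pby (sq≥0 j) (l (j * j))))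
    where
    l : ∀ x → x + 1ℤ - 1ℤ ≡ x
    l = solve-∀
  cofactor-small : ∀ P j c → 0ℤ < P → 0ℤ < P - 1ℤ → 0ℤ ≤ j → 0ℤ < P - j → j * j + 1ℤ ≡ c * P → 0ℤ < P - c
  cofactor-small P j c P>0 P>1 j≥0 j<P e = pos*-cancelˡ {P} {P - c} P>0 (pby (pred≥0 j<P ⊗ (pos→nn P>0 ⊕ j≥0) ⊕ j≥0 ⊕ pred≥0 P>1)
      (trans (l₁ P c) (trans (cong (λ u → P * P - u - 1ℤ) (sym e)) (l₂ P j))))
    where
    l₁ : ∀ p c → p * (p - c) - 1ℤ ≡ p * p - c * p - 1ℤ
    l₁ = solve 2 (λ p c → p :* (p :- c) :- # 1 := p :* p :- c :* p :- # 1) refl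
    l₂ : ∀ p x → p * p - (x * x + 1ℤ) - 1ℤ ≡ (p - x - 1ℤ) * (p + x) + x + (p - 1ℤ - 1ℤ)
    l₂ = solve 2 (λ p x → p :* p :- (x :* x :+ # 1) :- # 1 := (p :- x :- # 1) :* (p :+ x) :+ x :+ (p :- # 1 :- # 1)) refl
  cofactor-χ : ∀ P l c → χ P ≡ -1ℤ → + 2 * l * (+ 2 * l) + 1ℤ ≡ c * P → χ c ≡ -1ℤ
  cofactor-χ P l c χP e = trans (l₁ (χ c)) (trans (cong (λ u → - (χ c * u)) (sym χP)) (cong -_
      (trans (sym (χ-* c P)) (trans (cong χ (trans (sym e) (l₂ l))) (χ-per 1ℤ (l * l))))))
    where
    l₁ : ∀ x → x ≡ - (x * -1ℤ)
    l₁ = solve-∀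
    l₂ : ∀ l → + 2 * l * (+ 2 * l) + 1ℤ ≡ 1ℤ + + 4 * (l * l)
    l₂ = solve 1 (λ l → # 2 :* l :* (# 2 :* l) :+ # 1 := # 1 :+ # 4 :* (l :* l)) refl
  less : ∀ {i j} → 0ℤ < i - j → j < i
  less {i} {j} h = subst₂ _<_ (+-identityˡ j) (l i j) (+-monoˡ-< j h)
    where
    l : ∀ x y → x - y + y ≡ x
    l = solve-∀
  step : ∀ p → (∀ {q} → q ℕ.< p → Prime q → χ (+ q) ≡ -1ℤ → ∀ i → ¬ + q dvd i * i + 1ℤ) → Prime p → χ (+ p) ≡ -1ℤ → ∀ i → ¬ + p dvd i * i + 1ℤ
  step p rec pr χp i h = go (even-residue pr (χ-prime-odd χp) i h)
    where
    finish : ∀ l c → 0ℤ < + c → 0ℤ < + p - + c → χ (+ c) ≡ -1ℤ → + c dvd + 2 * l * (+ 2 * l) + 1ℤ → ⊥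
    finish l c c>0 c<p χc d′ = let instance _ = pos⇒nonZero c>0
                                   q , prq , d , χq = prime-factor-3 {c} χc
                               in rec (ℕₚ.≤-<-trans (ℕ∣.∣⇒≤ d) (drop‿+<+ (less {+ p} {+ c} c<p))) prq χq (+ 2 * l) (∣-trans (∣ᵤ⇒∣ d) d′)
    go : (∃ λ l → 0ℤ ≤ + 2 * l × 0ℤ < + p - + 2 * l × + p dvd + 2 * l * (+ 2 * l) + 1ℤ) → ⊥
    go (l , l≥0 , l<p , divides (+ c) e) = finish l c (cofactor-pos (+ p) (+ 2 * l) (+ c) (prime>0 pr) e)
      (cofactor-small (+ p) (+ 2 * l) (+ c) (prime>0 pr) (prime>1 pr) l≥0 l<p e) (cofactor-χ (+ p) l (+ c) χp e) (divides (+ p) (trans e (*-comm (+ c) (+ p))))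
    go (l , _ , _ , divides -[1+ c ] e) with cofactor-pos (+ p) (+ 2 * l) -[1+ c ] (prime>0 pr) e
    ... | ()

inverse-formula : ∀ {P D k α γ u v x} → 0ℤ < P → 0ℤ < D → P ≡ α * D → x ≡ γ * D → α * u + γ * v ≡ 1ℤ → α ≡ k * P → x * v - 1ℤ ≡ - u * P
inverse-formula {P} {D} {k} {α} {γ} {u} {v} {x} P>0 D>0 P≡ x≡ uv α≡ = begin
  x * v - 1ℤ                     ≡⟨ cong₂ (λ y z → y * v - z) (trans x≡ (trans (cong (_*_ γ) D1) (*-identityʳ γ))) (sym uv) ⟩
  γ * v - (α * u + γ * v)        ≡⟨ l₂ α γ u v ⟩
  - u * α                        ≡⟨ cong (_*_ (- u)) (sym (trans P≡ (trans (cong (_*_ α) D1) (*-identityʳ α)))) ⟩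
  - u * P                        ∎
  where
  open ≡-Reasoning
  l₁ : ∀ k P D → P * (D * k) ≡ k * P * D
  l₁ = solve 3 (λ k P D → P :* (D :* k) := k :* P :* D) refl
  l₂ : ∀ α γ u v → γ * v - (α * u + γ * v) ≡ - u * α
  l₂ = solve 4 (λ α γ u v → γ :* v :- (α :* u :+ γ :* v) := :- u :* α) refl
  Dk : D * k ≡ 1ℤ
  Dk = pos*-cancel-≡ {P} {D * k} {1ℤ} P>0 (trans (l₁ k P D) (trans (cong (_* D) (sym α≡)) (trans (sym P≡) (sym (*-identityʳ P)))))
  D1 : D ≡ 1ℤ
  D1 = factor-1 {D} {k} D>0 (pos*-cancelˡ {D} {k} D>0 (subst (0ℤ <_) (sym Dk) (+<+ (ℕ.s≤s ℕ.z≤n)))) Dk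

-- In `p = α D`, with `D` the gcd of `p` and `x`, the prime divides `α` or `D`. The latter would
-- make it divide `x`; the former forces `D = 1`, and the Bézout coefficient `v` is the inverse.
inverse-mod : ∀ {p} → Prime p → ∀ x → ¬ + p dvd x → ∃ λ v → + p dvd x * v - 1ℤ
inverse-mod {p} pr x ¬d = find (+ p) refl
  where
  find : ∀ P → P ≡ + p → ∃ λ v → P dvd x * v - 1ℤ
  find P e = let D , α , γ , u , v , D>0 , P≡ , x≡ , uv = bezout P x (subst (0ℤ <_) (sym e) (prime>0 pr))
             in go {D} {α} {γ} {u} {v} D>0 P≡ x≡ uv (euclid pr α D (divides 1ℤ (trans (sym P≡) (trans e (sym (*-identityˡ (+ p)))))))
    where
    go : ∀ {D α γ u v} → 0ℤ < D → P ≡ α * D → x ≡ γ * D → α * u + γ * v ≡ 1ℤ → + p dvd α ⊎ + p dvd D → ∃ λ v → P dvd x * v - 1ℤ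
    go {D} {α} {γ} {u} {v} D>0 P≡ x≡ uv (inj₂ (divides k D≡)) = ⊥-elim (¬d (divides (γ * k) (trans x≡ (trans (cong (_*_ γ) D≡) (sym (*-assoc γ k (+ p)))))))
    go {D} {α} {γ} {u} {v} D>0 P≡ x≡ uv (inj₁ (divides k α≡)) = v , divides (- u) (inverse-formula {P} {D} {k} {α} {γ} {u} {v} {x} (subst (0ℤ <_) (sym e) (prime>0 pr)) D>0 P≡ x≡ uv (trans α≡ (cong (_*_ k) (sym e))))

-- If `x` were invertible modulo `p` with inverse `u`, then `y u` would be a square root of -1,
-- against `no-root`.
two-squares-mod : ∀ {p} → Prime p → χ (+ p) ≡ -1ℤ → ∀ x y → + p dvd x * x + y * y → + p dvd x
two-squares-mod {p} pr χp x y h with + p dvd? x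
... | yes d = d
... | no ¬d = let u , h′ = inverse-mod pr x ¬d in
    ⊥-elim (no-root p pr χp (y * u) (∣-subst (l x y u) (∣m∣n⇒∣m-n (∣m⇒∣m*n (u * u) h) (∣m⇒∣m*n (x * u + 1ℤ) h′))))
  where
  l : ∀ x y u → (x * x + y * y) * (u * u) - (x * u - 1ℤ) * (x * u + 1ℤ) ≡ y * u * (y * u) + 1ℤ
  l = solve 3 (λ x y u → (x :* x :+ y :* y) :* (u :* u) :- (x :* u :- # 1) :* (x :* u :+ # 1) := y :* u :* (y :* u) :+ # 1) refl

-- Hecke relations for the divisor sum

module HeckeD {n} (pr : Prime n) (k : ℤ) where
  p = + n
  p>0 : 0ℤ < p
  p>0 = prime>0 pr

  p∣δ? : Decidable (λ (x : ℤ²) → p dvd proj₂ x)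
  p∣δ? x = p dvd? proj₂ x

  S : ℤ
  S = ∑ (restrict (factors k) p∣δ?) (χ ∘ proj₁)

  scaled : ∀ k → ∑ (restrict (factors (p * k)) p∣δ?) (χ ∘ proj₁) ≡ D k
  scaled k = sym (∑-bij (factors k) (restrict (factors (p * k)) p∣δ?) (λ (d , δ) → d , δ * p)
    (λ { {d , δ} (mkFactors q r e) → mkFactors q (pos* r p>0) (trans (l₁ d δ p) (cong (_*_ p) e)) , divides δ refl })
    (λ { {d , δ} {d′ , δ′} _ _ e → cong₂ _,_ (cong proj₁ e) (pos*-cancel-≡ {p} {δ} {δ′} p>0 (trans (*-comm p δ) (trans (cong proj₂ e) (*-comm δ′ p)))) })
    (λ { {d , δ} (mkFactors q r e , divides δ′ refl) → (d , δ′)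
         , mkFactors q (pos*-cancelˡ {p} {δ′} p>0 (subst (0ℤ <_) (*-comm δ′ p) r)) (pos*-cancel-≡ {p} {d * δ′} {k} p>0 (trans (sym (l₁ d δ′ p)) e)) , refl })
    (λ _ → refl))
    where
    l₁ : ∀ d δ p → d * (δ * p) ≡ p * (d * δ)
    l₁ = solve 3 (λ d δ p → d :* (δ :* p) := p :* (d :* δ)) refl

  unscaled : ∑ (restrict (factors (p * k)) (¬? ∘ p∣δ?)) (χ ∘ proj₁) ≡ χ p * ∑ (restrict (factors k) (¬? ∘ p∣δ?)) (χ ∘ proj₁)
  unscaled = sym (trans (sym (∑-* (restrict (factors k) (¬? ∘ p∣δ?)) (χ p) (χ ∘ proj₁)))
    (∑-bij (restrict (factors k) (¬? ∘ p∣δ?)) (restrict (factors (p * k)) (¬? ∘ p∣δ?)) (λ (d , δ) → p * d , δ)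
    (λ { {d , δ} (mkFactors q r e , nd) → mkFactors (pos* p>0 q) r (trans (*-assoc p d δ) (cong (_*_ p) e)) , nd })
    (λ { {d , δ} {d′ , δ′} _ _ e → cong₂ _,_ (pos*-cancel-≡ {p} {d} {d′} p>0 (cong proj₁ e)) (cong proj₂ e) })
    (λ { {d , δ} (mkFactors q r e , nd) → back d δ q r e nd (euclid pr d δ (divides k (trans e (*-comm p k)))) })
    (λ { {d , δ} _ → sym (χ-* p d) })))
    where
    back : ∀ d δ → 0ℤ < d → 0ℤ < δ → d * δ ≡ p * k → ¬ p dvd δ → p dvd d ⊎ p dvd δ →
      ∃ λ (x : ℤ²) → (Factors k x × ¬ p dvd proj₂ x) × (p * proj₁ x , proj₂ x) ≡ (d , δ)
    back d δ q r e nd (inj₂ h) = ⊥-elim (nd h)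
    back d δ q r e nd (inj₁ (divides d′ refl)) = (d′ , δ)
      , (mkFactors (pos*-cancelˡ {p} {d′} p>0 (subst (0ℤ <_) (*-comm d′ p) q)) r (pos*-cancel-≡ {p} {d′ * δ} {k} p>0 (trans (sym (*-assoc p d′ δ)) (trans (cong (_* δ) (*-comm p d′)) e))) , nd)
      , cong (_, δ) (*-comm p d′)

  -- Divide the pairs by whether `p` divides `δ`. If so, `p` is removed from `δ`, which keeps `χ d`;
  -- if not, `p` divides `d`, and removing it there costs the factor `χ p`. `S` plays the part of
  -- `D (k / p)`, read as 0 when `p` does not divide `k`.
  hecke : D (p * k) ≡ D k + χ p * (D k - S)
  hecke = trans (∑-split (factors (p * k)) p∣δ? (χ ∘ proj₁)) (cong₂ _+_ (scaled k) (trans unscaled (cong (_*_ (χ p)) rest)))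
    where
    l : ∀ a b → b ≡ a + b - a
    l = solve-∀
    rest : ∑ (restrict (factors k) (¬? ∘ p∣δ?)) (χ ∘ proj₁) ≡ D k - S
    rest = trans (l S _) (cong (_- S) (sym (∑-split (factors k) p∣δ? (χ ∘ proj₁))))

  S-scaled : ∀ k′ → k ≡ p * k′ → S ≡ D k′
  S-scaled k′ refl = scaled k′

  S-zero : ¬ p dvd k → S ≡ 0ℤ
  S-zero nd = ∑-zero (restrict (factors k) p∣δ?) λ { {d , δ} (mkFactors _ _ e , h) → ⊥-elim (nd (∣-subst e (∣n⇒∣m*n d h))) }

single : ∀ {A : Set} (x : A) → Finite (_≡ x)
single x = record { elems = x ∷ [] ; unique = [] ∷ [] ; sound = λ { (here e) → e } ; complete = λ { refl → here refl } }

∑-single : ∀ {A : Set} {P : A → Set} (F : Finite P) x {w} → P x → (∀ {y} → P y → y ≡ x) → ∑ F w ≡ w x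
∑-single F x {w} px e = trans (∑-same F (single x) {w} e (λ { refl → px })) (+-identityʳ (w x))

D-prime : ∀ {n} → Prime n → χ (+ n) ≡ 1ℤ → D (+ n) ≡ + 2
D-prime {n} pr e = trans (cong D (sym (*-identityʳ (+ n)))) (trans (HeckeD.hecke pr 1ℤ) (cong₂ (λ u v → 1ℤ + u * (1ℤ - v)) e (HeckeD.S-zero pr 1ℤ (p∤1 pr))))

prime-nonsquare : ∀ {n} → Prime n → ∀ r → r * r ≢ + n
prime-nonsquare {n} pr r e = let divides q r≡ = euclid² pr r (divides 1ℤ (trans e (sym (*-identityˡ (+ n))))) in p∤1 pr (divides (q * q) (pos*-cancel-≡ {+ n} {1ℤ} {q * q * + n} (prime>0 pr)
      (trans (*-identityʳ (+ n)) (trans (sym e) (trans (cong (λ u → u * u) r≡) (l q (+ n)))))))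
  where
  l : ∀ q p → q * p * (q * p) ≡ p * (q * q * p)
  l = solve 2 (λ q p → q :* p :* (q :* p) := p :* (q :* q :* p)) refl

-- In the alternating sum over z, the terms with z ≠ 0 and those with d ≠ δ come in pairs,
-- so modulo 4 only D p = 2 and the solutions of p = d² + 4 z² contribute.
module Fermat {n : ℕ} (pr : Prime n) (μ : ℤ) (n≡ : + n ≡ 1ℤ + + 4 * μ) where

  f : ℤ → ℤ
  f z = sg z * D (1ℤ + + 4 * (μ - z * z))

  z>0? : Decidable (0ℤ <_)
  z>0? z = 0<? z

  z<0? : Decidable (λ z → 0ℤ < - z)
  z<0? z = 0<? (- z)

  positive = restrict (roots μ) z>0?
  rest = restrict (roots μ) (¬? ∘ z>0?)

  root-neg : ∀ {z} → Root μ z → Root μ (- z)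
  root-neg {z} (mkRoot h) = mkRoot (subst (λ u → 0ℤ ≤ μ - u) (l z) h)
    where
    l : ∀ z → z * z ≡ - z * - z
    l = solve 1 (λ z → z :* z := :- z :* :- z) refl

  f-neg : ∀ z → f z ≡ f (- z)
  f-neg z = cong₂ (λ s u → s * D (1ℤ + + 4 * (μ - u))) (sym (sg-neg z)) (l z)
    where
    l : ∀ z → z * z ≡ - z * - z
    l = solve 1 (λ z → z :* z := :- z :* :- z) refl

  negative-part : ∑ (restrict rest z<0?) f ≡ ∑ positive f
  negative-part = ∑-bij (restrict rest z<0?) positive -_ (λ ((r , _) , h) → root-neg r , h) (λ _ _ → neg-injective)
    (λ {z} (r , h) → - z , ((root-neg r , neg-pos { - z} (subst (0ℤ <_) (sym (neg-involutive z)) h)) , subst (0ℤ <_) (sym (neg-involutive z)) h) , neg-involutive z)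
    (λ {z} _ → f-neg z)

  μ≥0 : 0ℤ ≤ μ
  μ≥0 = pos-quarter {μ} (subst (0ℤ <_) n≡ (prime>0 pr))

  zero-part : ∑ (restrict rest (¬? ∘ z<0?)) f ≡ + 2
  zero-part = trans (∑-single (restrict rest (¬? ∘ z<0?)) 0ℤ {f} ((mkRoot (subst (0ℤ ≤_) (sym (+-identityʳ μ)) μ≥0) , <-irrefl refl) , <-irrefl refl) only0)
    (trans (*-identityˡ _) (trans (cong D (trans (cong (λ u → 1ℤ + + 4 * u) (+-identityʳ μ)) (sym n≡))) (D-prime pr (trans (cong χ n≡) (χ-per 1ℤ μ)))))
    where
    only0 : ∀ {z} → (Root μ z × ¬ 0ℤ < z) × ¬ 0ℤ < - z → z ≡ 0ℤ
    only0 {z} ((_ , a) , b) with sign z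
    ... | isPos h  = ⊥-elim (a h)
    ... | isZero e = e
    ... | isNeg h  = ⊥-elim (b h)

  S : ℤ
  S = ∑ positive f

  S≡-1 : S ≡ -1ℤ
  S≡-1 = *-cancelˡ-≡ (+ 2) S -1ℤ (trans (l S) (cong (_- + 2) (trans (sym (trans (∑-split (roots μ) z>0? f) (cong (_+_ S) (trans (∑-split rest z<0? f) (cong₂ _+_ negative-part zero-part)))))
      (alternating-sum μ λ r e → prime-nonsquare pr r (trans e (sym n≡))))))
    where
    l : ∀ S → + 2 * S ≡ S + (S + + 2) - + 2
    l = solve 1 (λ S → # 2 :* S := S :+ (S :+ # 2) :- # 2) refl

  w : ℤ × ℤ² → ℤ
  w (z , d , δ) = sg z * χ d

  Ω = sigma positive (λ z → factors (1ℤ + + 4 * (μ - z * z)))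

  d>δ d<δ : ℤ × ℤ² → Set
  d>δ (z , d , δ) = 0ℤ < d - δ
  d<δ (z , d , δ) = 0ℤ < δ - d

  d>δ? : Decidable d>δ
  d>δ? (z , d , δ) = 0<? (d - δ)
  d<δ? : Decidable d<δ
  d<δ? (z , d , δ) = 0<? (δ - d)

  open Liouville μ using (not-both; neither)

  swapped : ∑ (restrict (restrict Ω (¬? ∘ d>δ?)) d<δ?) w ≡ ∑ (restrict Ω d>δ?) w
  swapped = ∑-bij (restrict (restrict Ω (¬? ∘ d>δ?)) d<δ?) (restrict Ω d>δ?) (λ (z , d , δ) → z , δ , d)
    (λ { {z , d , δ} (((r , mkFactors p q e) , _) , h) → (r , mkFactors q p (trans (*-comm δ d) e)) , h })
    (λ { _ _ refl → refl })
    (λ { {z , d , δ} ((r , mkFactors p q e) , h) → (z , δ , d) , (((r , mkFactors q p (trans (*-comm δ d) e)) , not-both {d} {δ} h) , h) , refl })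
    (λ { {z , d , δ} (((r , mkFactors p q e) , _) , _) → cong (_*_ (sg z)) (sym (χ-factors {1ℤ + + 4 * (μ - z * z)} {d} {δ} (χ-per 1ℤ (μ - z * z)) e)) })

  diagonal = restrict (restrict Ω (¬? ∘ d>δ?)) (¬? ∘ d<δ?)

  diagonal≢0 : ∑ diagonal w ≢ 0ℤ
  diagonal≢0 e = even≢odd { -1ℤ} {∑ (restrict Ω d>δ?) w} (trans (sym S≡-1) (trans (trans (∑-cong positive (λ {z} _ → sym (∑-* (factors (1ℤ + + 4 * (μ - z * z))) (sg z) (χ ∘ proj₁))))
      (sym (∑-sigma positive (λ z → factors (1ℤ + + 4 * (μ - z * z))) w)))
      (trans (∑-split Ω d>δ? w) (trans (cong (_+_ (∑ (restrict Ω d>δ?) w)) (trans (∑-split (restrict Ω (¬? ∘ d>δ?)) d<δ? w) (cong₂ _+_ swapped e))) (l (∑ (restrict Ω d>δ?) w))))))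
    where
    l : ∀ x → x + (x + 0ℤ) ≡ + 2 * x
    l = solve 1 (λ x → x :+ (x :+ # 0) := # 2 :* x) refl

  diagonal-point : ∀ z d δ → d ≡ δ → d * δ ≡ 1ℤ + + 4 * (μ - z * z) → ∃ λ c → ∃ λ z → Odd c × c * c + + 2 * z * (+ 2 * z) ≡ + n
  diagonal-point z d _ refl dd = d , z , od , trans (cong (_+ + 2 * z * (+ 2 * z)) dd) (trans (l z μ) (sym n≡))
    where
    od : Odd d
    od = odd*ˡ {d} {d} (odd-by (+ 2 * (μ - z * z)) (trans dd (l′ (μ - z * z))))
      where
      l′ : ∀ u → 1ℤ + + 4 * u ≡ 1ℤ + + 2 * (+ 2 * u)
      l′ = solve 1 (λ u → # 1 :+ # 4 :* u := # 1 :+ # 2 :* (# 2 :* u)) refl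
    l : ∀ z μ → 1ℤ + + 4 * (μ - z * z) + + 2 * z * (+ 2 * z) ≡ 1ℤ + + 4 * μ
    l = solve 2 (λ z μ → # 1 :+ # 4 :* (μ :- z :* z) :+ # 2 :* z :* (# 2 :* z) := # 1 :+ # 4 :* μ) refl

  fermat : ∃ λ c → ∃ λ z → Odd c × c * c + + 2 * z * (+ 2 * z) ≡ + n
  fermat = let (z , d , δ) , ((_ , F) , n₁) , n₂ = ∑≢0 diagonal {w} diagonal≢0
           in diagonal-point z d δ (neither {d} {δ} n₁ n₂) (Factors.prod F)

-- Counting sums of two squares

-- For odd `m` exactly one coordinate is odd; requiring it to be the first keeps half of the
-- representations.
record TwoSq (m : ℤ) (v : ℤ²) : Set where
  constructor mkTwoSq
  field
    odd-x : Odd (proj₁ v)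
    sum   : proj₁ v * proj₁ v + proj₂ v * proj₂ v ≡ m

twoSqs : ∀ m → Finite (TwoSq m)
twoSqs m = finite₂ (∣ m ∣) (λ (x , y) → map′ (λ (p , q) → mkTwoSq p q) (λ (mkTwoSq p q) → p , q) (odd? x ×-dec (x * x + y * y ≟ m))) bound
  where
  M = ∣ m ∣
  le : ∀ x y → x * x + y * y ≡ m → Abs≤ M x
  le x y refl = ≤⇒Abs≤ x (by (+∣ m ∣≥ ⊕ sq-x x ⊕ sq≥0 y) (l₁ (+ M) x y)) (by (+∣ m ∣≥ ⊕ sq+x x ⊕ sq≥0 y) (l₂ (+ M) x y))
    where
    l₁ : ∀ M x y → M - x ≡ M - (x * x + y * y) + (x * x - x) + y * y
    l₁ = solve 3 (λ M x y → M :- x := M :- (x :* x :+ y :* y) :+ (x :* x :- x) :+ y :* y) refl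
    l₂ : ∀ M x y → M + x ≡ M - (x * x + y * y) + (x * x + x) + y * y
    l₂ = solve 3 (λ M x y → M :+ x := M :- (x :* x :+ y :* y) :+ (x :* x :+ x) :+ y :* y) refl
  bound : ∀ {v} → TwoSq m v → Abs≤ M (proj₁ v) × Abs≤ M (proj₂ v)
  bound {x , y} (mkTwoSq _ e) = le x y e , le y x (trans (+-comm (y * y) (x * x)) e)

-- Multiplication by the Gaussian integer c + i e of norm p
module Gauss {n : ℕ} (pr : Prime n) (c e : ℤ) (oc : Odd c) (ee : Even e) (norm : c * c + e * e ≡ + n) (k : ℤ) where
  p = + n
  p>0 : 0ℤ < p
  p>0 = prime>0 pr

  Div : ℤ² → Set
  Div (x , y) = p dvd c * x + e * y

  div? : Decidable Div
  div? (x , y) = p dvd? c * x + e * y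

  mult : ℤ² → ℤ²
  mult (x , y) = c * x - e * y , e * x + c * y

  norm-eq : ∀ x y → (c * x - e * y) * (c * x - e * y) + (e * x + c * y) * (e * x + c * y) ≡ p * (x * x + y * y)
  norm-eq x y = trans (l c e x y) (cong (_* (x * x + y * y)) norm)
    where
    l : ∀ c e x y → (c * x - e * y) * (c * x - e * y) + (e * x + c * y) * (e * x + c * y) ≡ (c * c + e * e) * (x * x + y * y)
    l = solve 4 (λ c e x y → (c :* x :- e :* y) :* (c :* x :- e :* y) :+ (e :* x :+ c :* y) :* (e :* x :+ c :* y) := (c :* c :+ e :* e) :* (x :* x :+ y :* y)) refl

  recover-x : ∀ x y → c * (c * x - e * y) + e * (e * x + c * y) ≡ p * x
  recover-x x y = trans (l c e x y) (cong (_* x) norm)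
    where
    l : ∀ c e x y → c * (c * x - e * y) + e * (e * x + c * y) ≡ (c * c + e * e) * x
    l = solve 4 (λ c e x y → c :* (c :* x :- e :* y) :+ e :* (e :* x :+ c :* y) := (c :* c :+ e :* e) :* x) refl

  recover-y : ∀ x y → c * (e * x + c * y) - e * (c * x - e * y) ≡ p * y
  recover-y x y = trans (l c e x y) (cong (_* y) norm)
    where
    l : ∀ c e x y → c * (e * x + c * y) - e * (c * x - e * y) ≡ (c * c + e * e) * y
    l = solve 4 (λ c e x y → c :* (e :* x :+ c :* y) :- e :* (c :* x :- e :* y) := (c :* c :+ e :* e) :* y) refl

  even-mult : ∀ y → Even (e * y)
  even-mult y with parity e
  ... | even l refl = mkEven (trans (cong sg (l′ l y)) (sg-even (l * y)))
    where
    l′ : ∀ l y → (0ℤ + + 2 * l) * y ≡ 0ℤ + + 2 * (l * y)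
    l′ = solve 2 (λ l y → (# 0 :+ # 2 :* l) :* y := # 0 :+ # 2 :* (l :* y)) refl
  ... | odd l refl = ⊥-elim (1≢-1 (trans (sym (Even.sg1 ee)) (sg-odd l)))

  mult∈ : ∀ {v} → TwoSq k v → TwoSq (p * k) (mult v) × Div (mult v)
  mult∈ {x , y} (mkTwoSq o s) = mkTwoSq (Odd+Even (odd* oc o) (Even-neg (even-mult y))) (trans (norm-eq x y) (cong (_*_ p) s))
                              , divides x (trans (recover-x x y) (*-comm p x))

  mult-injective : ∀ {v v′} → mult v ≡ mult v′ → v ≡ v′
  mult-injective {x , y} {x′ , y′} h = cong₂ _,_
    (pos*-cancel-≡ {p} {x} {x′} p>0 (trans (sym (recover-x x y)) (trans (cong₂ (λ u v → c * u + e * v) (cong proj₁ h) (cong proj₂ h)) (recover-x x′ y′))))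
    (pos*-cancel-≡ {p} {y} {y′} p>0 (trans (sym (recover-y x y)) (trans (cong₂ (λ u v → c * v - e * u) (cong proj₁ h) (cong proj₂ h)) (recover-y x′ y′))))

  divide : ∀ x y u v → Odd x → x * x + y * y ≡ p * k → c * x + e * y ≡ u * p → c * y - e * x ≡ v * p → ∃ λ w → TwoSq k w × mult w ≡ (x , y)
  divide x y u v o s eu ev = (u , v) , mkTwoSq ou uv , cong₂ _,_ x≡ y≡
    where
    x≡ : c * u - e * v ≡ x
    x≡ = pos*-cancel-≡ {p} {c * u - e * v} {x} p>0 (trans (l₁ c e u v p) (trans (sym (cong₂ (λ a b → c * a - e * b) eu ev)) (trans (l₂ c e x y) (cong (_* x) norm))))
      where
      l₁ : ∀ c e u v p → p * (c * u - e * v) ≡ c * (u * p) - e * (v * p)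
      l₁ = solve 5 (λ c e u v p → p :* (c :* u :- e :* v) := c :* (u :* p) :- e :* (v :* p)) refl
      l₂ : ∀ c e x y → c * (c * x + e * y) - e * (c * y - e * x) ≡ (c * c + e * e) * x
      l₂ = solve 4 (λ c e x y → c :* (c :* x :+ e :* y) :- e :* (c :* y :- e :* x) := (c :* c :+ e :* e) :* x) refl
    y≡ : e * u + c * v ≡ y
    y≡ = pos*-cancel-≡ {p} {e * u + c * v} {y} p>0 (trans (l₁ c e u v p) (trans (sym (cong₂ (λ a b → e * a + c * b) eu ev)) (trans (l₂ c e x y) (cong (_* y) norm))))
      where
      l₁ : ∀ c e u v p → p * (e * u + c * v) ≡ e * (u * p) + c * (v * p)
      l₁ = solve 5 (λ c e u v p → p :* (e :* u :+ c :* v) := e :* (u :* p) :+ c :* (v :* p)) refl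
      l₂ : ∀ c e x y → e * (c * x + e * y) + c * (c * y - e * x) ≡ (c * c + e * e) * y
      l₂ = solve 4 (λ c e x y → e :* (c :* x :+ e :* y) :+ c :* (c :* y :- e :* x) := (c :* c :+ e :* e) :* y) refl
    uv : u * u + v * v ≡ k
    uv = pos*-cancel-≡ {p} {u * u + v * v} {k} p>0 (trans (sym (norm-eq u v)) (trans (cong₂ (λ a b → a * a + b * b) x≡ y≡) s))
    ou : Odd u
    ou = odd*ʳ {c} {u} (subst Odd (trans (cong (_+ e * v) (sym x≡)) (l (c * u) (e * v))) (Odd+Even o (even-mult v)))
      where
      l : ∀ a b → a - b + b ≡ a
      l = solve-∀

  -- `p (x² + y²) - (c x + e y)²` is the square of `c y - e x`. So `p` divides that number too, and
  -- both coordinates of the quotient of `x + i y` by `c + i e` are integers.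
  divisible : ∀ {w} → TwoSq (p * k) w × Div w → ∃ λ v → TwoSq k v × mult v ≡ w
  divisible {x , y} (mkTwoSq o s , h@(divides u eu)) = let divides v ev = euclid² pr (c * y - e * x) h′ in divide x y u v o s eu ev
    where
    l : ∀ c e x y → (c * c + e * e) * (x * x + y * y) - (c * x + e * y) * (c * x + e * y) ≡ (c * y - e * x) * (c * y - e * x)
    l = solve 4 (λ c e x y → (c :* c :+ e :* e) :* (x :* x :+ y :* y) :- (c :* x :+ e :* y) :* (c :* x :+ e :* y) := (c :* y :- e :* x) :* (c :* y :- e :* x)) refl
    h′ : p dvd (c * y - e * x) * (c * y - e * x)
    h′ = ∣-subst (trans (cong (λ a → a * (x * x + y * y) - (c * x + e * y) * (c * x + e * y)) (sym norm)) (l c e x y))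
           (∣m∣n⇒∣m-n (∣m⇒∣m*n (x * x + y * y) (divides 1ℤ (sym (*-identityˡ p)))) (∣m⇒∣m*n (c * x + e * y) h))

  count-divisible : count (restrict (twoSqs (p * k)) div?) ≡ count (twoSqs k)
  count-divisible = sym (∑-bij (twoSqs k) (restrict (twoSqs (p * k)) div?) mult mult∈ (λ _ _ → mult-injective) divisible (λ _ → refl))

module Scale {n : ℕ} (pr : Prime n) (op : Odd (+ n)) where
  p = + n
  p>0 : 0ℤ < p
  p>0 = prime>0 pr

  Both : ℤ² → Set
  Both (x , y) = p dvd x × p dvd y

  both? : Decidable Both
  both? (x , y) = p dvd? x ×-dec p dvd? y

  Z : ℤ → ℤ
  Z k = count (restrict (twoSqs (p * k)) both?)

  Z-scaled : ∀ k → Z (p * k) ≡ count (twoSqs k)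
  Z-scaled k = sym (∑-bij (twoSqs k) (restrict (twoSqs (p * (p * k))) both?) (λ (x , y) → p * x , p * y)
    (λ { {x , y} (mkTwoSq o s) → mkTwoSq (odd* op o) (trans (l p x y) (cong (λ u → p * (p * u)) s)) , divides x (*-comm p x) , divides y (*-comm p y) })
    (λ { {x , y} {x′ , y′} _ _ h → cong₂ _,_ (pos*-cancel-≡ {p} {x} {x′} p>0 (cong proj₁ h)) (pos*-cancel-≡ {p} {y} {y′} p>0 (cong proj₂ h)) })
    (λ { {x , y} (mkTwoSq o s , divides x′ ex , divides y′ ey) → back x y x′ y′ o s ex ey })
    (λ _ → refl))
    where
    l : ∀ p x y → p * x * (p * x) + p * y * (p * y) ≡ p * (p * (x * x + y * y))
    l = solve 3 (λ p x y → p :* x :* (p :* x) :+ p :* y :* (p :* y) := p :* (p :* (x :* x :+ y :* y))) refl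
    back : ∀ x y x′ y′ → Odd x → x * x + y * y ≡ p * (p * k) → x ≡ x′ * p → y ≡ y′ * p → ∃ λ (v : ℤ²) → TwoSq k v × (p * proj₁ v , p * proj₂ v) ≡ (x , y)
    back _ _ x′ y′ o s refl refl = (x′ , y′)
      , mkTwoSq (odd*ˡ {x′} {p} o) (pos*-cancel-≡ {p} {x′ * x′ + y′ * y′} {k} p>0 (pos*-cancel-≡ {p} {p * (x′ * x′ + y′ * y′)} {p * k} p>0 (trans (l′ p x′ y′) s)))
      , cong₂ _,_ (*-comm p x′) (*-comm p y′)
      where
      l′ : ∀ p x y → p * (p * (x * x + y * y)) ≡ x * p * (x * p) + y * p * (y * p)
      l′ = solve 3 (λ p x y → p :* (p :* (x :* x :+ y :* y)) := x :* p :* (x :* p) :+ y :* p :* (y :* p)) refl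

  Z-zero : ∀ k → ¬ p dvd k → Z k ≡ 0ℤ
  Z-zero k nd = ∑-zero (restrict (twoSqs (p * k)) both?) λ { {x , y} (mkTwoSq o s , divides x′ ex , divides y′ ey) → ⊥-elim (nd (go x y x′ y′ s ex ey)) }
    where
    l : ∀ p x y → x * p * (x * p) + y * p * (y * p) ≡ p * ((x * x + y * y) * p)
    l = solve 3 (λ p x y → x :* p :* (x :* p) :+ y :* p :* (y :* p) := p :* ((x :* x :+ y :* y) :* p)) refl
    go : ∀ x y x′ y′ → x * x + y * y ≡ p * k → x ≡ x′ * p → y ≡ y′ * p → p dvd k
    go _ _ x′ y′ s refl refl = divides (x′ * x′ + y′ * y′) (pos*-cancel-≡ {p} {k} {(x′ * x′ + y′ * y′) * p} p>0 (trans (sym s) (l p x′ y′)))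

  inert : χ p ≡ -1ℤ → ∀ k → count (twoSqs (p * k)) ≡ Z k
  inert χp k = ∑-same (twoSqs (p * k)) (restrict (twoSqs (p * k)) both?)
    (λ { {x , y} q@(mkTwoSq o s) → q , two-squares-mod pr χp x y (divides k (trans s (*-comm p k))) , two-squares-mod pr χp y x (divides k (trans (+-comm (y * y) (x * x)) (trans s (*-comm p k)))) })
    proj₁

  module Split (c e : ℤ) (oc : Odd c) (ee : Even e) (norm : c * c + e * e ≡ p) (k : ℤ) where
    norm′ : c * c + - e * - e ≡ p
    norm′ = trans (l c e) norm
      where
      l : ∀ c e → c * c + - e * - e ≡ c * c + e * e
      l = solve 2 (λ c e → c :* c :+ :- e :* :- e := c :* c :+ e :* e) refl
    module G₁ = Gauss pr c e oc ee norm k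
    module G₂ = Gauss pr c (- e) oc (Even-neg ee) norm′ k
    X = twoSqs (p * k)

    -- The product of `c x + e y` and `c x - e y` is `p x² - e² p k`, hence divisible by `p`.
    one-divides : ∀ {v} → TwoSq (p * k) v → ¬ G₁.Div v → G₂.Div v
    one-divides {x , y} (mkTwoSq o s) nd = go (euclid pr (c * x + e * y) (c * x + - e * y) (divides (x * x - e * e * k) eq))
      where
      go : p dvd c * x + e * y ⊎ p dvd c * x + - e * y → p dvd c * x + - e * y
      go (inj₁ h) = ⊥-elim (nd h)
      go (inj₂ h) = h
      l₁ : ∀ c e x y → (c * x + e * y) * (c * x + - e * y) ≡ (c * c + e * e) * (x * x) - e * e * (x * x + y * y)
      l₁ = solve 4 (λ c e x y → (c :* x :+ e :* y) :* (c :* x :+ :- e :* y) := (c :* c :+ e :* e) :* (x :* x) :- e :* e :* (x :* x :+ y :* y)) refl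
      l₂ : ∀ p e k u → p * u - e * e * (p * k) ≡ (u - e * e * k) * p
      l₂ = solve 4 (λ p e k u → p :* u :- e :* e :* (p :* k) := (u :- e :* e :* k) :* p) refl
      eq : (c * x + e * y) * (c * x + - e * y) ≡ (x * x - e * e * k) * p
      eq = trans (l₁ c e x y) (trans (cong₂ (λ a b → a * (x * x) - e * e * b) norm s) (l₂ p e k (x * x)))

    p∤c : ¬ p dvd c
    p∤c h@(divides q c≡) = let divides r e≡ = euclid² pr e (∣-subst (l₁ c e) (∣m∣n⇒∣m-n (divides 1ℤ (trans norm (sym (*-identityˡ p)))) (∣m⇒∣m*n c h)))
                           in p∤1 pr (divides (q * q + r * r) (pos*-cancel-≡ {p} {1ℤ} {(q * q + r * r) * p} p>0
                                (trans (*-identityʳ p) (trans (sym norm) (trans (cong₂ (λ a b → a * a + b * b) c≡ e≡) (l₂ q r p))))))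
      where
      l₁ : ∀ c e → c * c + e * e - c * c ≡ e * e
      l₁ = solve 2 (λ c e → c :* c :+ e :* e :- c :* c := e :* e) refl
      l₂ : ∀ q r p → q * p * (q * p) + r * p * (r * p) ≡ p * ((q * q + r * r) * p)
      l₂ = solve 3 (λ q r p → q :* p :* (q :* p) :+ r :* p :* (r :* p) := p :* ((q :* q :+ r :* r) :* p)) refl

    p∤2 : ¬ p dvd + 2
    p∤2 (divides q e′) = go (odd⇒ op)
      where
      go : (∃ λ h → p ≡ 1ℤ + + 2 * h) → ⊥
      go (h , p≡) = p∤1 pr (∣-subst (trans (cong (_- + 2 * h) p≡) (l h)) (∣m∣n⇒∣m-n (divides 1ℤ (sym (*-identityˡ p))) (∣m⇒∣m*n h (divides q e′))))
        where
        l : ∀ h → 1ℤ + + 2 * h - + 2 * h ≡ 1ℤ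
        l = solve 1 (λ h → # 1 :+ # 2 :* h :- # 2 :* h := # 1) refl

    both-divide : ∀ {v} → TwoSq (p * k) v → G₁.Div v → G₂.Div v → Both v
    both-divide {x , y} (mkTwoSq o s) h₁ h₂ = px , euclid² pr y (∣-subst (l₂ (x * x) (y * y)) (∣m∣n⇒∣m-n (divides k (trans s (*-comm p k))) (∣m⇒∣m*n x px)))
      where
      l₁ : ∀ c e x y → c * x + e * y + (c * x + - e * y) ≡ + 2 * (c * x)
      l₁ = solve 4 (λ c e x y → c :* x :+ e :* y :+ (c :* x :+ :- e :* y) := # 2 :* (c :* x)) refl
      l₂ : ∀ a b → a + b - a ≡ b
      l₂ = solve-∀
      px : p dvd x
      px = [ ⊥-elim ∘ p∤2 , [ ⊥-elim ∘ p∤c , id ]′ ∘ euclid pr c x ]′ (euclid pr (+ 2) (c * x) (∣-subst (l₁ c e x y) (∣m∣n⇒∣m+n h₁ h₂)))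

    both-divide⁻¹ : ∀ {v} → Both v → G₁.Div v × G₂.Div v
    both-divide⁻¹ {x , y} (px , py) = ∣m∣n⇒∣m+n (∣n⇒∣m*n c px) (∣n⇒∣m*n e py) , ∣m∣n⇒∣m+n (∣n⇒∣m*n c px) (∣n⇒∣m*n (- e) py)

    -- Inclusion and exclusion: every representation of `p k` is divisible by `c + i e` or by
    -- `c - i e`, each kind corresponds to the representations of `k`, and divisibility by both
    -- means divisibility by `p`.
    split : count X ≡ count (twoSqs k) + (count (twoSqs k) - Z k)
    split = trans (∑-split X G₁.div? _) (cong₂ _+_ G₁.count-divisible (trans (l B₁ B₂) (cong (_- Z k) (trans (sym eq) G₂.count-divisible))))
      where
      B₁ B₂ : ℤ
      B₁ = Z k
      B₂ = count (restrict X (¬? ∘ G₁.div?))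
      l : ∀ a b → b ≡ a + b - a
      l = solve-∀
      eq : count (restrict X G₂.div?) ≡ B₁ + B₂
      eq = trans (∑-split (restrict X G₂.div?) G₁.div? _) (cong₂ _+_
        (∑-same (restrict (restrict X G₂.div?) G₁.div?) (restrict X both?) (λ ((q , h₂) , h₁) → q , both-divide q h₁ h₂) (λ (q , b) → (q , proj₂ (both-divide⁻¹ b)) , proj₁ (both-divide⁻¹ b)))
        (∑-same (restrict (restrict X G₂.div?) (¬? ∘ G₁.div?)) (restrict X (¬? ∘ G₁.div?)) (λ ((q , _) , n₁) → q , n₁) (λ (q , n₁) → (q , one-divides q n₁) , n₁)))

TwoSquareCount : ℤ → Set
TwoSquareCount m = count (twoSqs m) ≡ + 2 * D m

module _ {n : ℕ} (pr : Prime n) (op : Odd (+ n)) (k : ℤ) (rec : TwoSquareCount k) (rec′ : ∀ k′ → k ≡ + n * k′ → TwoSquareCount k′) where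
  open Scale pr op
  private
    module H = HeckeD pr k

    Z≡ : Z k ≡ + 2 * H.S
    Z≡ with p dvd? k
    ... | yes (divides q e) = trans (cong Z k≡) (trans (Z-scaled q) (trans (rec′ q k≡) (cong (_*_ (+ 2)) (sym (H.S-scaled q k≡)))))
      where
      k≡ : k ≡ p * q
      k≡ = trans e (*-comm q p)
    ... | no nd = trans (Z-zero k nd) (cong (_*_ (+ 2)) (sym (H.S-zero nd)))

  -- The representation count obeys the recursion of `hecke`, in the inert and in the split case
  -- alike, up to the common factor 2.
  two-squares-step : TwoSquareCount (+ n * k)
  two-squares-step with χ±1 op
  ... | inj₂ χp = trans (inert χp k) (trans Z≡ (cong (_*_ (+ 2)) (sym (trans H.hecke (trans (cong (λ u → D k + u * (D k - H.S)) χp) (l (D k) H.S))))))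
    where
    l : ∀ d s → d + -1ℤ * (d - s) ≡ s
    l = solve 2 (λ d s → d :+ con -1ℤ :* (d :- s) := s) refl
  ... | inj₁ χp = trans split′ (trans (cong₂ (λ u v → u + (u - v)) rec Z≡) (trans (l (D k) H.S) (cong (_*_ (+ 2)) (sym (trans H.hecke (cong (λ u → D k + u * (D k - H.S)) χp))))))
    where
    l : ∀ d s → + 2 * d + (+ 2 * d - + 2 * s) ≡ + 2 * (d + 1ℤ * (d - s))
    l = solve 2 (λ d s → # 2 :* d :+ (# 2 :* d :- # 2 :* s) := # 2 :* (d :+ # 1 :* (d :- s))) refl
    split′ : count (twoSqs (p * k)) ≡ count (twoSqs k) + (count (twoSqs k) - Z k)
    split′ = let μ , n≡ = χ≡1⇒ {p} χp
                 c , z , oc , norm = Fermat.fermat pr μ n≡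
             in Split.split c (+ 2 * z) oc (mkEven (trans (cong sg (sym (+-identityˡ (+ 2 * z)))) (sg-even z))) norm k

two-squares-count : ∀ m → Odd (+ m) → TwoSquareCount (+ m)
two-squares-count = <-rec _ step
  where
  step : ∀ m → (∀ {k} → k ℕ.< m → Odd (+ k) → TwoSquareCount (+ k)) → Odd (+ m) → TwoSquareCount (+ m)
  step zero    rec o = ⊥-elim (odd≢0 o refl)
  step (suc m) rec o = go primes isFactorisation factorsPrime
    where
    open PrimeFactorisation (factorise (suc m)) renaming (factors to primes)
    go : ∀ ps → suc m ≡ product ps → All Prime ps → TwoSquareCount (+ suc m)
    -- Here `m = 1`, and both sides evaluate to 2.
    go [] e [] = subst (TwoSquareCount ∘ +_) (sym e) refl
    go (p ∷ ps) e (pr ∷ _) = subst TwoSquareCount (sym m≡) (two-squares-step pr op (+ k) (rec k<m ok) rec′)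
      where
      k = product ps
      m≡ : + suc m ≡ + p * + k
      m≡ = trans (cong +_ e) (pos-* p k)
      opk : Odd (+ p * + k)
      opk = subst Odd m≡ o
      op : Odd (+ p)
      op = odd*ˡ {+ p} {+ k} opk
      ok : Odd (+ k)
      ok = odd*ʳ {+ p} {+ k} opk
      smaller : ∀ {q} a → Prime q → 0ℤ < a → 0ℤ < + q * a - a
      smaller {q} a prq h = subst (0ℤ <_) (l (+ q) a) (pos* (prime>1 prq) h)
        where
        l : ∀ q a → (q - 1ℤ) * a ≡ q * a - a
        l = solve 2 (λ q a → (q :- # 1) :* a := q :* a :- a) refl
      less : ∀ {i j} → 0ℤ < i - j → j < i
      less {i} {j} h = subst₂ _<_ (+-identityˡ j) (x-y+y i j) (+-monoˡ-< j h)
      k>0 : 0ℤ < + k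
      k>0 = pos*-cancelˡ {+ p} {+ k} (prime>0 pr) (subst (0ℤ <_) m≡ (+<+ (ℕ.s≤s ℕ.z≤n)))
      k<m : k ℕ.< suc m
      k<m = drop‿+<+ (less {+ suc m} {+ k} (subst (λ u → 0ℤ < u - + k) (sym m≡) (smaller (+ k) pr k>0)))
      rec′ : ∀ k′ → + k ≡ + p * k′ → TwoSquareCount k′
      rec′ (+ k′) e′ = rec (ℕₚ.<-trans (drop‿+<+ (less {+ k} {+ k′} (subst (λ u → 0ℤ < u - + k′) (sym e′) (smaller (+ k′) pr k′>0)))) k<m) (odd*ʳ {+ p} {+ k′} (subst Odd e′ ok))
        where
        k′>0 : 0ℤ < + k′
        k′>0 = pos*-cancelˡ {+ p} {+ k′} (prime>0 pr) (subst (0ℤ <_) e′ k>0)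
      rec′ -[1+ k′ ] e′ = 0≮-[1+n] (pos*-cancelˡ {+ p} { -[1+ k′ ]} (prime>0 pr) (subst (0ℤ <_) e′ k>0))

-- Representations by `i (i + 1) + w²`.

record Tri (ν : ℤ) (v : ℤ²) : Set where
  constructor mkTri
  field
    i≥0 : 0ℤ ≤ proj₁ v
    sum : proj₁ v * (proj₁ v + 1ℤ) + proj₂ v * proj₂ v ≡ ν

tri? : ∀ ν → Decidable (Tri ν)
tri? ν (i , w) = map′ (λ (p , q) → mkTri p q) (λ (mkTri p q) → p , q) ((0ℤ ≤? i) ×-dec (i * (i + 1ℤ) + w * w ≟ ν))

tris : ∀ ν → Finite (Tri ν)
tris ν = finite₂ (∣ ν ∣) (tri? ν) bound
  where
  M = ∣ ν ∣
  bound : ∀ {v} → Tri ν v → Abs≤ M (proj₁ v) × Abs≤ M (proj₂ v)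
  bound {i , w} (mkTri p refl) = ≤⇒Abs≤ i (by (+∣ ν ∣≥ ⊕ sq≥0 i ⊕ sq≥0 w) (l₁ (+ M) i w)) (nat≥0 M ⊕ p)
    , ≤⇒Abs≤ w (by (+∣ ν ∣≥ ⊕ sq-x w ⊕ sq≥0 i ⊕ p) (l₂ (+ M) i w)) (by (+∣ ν ∣≥ ⊕ sq+x w ⊕ sq≥0 i ⊕ p) (l₃ (+ M) i w))
    where
    l₁ : ∀ M i w → M - i ≡ M - (i * (i + 1ℤ) + w * w) + i * i + w * w
    l₁ = solve 3 (λ M i w → M :- i := M :- (i :* (i :+ # 1) :+ w :* w) :+ i :* i :+ w :* w) refl
    l₂ : ∀ M i w → M - w ≡ M - (i * (i + 1ℤ) + w * w) + (w * w - w) + i * i + i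
    l₂ = solve 3 (λ M i w → M :- w := M :- (i :* (i :+ # 1) :+ w :* w) :+ (w :* w :- w) :+ i :* i :+ i) refl
    l₃ : ∀ M i w → M + w ≡ M - (i * (i + 1ℤ) + w * w) + (w * w + w) + i * i + i
    l₃ = solve 3 (λ M i w → M :+ w := M :- (i :* (i :+ # 1) :+ w :* w) :+ (w :* w :+ w) :+ i :* i :+ i) refl

nn-from-odd : ∀ {i} → 0ℤ < 1ℤ + + 2 * i → 0ℤ ≤ i
nn-from-odd {i} h with nn⊎neg i
... | inj₁ p = p
... | inj₂ p = ⊥-elim (absurd {n = 1} (pred≥0 h ⊕ nat≥0 2 ⊗ pred≥0 p) (l i))
  where
  l : ∀ i → 1ℤ + + 2 * i - 1ℤ + + 2 * (- i - 1ℤ) ≡ -[1+ 1 ]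
  l = solve 1 (λ i → # 1 :+ # 2 :* i :- # 1 :+ # 2 :* (:- i :- # 1) := con -[1+ 1 ]) refl

-- `4 ν + 1 = (2 i + 1)² + (2 w)²`; the condition `i ≥ 0` selects one sign of the odd coordinate,
-- that is, half of the `2 D` representations.
tri-count : ∀ {ν} → 0ℤ ≤ ν → count (tris ν) ≡ D (1ℤ + + 4 * ν)
tri-count {ν} ν≥0 = *-cancelˡ-≡ (+ 2) (count (tris ν)) (D m) (trans (sym double) (subst TwoSquareCount m≡ (two-squares-count (∣ m ∣) (subst Odd (sym m≡) om))))
  where
  m = 1ℤ + + 4 * ν
  m≡ : + ∣ m ∣ ≡ m
  m≡ = 0≤i⇒+∣i∣≡i (nat≥0 1 ⊕ nat≥0 4 ⊗ ν≥0)
  om : Odd m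
  om = odd-by (+ 2 * ν) (l ν)
    where
    l : ∀ ν → 1ℤ + + 4 * ν ≡ 1ℤ + + 2 * (+ 2 * ν)
    l = solve 1 (λ ν → # 1 :+ # 4 :* ν := # 1 :+ # 2 :* (# 2 :* ν)) refl
  X = twoSqs m
  x>0? : Decidable (λ (v : ℤ²) → 0ℤ < proj₁ v)
  x>0? v = 0<? (proj₁ v)
  sq-neg : ∀ x → - x * - x ≡ x * x
  sq-neg = solve 1 (λ x → :- x :* :- x := x :* x) refl
  mirror : count (restrict X (¬? ∘ x>0?)) ≡ count (restrict X x>0?)
  mirror = ∑-bij (restrict X (¬? ∘ x>0?)) (restrict X x>0?) (λ (x , y) → - x , y)
    (λ { {x , y} (mkTwoSq o s , h) → mkTwoSq (odd-neg o) (trans (cong (_+ y * y) (sq-neg x)) s) , nonpos o h })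
    (λ { {x , y} {x′ , y′} _ _ e → cong₂ _,_ (neg-injective (cong proj₁ e)) (cong proj₂ e) })
    (λ { {x , y} (mkTwoSq o s , h) → (- x , y) , (mkTwoSq (odd-neg o) (trans (cong (_+ y * y) (sq-neg x)) s) , neg-pos { - x} (subst (0ℤ <_) (sym (neg-involutive x)) h)) , cong (_, y) (neg-involutive x) })
    (λ _ → refl)
  l₁ : ∀ i w → (1ℤ + + 2 * i) * (1ℤ + + 2 * i) + + 2 * w * (+ 2 * w) ≡ 1ℤ + + 4 * (i * (i + 1ℤ) + w * w)
  l₁ = solve 2 (λ i w → (# 1 :+ # 2 :* i) :* (# 1 :+ # 2 :* i) :+ # 2 :* w :* (# 2 :* w) := # 1 :+ # 4 :* (i :* (i :+ # 1) :+ w :* w)) refl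
  half : ∀ {a b} → 1ℤ + + 2 * a ≡ 1ℤ + + 2 * b → a ≡ b
  half {a} {b} e = *-cancelˡ-≡ (+ 2) a b (trans (l a) (trans (cong (_- 1ℤ) e) (sym (l b))))
    where
    l : ∀ a → + 2 * a ≡ 1ℤ + + 2 * a - 1ℤ
    l = solve 1 (λ a → # 2 :* a := # 1 :+ # 2 :* a :- # 1) refl
  back : ∀ x y → Odd x → x * x + y * y ≡ m → 0ℤ < x → ∃ λ (v : ℤ²) → Tri ν v × (1ℤ + + 2 * proj₁ v , + 2 * proj₂ v) ≡ (x , y)
  back x y o s h with odd⇒ o | parity y
  ... | i , refl | even w refl = (i , w) , mkTri (nn-from-odd h) (quarter (trans (sym (l₁ i w)) (trans (cong (λ u → (1ℤ + + 2 * i) * (1ℤ + + 2 * i) + u * u) (sym (+-identityˡ (+ 2 * w)))) s))) , cong (1ℤ + + 2 * i ,_) (sym (+-identityˡ (+ 2 * w)))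
  ... | i , refl | odd w refl = ⊥-elim (1≢-1 (trans (sym (Even.sg1 (odd+odd (odd* o o) (odd* oy oy)))) (trans (cong sg s) (Odd.sg-1 om))))
    where
    oy : Odd (1ℤ + + 2 * w)
    oy = odd-by w refl
  half-plane : count (restrict X x>0?) ≡ count (tris ν)
  half-plane = sym (∑-bij (tris ν) (restrict X x>0?) (λ (i , w) → 1ℤ + + 2 * i , + 2 * w)
    (λ { {i , w} (mkTri p s) → mkTwoSq (odd-by i refl) (trans (l₁ i w) (cong (λ u → 1ℤ + + 4 * u) s)) , pby (nat≥0 2 ⊗ p) (l₂ i) })
    (λ { {i , w} {i′ , w′} _ _ e → cong₂ _,_ (half (cong proj₁ e)) (*-cancelˡ-≡ (+ 2) w w′ (cong proj₂ e)) })
    (λ { {x , y} (mkTwoSq o s , h) → back x y o s h })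
    (λ _ → refl))
    where
    l₂ : ∀ i → 1ℤ + + 2 * i - 1ℤ ≡ + 2 * i
    l₂ = solve 1 (λ i → # 1 :+ # 2 :* i :- # 1 := # 2 :* i) refl
  double : count X ≡ + 2 * count (tris ν)
  double = trans (∑-split X x>0? _) (trans (cong₂ _+_ half-plane (trans mirror half-plane)) (l (count (tris ν))))
    where
    l : ∀ c → c + c ≡ + 2 * c
    l = solve-∀

-- Sums of three and four squares

-- These are the solutions counted by R. With `z` in front, a weight depending on `z` factors out
-- and leaves a value of `D`.
ThreeSq : ℤ → ℤ × ℤ² → Set
ThreeSq μ (z , v) = Root μ z × Tri (μ - z * z) v

threeSqs : ∀ μ → Finite (ThreeSq μ)
threeSqs μ = sigma (roots μ) (λ z → tris (μ - z * z))

threeSqs-∑ : ∀ μ w → ∑ (threeSqs μ) (w ∘ proj₁) ≡ ∑ (roots μ) (λ z → w z * D (1ℤ + + 4 * (μ - z * z)))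
threeSqs-∑ μ w = trans (∑-sigma (roots μ) (λ z → tris (μ - z * z)) (w ∘ proj₁)) (∑-cong (roots μ) λ {z} r →
  trans (∑-cong (tris (μ - z * z)) (λ _ → sym (*-identityʳ (w z)))) (trans (∑-* (tris (μ - z * z)) (w z) (λ _ → 1ℤ)) (cong (_*_ (w z)) (tri-count (Root.root r)))))

record Level (κ k : ℤ) : Set where
  constructor mkLevel
  field
    k≥0 : 0ℤ ≤ k
    k≤κ : 0ℤ ≤ κ - k

levels : ∀ κ → Finite (Level κ)
levels κ = finite₁ ∣ κ ∣ (λ k → map′ (λ (p , q) → mkLevel p q) (λ (mkLevel p q) → p , q) ((0ℤ ≤? k) ×-dec (0ℤ ≤? (κ - k))))
  λ {k} (mkLevel p q) → ≤⇒Abs≤ k (by (+∣ κ ∣≥ ⊕ q) (l (+ ∣ κ ∣) κ k)) (nat≥0 ∣ κ ∣ ⊕ p)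
  where
  l : ∀ M κ k → M - k ≡ M - κ + (κ - k)
  l = solve 3 (λ M κ k → M :- k := M :- κ :+ (κ :- k)) refl

module FourSquares (κ : ℤ) where

  private
    N = + 2 + + 4 * κ

    G : ∀ k → Finite (Factors (1ℤ + + 4 * (κ - k)))
    G k = factors (1ℤ + + 4 * (κ - k))

    -- ∑ₖ D (1 + 4 (κ - k)) D (1 + 4 k), with the second factor written as a divisor sum and as a count of representations
    pairs = sigma (levels κ) λ k → sigma (G k) λ _ → factors (1ℤ + + 4 * k)
    mixed = sigma (levels κ) λ k → sigma (G k) λ _ → tris k

    u₁ : ℤ × (ℤ² × ℤ²) → ℤ
    u₁ (k , (d , δ) , (a , _)) = χ d * χ a
    u₂ : ℤ × (ℤ² × ℤ²) → ℤ
    u₂ (k , (d , δ) , _) = χ d * 1ℤ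

    pairs≡mixed : ∑ pairs u₁ ≡ ∑ mixed u₂
    pairs≡mixed = trans (∑-sigma (levels κ) (λ k → sigma (G k) λ _ → factors (1ℤ + + 4 * k)) u₁)
      (trans (∑-cong (levels κ) (λ {k} L → step k (Level.k≥0 L)))
        (sym (∑-sigma (levels κ) (λ k → sigma (G k) λ _ → tris k) u₂)))
      where
      step : ∀ k → 0ℤ ≤ k → ∑ (sigma (G k) λ _ → factors (1ℤ + + 4 * k)) (λ x → u₁ (k , x)) ≡ ∑ (sigma (G k) λ _ → tris k) (λ x → u₂ (k , x))
      step k k≥0 = trans (∑-sigma (G k) (λ _ → factors (1ℤ + + 4 * k)) (λ x → u₁ (k , x)))
        (trans (∑-cong (G k) λ {dδ} _ → trans (∑-* (factors (1ℤ + + 4 * k)) (χ (proj₁ dδ)) (χ ∘ proj₁))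
            (trans (cong (_*_ (χ (proj₁ dδ))) (sym (tri-count k≥0))) (sym (∑-* (tris k) (χ (proj₁ dδ)) (λ _ → 1ℤ)))))
          (sym (∑-sigma (G k) (λ _ → tris k) (λ x → u₂ (k , x)))))

    H : ∀ j → Finite (λ (x : ℤ × ℤ²) → Root (κ - j * (j + 1ℤ)) (proj₁ x) × Factors (1ℤ + + 4 * (κ - j * (j + 1ℤ) - proj₁ x * proj₁ x)) (proj₂ x))
    H j = sigma (roots (κ - j * (j + 1ℤ))) λ z → factors (1ℤ + + 4 * (κ - j * (j + 1ℤ) - z * z))

    u₃ : ℤ × (ℤ × ℤ²) → ℤ
    u₃ (j , z , (d , δ)) = χ d

    -- `k = j (j + 1) + z²` is determined by `j` and `z`, so the sum over `k` becomes one over `j`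
    -- and `z`.
    mixed≡ : ∑ mixed u₂ ≡ ∑ (sigma (indices κ) H) u₃
    mixed≡ = ∑-bij mixed (sigma (indices κ) H) (λ (k , dδ , (j , z)) → j , z , dδ)
      (λ { {k , (d , δ) , (j , z)} (mkLevel p q , mkFactors r s e , mkTri t e′) →
        (t , by (q ⊕ sq≥0 z) (trans (l₁ κ (j * (j + 1ℤ)) (z * z)) (cong (λ x → κ - x + z * z) e′)))
        , mkRoot (by q (trans (l₂ κ (j * (j + 1ℤ)) (z * z)) (cong (λ x → κ - x) e′)))
        , mkFactors r s (trans e (cong (λ x → 1ℤ + + 4 * x) (sym (trans (l₂ κ (j * (j + 1ℤ)) (z * z)) (cong (λ x → κ - x) e′))))) })
      (λ { {k , (d , δ) , (j , z)} {k′ , (d′ , δ′) , (j′ , z′)} (_ , _ , mkTri _ e) (_ , _ , mkTri _ e′) h → inj e e′ h })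
      (λ { {j , z , (d , δ)} ((p , q) , mkRoot r , mkFactors s t e) → (j * (j + 1ℤ) + z * z , (d , δ) , (j , z))
        , (mkLevel (p ⊗ (p ⊕ nat≥0 1) ⊕ sq≥0 z) (by r (sym (l₂ κ (j * (j + 1ℤ)) (z * z))))
          , mkFactors s t (trans e (cong (λ x → 1ℤ + + 4 * x) (l₂ κ (j * (j + 1ℤ)) (z * z)))) , mkTri p refl) , refl })
      (λ { {k , (d , δ) , (j , z)} _ → *-identityʳ (χ d) })
      where
      l₁ : ∀ κ x y → κ - x ≡ κ - (x + y) + y
      l₁ = solve 3 (λ κ x y → κ :- x := κ :- (x :+ y) :+ y) refl
      l₂ : ∀ κ x y → κ - x - y ≡ κ - (x + y)
      l₂ = solve 3 (λ κ x y → κ :- x :- y := κ :- (x :+ y)) refl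
      inj : ∀ {k k′ j j′ z z′} {v v′ : ℤ²} → j * (j + 1ℤ) + z * z ≡ k → j′ * (j′ + 1ℤ) + z′ * z′ ≡ k′ → (j , z , v) ≡ (j′ , z′ , v′) → (k , v , (j , z)) ≡ (k′ , v′ , (j′ , z′))
      inj refl refl refl = refl

    E₁ : ∑ (sigma (indices κ) H) u₃ ≡ ∑ (indices κ) (λ j → count (threeSqs (κ - j * (j + 1ℤ))))
    E₁ = trans (∑-sigma (indices κ) H u₃) (∑-cong (indices κ) λ {j} _ → step (κ - j * (j + 1ℤ)) j)
      where
      step : ∀ μ j → ∑ (sigma (roots μ) λ z → factors (1ℤ + + 4 * (μ - z * z))) (λ x → u₃ (j , x)) ≡ count (threeSqs μ)
      step μ j = trans (∑-sigma (roots μ) (λ z → factors (1ℤ + + 4 * (μ - z * z))) (λ x → u₃ (j , x)))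
        (trans (∑-cong (roots μ) (λ {z} _ → sym (*-identityˡ (D (1ℤ + + 4 * (μ - z * z)))))) (sym (threeSqs-∑ μ (λ _ → 1ℤ))))

    W : ℤ⁴ → ℤ
    W (a , x , b , y) = χ a * χ b

    principal? : Decidable (λ (u : ℤ⁴) → χ (proj₁ u * proj₁ (proj₂ u)) ≡ 1ℤ)
    principal? (a , x , b , y) = χ (a * x) ≟ 1ℤ

    -- Exchanging d and δ changes the sign of χ d when χ (d δ) = -1.
    rest : ∑ (restrict (quads N) (¬? ∘ principal?)) W ≡ 0ℤ
    rest = x≡-x⇒0 (trans (∑-bij Q Q (λ (a , x , b , y) → x , a , b , y) {W} { -_ ∘ W}
        (λ { {a , x , b , y} (mkQuad p q r s p′ q′ r′ s′ e , n) → mkQuad q p r s q′ p′ r′ s′ (trans (cong (_+ b * y) (*-comm x a)) e) , n ∘ trans (cong χ (*-comm a x)) })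
        (λ { {a , x , b , y} {a′ , x′ , b′ , y′} _ _ e → cong (λ (a , x , b , y) → x , a , b , y) e })
        (λ { {a , x , b , y} (mkQuad p q r s p′ q′ r′ s′ e , n) → (x , a , b , y) , (mkQuad q p r s q′ p′ r′ s′ (trans (cong (_+ b * y) (*-comm x a)) e) , n ∘ trans (cong χ (*-comm a x))) , refl })
        (λ { {a , x , b , y} (mkQuad p q r s p′ q′ r′ s′ e , n) → flip a x (χ b) p′ q′ n }))
      (∑-neg Q W))
      where
      Q = restrict (quads N) (¬? ∘ principal?)
      flip : ∀ a x c → Odd a → Odd x → χ (a * x) ≢ 1ℤ → χ a * c ≡ - (χ x * c)
      flip a x c oa ox n with χ±1 oa | χ±1 ox
      ... | inj₁ e | inj₁ e′ = ⊥-elim (n (trans (χ-* a x) (cong₂ _*_ e e′)))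
      ... | inj₂ e | inj₂ e′ = ⊥-elim (n (trans (χ-* a x) (cong₂ _*_ e e′)))
      ... | inj₁ e | inj₂ e′ rewrite e | e′ = l c
        where
        l : ∀ c → 1ℤ * c ≡ - (-1ℤ * c)
        l = solve 1 (λ c → # 1 :* c := :- (con -1ℤ :* c)) refl
      ... | inj₂ e | inj₁ e′ rewrite e | e′ = l c
        where
        l : ∀ c → -1ℤ * c ≡ - (1ℤ * c)
        l = solve 1 (λ c → con -1ℤ :* c := :- (# 1 :* c)) refl

    main : ∑ pairs u₁ ≡ ∑ (restrict (quads N) principal?) W
    main = ∑-bij pairs (restrict (quads N) principal?) (λ (k , (d , δ) , (a , b)) → d , δ , a , b)
      (λ { {k , (d , δ) , (a , b)} (mkLevel _ _ , mkFactors p q e , mkFactors r s e′) → into p q r s e e′ })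
      (λ { {k , (d , δ) , (a , b)} {k′ , (d′ , δ′) , (a′ , b′)} (_ , _ , mkFactors _ _ e) (_ , _ , mkFactors _ _ e′) h → inj e e′ h })
      (λ { {d , δ , a , b} (mkQuad p q r s _ _ _ _ e , h) → surj d δ a b p q r s e h })
      (λ { {k , (d , δ) , (a , b)} _ → refl })
      where
      χ1 : ∀ k → χ (1ℤ + + 4 * k) ≡ 1ℤ
      χ1 = χ-per 1ℤ
      o1 : ∀ {x} k → x ≡ 1ℤ + + 4 * k → Odd x
      o1 k refl = odd-by (+ 2 * k) (l k)
        where
        l : ∀ k → 1ℤ + + 4 * k ≡ 1ℤ + + 2 * (+ 2 * k)
        l = solve 1 (λ k → # 1 :+ # 4 :* k := # 1 :+ # 2 :* (# 2 :* k)) refl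
      into : ∀ {k d δ a b} → 0ℤ < d → 0ℤ < δ → 0ℤ < a → 0ℤ < b → d * δ ≡ 1ℤ + + 4 * (κ - k) → a * b ≡ 1ℤ + + 4 * k → Quad N (d , δ , a , b) × χ (d * δ) ≡ 1ℤ
      into {k} {d} {δ} {a} {b} p q r s e e′ = mkQuad p q r s (odd*ˡ {d} {δ} (o1 (κ - k) e)) (odd*ʳ {d} {δ} (o1 (κ - k) e)) (odd*ˡ {a} {b} (o1 k e′)) (odd*ʳ {a} {b} (o1 k e′))
          (trans (cong₂ _+_ e e′) (l κ k)) , trans (cong χ e) (χ1 (κ - k))
        where
        l : ∀ κ k → 1ℤ + + 4 * (κ - k) + (1ℤ + + 4 * k) ≡ + 2 + + 4 * κ
        l = solve 2 (λ κ k → # 1 :+ # 4 :* (κ :- k) :+ (# 1 :+ # 4 :* k) := # 2 :+ # 4 :* κ) refl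
      inj : ∀ {k k′ d d′ δ δ′ a a′ b b′} → a * b ≡ 1ℤ + + 4 * k → a′ * b′ ≡ 1ℤ + + 4 * k′ → (d , δ , a , b) ≡ (d′ , δ′ , a′ , b′) → (k , (d , δ) , (a , b)) ≡ (k′ , (d′ , δ′) , (a′ , b′))
      inj e e′ refl = cong (λ k → k , _) (quarter (trans (sym e) e′))
      surj : ∀ d δ a b → 0ℤ < d → 0ℤ < δ → 0ℤ < a → 0ℤ < b → d * δ + a * b ≡ N → χ (d * δ) ≡ 1ℤ →
        ∃ λ (v : ℤ × (ℤ² × ℤ²)) → (Level κ (proj₁ v) × Factors (1ℤ + + 4 * (κ - proj₁ v)) (proj₁ (proj₂ v)) × Factors (1ℤ + + 4 * proj₁ v) (proj₂ (proj₂ v))) × (proj₁ (proj₁ (proj₂ v)) , proj₂ (proj₁ (proj₂ v)) , proj₁ (proj₂ (proj₂ v)) , proj₂ (proj₂ (proj₂ v))) ≡ (d , δ , a , b)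
      surj d δ a b p q r s e h with χ≡1⇒ {d * δ} h
      ... | t , e₁ = (κ - t , (d , δ) , (a , b)) , (mkLevel (pos-quarter {κ - t} (subst (0ℤ <_) ab (pos* {a} {b} r s))) (by (pos-quarter {t} (subst (0ℤ <_) e₁ (pos* {d} {δ} p q))) (l₁ κ t))
          , mkFactors p q (trans e₁ (cong (λ x → 1ℤ + + 4 * x) (sym (l₁ κ t)))) , mkFactors r s ab) , refl
        where
        l₁ : ∀ κ t → κ - (κ - t) ≡ t
        l₁ = solve-∀
        l₂ : ∀ u v → v ≡ u + v - u
        l₂ = solve-∀
        l₃ : ∀ κ t → + 2 + + 4 * κ - (1ℤ + + 4 * t) ≡ 1ℤ + + 4 * (κ - t)
        l₃ = solve 2 (λ κ t → # 2 :+ # 4 :* κ :- (# 1 :+ # 4 :* t) := # 1 :+ # 4 :* (κ :- t)) refl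
        ab : a * b ≡ 1ℤ + + 4 * (κ - t)
        ab = trans (l₂ (d * δ) (a * b)) (trans (cong₂ _-_ e e₁) (l₃ κ t))

  -- In a quadruple the two odd products add up to 2 modulo 4, so both are 1 or both are 3 modulo 4.
  -- The first kind is the convolution of divisor sums, the second kind cancels, and Liouville's
  -- identity evaluates the whole.
  four-squares : ∑ (indices κ) (λ j → count (threeSqs (κ - j * (j + 1ℤ)))) ≡ count (triples N)
  four-squares = trans (sym (trans pairs≡mixed (trans mixed≡ E₁))) (trans main
    (trans (sym (trans (∑-split (quads N) principal? W) (trans (cong (_+_ (∑ (restrict (quads N) principal?) W)) rest) (+-identityʳ _)))) (Liouville.liouville κ)))

-- The j = 0 terms are f κ and g κ, so equal sums for all κ determine the functions recursively.
triangular-inversion : ∀ (f g : ℤ → ℤ) →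
  (∀ κ → 0ℤ ≤ κ → ∑ (indices κ) (λ j → f (κ - j * (j + 1ℤ))) ≡ ∑ (indices κ) (λ j → g (κ - j * (j + 1ℤ)))) →
  ∀ m → f (+ m) ≡ g (+ m)
triangular-inversion f g e = <-rec _ step
  where
  step : ∀ m → (∀ {k} → k ℕ.< m → f (+ k) ≡ g (+ k)) → f (+ m) ≡ g (+ m)
  step m rec = +-cancelʳ′ tail (trans (sym (expand f refl)) (trans (e κ (nat≥0 m)) (expand g tails)))
    where
    κ = + m
    zero? : Decidable (_≡ 0ℤ)
    zero? j = j ≟ 0ℤ
    rest = restrict (indices κ) (¬? ∘ zero?)
    tail = ∑ rest (λ j → f (κ - j * (j + 1ℤ)))
    expand : ∀ h → ∑ rest (λ j → h (κ - j * (j + 1ℤ))) ≡ tail → ∑ (indices κ) (λ j → h (κ - j * (j + 1ℤ))) ≡ h κ + tail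
    expand h t = trans (∑-split (indices κ) zero? (λ j → h (κ - j * (j + 1ℤ)))) (cong₂ _+_
      (trans (∑-single (restrict (indices κ) zero?) 0ℤ {λ j → h (κ - j * (j + 1ℤ))} ((≤-refl , subst (0ℤ ≤_) (sym (+-identityʳ κ)) (nat≥0 m)) , refl) proj₂) (cong h (+-identityʳ κ))) t)
    smaller : ∀ j μ → 0ℤ ≤ j → j ≢ 0ℤ → 0ℤ ≤ μ → μ ≡ κ - j * (j + 1ℤ) → f μ ≡ g μ
    smaller j (+ k) j≥0 j≢0 _ eq = rec (drop‿+<+ (subst₂ _<_ (sym eq) (+-identityʳ κ) (+-monoʳ-< κ (neg-mono-< (pos* {j} {j + 1ℤ} j>0 (pby j≥0 (l j)))))))
      where
      l : ∀ j → j + 1ℤ - 1ℤ ≡ j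
      l = solve-∀
      j>0 : 0ℤ < j
      j>0 = ≤∧≢⇒< j≥0 (j≢0 ∘ sym)
    tails : ∑ rest (λ j → g (κ - j * (j + 1ℤ))) ≡ tail
    tails = ∑-cong rest λ {j} ((p , q) , ne) → sym (smaller j (κ - j * (j + 1ℤ)) p ne q refl)

three-squares : ∀ m → count (threeSqs (+ m)) ≡ count (forms (+ m))
three-squares = triangular-inversion (count ∘ threeSqs) (count ∘ forms) λ κ κ≥0 →
  trans (FourSquares.four-squares κ) (trans (sym (forms-triples κ (pby (nat≥0 1 ⊕ nat≥0 4 ⊗ κ≥0) (l κ))))
    (∑-sigma (indices κ) (λ j → forms (κ - j * (j + 1ℤ))) (λ _ → 1ℤ)))
  where
  l : ∀ κ → + 2 + + 4 * κ - 1ℤ ≡ + 1 + + 4 * κ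
  l = solve 1 (λ κ → # 2 :+ # 4 :* κ :- # 1 := # 1 :+ # 4 :* κ) refl

-- The principal form of determinant `4 m + 1` is reduced.
three-squares>0 : ∀ m → 0ℤ < count (threeSqs (+ m))
three-squares>0 m = subst (0ℤ <_) (sym (three-squares m)) (count>0 (forms (+ m)) ((1ℤ , 0ℤ , 1ℤ + + 4 * + m) ,
  record { A-b = 1>0 ; A+b = 1>0 ; C-b = subst (0ℤ <_) (sym (+-identityʳ _)) C>0 ; C+b = subst (0ℤ <_) (sym (+-identityʳ _)) C>0 ; det = l (+ m) }))
  where
  1>0 : 0ℤ < 1ℤ
  1>0 = +<+ (ℕ.s≤s ℕ.z≤n)
  l : ∀ m → 1ℤ * (1ℤ + + 4 * m) - + 4 * (0ℤ * 0ℤ) ≡ 1ℤ + + 4 * m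
  l = solve 1 (λ m → # 1 :* (# 1 :+ # 4 :* m) :- # 4 :* (# 0 :* # 0) := # 1 :+ # 4 :* m) refl
  l₁ : ∀ m → 1ℤ + + 4 * m - 1ℤ ≡ + 4 * m
  l₁ = solve 1 (λ m → # 1 :+ # 4 :* m :- # 1 := # 4 :* m) refl
  C>0 : 0ℤ < 1ℤ + + 4 * + m
  C>0 = pby (nat≥0 4 ⊗ nat≥0 m) (l₁ (+ m))

-- If every z were even, the alternating sum would be the number of representations.
odd-three-squares : ∀ m → (∀ r → r * r ≢ 1ℤ + + 4 * + m) → ∃ λ (v : ℤ × ℤ²) → ThreeSq (+ m) v × Odd (proj₁ v)
odd-three-squares m nonsquare with count odds ≟ 0ℤ
  where
  odds = restrict (threeSqs (+ m)) (odd? ∘ proj₁)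
... | no  ne = ∑≢0 (restrict (threeSqs (+ m)) (odd? ∘ proj₁)) ne
... | yes e0 = ⊥-elim (pos≢0 (three-squares>0 m) (trans (∑-split X (odd? ∘ proj₁) (λ _ → 1ℤ)) (trans (cong (_+ count evens) e0) (trans (+-identityˡ _) evens0))))
  where
  X     = threeSqs (+ m)
  odds  = restrict X (odd? ∘ proj₁)
  evens = restrict X (¬? ∘ odd? ∘ proj₁)
  sg-nonodd : ∀ z → ¬ Odd z → sg z ≡ 1ℤ
  sg-nonodd z n with parity z
  ... | even k refl = sg-even k
  ... | odd k e     = ⊥-elim (n (odd-by k e))
  total : ∑ X (sg ∘ proj₁) ≡ 0ℤ
  total = trans (threeSqs-∑ (+ m) sg) (alternating-sum (+ m) nonsquare)
  odds0 : ∑ odds (sg ∘ proj₁) ≡ 0ℤ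
  odds0 = trans (∑-cong odds (λ (_ , o) → Odd.sg-1 o)) (trans (∑-neg odds (λ _ → 1ℤ)) (cong -_ e0))
  evens0 : count evens ≡ 0ℤ
  evens0 = trans (sym (trans (∑-split X (odd? ∘ proj₁) (sg ∘ proj₁))
      (trans (cong₂ _+_ odds0 (∑-cong evens λ {v} (_ , n) → sg-nonodd (proj₁ v) n)) (+-identityˡ _)))) total

-- The number of triples is positive because `D = p = 1`, `q = 4 k + 1` is one. In effect this is
-- the four-square theorem for the odd number `2 k + 1`.
four-squares-exist : ∀ k → ∃ λ (v : ℤ × (ℤ × ℤ²)) → Index (+ k) (proj₁ v) × ThreeSq (+ k - proj₁ v * (proj₁ v + 1ℤ)) (proj₂ v)
four-squares-exist k = ∑≢0 (sigma (indices (+ k)) (λ j → threeSqs (+ k - j * (j + 1ℤ)))) {λ _ → 1ℤ}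
  (λ e → pos≢0 (count>0 (triples (+ 2 + + 4 * + k)) ((1ℤ , 1ℤ , 1ℤ + + 4 * + k) , t))
    (trans (sym (FourSquares.four-squares (+ k))) (trans (sym (∑-sigma (indices (+ k)) (λ j → threeSqs (+ k - j * (j + 1ℤ))) (λ _ → 1ℤ))) e)))
  where
  l₁ : ∀ m → 1ℤ + + 4 * m - 1ℤ ≡ + 4 * m
  l₁ = solve 1 (λ m → # 1 :+ # 4 :* m :- # 1 := # 4 :* m) refl
  l₂ : ∀ m → 1ℤ + + 4 * m ≡ 1ℤ + + 2 * (+ 2 * m)
  l₂ = solve 1 (λ m → # 1 :+ # 4 :* m := # 1 :+ # 2 :* (# 2 :* m)) refl
  l₃ : ∀ m → 1ℤ * (1ℤ + (1ℤ + + 4 * m)) ≡ + 2 + + 4 * m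
  l₃ = solve 1 (λ m → # 1 :* (# 1 :+ (# 1 :+ # 4 :* m)) := # 2 :+ # 4 :* m) refl
  t : Triple (+ 2 + + 4 * + k) (1ℤ , 1ℤ , 1ℤ + + 4 * + k)
  t = record { D>0 = +<+ (ℕ.s≤s ℕ.z≤n) ; p>0 = +<+ (ℕ.s≤s ℕ.z≤n) ; q>0 = pby (nat≥0 4 ⊗ nat≥0 k) (l₁ (+ k))
             ; odd-D = mkOdd refl ; odd-p = mkOdd refl ; odd-q = odd-by (+ 2 * + k) (l₂ (+ k)) ; prod = l₃ (+ k) }

-- The criterion `m = a² + 4 w² + 4 z²` with `a` and `z` odd.

record Special (m : ℤ) : Set where
  constructor mkSpecial
  field
    {a w z} : ℤ
    odd-a   : Odd a
    odd-z   : Odd z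
    sum     : a * a + + 4 * (w * w) + + 4 * (z * z) ≡ m

-- Products of consecutive integers are even, so `k` has the parity of `w² + z²` and of `w + z`. For
-- a number `2 k + 1` that is 3 modulo 4, this is what makes the last term of the squared norm form
-- odd.
odd-triangular : ∀ i j w z k → i * (i + 1ℤ) + w * w ≡ k - j * (j + 1ℤ) - z * z → Odd k → Odd (w + z)
odd-triangular i j w z k e (mkOdd o) = mkOdd (trans (sg-+ w z) (trans (sym (cong₂ _*_ (sg-sq w) (sg-sq z))) (trans (sym (sg-+ (w * w) (z * z)))
    (trans (sym (trans (cong sg (trans (k≡ k (i * (i + 1ℤ)) (j * (j + 1ℤ)) (w * w) (z * z) e) (+-comm (pronic i + pronic j) _))) (trans (sg-+ (w * w + z * z) (pronic i + pronic j)) (trans (cong (_*_ (sg (w * w + z * z))) (trans (sg-+ (pronic i) (pronic j)) (cong₂ _*_ (sg-pronic i) (sg-pronic j)))) (*-identityʳ _))))) o))))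
  where
  pronic : ℤ → ℤ
  pronic i = i * (i + 1ℤ)
  k≡ : ∀ k x y u v → x + u ≡ k - y - v → k ≡ x + y + (u + v)
  k≡ k x y u v e = trans (l₁ k y v) (trans (cong (λ t → t + (y + v)) (sym e)) (l₂ x y u v))
    where
    l₁ : ∀ k y v → k ≡ k - y - v + (y + v)
    l₁ = solve 3 (λ k y v → k := k :- y :- v :+ (y :+ v)) refl
    l₂ : ∀ x y u v → x + u + (y + v) ≡ x + y + (u + v)
    l₂ = solve 4 (λ x y u v → x :+ u :+ (y :+ v) := x :+ y :+ (u :+ v)) refl
  sg-sq : ∀ x → sg (x * x) ≡ sg x
  sg-sq x with parity x
  ... | even k refl = trans (cong sg (l k)) (trans (sg-even (+ 2 * (k * k))) (sym (sg-even k)))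
    where
    l : ∀ k → (0ℤ + + 2 * k) * (0ℤ + + 2 * k) ≡ 0ℤ + + 2 * (+ 2 * (k * k))
    l = solve 1 (λ k → (# 0 :+ # 2 :* k) :* (# 0 :+ # 2 :* k) := # 0 :+ # 2 :* (# 2 :* (k :* k))) refl
  ... | odd k refl = trans (Odd.sg-1 (odd* {1ℤ + + 2 * k} {1ℤ + + 2 * k} (odd-by k refl) (odd-by k refl))) (sym (sg-odd k))
  sg-pronic : ∀ x → sg (pronic x) ≡ 1ℤ
  sg-pronic x = trans (cong sg (*-distribˡ-+ x x 1ℤ)) (trans (sg-+ (x * x) (x * 1ℤ)) (trans (cong₂ _*_ (sg-sq x) (cong sg (*-identityʳ x))) (sg² x)))

-- Squaring the quaternion norm form: (s₁² + s₂² + s₃² + s₄²)² = (s₁² + s₂² - s₃² - s₄²)² + 4 (s₁ s₃ + s₂ s₄)² + 4 (s₁ s₄ - s₂ s₃)²,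
-- where s₁ = i + j + 1, s₂ = i - j, s₃ = w + z, s₄ = w - z.
special-square : ∀ k → Odd (+ k) → Special ((1ℤ + + 2 * + k) * (1ℤ + + 2 * + k))
special-square k o = go (four-squares-exist k)
  where
  l₁ : ∀ i j w z → let s₁ = i + j + 1ℤ ; s₂ = i - j ; s₃ = w + z ; s₄ = w - z ; a = s₁ * s₁ + s₂ * s₂ - s₃ * s₃ - s₄ * s₄ ; u = s₁ * s₃ + s₂ * s₄ ; v = s₁ * s₄ - s₂ * s₃ in
    a * a + + 4 * (u * u) + + 4 * (v * v)
      ≡ (1ℤ + + 2 * (i * (i + 1ℤ) + w * w + (j * (j + 1ℤ) + z * z))) * (1ℤ + + 2 * (i * (i + 1ℤ) + w * w + (j * (j + 1ℤ) + z * z)))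
  l₁ = solve-∀
  l₂ : ∀ k y v → k - y - v + (y + v) ≡ k
  l₂ = solve 3 (λ k y v → k :- y :- v :+ (y :+ v) := k) refl
  l₃ : ∀ i j w z → let s₁ = i + j + 1ℤ ; s₂ = i - j ; s₃ = w + z ; s₄ = w - z in
    s₁ * s₁ + s₂ * s₂ - s₃ * s₃ - s₄ * s₄ ≡ 1ℤ + + 2 * (i * (i + 1ℤ) + j * (j + 1ℤ) - w * w - z * z)
  l₃ = solve-∀
  l₄ : ∀ i j w z → (i + j + 1ℤ) * (w - z) - (i - j) * (w + z) ≡ w + z + + 2 * (j * w - i * z - z)
  l₄ = solve 4 (λ i j w z → (i :+ j :+ # 1) :* (w :- z) :- (i :- j) :* (w :+ z) := w :+ z :+ # 2 :* (j :* w :- i :* z :- z)) refl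
  go : (∃ λ (v : ℤ × (ℤ × ℤ²)) → Index (+ k) (proj₁ v) × ThreeSq (+ k - proj₁ v * (proj₁ v + 1ℤ)) (proj₂ v)) → Special ((1ℤ + + 2 * + k) * (1ℤ + + 2 * + k))
  go ((j , z , (i , w)) , _ , _ , mkTri _ e) = mkSpecial
    {a = (i + j + 1ℤ) * (i + j + 1ℤ) + (i - j) * (i - j) - (w + z) * (w + z) - (w - z) * (w - z)} {w = (i + j + 1ℤ) * (w + z) + (i - j) * (w - z)} {z = (i + j + 1ℤ) * (w - z) - (i - j) * (w + z)}
    (odd-by (i * (i + 1ℤ) + j * (j + 1ℤ) - w * w - z * z) (l₃ i j w z))
    (subst Odd (sym (l₄ i j w z)) (odd-per (j * w - i * z - z) (odd-triangular i j w z (+ k) e o)))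
    (trans (l₁ i j w z) (cong (λ x → (1ℤ + + 2 * x) * (1ℤ + + 2 * x)) (trans (cong (_+ (j * (j + 1ℤ) + z * z)) e) (l₂ (+ k) (j * (j + 1ℤ)) (z * z)))))

special-scale : ∀ {m} c → Odd c → Special m → Special (c * c * m)
special-scale {m} c oc (mkSpecial {a} {w} {z} oa oz e) = mkSpecial {a = c * a} {w = c * w} {z = c * z} (odd* oc oa) (odd* oc oz) (trans (l c a w z) (cong (_*_ (c * c)) e))
  where
  l : ∀ c a w z → c * a * (c * a) + + 4 * (c * w * (c * w)) + + 4 * (c * z * (c * z)) ≡ c * c * (a * a + + 4 * (w * w) + + 4 * (z * z))
  l = solve 4 (λ c a w z → c :* a :* (c :* a) :+ # 4 :* (c :* w :* (c :* w)) :+ # 4 :* (c :* z :* (c :* z)) := c :* c :* (a :* a :+ # 4 :* (w :* w) :+ # 4 :* (z :* z))) refl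

special-nonsquare : ∀ m → (∀ r → r * r ≢ 1ℤ + + 4 * + m) → Special (1ℤ + + 4 * + m)
special-nonsquare m ns = go (odd-three-squares m ns)
  where
  go : (∃ λ (v : ℤ × ℤ²) → ThreeSq (+ m) v × Odd (proj₁ v)) → Special (1ℤ + + 4 * + m)
  go ((z , (i , w)) , (_ , mkTri _ e) , oz) = mkSpecial {a = 1ℤ + + 2 * i} {w = w} {z = z} (odd-by i refl) oz
    (trans (l₁ i w z) (trans (cong (λ x → 1ℤ + + 4 * (x + z * z)) e) (cong (λ x → 1ℤ + + 4 * x) (x-y+y (+ m) (z * z)))))
    where
    l₁ : ∀ i w z → (1ℤ + + 2 * i) * (1ℤ + + 2 * i) + + 4 * (w * w) + + 4 * (z * z) ≡ 1ℤ + + 4 * (i * (i + 1ℤ) + w * w + z * z)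
    l₁ = solve 3 (λ i w z → (# 1 :+ # 2 :* i) :* (# 1 :+ # 2 :* i) :+ # 4 :* (w :* w) :+ # 4 :* (z :* z) := # 1 :+ # 4 :* (i :* (i :+ # 1) :+ w :* w :+ z :* z)) refl

-- Back to triangular numbers.

tri-double : ∀ x → tri x * + 2 ≡ x * (x - 1ℤ)
tri-double x = exact (x * (x - 1ℤ)) (even-product x)
  where
  even-product : ∀ x → ∃ λ k → x * (x - 1ℤ) ≡ 0ℤ + + 2 * k
  even-product x with parity x
  ... | even k refl = k * (+ 2 * k - 1ℤ) , l k
    where
    l : ∀ k → (0ℤ + + 2 * k) * (0ℤ + + 2 * k - 1ℤ) ≡ 0ℤ + + 2 * (k * (+ 2 * k - 1ℤ))
    l = solve 1 (λ k → (# 0 :+ # 2 :* k) :* (# 0 :+ # 2 :* k :- # 1) := # 0 :+ # 2 :* (k :* (# 2 :* k :- # 1))) refl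
  ... | odd k refl = k * (1ℤ + + 2 * k) , l k
    where
    l : ∀ k → (1ℤ + + 2 * k) * (1ℤ + + 2 * k - 1ℤ) ≡ 0ℤ + + 2 * (k * (1ℤ + + 2 * k))
    l = solve 1 (λ k → (# 1 :+ # 2 :* k) :* (# 1 :+ # 2 :* k :- # 1) := # 0 :+ # 2 :* (k :* (# 1 :+ # 2 :* k))) refl
  exact : ∀ a → (∃ λ k → a ≡ 0ℤ + + 2 * k) → a / + 2 * + 2 ≡ a
  exact a (k , e) = go (a % + 2) (a / + 2) (n%d<d a (+ 2)) (a≡a%n+[a/n]*n a (+ 2))
    where
    go : ∀ r q → r ℕ.< 2 → a ≡ + r + q * + 2 → q * + 2 ≡ a
    go 0 q _ h = trans (sym (+-identityˡ _)) (sym h)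
    go 1 q _ h = ⊥-elim (1≢-1 (trans (sym (sg-even k)) (trans (cong sg (trans (sym e) (trans h (cong (_+_ 1ℤ) (*-comm q (+ 2)))))) (sg-odd q))))
    go (suc (suc _)) _ (ℕ.s≤s (ℕ.s≤s ())) _

Represented : ℤ → Set
Represented n = ∃ λ x → ∃ λ y → ∃ λ z → n ≡ tri x + tri y + + 8 * tri z

special⇒represented : ∀ n → Special (+ 5 + + 4 * n) → Represented n
special⇒represented n (mkSpecial {a} {w} {z} oa oz e) with odd⇒ oa | odd⇒ oz
-- Solves `x + y - 1 = a`, `x - y = 2 w` and `2 z - 1` equal to the given odd number.
... | i , refl | t , refl = i + 1ℤ + w , i + 1ℤ - w , t + 1ℤ , *-cancelˡ-≡ (+ 4) n _ (trans (l₁ n) (trans (cong (_- + 5) (sym e)) (sym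
      (trans (l₂ (tri x) (tri y) (tri z′)) (trans (cong₂ (λ u v → + 2 * u + + 16 * v) (cong₂ _+_ (tri-double x) (tri-double y)) (tri-double z′)) (l₃ i w t))))))
  where
  x = i + 1ℤ + w
  y = i + 1ℤ - w
  z′ = t + 1ℤ
  l₁ : ∀ n → + 4 * n ≡ + 5 + + 4 * n - + 5
  l₁ = solve 1 (λ n → # 4 :* n := # 5 :+ # 4 :* n :- # 5) refl
  l₂ : ∀ p q r → + 4 * (p + q + + 8 * r) ≡ + 2 * (p * + 2 + q * + 2) + + 16 * (r * + 2)
  l₂ = solve 3 (λ p q r → # 4 :* (p :+ q :+ # 8 :* r) := # 2 :* (p :* # 2 :+ q :* # 2) :+ # 16 :* (r :* # 2)) refl
  l₃ : ∀ i w t → + 2 * ((i + 1ℤ + w) * (i + 1ℤ + w - 1ℤ) + (i + 1ℤ - w) * (i + 1ℤ - w - 1ℤ)) + + 16 * ((t + 1ℤ) * (t + 1ℤ - 1ℤ))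
    ≡ (1ℤ + + 2 * i) * (1ℤ + + 2 * i) + + 4 * (w * w) + + 4 * ((1ℤ + + 2 * t) * (1ℤ + + 2 * t)) - + 5
  l₃ = solve 3 (λ i w t → # 2 :* ((i :+ # 1 :+ w) :* (i :+ # 1 :+ w :- # 1) :+ (i :+ # 1 :- w) :* (i :+ # 1 :- w :- # 1)) :+ # 16 :* ((t :+ # 1) :* (t :+ # 1 :- # 1)) := (# 1 :+ # 2 :* i) :* (# 1 :+ # 2 :* i) :+ # 4 :* (w :* w) :+ # 4 :* ((# 1 :+ # 2 :* t) :* (# 1 :+ # 2 :* t)) :- # 5) refl

represented⇒ : ∀ n x y z → n ≡ tri x + tri y + + 8 * tri z →
  (x + y - 1ℤ) * (x + y - 1ℤ) + (x - y) * (x - y) + + 4 * ((+ 2 * z - 1ℤ) * (+ 2 * z - 1ℤ)) ≡ + 5 + + 4 * n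
represented⇒ n x y z e = trans (l₁ x y z) (trans (cong₂ (λ u v → + 5 + + 2 * u + + 16 * v) (cong₂ _+_ (sym (tri-double x)) (sym (tri-double y))) (sym (tri-double z)))
    (trans (l₂ (tri x) (tri y) (tri z)) (cong (λ u → + 5 + + 4 * u) (sym e))))
  where
  l₁ : ∀ x y z → (x + y - 1ℤ) * (x + y - 1ℤ) + (x - y) * (x - y) + + 4 * ((+ 2 * z - 1ℤ) * (+ 2 * z - 1ℤ)) ≡ + 5 + + 2 * (x * (x - 1ℤ) + y * (y - 1ℤ)) + + 16 * (z * (z - 1ℤ))
  l₁ = solve 3 (λ x y z → (x :+ y :- # 1) :* (x :+ y :- # 1) :+ (x :- y) :* (x :- y) :+ # 4 :* ((# 2 :* z :- # 1) :* (# 2 :* z :- # 1)) := # 5 :+ # 2 :* (x :* (x :- # 1) :+ y :* (y :- # 1)) :+ # 16 :* (z :* (z :- # 1))) refl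
  l₂ : ∀ p q r → + 5 + + 2 * (p * + 2 + q * + 2) + + 16 * (r * + 2) ≡ + 5 + + 4 * (p + q + + 8 * r)
  l₂ = solve 3 (λ p q r → # 5 :+ # 2 :* (p :* # 2 :+ q :* # 2) :+ # 16 :* (r :* # 2) := # 5 :+ # 4 :* (p :+ q :+ # 8 :* r)) refl

-- The case of a square

χ≡-1⇒ : ∀ q → χ (+ q) ≡ -1ℤ → ∃ λ k → q ≡ 4 ℕ.* k ℕ.+ 3
χ≡-1⇒ 3 _ = 0 , refl
χ≡-1⇒ (suc (suc (suc (suc q)))) e with χ≡-1⇒ q e
... | k , refl = suc k , cong (ℕ._+ 3) (sym (ℕₚ.*-suc 4 k))

isSquare? : ∀ m → Dec (IsSquare m)
isSquare? m = map′ (λ (r , _ , e) → r , e) (λ (r , e) → r , ℕ.s≤s (bound r e) , e) (ℕₚ.anyUpTo? (λ r → m ℕₚ.≟ r ℕ.* r) (suc m))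
  where
  bound : ∀ r → m ≡ r ℕ.* r → r ℕ.≤ m
  bound zero    _    = ℕ.z≤n
  bound (suc r) refl = ℕₚ.m≤m*n (suc r) (suc r)

-- Fermat descent: a prime q of χ = -1 dividing P but not Q divides u and v, so q² divides P and can be removed.
common-prime : ∀ P Q u v → χ (+ P) ≡ -1ℤ → + P * Q ≡ u * u + v * v → ∃ λ q → Prime q × χ (+ q) ≡ -1ℤ × + q dvd + P × + q dvd Q
common-prime = <-rec _ step
  where
  Claim : ℕ → Set
  Claim P = ∀ Q u v → χ (+ P) ≡ -1ℤ → + P * Q ≡ u * u + v * v → ∃ λ q → Prime q × χ (+ q) ≡ -1ℤ × + q dvd + P × + q dvd Q
  step : ∀ P → (∀ {P′} → P′ ℕ.< P → Claim P′) → Claim P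
  step (suc P₀) rec Q u v χP e = split (prime-factor-3 {P} χP)
    where
    P = suc P₀
    Goal = ∃ λ q → Prime q × χ (+ q) ≡ -1ℤ × + q dvd + P × + q dvd Q
    split : (∃ λ q → Prime q × q ℕ∣.∣ P × χ (+ q) ≡ -1ℤ) → Goal
    split (q , pr , d , χq) with + q dvd? Q
    ... | yes d′ = q , pr , χq , ∣ᵤ⇒∣ d , d′
    ... | no ¬d′ = remove (∣ᵤ⇒∣ d) (two-squares-mod pr χq u v q∣) (two-squares-mod pr χq v u (∣-subst (+-comm (u * u) (v * v)) q∣))
      where
      q>0 = prime>0 pr
      q∣ : + q dvd u * u + v * v
      q∣ = ∣-subst e (∣m⇒∣m*n {+ q} {+ P} Q (∣ᵤ⇒∣ d))
      remove : + q dvd + P → + q dvd u → + q dvd v → Goal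
      remove (divides M P≡) (divides u′ refl) (divides v′ refl) = again (euclid pr M Q (divides (u′ * u′ + v′ * v′) MQ))
        where
        l₁ : ∀ q M Q → q * (M * Q) ≡ M * q * Q
        l₁ = solve 3 (λ q M Q → q :* (M :* Q) := M :* q :* Q) refl
        l₂ : ∀ q u v → u * q * (u * q) + v * q * (v * q) ≡ q * ((u * u + v * v) * q)
        l₂ = solve 3 (λ q u v → u :* q :* (u :* q) :+ v :* q :* (v :* q) := q :* ((u :* u :+ v :* v) :* q)) refl
        MQ : M * Q ≡ (u′ * u′ + v′ * v′) * + q
        MQ = pos*-cancel-≡ {+ q} {M * Q} q>0 (trans (l₁ (+ q) M Q) (trans (cong (_* Q) (sym P≡)) (trans e (l₂ (+ q) u′ v′))))
        descend : ∀ M → + P ≡ + q * + q * M → M * Q ≡ u′ * u′ + v′ * v′ → Goal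
        descend -[1+ M ] P≡ h = 0≮-[1+n] (pos*-cancelˡ {+ q * + q} { -[1+ M ]} (pos* q>0 q>0) (subst (0ℤ <_) P≡ (+<+ (ℕ.s≤s ℕ.z≤n))))
        descend (+ P′) P≡ h = let q′ , pr′ , χ′ , d₁ , d₂ = rec P′<P Q u′ v′ χP′ h
                                 in q′ , pr′ , χ′ , ∣-subst (sym P≡) (∣n⇒∣m*n (+ q * + q) d₁) , d₂
          where
          P′>0 : 0ℤ < + P′
          P′>0 = pos*-cancelˡ {+ q * + q} {+ P′} (pos* q>0 q>0) (subst (0ℤ <_) P≡ (+<+ (ℕ.s≤s ℕ.z≤n)))
          χP′ : χ (+ P′) ≡ -1ℤ
          χP′ = trans (sym (trans (cong χ P≡) (trans (χ-* (+ q * + q) (+ P′)) (trans (cong (_* χ (+ P′)) (trans (χ-* (+ q) (+ q)) (cong₂ _*_ χq χq))) (*-identityˡ _))))) χP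
          l : ∀ q P → q * q * P - P - 1ℤ ≡ (q - 1ℤ - 1ℤ) * (q + 1ℤ) * P + q * P + (P - 1ℤ)
          l = solve 2 (λ q P → q :* q :* P :- P :- # 1 := (q :- # 1 :- # 1) :* (q :+ # 1) :* P :+ q :* P :+ (P :- # 1)) refl
          P′<P : P′ ℕ.< P
          P′<P = drop‿+<+ (subst₂ _<_ (+-identityˡ (+ P′)) (trans (x-y+y _ (+ P′)) (sym P≡)) (+-monoˡ-< (+ P′)
            (pby {+ q * + q * + P′ - + P′} (pred≥0 (prime>1 pr) ⊗ (nat≥0 q ⊕ nat≥0 1) ⊗ nat≥0 P′ ⊕ nat≥0 q ⊗ nat≥0 P′ ⊕ pred≥0 P′>0) (l (+ q) (+ P′)))))
        again : + q dvd M ⊎ + q dvd Q → Goal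
        again (inj₂ d′) = ⊥-elim (¬d′ d′)
        again (inj₁ (divides M′ M≡)) = descend M′ P≡′ M′Q
          where
          P≡′ : + P ≡ + q * + q * M′
          P≡′ = trans P≡ (trans (cong (_* + q) M≡) (l (+ q) M′))
            where
            l : ∀ q M → M * q * q ≡ q * q * M
            l = solve 2 (λ q M → M :* q :* q := q :* q :* M) refl
          M′Q : M′ * Q ≡ u′ * u′ + v′ * v′
          M′Q = pos*-cancel-≡ {+ q} {M′ * Q} q>0 (trans (l (+ q) M′ Q) (trans (cong (_* Q) (sym M≡)) (trans MQ (*-comm _ (+ q)))))
            where
            l : ∀ q M Q → q * (M * Q) ≡ M * q * Q
            l = solve 3 (λ q M Q → q :* (M :* Q) := M :* q :* Q) refl

pos-4n+5 : ∀ n → + (4 ℕ.* n ℕ.+ 5) ≡ + 5 + + 4 * + n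
pos-4n+5 n = trans (cong +_ (ℕₚ.+-comm (4 ℕ.* n) 5)) (cong (_+_ (+ 5)) (pos-* 4 n))

both-positive : ∀ {P Q} → 0ℤ < P * Q → 0ℤ < P + Q → 0ℤ < P
both-positive {P} {Q} h s with sign P
... | isPos p     = p
... | isZero refl = ⊥-elim (pos≢0 h (*-zeroˡ Q))
... | isNeg p     = ⊥-elim (neg-pos {P * Q} (subst (0ℤ <_) (l P Q) (pos* p (pby (pred≥0 s ⊕ pos→nn p) (l′ P Q)))) h)
  where
  l : ∀ P Q → - P * Q ≡ - (P * Q)
  l = solve 2 (λ P Q → :- P :* Q := :- (P :* Q)) refl
  l′ : ∀ P Q → Q - 1ℤ ≡ P + Q - 1ℤ + - P
  l′ = solve 2 (λ P Q → Q :- # 1 := P :+ Q :- # 1 :+ :- P) refl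

odd-cancel-2 : ∀ {q} r → Odd q → q dvd + 2 * r → q dvd r
odd-cancel-2 {q} r o h with odd⇒ o
... | k , refl = ∣-subst (l k r) (∣m∣n⇒∣m-n (∣m⇒∣m*n {1ℤ + + 2 * k} {1ℤ + + 2 * k} r (divides 1ℤ (sym (*-identityˡ _)))) (∣n⇒∣m*n k h))
  where
  l : ∀ k r → (1ℤ + + 2 * k) * r - k * (+ 2 * r) ≡ r
  l = solve 2 (λ k r → (# 1 :+ # 2 :* k) :* r :- k :* (# 2 :* r) := r) refl

square-prime : ∀ r u v t → + r * + r ≡ u * u + v * v + + 4 * ((+ 2 * t - 1ℤ) * (+ 2 * t - 1ℤ)) → Odd (+ r) → ∃ λ q → Prime q × χ (+ q) ≡ -1ℤ × q ℕ∣.∣ r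
square-prime zero u v t e o = ⊥-elim (odd≢0 o refl)
square-prime r@(suc _) u v t e o with χ±1 o
-- If `r` is itself 3 modulo 4, it has such a prime factor outright.
... | inj₂ χr = let q , pr , d , χq = prime-factor-3 {r} χr in q , pr , χq , d
... | inj₁ χr = go P refl
  where
  s = + 2 * t - 1ℤ
  P = + r + + 2 * s
  Q = + r - + 2 * s
  l₁ : ∀ r s → (r + + 2 * s) * (r - + 2 * s) ≡ r * r - + 4 * (s * s)
  l₁ = solve 2 (λ r s → (r :+ # 2 :* s) :* (r :- # 2 :* s) := r :* r :- # 4 :* (s :* s)) refl
  PQ : P * Q ≡ u * u + v * v
  PQ = trans (l₁ (+ r) s) (trans (cong (_- + 4 * (s * s)) e) (x+y-y (u * u + v * v) (+ 4 * (s * s))))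
  l₃ : ∀ r s → r - + 2 * s ≡ r + + 2 * - s
  l₃ = solve 2 (λ r s → r :- # 2 :* s := r :+ # 2 :* :- s) refl
  odd-PQ : Odd (P * Q)
  odd-PQ = odd* {P} {Q} (odd-per s o) (subst Odd (sym (l₃ (+ r) s)) (odd-per (- s) o))
  PQ>0 : 0ℤ < P * Q
  PQ>0 = ≤∧≢⇒< (by (sq≥0 u ⊕ sq≥0 v) PQ) (odd≢0 odd-PQ ∘ sym)
  l₄ : ∀ r s → + 2 * r ≡ r + + 2 * s + (r - + 2 * s)
  l₄ = solve 2 (λ r s → # 2 :* r := r :+ # 2 :* s :+ (r :- # 2 :* s)) refl
  -- A common prime of `P` and `Q` divides `2 r`, and being odd it divides `r`.
  P+Q : + 2 * + r ≡ P + Q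
  P+Q = l₄ (+ r) s
  P>0 : 0ℤ < P
  P>0 = both-positive {P} {Q} PQ>0 (subst (0ℤ <_) P+Q (+<+ (ℕ.s≤s ℕ.z≤n)))
  l₅ : ∀ k t → 1ℤ + + 4 * k + + 2 * (+ 2 * t - 1ℤ) ≡ -1ℤ + + 4 * (k + t)
  l₅ = solve 2 (λ k t → # 1 :+ # 4 :* k :+ # 2 :* (# 2 :* t :- # 1) := con -1ℤ :+ # 4 :* (k :+ t)) refl
  χP : χ P ≡ -1ℤ
  χP = let k , e′ = χ≡1⇒ {+ r} χr in trans (cong χ (trans (cong (λ x → x + + 2 * s) e′) (l₅ k t))) (χ-per -1ℤ (k + t))
  go : ∀ P′ → P′ ≡ P → ∃ λ q → Prime q × χ (+ q) ≡ -1ℤ × q ℕ∣.∣ r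
  go (+ p) eq = let q , pr , χq , d₁ , d₂ = common-prime p Q u v (trans (cong χ eq) χP) (trans (cong (_* Q) eq) PQ)
                in q , pr , χq , ∣⇒∣ᵤ (odd-cancel-2 (+ r) (χ-prime-odd χq) (∣-subst (sym P+Q) (∣m∣n⇒∣m+n (∣-subst eq d₁) d₂)))
  go -[1+ p ] eq = 0≮-[1+n] (subst (0ℤ <_) (sym eq) P>0)

odd-4n+5 : ∀ n → Odd (+ (4 ℕ.* n ℕ.+ 5))
odd-4n+5 n = odd-by (+ 2 + + 2 * + n) (trans (pos-4n+5 n) (l (+ n)))
  where
  l : ∀ n → + 5 + + 4 * n ≡ 1ℤ + + 2 * (+ 2 + + 2 * n)
  l = solve 1 (λ n → # 5 :+ # 4 :* n := # 1 :+ # 2 :* (# 2 :+ # 2 :* n)) refl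

-- The two directions of the equivalence.

Condition : ℕ → Set
Condition n = ¬ IsSquare (4 ℕ.* n ℕ.+ 5) ⊎ (∃ λ p → Prime p × p ℕ∣.∣ 4 ℕ.* n ℕ.+ 5 × (∃ λ k → p ≡ 4 ℕ.* k ℕ.+ 3))

necessity : ∀ n → Represented (+ n) → Condition n
necessity n (x , y , z , e) with isSquare? (4 ℕ.* n ℕ.+ 5)
... | no ¬sq = inj₁ ¬sq
... | yes (r , m≡r²) = inj₂ (finish (square-prime r (x + y - 1ℤ) (x - y) z (trans r² (sym (represented⇒ (+ n) x y z e))) odd-r))
  where
  r² : + r * + r ≡ + 5 + + 4 * + n
  r² = trans (sym (pos-* r r)) (trans (cong +_ (sym m≡r²)) (pos-4n+5 n))
  odd-r : Odd (+ r)
  odd-r = odd*ˡ {+ r} {+ r} (subst Odd (trans (cong +_ m≡r²) (pos-* r r)) (odd-4n+5 n))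
  finish : (∃ λ q → Prime q × χ (+ q) ≡ -1ℤ × q ℕ∣.∣ r) → ∃ λ p → Prime p × p ℕ∣.∣ 4 ℕ.* n ℕ.+ 5 × (∃ λ k → p ≡ 4 ℕ.* k ℕ.+ 3)
  finish (q , pr , χq , d) = q , pr , subst (q ℕ∣.∣_) (sym m≡r²) (ℕ∣.∣m⇒∣m*n r d) , χ≡-1⇒ q χq

nonsquare-case : ∀ n → ¬ IsSquare (4 ℕ.* n ℕ.+ 5) → Special (+ 5 + + 4 * + n)
-- `4 n + 5 = 4 (n + 1) + 1`, which accounts for `suc n`.
nonsquare-case n ¬sq = subst Special (l (+ n)) (special-nonsquare (suc n) λ r e → ¬sq (∣ r ∣ , +-injective
    (trans (pos-4n+5 n) (trans (sym (l (+ n))) (trans (sym e) (sym (trans (pos-* ∣ r ∣ ∣ r ∣) (abs-square r))))))))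
  where
  l : ∀ n → 1ℤ + + 4 * (1ℤ + n) ≡ + 5 + + 4 * n
  l = solve 1 (λ n → # 1 :+ # 4 :* (# 1 :+ n) := # 5 :+ # 4 :* n) refl
  abs-square : ∀ r → + ∣ r ∣ * + ∣ r ∣ ≡ r * r
  abs-square (+ _)    = refl
  abs-square -[1+ _ ] = refl

square-case : ∀ n r k → 4 ℕ.* n ℕ.+ 5 ≡ r ℕ.* r → Prime (4 ℕ.* k ℕ.+ 3) → 4 ℕ.* k ℕ.+ 3 ℕ∣.∣ 4 ℕ.* n ℕ.+ 5 → Special (+ 5 + + 4 * + n)
square-case n r k m≡r² pr d = go (euclid² pr (+ r) (∣-subst (trans (cong +_ m≡r²) (pos-* r r)) (∣ᵤ⇒∣ d)))
  where
  p = 4 ℕ.* k ℕ.+ 3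
  -- `p = 2 j + 1`, and `j` is odd because `p` is 3 modulo 4, as `special-square` requires.
  j = suc (2 ℕ.* k)
  l : ∀ k → + 3 + + 4 * k ≡ 1ℤ + + 2 * (1ℤ + + 2 * k)
  l = solve 1 (λ k → # 3 :+ # 4 :* k := # 1 :+ # 2 :* (# 1 :+ # 2 :* k)) refl
  j≡ : + j ≡ 1ℤ + + 2 * + k
  j≡ = cong (_+_ 1ℤ) (pos-* 2 k)
  p≡ : + p ≡ 1ℤ + + 2 * + j
  p≡ = trans (trans (cong +_ (ℕₚ.+-comm (4 ℕ.* k) 3)) (cong (_+_ (+ 3)) (pos-* 4 k))) (trans (l (+ k)) (cong (λ x → 1ℤ + + 2 * x) (sym j≡)))
  l₁ : ∀ c p → c * c * (p * p) ≡ c * p * (c * p)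
  l₁ = solve 2 (λ c p → c :* c :* (p :* p) := c :* p :* (c :* p)) refl
  m≡′ : + r * + r ≡ + (4 ℕ.* n ℕ.+ 5)
  m≡′ = trans (sym (pos-* r r)) (cong +_ (sym m≡r²))
  go : + p dvd + r → Special (+ 5 + + 4 * + n)
  go (divides c r≡) = subst Special (trans (cong (λ x → c * c * (x * x)) (sym p≡)) (trans (l₁ c (+ p)) (trans (cong (λ x → x * x) (sym r≡)) (trans m≡′ (pos-4n+5 n)))))
      (special-scale c oc (special-square j (odd-by (+ k) j≡)))
    where
    oc : Odd c
    oc = odd*ˡ {c} {+ p} (subst Odd r≡ (odd*ˡ {+ r} {+ r} (subst Odd (sym m≡′) (odd-4n+5 n))))

sufficiency : ∀ n → Condition n → Represented (+ n)
sufficiency n c = special⇒represented (+ n) (special c)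
  where
  special : Condition n → Special (+ 5 + + 4 * + n)
  special (inj₁ ¬sq) = nonsquare-case n ¬sq
  special (inj₂ (_ , pr , d , k , refl)) with isSquare? (4 ℕ.* n ℕ.+ 5)
  ... | no ¬sq    = nonsquare-case n ¬sq
  ... | yes (r , e) = square-case n r k e pr d

theorem2p2 : (n : ℕ) → .{{ℕ.NonZero n}} →
    (∃ λ (x : ℤ) → ∃ λ (y : ℤ) → ∃ λ (z : ℤ) → + n ≡ tri x ℤ.+ tri y ℤ.+ + 8 ℤ.* tri z)
    ⇔ (¬ IsSquare (4 ℕ.* n ℕ.+ 5) ⊎ (∃ λ p → Prime p × p ℕ∣.∣ 4 ℕ.* n ℕ.+ 5 × (∃ λ k → p ≡ 4 ℕ.* k ℕ.+ 3)))
theorem2p2 n = mk⇔ (necessity n) (sufficiency n)
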